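{- Let $\Gamma$ be a connected girth-regular graph of valence $k$, girth $2d$ for some integer $d$, and signature $(a_1,\ldots,a_k)$ with $a_k=(k-1)^d$. Then $a_1=a_2=\cdots=a_k$ and $\Gamma$ is the incidence graph of a generalised $d$-gon of order $(k-1,k-1)$. In particular, if $k=3$, then $g=2d\in\{4,6,8,12\}$ and $\Gamma$ is isomorphic to $K_{3,3}$ (if $g=4$), the Heawood graph (if $g=6$), the Tutte–Coxeter graph (if $g=8$) or the Tutte $12$-cage (if $g=12$).
   Context: Graphs are finite and simple. For a graph $\Gamma$ of finite girth $g$, a girth cycle is a cycle of length $g$, and for an edge $e$, $\epsilon(e)$ denotes the number of girth cycles containing $e$. If $v$ is a vertex with incident edges $e_1,\ldots,e_k$ ordered so that $\epsilon(e_1)\le\cdots\le\epsilon(e_k)$, the signature of $v$ is $(\epsilon(e_1),\ldots,\epsilon(e_k))$. A graph is girth-regular if all its vertices have the same signature, called the signature of the graph. A generalised $d$-gon of order $(s,t)$ is an incidence structure of points and lines whose (bipartite) incidence graph has diameter $d$ and girth $2d$, each line being incident with $s+1$ points and each point with $t+1$ lines. The Heawood graph is the incidence graph of the Fano plane; the Tutte–Coxeter graph (Tutte $8$-cage) is the incidence graph of the generalised quadrangle of order $(2,2)$; the Tutte $12$-cage is the incidence graph of the generalised hexagon of order $(2,2)$ (on 126 vertices). -}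

module Defs where

open import Data.Nat using (ℕ; zero; suc; _+_; _*_; _∸_; _^_; _≤_; _<_; _≡ᵇ_)
open import Data.Nat.Properties using (≤-decTotalOrder)
open import Data.Bool using (Bool; true; false; _∧_; _∨_; not) renaming (_≟_ to _≟ᴮ_)
open import Data.Fin using (Fin; toℕ; splitAt)
open import Data.Fin.Properties using (_≟_)
open import Data.Bool.ListAction using (any)
open import Data.List using (List; []; _∷_; length; filter; map; concatMap; upTo; applyUpTo; _++_)
open import Data.List.Base using (allFin)
open import Data.Product using (Σ; ∃; ∃-syntax; _×_; _,_)
open import Data.Sum using (_⊎_; inj₁; inj₂)
open import Data.Integer as ℤ using (ℤ; +_; -[1+_])
open import Data.Integer.DivMod using (_%ℕ_)
open import Function.Bundles using (_↔_; Inverse)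
open import Relation.Nullary using (¬_; does)
open import Relation.Binary.PropositionalEquality using (_≡_; refl)
open import Data.List.Sort ≤-decTotalOrder using (sort)

record Graph (n : ℕ) : Set where
  field
    adj    : Fin n → Fin n → Bool
    sym    : ∀ u v → adj u v ≡ adj v u
    irrefl : ∀ v → adj v v ≡ false
open Graph public

module _ {n : ℕ} (G : Graph n) where

  neighbours : Fin n → List (Fin n)
  neighbours v = filter (λ w → adj G v w ≟ᴮ true) (allFin n)

  degree : Fin n → ℕ
  degree v = length (neighbours v)

  Regular : ℕ → Set
  Regular k = ∀ v → degree v ≡ k

  data Walk : Fin n → Fin n → ℕ → Set where
    here : ∀ {u} → Walk u u 0
    step : ∀ {u w v ℓ} → adj G u w ≡ true → Walk w v ℓ → Walk u v (suc ℓ)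

  Connected : Set
  Connected = ∀ u v → ∃[ ℓ ] Walk u v ℓ

  Diameter : ℕ → Set
  Diameter d = (∀ u v → ∃[ ℓ ] (ℓ ≤ d × Walk u v ℓ))
             × (∃[ u ] ∃[ v ] (∀ ℓ → Walk u v ℓ → d ≤ ℓ))

  distinct : List (Fin n) → Bool
  distinct [] = true
  distinct (x ∷ xs) = not (any (λ y → does (x ≟ y)) xs) ∧ distinct xs

  chain : List (Fin n) → Bool
  chain [] = true
  chain (x ∷ []) = true
  chain (x ∷ y ∷ xs) = adj G x y ∧ chain (y ∷ xs)

  lastOr : Fin n → List (Fin n) → Fin n
  lastOr d [] = d
  lastOr d (x ∷ xs) = lastOr x xs

  isCycle : List (Fin n) → Bool
  isCycle [] = false
  isCycle (x ∷ []) = false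
  isCycle (x ∷ y ∷ []) = false
  isCycle (x ∷ xs@(y ∷ z ∷ _)) =
    distinct (x ∷ xs) ∧ chain (x ∷ xs) ∧ adj G (lastOr x xs) x

  HasCycle : ℕ → Set
  HasCycle ℓ = Σ (List (Fin n)) λ xs → length xs ≡ ℓ × isCycle xs ≡ true

  Girth : ℕ → Set
  Girth g = HasCycle g × (∀ ℓ → ℓ < g → ¬ HasCycle ℓ)

  lists : ℕ → List (List (Fin n))
  lists zero = [] ∷ []
  lists (suc m) = concatMap (λ x → map (x ∷_) (lists m)) (allFin n)

  -- ε(uv): number of cycles of length g through the edge uv.
  -- A cycle through the edge uv corresponds to exactly one vertex
  -- sequence u, v, x₂, ..., x_{g-1} (start at u, traverse uv first).
  eps : ℕ → Fin n → Fin n → ℕ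
  eps g u v = length (filter (λ xs → isCycle (u ∷ v ∷ xs) ≟ᴮ true) (lists (g ∸ 2)))

  signature : ℕ → Fin n → List ℕ
  signature g v = sort (map (eps g v) (neighbours v))

  GirthRegular : ℕ → List ℕ → Set
  GirthRegular g a = Girth g × (∀ v → signature g v ≡ a)

  Bipartite : Set
  Bipartite = Σ (Fin n → Bool) λ c → ∀ u v → adj G u v ≡ true → ¬ (c u ≡ c v)

_≅_ : ∀ {n m} → Graph n → Graph m → Set
_≅_ {n} {m} G H = Σ (Fin n ↔ Fin m) λ f →
  ∀ u v → adj G u v ≡ adj H (Inverse.to f u) (Inverse.to f v)

record IncidenceStructure : Set where
  field
    #points #lines : ℕ
    I : Fin #points → Fin #lines → Bool
open IncidenceStructure public

incidenceGraph : (S : IncidenceStructure) → Graph (#points S + #lines S)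
incidenceGraph S = record { adj = A ; sym = s ; irrefl = i }
  where
  p = #points S
  l = #lines S
  A : Fin (p + l) → Fin (p + l) → Bool
  A u v with splitAt p u | splitAt p v
  ... | inj₁ x | inj₂ y = I S x y
  ... | inj₂ y | inj₁ x = I S x y
  ... | inj₁ _ | inj₁ _ = false
  ... | inj₂ _ | inj₂ _ = false
  s : ∀ u v → A u v ≡ A v u
  s u v with splitAt p u | splitAt p v
  ... | inj₁ x | inj₂ y = refl
  ... | inj₂ y | inj₁ x = refl
  ... | inj₁ _ | inj₁ _ = refl
  ... | inj₂ _ | inj₂ _ = refl
  i : ∀ v → A v v ≡ false
  i v with splitAt p v
  ... | inj₁ _ = refl
  ... | inj₂ _ = refl

record GeneralisedPolygon (d s t : ℕ) : Set where
  field
    structure : IncidenceStructure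
    diameter  : Diameter (incidenceGraph structure) d
    girth     : Girth (incidenceGraph structure) (2 * d)
    linePts   : ∀ (L : Fin (#lines structure)) →
                length (filter (λ P → I structure P L ≟ᴮ true) (allFin (#points structure))) ≡ suc s
    pointLns  : ∀ (P : Fin (#points structure)) →
                length (filter (λ L → I structure P L ≟ᴮ true) (allFin (#lines structure))) ≡ suc t
open GeneralisedPolygon public

IsIncidenceGraphOfGenPolygon : ∀ {n} → Graph n → ℕ → ℕ → ℕ → Set
IsIncidenceGraphOfGenPolygon Γ d s t =
  Σ (GeneralisedPolygon d s t) λ P → Γ ≅ incidenceGraph (structure P)

module _ where
  open import Data.Bool.Properties using (∨-comm)
  open import Relation.Binary.PropositionalEquality using (cong₂) renaming (sym to ≡-sym)
  open import Relation.Nullary using (yes; no)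
  open import Data.Empty using (⊥-elim)

  edgeIn : List (ℕ × ℕ) → ℕ → ℕ → Bool
  edgeIn [] a b = false
  edgeIn ((x , y) ∷ es) a b = (((x ≡ᵇ a) ∧ (y ≡ᵇ b)) ∨ ((x ≡ᵇ b) ∧ (y ≡ᵇ a))) ∨ edgeIn es a b

  edgeIn-sym : ∀ es a b → edgeIn es a b ≡ edgeIn es b a
  edgeIn-sym [] a b = refl
  edgeIn-sym ((x , y) ∷ es) a b = cong₂ _∨_ (∨-comm ((x ≡ᵇ a) ∧ (y ≡ᵇ b)) ((x ≡ᵇ b) ∧ (y ≡ᵇ a))) (edgeIn-sym es a b)

  fromEdges : (n : ℕ) → List (ℕ × ℕ) → Graph n
  fromEdges n es = record { adj = A ; sym = s ; irrefl = i }
    where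
    A : Fin n → Fin n → Bool
    A u v = not (does (u ≟ v)) ∧ edgeIn es (toℕ u) (toℕ v)
    s : ∀ u v → A u v ≡ A v u
    s u v with u ≟ v | v ≟ u
    ... | yes _ | yes _ = refl
    ... | no _ | no _ = cong₂ _∧_ refl (edgeIn-sym es (toℕ u) (toℕ v))
    ... | yes p | no q = ⊥-elim (q (≡-sym p))
    ... | no q | yes p = ⊥-elim (q (≡-sym p))
    i : ∀ v → A v v ≡ false
    i v with v ≟ v
    ... | yes _ = refl
    ... | no p = ⊥-elim (p refl)

-- LCF notation [L]^r on n = r * length L vertices:
-- Hamiltonian cycle 0 ~ 1 ~ ... ~ n-1 ~ 0 plus chords i ~ i + L[i mod |L|] (mod n)
LCF : List ℤ → ℕ → Σ ℕ Graph
LCF L r = n , fromEdges n (concatMap edgesAt (upTo n))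
  where
  open import Data.List using (replicate; concat; lookup)
  L* : List ℤ
  L* = concat (replicate r L)
  n : ℕ
  n = length L*
  nth : List ℤ → ℕ → ℤ
  nth [] _ = + 0
  nth (x ∷ xs) zero = x
  nth (x ∷ xs) (suc i) = nth xs i
  modn : ℤ → ℕ
  modn z with n
  ... | zero = 0
  ... | suc m = z %ℕ suc m
  edgesAt : ℕ → List (ℕ × ℕ)
  edgesAt i = (i , modn (+ suc i)) ∷ (i , modn ((+ i) ℤ.+ nth L* i)) ∷ []

K33 : Graph 6
K33 = fromEdges 6 (concatMap (λ i → map (λ j → (i , 3 + j)) (upTo 3)) (upTo 3))

private
  neg : ℕ → ℤ
  neg k = ℤ.- (+ k)

heawood : Σ ℕ Graph
heawood = LCF (+ 5 ∷ neg 5 ∷ []) 7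

tutteCoxeter : Σ ℕ Graph
tutteCoxeter = LCF (neg 13 ∷ neg 9 ∷ + 7 ∷ neg 7 ∷ + 9 ∷ + 13 ∷ []) 5

tutte12cage : Σ ℕ Graph
tutte12cage = LCF (+ 17 ∷ + 27 ∷ neg 13 ∷ neg 59 ∷ neg 35 ∷ + 35 ∷ neg 11 ∷ + 13 ∷ neg 53 ∷
                   + 53 ∷ neg 27 ∷ + 21 ∷ + 57 ∷ + 11 ∷ neg 21 ∷ neg 57 ∷ + 59 ∷ neg 17 ∷ []) 7

_≅'_ : ∀ {n} → Graph n → Σ ℕ Graph → Set
G ≅' (m , H) = G ≅ H

{-# OPTIONS --safe #-}
module Submission where

-- At an edge vw every non-backtracking walk of d + 1 edges that starts with v, w lies in at most one girth
-- cycle, so ε(vw) ≤ (k-1)^d, and equality says that every such walk closes up.  Since every vertex v has an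
-- edge with equality, non-backtracking walks of length d + 1 always end at distance d - 1 from their start;
-- hence distances are at most d, adjacent vertices have distances to a third one of different parity, and
-- below distance d geodesics are unique.  This is the generalised polygon.
--
-- For k = 3 the possible d are found by a p-adic form of the Feit-Higman argument.  Let A be the adjacency
-- matrix and z a root of z² - λ z + 2 = 0 for each eigenvalue λ of A.  The sums of the z^(2q) are traces of
-- powers of an integer matrix, and equal n / (2^d - 1) times 4^q + 1 + 2^q c(q) with c of period d.  For an odd
-- prime p they are congruent modulo p^(j+1) at q = p^j and at q = p^(j+1).  If p does not divide d this forces
-- c(p) = c(1), that is p ≡ ±1 mod d, and for d ∉ {2,3,4,6} there is a smaller prime that violates it.
--
-- For uniqueness fix a root.  A vertex z opposite to it has one address of d - 2 bits along each of the three
-- edges at the root, and the girth forbids short closed sequences of opposite vertices that share address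
-- prefixes.  After the bits are normalised along reference vertices, a finite case tree leaves at most two
-- assignments (two for d = 6, the two orders of points and lines), each of which is the named graph.

open import Data.Bool using (true; false; _∧_; not; Bool; if_then_else_; _∨_) renaming (_≟_ to _≟ᴮ_)
open import Data.Empty using (⊥-elim; ⊥)
open import Data.List using (List; []; _∷_; _++_; length; map; _∷ʳ_; _ʳ++_; reverse; concatMap; filter; take;
  drop; initLast; _∷ʳ′_; allFin; concat; replicate; tabulate; foldr; upTo)
open import Data.List.Membership.Propositional using (_∈_; _∉_)
open import Data.List.Membership.Propositional.Properties using (∈-∃++; ∈-++⁺ˡ; ∈-++⁺ʳ; ∈-++⁻; ∈-map⁻;
  ∈-map⁺; ∈-filter⁺; ∈-filter⁻; ∈-allFin; ∈-concatMap⁺; ∈-concatMap⁻; ∈-lookup; ∈-length; ∈-upTo⁺)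
open import Data.List.Properties using (length-++; length-ʳ++; ʳ++-defn; ++-ʳ++; length-map; length-reverse;
  reverse-++; unfold-reverse; reverse-injective; take++drop≡id; length-take; ≡-dec; ++-assoc; ∷-injective;
  length-drop; ++-identityʳ; length-replicate)
open import Data.List.Relation.Binary.Subset.Propositional using (_⊆_)
open import Data.List.Relation.Unary.Any using (here; there)
open import Data.List.Relation.Unary.Unique.Propositional.Properties using (Unique[x∷xs]⇒x∉xs; map⁺; ++⁺; allFin⁺; filter⁺)
open import Data.Product using (_,_; ∃; _×_; proj₁; proj₂)
open import Data.Sum using (inj₁; inj₂; _⊎_)
open import Function using (_∘_)
open import Relation.Binary.PropositionalEquality using (_≡_; refl; sym; trans; cong; subst; _≢_; cong₂; subst₂; module ≡-Reasoning)
open import Relation.Nullary using (yes; no; ¬_; does; Dec; ¬?)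

-- Throughout e = d - 2; a cycle has at least three vertices, so d ≥ 2. No eigenvalue is ever
-- computed. The period d of c has a spectral reason, z^(2d) = 2^d whenever λ is not 3 or -3; over
-- the integers it appears as two identities between polynomials in A, a reflection at d and a shift
-- by 2d. The congruences come from rotating words. A trace of a power is a weighted count of closed
-- words; free orbits contribute multiples of p^(j+1), and every other word is a p-th power of a
-- shorter word u. Entries 0, 1, -1 satisfy x³ = x, so for odd p this power has exactly the weight
-- of u, which settles all moduli at once. This is why the companion matrix of z² - A z + 2 gets
-- three blocks: its entry -2 is spread over two entries -1. For uniqueness the obstacle is the
-- freedom of naming: every branching of the three binary trees could be swapped. Reference vertices
-- remove most of this freedom, and what remains is a search over partial tables of bits. The
-- checker does not mention Γ, so a case tree is verified by evaluation, and one soundness proof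
-- carries the result to Γ.

-- Lists without repetitions.

module ListLemmas where

  open import Data.Nat using (suc; _≤_; z≤n; s≤s)
  open import Data.Nat.Properties using (≤-trans; ≤-reflexive; <⇒≱; +-suc; +-comm)
  open import Data.List.Relation.Unary.All as All using (All; []; _∷_)
  open import Data.List.Relation.Unary.Unique.Propositional using (Unique; []; _∷_)
  open import Relation.Binary using (DecidableEquality)

  module _ {a} {A : Set a} where

    length-∷ʳ : (x : A) (xs : List A) → length (xs ∷ʳ x) ≡ suc (length xs)
    length-∷ʳ x xs = trans (length-++ xs) (+-comm (length xs) 1)

    ∉⇒unique : {x : A} {xs : List A} → x ∉ xs → Unique xs → Unique (x ∷ xs)
    ∉⇒unique {x} {xs} x∉ u = All.tabulate (λ y∈ x≡y → x∉ (subst (_∈ xs) (sym x≡y) y∈)) ∷ u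

    unique-⊆⇒length≤ : {xs ys : List A} → Unique xs → xs ⊆ ys → length xs ≤ length ys
    unique-⊆⇒length≤ {[]} _ _ = z≤n
    unique-⊆⇒length≤ {x ∷ xs} {ys} u@(_ ∷ u′) sub with ∈-∃++ (sub (here refl))
    ... | ps , qs , refl = ≤-trans (s≤s (unique-⊆⇒length≤ u′ sub′)) (≤-reflexive len)
      where
      sub′ : xs ⊆ ps ++ qs
      sub′ {y} y∈ with ∈-++⁻ ps (sub (there y∈))
      ... | inj₁ p = ∈-++⁺ˡ p
      ... | inj₂ (here refl) = ⊥-elim (Unique[x∷xs]⇒x∉xs u y∈)
      ... | inj₂ (there q) = ∈-++⁺ʳ ps q
      len : suc (length (ps ++ qs)) ≡ length (ps ++ x ∷ qs)
      len = trans (cong suc (length-++ ps)) (trans (sym (+-suc (length ps) (length qs))) (sym (length-++ ps)))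

    -- An entry of `ys` outside `xs` could be put in front of `xs`, giving too many distinct entries
    -- of `ys`. This is the step that turns equality of two counts into surjectivity.
    unique-⊆⇒⊇ : DecidableEquality A → {xs ys : List A} → Unique xs → xs ⊆ ys → length ys ≤ length xs → ys ⊆ xs
    unique-⊆⇒⊇ _≟_ {xs} {ys} u sub le {y} y∈ with y ∈? xs
      where open import Data.List.Membership.DecPropositional _≟_ using (_∈?_)
    ... | yes p = p
    ... | no y∉ = ⊥-elim (<⇒≱ (unique-⊆⇒length≤ (∉⇒unique y∉ u) (λ { (here refl) → y∈ ; (there z∈) → sub z∈ })) le)

  module _ {a b} {A : Set a} {B : Set b} where

    unique-map : (f : A → B) {xs : List A} →
      (∀ {x y} → x ∈ xs → y ∈ xs → f x ≡ f y → x ≡ y) → Unique xs → Unique (map f xs)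
    unique-map f {[]} inj u = []
    unique-map f {x ∷ xs} inj u@(_ ∷ u′) = ∉⇒unique fx∉ (unique-map f (λ p q → inj (there p) (there q)) u′)
      where
      fx∉ : f x ∉ map f xs
      fx∉ p with ∈-map⁻ f p
      ... | y , y∈ , eq = Unique[x∷xs]⇒x∉xs u (subst (_∈ xs) (sym (inj (here refl) (there y∈) eq)) y∈)

-- Non-backtracking walks and the girth.

module Walks where

  open import Defs renaming (sym to adj-sym)
  open ListLemmas
  open import Data.Nat using (ℕ; suc; _+_; _≤_; _<_; s≤s)
  open import Data.Nat.Properties using (≤-trans; ≤-reflexive; m≤m+n; +-suc; <⇒≱; ≤-total; m≤n⇒m<n∨m≡n; n≤1+n;
    ≤-<-trans; <-≤-trans; m≤n⇒m≤1+n; +-monoʳ-≤; <⇒≤)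
  open import Data.Bool.ListAction using (any)
  open import Data.Fin using (Fin)
  open import Data.Fin.Properties using (_≟_)
  open import Data.List.Relation.Unary.All as All using ([]; _∷_)
  open import Data.List.Relation.Unary.Unique.Propositional using (Unique; []; _∷_)

  ∧-true⁻ : ∀ {a b} → a ∧ b ≡ true → a ≡ true × b ≡ true
  ∧-true⁻ {true} {true} _ = refl , refl

  ∧-true⁺ : ∀ {a b} → a ≡ true → b ≡ true → a ∧ b ≡ true
  ∧-true⁺ refl refl = refl

  false≢true : false ≢ true
  false≢true ()

  module NonBacktracking {n : ℕ} (Γ : Graph n) where

    open import Data.List.Membership.DecPropositional (_≟_ {n}) public using (_∈?_)

    V : Set
    V = Fin n

    infix 4 _~_
    _~_ : V → V → Set
    u ~ v = adj Γ u v ≡ true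

    ~-sym : ∀ {u v} → u ~ v → v ~ u
    ~-sym {u} {v} e = trans (adj-sym Γ v u) e

    ~⇒≢ : ∀ {u v} → u ~ v → u ≢ v
    ~⇒≢ {u} e refl = false≢true (trans (sym (irrefl Γ u)) e)

    data NB : List V → Set where
      one  : ∀ {x} → NB (x ∷ [])
      two  : ∀ {x y} → x ~ y → NB (x ∷ y ∷ [])
      cons : ∀ {x y z xs} → x ~ y → x ≢ z → NB (y ∷ z ∷ xs) → NB (x ∷ y ∷ z ∷ xs)

    last : V → List V → V
    last = lastOr Γ

    NB-tail : ∀ {x y xs} → NB (x ∷ y ∷ xs) → NB (y ∷ xs)
    NB-tail (two _) = one
    NB-tail (cons _ _ w) = w

    NB-head : ∀ {x y xs} → NB (x ∷ y ∷ xs) → x ~ y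
    NB-head (two e) = e
    NB-head (cons e _ _) = e

    NB-prefix : ∀ x xs {ys} → NB (x ∷ xs ++ ys) → NB (x ∷ xs)
    NB-prefix x [] _ = one
    NB-prefix x (y ∷ []) w = two (NB-head w)
    NB-prefix x (y ∷ z ∷ xs) (cons e ne w) = cons e ne (NB-prefix y (z ∷ xs) w)

    NB-suffix : ∀ x xs {ys} → NB (x ∷ xs ++ ys) → NB (last x xs ∷ ys)
    NB-suffix x [] w = w
    NB-suffix x (y ∷ xs) w = NB-suffix y xs (NB-tail w)

    penultimate : V → V → List V → V
    penultimate a b [] = a
    penultimate a b (c ∷ xs) = penultimate b c xs

    NB-snoc : ∀ {a b xs t} → NB (a ∷ b ∷ xs) → last b xs ~ t → penultimate a b xs ≢ t → NB (a ∷ b ∷ xs ∷ʳ t)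
    NB-snoc (two e) f ne = cons e ne (two f)
    NB-snoc (cons e ne w) f ne′ = cons e ne (NB-snoc w f ne′)

    NB-pen~last : ∀ {a b xs} → NB (a ∷ b ∷ xs) → penultimate a b xs ~ last b xs
    NB-pen~last (two e) = e
    NB-pen~last (cons _ _ w) = NB-pen~last w

    NB-ʳ++ : ∀ {x y acc} L → NB (x ∷ y ∷ L) → NB (y ∷ x ∷ acc) → NB (L ʳ++ (y ∷ x ∷ acc))
    NB-ʳ++ [] w a = a
    NB-ʳ++ (z ∷ L) (cons e ne w) a = NB-ʳ++ L w (cons (~-sym (NB-head w)) (λ q → ne (sym q)) a)

    NB-turn : ∀ {u a b L M} → NB (u ∷ a ∷ L) → NB (u ∷ b ∷ M) → a ≢ b → NB (L ʳ++ (a ∷ u ∷ b ∷ M))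
    NB-turn {L = L} w w′ ne = NB-ʳ++ L w (cons (~-sym (NB-head w)) ne w′)

    NB-reverse : ∀ {u a} L → NB (u ∷ a ∷ L) → NB (L ʳ++ (a ∷ u ∷ []))
    NB-reverse L w = NB-ʳ++ L w (two (~-sym (NB-head w)))

    last-++ : ∀ x xs {y ys} → last x (xs ++ y ∷ ys) ≡ last y ys
    last-++ x [] = refl
    last-++ x (z ∷ xs) = last-++ z xs

    last∈ : ∀ x xs → last x xs ∈ x ∷ xs
    last∈ x [] = here refl
    last∈ x (y ∷ xs) = there (last∈ y xs)

    snoc-view : ∀ x xs → ∃ λ ys → x ∷ xs ≡ ys ∷ʳ last x xs
    snoc-view x [] = [] , refl
    snoc-view x (y ∷ xs) with snoc-view y xs
    ... | ys , eq = x ∷ ys , cong (x ∷_) eq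

    NB⇒chain : ∀ {L} → NB L → chain Γ L ≡ true
    NB⇒chain one = refl
    NB⇒chain (two e) = ∧-true⁺ e refl
    NB⇒chain (cons e _ w) = ∧-true⁺ e (NB⇒chain w)

    ∉⇒any : ∀ {x : V} {xs} → x ∉ xs → any (λ y → does (x ≟ y)) xs ≡ false
    ∉⇒any {x} {[]} _ = refl
    ∉⇒any {x} {y ∷ xs} x∉ with x ≟ y
    ... | yes p = ⊥-elim (x∉ (here p))
    ... | no _ = ∉⇒any (λ p → x∉ (there p))

    any⇒∉ : ∀ {x : V} {xs} → any (λ y → does (x ≟ y)) xs ≡ false → x ∉ xs
    any⇒∉ {x} {y ∷ xs} eq x∈ with x ≟ y
    any⇒∉ {x} {y ∷ xs} () _ | yes _
    any⇒∉ {x} {y ∷ xs} eq (here p) | no ne = ne p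
    any⇒∉ {x} {y ∷ xs} eq (there p) | no _ = any⇒∉ eq p

    Unique⇒distinct : ∀ {xs : List V} → Unique xs → distinct Γ xs ≡ true
    Unique⇒distinct {[]} [] = refl
    Unique⇒distinct {x ∷ xs} u@(_ ∷ u′) =
      ∧-true⁺ (cong not (∉⇒any (Unique[x∷xs]⇒x∉xs u))) (Unique⇒distinct u′)

    distinct⇒Unique : ∀ {xs : List V} → distinct Γ xs ≡ true → Unique xs
    distinct⇒Unique {[]} _ = []
    distinct⇒Unique {x ∷ xs} eq with any (λ y → does (x ≟ y)) xs in e
    distinct⇒Unique {x ∷ xs} () | true
    ... | false = ∉⇒unique (any⇒∉ e) (distinct⇒Unique eq)

    Unique∧chain⇒NB : ∀ x xs → Unique (x ∷ xs) → chain Γ (x ∷ xs) ≡ true → NB (x ∷ xs)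
    Unique∧chain⇒NB x [] u c = one
    Unique∧chain⇒NB x (y ∷ []) u c = two (proj₁ (∧-true⁻ c))
    Unique∧chain⇒NB x (y ∷ z ∷ xs) ((_ ∷ ne ∷ _) ∷ u) c with ∧-true⁻ c
    ... | e , c′ = cons e ne (Unique∧chain⇒NB y (z ∷ xs) u c′)

    Unique-prefix : ∀ xs {ys : List V} → Unique (xs ++ ys) → Unique xs
    Unique-prefix [] u = []
    Unique-prefix (x ∷ xs) u@(_ ∷ u′) =
      ∉⇒unique (λ x∈ → Unique[x∷xs]⇒x∉xs u (∈-++⁺ˡ x∈)) (Unique-prefix xs u′)

    Unique-middle : ∀ xs {y : V} {ys} → Unique (xs ++ y ∷ ys) → y ∉ xs
    Unique-middle (x ∷ xs) u (here refl) = Unique[x∷xs]⇒x∉xs u (∈-++⁺ʳ xs (here refl))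
    Unique-middle (x ∷ xs) (_ ∷ u) (there p) = Unique-middle xs u p

    Unique-ʳ++-suffix : ∀ L {R : List V} → Unique (L ʳ++ R) → Unique R
    Unique-ʳ++-suffix [] u = u
    Unique-ʳ++-suffix (x ∷ L) u with Unique-ʳ++-suffix L u
    ... | _ ∷ u′ = u′

    Unique-ʳ++-disjoint : ∀ {x : V} L {R} → x ∈ L → x ∈ R → ¬ Unique (L ʳ++ R)
    Unique-ʳ++-disjoint (y ∷ L) (here refl) q u = Unique[x∷xs]⇒x∉xs (Unique-ʳ++-suffix L u) q
    Unique-ʳ++-disjoint (y ∷ L) (there p) q u = Unique-ʳ++-disjoint L p (there q) u

    -- The first vertex that recurs in a repetition-free tail cuts out a cycle. It has at least
    -- three vertices, because a return after one step would be a loop and a return after two steps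
    -- would be backtracking.
    unique-or-cycle : ∀ {L} → NB L → Unique L ⊎ ∃ λ m → m < length L × HasCycle Γ m
    unique-or-cycle one = inj₁ ([] ∷ [])
    unique-or-cycle (two e) = inj₁ ((~⇒≢ e ∷ []) ∷ [] ∷ [])
    unique-or-cycle {x ∷ y ∷ z ∷ xs} (cons e ne w) with unique-or-cycle w
    ... | inj₂ (m , m< , c) = inj₂ (m , m≤n⇒m≤1+n m< , c)
    ... | inj₁ u with x ∈? (y ∷ z ∷ xs)
    ...   | no x∉ = inj₁ (∉⇒unique x∉ u)
    ...   | yes x∈ with ∈-∃++ x∈
    ...     | [] , qs , refl = ⊥-elim (~⇒≢ e refl)
    ...     | _ ∷ [] , qs , refl = ⊥-elim (ne refl)
    ...     | p ∷ p′ ∷ ps , qs , refl = inj₂ (length (x ∷ p ∷ p′ ∷ ps) , len , (x ∷ p ∷ p′ ∷ ps) , refl , cyc)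
      where
      W : NB (x ∷ (p ∷ p′ ∷ ps) ++ x ∷ qs)
      W = cons e ne w
      cyc : isCycle Γ (x ∷ p ∷ p′ ∷ ps) ≡ true
      cyc = ∧-true⁺ (Unique⇒distinct (∉⇒unique (Unique-middle (p ∷ p′ ∷ ps) u) (Unique-prefix (p ∷ p′ ∷ ps) u)))
              (∧-true⁺ (NB⇒chain (NB-prefix x (p ∷ p′ ∷ ps) W)) (NB-head (NB-suffix x (p ∷ p′ ∷ ps) W)))
      len : length (x ∷ p ∷ p′ ∷ ps) < length (x ∷ (p ∷ p′ ∷ ps) ++ x ∷ qs)
      len = s≤s (s≤s (s≤s (≤-trans (s≤s (m≤m+n (length ps) (length qs)))
              (≤-reflexive (trans (sym (+-suc (length ps) (length qs))) (sym (length-++ ps)))))))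

  module GirthBound {n : ℕ} (Γ : Graph n) (g : ℕ) (noShort : ∀ ℓ → ℓ < g → ¬ HasCycle Γ ℓ) where

    open NonBacktracking Γ public

    short⇒Unique : ∀ {L} → NB L → length L ≤ g → Unique L
    short⇒Unique w le with unique-or-cycle w
    ... | inj₁ u = u
    ... | inj₂ (m , m< , c) = ⊥-elim (noShort m (<-≤-trans m< le) c)

    -- Nothing is demanded at the base point `x`, where the closed walk may backtrack. Chains of
    -- segments can therefore be closed up later without a condition on their first and last edges.
    closed-long : ∀ {x} L → NB (x ∷ L) → last x L ≡ x → L ≢ [] → g ≤ length L
    closed-long [] _ _ ne = ⊥-elim (ne refl)
    closed-long {x} (y ∷ L) w eq _ with unique-or-cycle w
    ... | inj₁ u = ⊥-elim (Unique[x∷xs]⇒x∉xs u (subst (_∈ y ∷ L) eq (last∈ y L)))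
    ... | inj₂ (m , s≤s m≤ , c) with ≤-total g (length (y ∷ L))

    ...   | inj₁ le = le
    ...   | inj₂ ge with m≤n⇒m<n∨m≡n ge

    ...     | inj₁ lt = ⊥-elim (noShort m (≤-<-trans m≤ lt) c)
    ...     | inj₂ eq′ = ≤-reflexive (sym eq′)

    -- After the common beginning the walks leave by different edges. One reversed and joined to the
    -- other is a non-backtracking walk with at most g vertices, which must be distinct, although
    -- the common end occurs twice.
    NB-unique : ∀ u xs ys → NB (u ∷ xs) → NB (u ∷ ys) → last u xs ≡ last u ys →
      length xs + length ys < g → xs ≡ ys
    NB-unique u [] [] _ _ _ _ = refl
    NB-unique u [] (b ∷ M) _ w eq lt =
      ⊥-elim (<⇒≱ lt (closed-long (b ∷ M) w (sym eq) (λ ())))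

    NB-unique u (a ∷ L) [] w _ eq lt =
      ⊥-elim (<⇒≱ lt (≤-trans (closed-long (a ∷ L) w eq (λ ())) (m≤m+n _ 0)))

    NB-unique u (a ∷ L) (b ∷ M) w w′ eq lt with a ≟ b
    ... | yes refl = cong (a ∷_) (NB-unique a L M (NB-tail w) (NB-tail w′) eq
            (≤-trans (s≤s (+-monoʳ-≤ (length L) (n≤1+n _))) (<⇒≤ lt)))

    ... | no a≢b = ⊥-elim (Unique-ʳ++-disjoint (a ∷ L) (last∈ a L)
            (there (subst (_∈ b ∷ M) (sym eq) (last∈ b M)))
            (short⇒Unique (NB-turn w w′ a≢b) (≤-trans (≤-reflexive len) lt)))
      where
      len : length (L ʳ++ (a ∷ u ∷ b ∷ M)) ≡ suc (length (a ∷ L) + length (b ∷ M))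
      len = trans (length-ʳ++ L) (trans (+-suc (length L) _) (cong suc (+-suc (length L) _)))

-- Girth cycles through an edge.

module CycleCounting where

  open import Defs renaming (sym to adj-sym)
  open ListLemmas
  open Walks
  open import Data.Nat using (ℕ; zero; suc; _+_; _*_; _∸_; _^_; _≤_; _<_; s≤s)
  open import Data.Nat.Properties using (≤-trans; ≤-reflexive; ≤-antisym; suc-injective; +-identityʳ; +-comm; m+n∸m≡n; +-monoʳ-≤; n≤1+n)
  open import Data.Fin.Properties using (_≟_)
  open import Data.List.Relation.Unary.Any as Any using (here; there)
  open import Data.List.Relation.Unary.Any.Properties using (reverse⁻)
  open import Data.List.Relation.Unary.All as All using ([]; _∷_)
  open import Data.List.Relation.Unary.Unique.Propositional using (Unique; []; _∷_)

  module _ {a} {A : Set a} where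

    unique-concatMap-∷ : (f : A → List (List A)) {ws : List A} → Unique ws → (∀ w → Unique (f w)) →
      Unique (concatMap (λ w → map (w ∷_) (f w)) ws)
    unique-concatMap-∷ f {[]} _ _ = []
    unique-concatMap-∷ f {w ∷ ws} u@(_ ∷ u′) uf =
      ++⁺ (map⁺ (λ eq → proj₂ (∷-injective eq)) (uf w)) (unique-concatMap-∷ f u′ uf) disj
      where
      disj : ∀ {xs} → xs ∈ map (w ∷_) (f w) × xs ∈ concatMap (λ w → map (w ∷_) (f w)) ws → ⊥
      disj (p , q) with ∈-map⁻ (w ∷_) p | ∈-concatMap⁻ (λ w → map (w ∷_) (f w)) {xs = ws} q
      ... | _ , _ , refl | r = Unique[x∷xs]⇒x∉xs u (Any.map same r)
        where
        same : ∀ {w′ ys} → w ∷ ys ∈ map (w′ ∷_) (f w′) → w ≡ w′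
        same s with ∈-map⁻ _ s
        ... | _ , _ , refl = refl

    length-concatMap : ∀ {b} {B : Set b} (f : A → List B) {c} ws → (∀ {w} → w ∈ ws → length (f w) ≡ c) →
      length (concatMap f ws) ≡ length ws * c
    length-concatMap f [] h = refl
    length-concatMap f (w ∷ ws) h =
      trans (length-++ (f w)) (cong₂ _+_ (h (here refl)) (length-concatMap f ws (h ∘ there)))

    module _ (_≟ᴬ_ : (x y : A) → Dec (x ≡ y)) where

      length-delete : ∀ {x} xs → Unique xs → x ∈ xs →
        suc (length (filter (λ y → ¬? (x ≟ᴬ y)) xs)) ≡ length xs
      length-delete {x} (y ∷ ys) u x∈ with x ≟ᴬ y
      length-delete {x} (y ∷ ys) u x∈ | yes refl = cong suc (keep ys (Unique[x∷xs]⇒x∉xs u))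
        where
        keep : ∀ zs → x ∉ zs → length (filter (λ y → ¬? (x ≟ᴬ y)) zs) ≡ length zs
        keep [] _ = refl
        keep (z ∷ zs) x∉ with x ≟ᴬ z
        ... | yes p = ⊥-elim (x∉ (here p))
        ... | no _ = cong suc (keep zs (x∉ ∘ there))
      length-delete {x} (y ∷ ys) u (here p) | no ne = ⊥-elim (ne p)
      length-delete {x} (y ∷ ys) (_ ∷ u) (there x∈) | no ne = cong suc (length-delete ys u x∈)

  module Neighbours {n : ℕ} (Γ : Graph n) where

    open NonBacktracking Γ

    ∈-neighbours⁺ : ∀ {v w} → v ~ w → w ∈ neighbours Γ v
    ∈-neighbours⁺ {v} e = ∈-filter⁺ (λ w → adj Γ v w ≟ᴮ true) (∈-allFin _) e

    ∈-neighbours⁻ : ∀ {v w} → w ∈ neighbours Γ v → v ~ w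
    ∈-neighbours⁻ {v} p = proj₂ (∈-filter⁻ (λ w → adj Γ v w ≟ᴮ true) {xs = allFin n} p)

    neighbours-unique : ∀ v → Unique (neighbours Γ v)
    neighbours-unique v = filter⁺ (λ w → adj Γ v w ≟ᴮ true) (allFin⁺ n)

    lists-unique : ∀ m → Unique (lists Γ m)
    lists-unique zero = [] ∷ []
    lists-unique (suc m) = unique-concatMap-∷ (λ _ → lists Γ m) (allFin⁺ n) (λ _ → lists-unique m)

    ∈-lists⁺ : ∀ xs → xs ∈ lists Γ (length xs)
    ∈-lists⁺ [] = here refl
    ∈-lists⁺ (x ∷ xs) = ∈-concatMap⁺ (λ x → map (x ∷_) (lists Γ (length xs)))
      (Any.map (λ { refl → ∈-map⁺ (x ∷_) (∈-lists⁺ xs) }) (∈-allFin x))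

    ∈-lists⁻ : ∀ m {xs} → xs ∈ lists Γ m → length xs ≡ m
    ∈-lists⁻ zero (here refl) = refl
    ∈-lists⁻ (suc m) p with Any.satisfied (∈-concatMap⁻ (λ x → map (x ∷_) (lists Γ m)) {xs = allFin n} p)
    ... | x , q with ∈-map⁻ (x ∷_) q
    ... | ys , r , refl = cong suc (∈-lists⁻ m r)

    successors : V → V → List V
    successors u v = filter (λ w → ¬? (u ≟ w)) (neighbours Γ v)

    -- The continuations of the arc from `u` to `v` by m more vertices. In valence k + 1 there are
    -- k^m of them, which is the source of the bound on ε.
    extensions : ℕ → V → V → List (List V)
    extensions zero u v = [] ∷ []
    extensions (suc m) u v = concatMap (λ w → map (w ∷_) (extensions m v w)) (successors u v)

    extensions-unique : ∀ m u v → Unique (extensions m u v)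
    extensions-unique zero u v = [] ∷ []
    extensions-unique (suc m) u v = unique-concatMap-∷ (extensions m v)
      (filter⁺ (λ w → ¬? (u ≟ w)) (neighbours-unique v)) (extensions-unique m v)

    ∈-successors⁻ : ∀ {u v w} → w ∈ successors u v → v ~ w × u ≢ w
    ∈-successors⁻ {u} {v} p with ∈-filter⁻ (λ w → ¬? (u ≟ w)) {xs = neighbours Γ v} p
    ... | q , ne = ∈-neighbours⁻ q , ne

    ∈-extensions⁺ : ∀ {u v} xs → NB (u ∷ v ∷ xs) → xs ∈ extensions (length xs) u v
    ∈-extensions⁺ [] _ = here refl
    ∈-extensions⁺ {u} {v} (x ∷ xs) (cons e ne w) = ∈-concatMap⁺ (λ w → map (w ∷_) (extensions (length xs) v w))
      (Any.map (λ { refl → ∈-map⁺ (x ∷_) (∈-extensions⁺ xs w) })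
        (∈-filter⁺ (λ w → ¬? (u ≟ w)) (∈-neighbours⁺ (NB-head w)) ne))

    ∈-extensions⁻ : ∀ m {u v xs} → u ~ v → xs ∈ extensions m u v → length xs ≡ m × NB (u ∷ v ∷ xs)
    ∈-extensions⁻ zero e (here refl) = refl , two e
    ∈-extensions⁻ (suc m) {u} {v} e p
      with find (∈-concatMap⁻ (λ w → map (w ∷_) (extensions m v w)) {xs = successors u v} p)
      where open import Data.List.Membership.Propositional using (find)
    ... | w , w∈ , q with ∈-map⁻ (w ∷_) q | ∈-successors⁻ w∈
    ... | ys , r , refl | f , ne with ∈-extensions⁻ m f r
    ... | len , nb = cong suc len , cons e ne nb

    module _ {k : ℕ} (reg : Regular Γ (suc k)) where

      length-successors : ∀ {u v} → v ~ u → length (successors u v) ≡ k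
      length-successors {u} {v} e = suc-injective
        (trans (length-delete _≟_ (neighbours Γ v) (neighbours-unique v) (∈-neighbours⁺ e)) (reg v))

      length-extensions : ∀ m {u v} → v ~ u → length (extensions m u v) ≡ k ^ m
      length-extensions zero e = refl
      length-extensions (suc m) {u} {v} e = trans
        (length-concatMap (λ w → map (w ∷_) (extensions m v w)) (successors u v)
          (λ {w} w∈ → trans (length-map (w ∷_) (extensions m v w)) (length-extensions m (~-sym (proj₁ (∈-successors⁻ w∈))))))
        (cong (_* k ^ m) (length-successors e))

  module GirthCycles {n : ℕ} (Γ : Graph n) (e : ℕ)
    (noShort : ∀ ℓ → ℓ < 2 * suc (suc e) → ¬ HasCycle Γ ℓ) where

    d g : ℕ
    d = suc (suc e)
    g = 2 * d

    open GirthBound Γ g noShort public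
    open Neighbours Γ public

    -- Besides the two ends of the edge, a girth cycle has d vertices that are chosen freely and e
    -- vertices that are then forced.
    g∸2 : g ∸ 2 ≡ d + e
    g∸2 = trans (cong (e +_) (+-identityʳ d)) (+-comm e d)

    -- Stands in for `isCycle`: at girth length a closed non-backtracking walk has no repetition,
    -- since a repetition would cut out a shorter cycle.
    Closed : V → V → List V → Set
    Closed u v xs = NB (u ∷ v ∷ xs ∷ʳ u)

    pen∈ : ∀ a b c xs → penultimate a b (c ∷ xs) ∈ b ∷ c ∷ xs
    pen∈ a b c [] = here refl
    pen∈ a b c (x ∷ xs) = there (pen∈ b c x xs)

    isCycle⇒Closed : ∀ u v a xs → isCycle Γ (u ∷ v ∷ a ∷ xs) ≡ true → Closed u v (a ∷ xs)
    isCycle⇒Closed u v a xs c with ∧-true⁻ c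
    ... | dis , c′ with ∧-true⁻ c′
    ... | ch , cl = NB-snoc (Unique∧chain⇒NB u (v ∷ a ∷ xs) uq ch) cl
            (λ eq → Unique[x∷xs]⇒x∉xs uq (subst (_∈ v ∷ a ∷ xs) eq (pen∈ u v a xs)))
      where uq = distinct⇒Unique dis

    Closed⇒Unique : ∀ u v xs → length xs ≡ d + e → Closed u v xs → Unique (u ∷ v ∷ xs)
    Closed⇒Unique u v xs len w = short⇒Unique (NB-prefix u (v ∷ xs) w)
      (≤-reflexive (cong (λ x → suc (suc x)) (trans len (sym g∸2))))

    Closed⇒isCycle : ∀ u v xs → length xs ≡ d + e → Closed u v xs → isCycle Γ (u ∷ v ∷ xs) ≡ true
    Closed⇒isCycle u v (a ∷ xs) len w =
      ∧-true⁺ (Unique⇒distinct (Closed⇒Unique u v (a ∷ xs) len w))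
        (∧-true⁺ (NB⇒chain (NB-prefix u (v ∷ a ∷ xs) w)) (NB-head (NB-suffix u (v ∷ a ∷ xs) w)))

    girthCycles : V → V → List (List V)
    girthCycles u v = filter (λ xs → isCycle Γ (u ∷ v ∷ xs) ≟ᴮ true) (lists Γ (g ∸ 2))

    girthCycles-unique : ∀ u v → Unique (girthCycles u v)
    girthCycles-unique u v = filter⁺ (λ xs → isCycle Γ (u ∷ v ∷ xs) ≟ᴮ true) (lists-unique (g ∸ 2))

    ∈-girthCycles⁺ : ∀ {u v xs} → length xs ≡ d + e → Closed u v xs → xs ∈ girthCycles u v
    ∈-girthCycles⁺ {u} {v} {xs} len w = ∈-filter⁺ (λ xs → isCycle Γ (u ∷ v ∷ xs) ≟ᴮ true)
      (subst (λ m → xs ∈ lists Γ m) (trans len (sym g∸2)) (∈-lists⁺ xs)) (Closed⇒isCycle u v xs len w)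

    ∈-girthCycles⁻ : ∀ {u v xs} → xs ∈ girthCycles u v → length xs ≡ d + e × Closed u v xs
    ∈-girthCycles⁻ {u} {v} {xs} p with ∈-filter⁻ (λ xs → isCycle Γ (u ∷ v ∷ xs) ≟ᴮ true) {xs = lists Γ (g ∸ 2)} p
    ... | q , c = len , closed xs len c
      where
      len = trans (∈-lists⁻ (g ∸ 2) q) g∸2
      closed : ∀ xs → length xs ≡ d + e → isCycle Γ (u ∷ v ∷ xs) ≡ true → Closed u v xs
      closed (a ∷ xs) _ c = isCycle⇒Closed u v a xs c

    NB-rev : ∀ x L t → NB (x ∷ L ∷ʳ t) → NB (t ∷ reverse L ∷ʳ x)
    NB-rev x [] t w = two (~-sym (NB-head w))
    NB-rev x (a ∷ L) t w = subst NB eq (NB-reverse (L ∷ʳ t) w)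
      where
      eq : (L ∷ʳ t) ʳ++ (a ∷ x ∷ []) ≡ t ∷ reverse (a ∷ L) ∷ʳ x
      eq = trans (++-ʳ++ L) (cong (t ∷_) (trans (ʳ++-defn L) (trans (sym (++-assoc (reverse L) (a ∷ []) (x ∷ [])))
             (cong (_∷ʳ x) (sym (unfold-reverse a L))))))

    Closed-reverse : ∀ {u v} xs → length xs ≡ d + e → Closed u v xs → Closed v u (reverse xs)
    Closed-reverse {u} {v} xs len w with NB-rev u (v ∷ xs) u w | Closed⇒Unique u v xs len w
    ... | w′ | _ ∷ uq = glue (reverse xs) nonempty (λ p → Unique[x∷xs]⇒x∉xs uq (reverse⁻ p)) w″
      where
      w″ : NB (u ∷ reverse xs ∷ʳ v)
      w″ = NB-prefix u (reverse xs ∷ʳ v) (subst (λ l → NB (u ∷ l ∷ʳ u)) (unfold-reverse v xs) w′)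
      nonempty : reverse xs ≢ []
      nonempty eq with trans (sym (length-reverse xs)) (cong length eq)
      ... | q with trans (sym len) q
      ... | ()
      glue : ∀ ys → ys ≢ [] → v ∉ ys → NB (u ∷ ys ∷ʳ v) → NB (v ∷ u ∷ ys ∷ʳ v)
      glue [] ne _ _ = ⊥-elim (ne refl)
      glue (y ∷ ys) _ v∉ nb = cons (~-sym (NB-head w)) (λ { refl → v∉ (here refl) }) nb

    eps-reverse-≤ : ∀ u v → eps Γ g u v ≤ eps Γ g v u
    eps-reverse-≤ u v = ≤-trans (≤-reflexive (sym (length-map reverse (girthCycles u v))))
      (unique-⊆⇒length≤ (map⁺ reverse-injective (girthCycles-unique u v)) sub)
      where
      sub : map reverse (girthCycles u v) ⊆ girthCycles v u
      sub p with ∈-map⁻ reverse p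
      ... | xs , q , refl with ∈-girthCycles⁻ q
      ... | len , w = ∈-girthCycles⁺ (trans (length-reverse xs) len) (Closed-reverse xs len w)

    eps-reverse : ∀ u v → eps Γ g u v ≡ eps Γ g v u
    eps-reverse u v = ≤-antisym (eps-reverse-≤ u v) (eps-reverse-≤ v u)

    -- The meaning of equality in ε ≤ k^d: each of the k^d extensions by d vertices begins a girth
    -- cycle.
    Closing : V → V → Set
    Closing u v = ∀ xs → length xs ≡ d → NB (u ∷ v ∷ xs) → ∃ λ ys → length ys ≡ e × Closed u v (xs ++ ys)

    Closed-back : ∀ {u v} xs ys → Closed u v (xs ++ ys) → NB (last v xs ∷ ys ∷ʳ u)
    Closed-back {u} {v} xs ys w = NB-suffix u (v ∷ xs) (subst (λ l → NB (u ∷ v ∷ l)) (++-assoc xs ys (u ∷ [])) w)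

    -- Both returns to `u` start at the same vertex and have e + 1 edges each, together 2d - 2 < g.
    Closed-determined : ∀ {u v} xs ys ys′ → length ys ≡ e → length ys′ ≡ e →
      Closed u v (xs ++ ys) → Closed u v (xs ++ ys′) → ys ≡ ys′
    Closed-determined {u} {v} xs ys ys′ l l′ w w′ = ∷ʳ-injectiveˡ ys ys′
      (NB-unique _ _ _ (Closed-back xs ys w) (Closed-back xs ys′ w′)
        (trans (last-++ _ ys) (sym (last-++ _ ys′)))
        (≤-trans (≤-reflexive (cong suc (cong₂ _+_ (len ys l) (len ys′ l′))))
          (s≤s (s≤s (+-monoʳ-≤ e (≤-trans (n≤1+n (suc e)) (≤-reflexive (sym (+-identityʳ d)))))))))
      where
      open import Data.List.Properties using (∷ʳ-injectiveˡ)
      len : ∀ zs → length zs ≡ e → length (zs ∷ʳ u) ≡ suc e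
      len zs eq = trans (length-∷ʳ u zs) (cong suc eq)

    length-drop-d : ∀ (xs : List V) → length xs ≡ d + e → length (drop d xs) ≡ e
    length-drop-d xs len = trans (length-drop d xs) (trans (cong (_∸ d) len) (m+n∸m≡n d e))

    prefixes : V → V → List (List V)
    prefixes u v = map (take d) (girthCycles u v)

    split : ∀ {u v} xs → length xs ≡ d + e → Closed u v xs → Closed u v (take d xs ++ drop d xs)
    split xs len w = subst (Closed _ _) (sym (take++drop≡id d xs)) w

    prefixes-unique : ∀ u v → Unique (prefixes u v)
    prefixes-unique u v = unique-map (take d) inj (girthCycles-unique u v)
      where
      inj : ∀ {xs ys} → xs ∈ girthCycles u v → ys ∈ girthCycles u v → take d xs ≡ take d ys → xs ≡ ys
      inj {xs} {ys} p q eq with ∈-girthCycles⁻ p | ∈-girthCycles⁻ q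
      ... | l , w | l′ , w′ = trans (sym (take++drop≡id d xs)) (trans (cong₂ _++_ eq tails) (take++drop≡id d ys))
        where
        tails : drop d xs ≡ drop d ys
        tails = Closed-determined (take d ys) (drop d xs) (drop d ys) (length-drop-d xs l) (length-drop-d ys l′)
          (subst (λ t → Closed u v (t ++ drop d xs)) eq (split xs l w)) (split ys l′ w′)

    module _ {k : ℕ} (reg : Regular Γ (suc k)) where

      prefixes⊆extensions : ∀ u v → prefixes u v ⊆ extensions d u v
      prefixes⊆extensions u v p with ∈-map⁻ (take d) p
      ... | xs , q , refl with ∈-girthCycles⁻ q
      ... | len , w = subst (λ m → take d xs ∈ extensions m u v) len′ (∈-extensions⁺ (take d xs)
              (NB-prefix u (v ∷ take d xs) (subst (λ l → NB (u ∷ v ∷ l)) (++-assoc (take d xs) (drop d xs) (u ∷ [])) (split xs len w))))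
        where
        len′ : length (take d xs) ≡ d
        len′ = trans (length-take d xs) (trans (cong (d ⊓_) len) (m≤n⇒m⊓n≡m (m≤m+n d e)))
          where
          open import Data.Nat using (_⊓_)
          open import Data.Nat.Properties using (m≤n⇒m⊓n≡m; m≤m+n)

      -- Cutting a girth cycle after its d free vertices is injective into the k^d extensions;
      -- between sets of equal size it is onto.
      eps-max⇒Closing : ∀ {u v} → u ~ v → eps Γ g u v ≡ k ^ d → Closing u v
      eps-max⇒Closing {u} {v} uv eq xs len w
        with ∈-map⁻ (take d) (unique-⊆⇒⊇ (≡-dec _≟_) (prefixes-unique u v) (prefixes⊆extensions u v)
               (≤-reflexive (trans (length-extensions reg d (~-sym uv)) (trans (sym eq) (sym (length-map (take d) (girthCycles u v))))))
               (subst (λ m → xs ∈ extensions m u v) len (∈-extensions⁺ xs w)))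
      ... | zs , p , refl with ∈-girthCycles⁻ p
      ... | len′ , w′ = drop d zs , length-drop-d zs len′ , split zs len′ w′

      Closing⇒eps-max : ∀ {u v} → u ~ v → Closing u v → eps Γ g u v ≡ k ^ d
      Closing⇒eps-max {u} {v} uv cl = ≤-antisym
        (subst₂ _≤_ lp le (unique-⊆⇒length≤ (prefixes-unique u v) (prefixes⊆extensions u v)))
        (subst₂ _≤_ le lp (unique-⊆⇒length≤ (extensions-unique d u v) sub))
        where
        lp = length-map (take d) (girthCycles u v)
        le = length-extensions reg d (~-sym uv)
        sub : extensions d u v ⊆ prefixes u v
        sub {xs} p with ∈-extensions⁻ d uv p
        ... | len , w with cl xs len w
        ... | ys , len′ , w′ = subst (_∈ prefixes u v) (trans (cong (λ m → take m (xs ++ ys)) (sym len)) (take-++ xs))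
                (∈-map⁺ (take d) (∈-girthCycles⁺ (trans (length-++ xs) (cong₂ _+_ len len′)) w′))
          where
          take-++ : ∀ as → take (length as) (as ++ ys) ≡ as
          take-++ [] = refl
          take-++ (a ∷ as) = cong (a ∷_) (take-++ as)

    last-snoc : ∀ {x : V} xs {y} → last x (xs ∷ʳ y) ≡ y
    last-snoc {x} xs = last-++ x xs

    pen-snoc : ∀ a b xs {y} → penultimate a b (xs ∷ʳ y) ≡ last b xs
    pen-snoc a b [] = refl
    pen-snoc a b (x ∷ xs) = pen-snoc b x xs

    ShortCut : V → List V → Set
    ShortCut v xs = ∃ λ ys → length ys ≡ suc e × NB (v ∷ ys) × last v ys ≡ last v xs

    Closing⇒ShortCut : ∀ {v w} → Closing v w → ∀ xs → length xs ≡ d → NB (v ∷ w ∷ xs) → ShortCut v (w ∷ xs)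
    Closing⇒ShortCut {v} {w} cl xs len nb with cl xs len nb
    ... | ys , len′ , c = reverse ys ∷ʳ last w xs ,
          trans (length-∷ʳ _ (reverse ys)) (cong suc (trans (length-reverse ys) len′)) ,
          NB-rev _ ys v (Closed-back xs ys c) , last-snoc (reverse ys)

    -- A walk of d + 1 edges is exchanged for one of d - 1 edges. This single property bounds the
    -- diameter, fixes the parity of distances and makes every edge closing; all later geometry is
    -- derived from it.
    Moore : Set
    Moore = ∀ v xs → length xs ≡ suc d → NB (v ∷ xs) → ShortCut v xs

    -- A single closing edge at `v` serves all walks from `v`. A walk that does not begin with `w`
    -- is prolonged backwards to `w` and closed. The girth cycle leads from `v` through `w` to the
    -- last vertex but one, `y`; the remaining edge from `y` either runs back along this path, which
    -- then is the short cut, or prolongs it to a walk that does begin with `w`.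
    Closing⇒Moore : ∀ {v w} → v ~ w → Closing v w → Closing w v →
      ∀ xs → length xs ≡ suc d → NB (v ∷ xs) → ShortCut v xs
    Closing⇒Moore {v} {w} vw cl cl′ (a ∷ xs) len nb with a ≟ w
    ... | yes refl = Closing⇒ShortCut cl xs (suc-injective len) nb
    ... | no a≢w with initLast xs
    ...   | xs′ ∷ʳ′ z = result
      where
      y = last a xs′
      len₁ : length (a ∷ xs′) ≡ d
      len₁ = trans (sym (length-∷ʳ z xs′)) (suc-injective len)
      y~z : y ~ z
      y~z = NB-head (NB-suffix v (a ∷ xs′) nb)
      closure = cl′ (a ∷ xs′) len₁ (cons (~-sym vw) (λ eq → a≢w (sym eq)) (NB-prefix v (a ∷ xs′) nb))
      ys = proj₁ closure
      rs = reverse ys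
      len-rs : length rs ≡ e
      len-rs = trans (length-reverse ys) (proj₁ (proj₂ closure))
      A = proj₁ (snoc-view a xs′)
      rev-eq : reverse ((a ∷ xs′) ++ ys) ≡ rs ++ y ∷ reverse A
      rev-eq = trans (reverse-++ (a ∷ xs′) ys)
        (cong (rs ++_) (trans (cong reverse (proj₂ (snoc-view a xs′))) (reverse-++ A (y ∷ []))))
      back : Closed v w (rs ++ y ∷ reverse A)
      back = subst (Closed v w) rev-eq (Closed-reverse ((a ∷ xs′) ++ ys)
        (trans (length-++ (a ∷ xs′)) (cong₂ _+_ len₁ (proj₁ (proj₂ closure)))) (proj₂ (proj₂ closure)))
      path : NB (v ∷ w ∷ rs ∷ʳ y)
      path = NB-prefix v (w ∷ rs ∷ʳ y) (subst (λ l → NB (v ∷ w ∷ l))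
        (trans (++-assoc rs (y ∷ reverse A) (v ∷ [])) (sym (++-assoc rs (y ∷ []) (reverse A ∷ʳ v)))) back)
      end : last v (a ∷ xs′ ∷ʳ z) ≡ z
      end = last-snoc xs′
      detour : z ≢ last w rs → ShortCut v (w ∷ (rs ∷ʳ y) ∷ʳ z)
      detour z≢ = Closing⇒ShortCut cl ((rs ∷ʳ y) ∷ʳ z)
        (trans (length-∷ʳ z (rs ∷ʳ y)) (cong suc (trans (length-∷ʳ y rs) (cong suc len-rs))))
        (NB-snoc path (subst (_~ z) (sym (last-snoc rs)) y~z) (λ eq → z≢ (trans (sym eq) (pen-snoc v w rs))))
      choose : Dec (z ≡ last w rs) → ShortCut v (a ∷ xs′ ∷ʳ z)
      choose (yes z≡) = w ∷ rs , cong suc len-rs , NB-prefix v (w ∷ rs) path , trans (sym z≡) (sym end)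
      choose (no z≢) = proj₁ (detour z≢) , proj₁ (proj₂ (detour z≢)) , proj₁ (proj₂ (proj₂ (detour z≢))) ,
        trans (proj₂ (proj₂ (proj₂ (detour z≢)))) (trans (last-snoc (rs ∷ʳ y)) (sym end))
      result : ShortCut v (a ∷ xs′ ∷ʳ z)
      result = choose (z ≟ last w rs)

-- Distances in a graph with the Moore property.

module Distances where

  open import Defs renaming (sym to adj-sym)
  open ListLemmas
  open Walks
  open CycleCounting
  open import Data.Nat using (ℕ; suc; _+_; _*_; _≤_; _<_; z≤n; s≤s)
  open import Data.Nat.Properties
  open import Data.Fin using (Fin)
  import Data.Fin.Properties as Fin

  module Distance {n : ℕ} (Γ : Graph n) (e : ℕ)
    (noShort : ∀ ℓ → ℓ < 2 * suc (suc e) → ¬ HasCycle Γ ℓ)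
    (conn : Connected Γ)
    (moore : GirthCycles.Moore Γ e noShort) where

    open GirthCycles Γ e noShort public

    g≡d+d : g ≡ d + d
    g≡d+d = cong (d +_) (+-identityʳ d)

    penultimate-split : ∀ (u a : V) (xs : List V) → ∃ λ (ys : List V) → u ∷ a ∷ xs ≡ u ∷ ys ∷ʳ last a xs × last u ys ≡ penultimate u a xs
    penultimate-split u a [] = [] , refl , refl
    penultimate-split u a (b ∷ xs) with penultimate-split a b xs
    ... | ys , eq , l = a ∷ ys , cong (u ∷_) eq , l

    record Geodesic (u v : V) : Set where
      constructor geodesic
      field
        path  : List V
        nb    : NB (u ∷ path)
        end   : last u path ≡ v
        short : length path ≤ d
    open Geodesic

    -- A new edge undoes the last one, or lengthens the walk; from length d it would give d + 1
    -- edges, which `moore` reduces to d - 1. So the length never exceeds d along any walk, and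
    -- connectedness bounds the diameter.
    extend : ∀ {u v w} → Geodesic u v → v ~ w → Geodesic u w
    extend (geodesic [] _ refl _) e = geodesic (_ ∷ []) (two e) refl (s≤s z≤n)
    extend {u} {v} {w} (geodesic (a ∷ xs) nb end le) e with w Fin.≟ penultimate u a xs
    ... | yes refl with penultimate-split u a xs
    ...   | ys , eq , l = geodesic ys (NB-prefix u ys (subst NB eq nb)) l
              (≤-trans (n≤1+n _) (≤-trans (≤-reflexive (sym (suc-injective (trans (cong length eq) (cong suc (length-∷ʳ _ ys)))))) le))
    extend {u} {v} {w} (geodesic (a ∷ xs) nb end le) e | no w≢ with m≤n⇒m<n∨m≡n le
    ...   | inj₁ lt = geodesic (a ∷ xs ∷ʳ w) (NB-snoc nb (subst (_~ w) (sym end) e) (λ q → w≢ (sym q))) (last-snoc xs)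
              (≤-trans (≤-reflexive (cong suc (length-∷ʳ w xs))) lt)
    ...   | inj₂ eq with moore u (a ∷ xs ∷ʳ w) (cong suc (trans (length-∷ʳ w xs) eq)) (NB-snoc nb (subst (_~ w) (sym end) e) (λ q → w≢ (sym q)))
    ...     | ys , len , nb′ , end′ = geodesic ys nb′ (trans end′ (last-snoc xs)) (≤-trans (≤-reflexive len) (n≤1+n _))

    walk⇒geodesic : ∀ {u v w ℓ} → Geodesic u v → Walk Γ v w ℓ → Geodesic u w
    walk⇒geodesic p here = p
    walk⇒geodesic p (step e q) = walk⇒geodesic (extend p e) q

    abstract
      geo : ∀ u v → Geodesic u v
      geo u v = walk⇒geodesic (geodesic [] one refl z≤n) (proj₂ (conn u v))

    δ : V → V → ℕ
    δ u v = length (path (geo u v))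

    δ≤d : ∀ u v → δ u v ≤ d
    δ≤d u v = short (geo u v)

    -- If one of the two walks has fewer than d edges, both have fewer than 2d = g together and
    -- coincide; otherwise both have d. Hence `δ` can be read off any non-backtracking walk of at
    -- most d edges.
    geodesic-length : ∀ {u v} (p q : Geodesic u v) → length (path p) ≡ length (path q)
    geodesic-length {u} p q with m≤n⇒m<n∨m≡n (short p) | m≤n⇒m<n∨m≡n (short q)
    ... | inj₁ lt | _ = cong length (NB-unique u _ _ (nb p) (nb q) (trans (end p) (sym (end q)))
            (≤-trans (+-mono-<-≤ lt (short q)) (≤-reflexive (sym g≡d+d))))
    ... | inj₂ _ | inj₁ lt = cong length (NB-unique u _ _ (nb p) (nb q) (trans (end p) (sym (end q)))
            (≤-trans (+-mono-≤-< (short p) lt) (≤-reflexive (sym g≡d+d))))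
    ... | inj₂ eq | inj₂ eq′ = trans eq (sym eq′)

    δ-unique : ∀ {u v} (p : Geodesic u v) → δ u v ≡ length (path p)
    δ-unique p = geodesic-length (geo _ _) p

    δ-path : ∀ {u} xs → NB (u ∷ xs) → length xs ≤ d → δ u (last u xs) ≡ length xs
    δ-path xs w le = δ-unique (geodesic xs w refl le)

    δ-refl : ∀ u → δ u u ≡ 0
    δ-refl u = δ-path [] one z≤n

    δ≡0⇒≡ : ∀ {u v} → δ u v ≡ 0 → u ≡ v
    δ≡0⇒≡ {u} {v} eq with path (geo u v) | end (geo u v)
    ... | [] | refl = refl
    ... | _ ∷ _ | _ with eq
    ... | ()

    reverse-geodesic : ∀ {u v} (p : Geodesic u v) → ∃ λ (q : Geodesic v u) → length (path q) ≡ length (path p)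
    reverse-geodesic (geodesic xs nb end le) with initLast xs
    ... | [] = geodesic [] one (sym end) z≤n , refl
    ... | ys ∷ʳ′ y with trans (sym (last-snoc ys)) end
    ... | refl = geodesic (reverse ys ∷ʳ _) (NB-rev _ ys y nb) (last-snoc (reverse ys)) (≤-trans (≤-reflexive len) le) , len
      where
      len : ∀ {x} → length (reverse ys ∷ʳ x) ≡ length (ys ∷ʳ y)
      len {x} = trans (length-∷ʳ x (reverse ys)) (trans (cong suc (length-reverse ys)) (sym (length-∷ʳ y ys)))

    δ-sym : ∀ u v → δ u v ≡ δ v u
    δ-sym u v with reverse-geodesic (geo u v)
    ... | q , len = trans (sym len) (sym (δ-unique q))

    data Step (v u w : V) : Set where
      closer  : suc (δ v w) ≡ δ v u → Step v u w
      farther : δ v w ≡ suc (δ v u) → Step v u w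

    -- Equal distances cannot occur: the geodesic to `u` followed by the edge is one shorter or one
    -- longer than before, and at length d it is exchanged for a walk of d - 1 edges. This is
    -- bipartiteness.
    δ-step : ∀ v {u w} → u ~ w → Step v u w
    δ-step v {u} {w} e with geo v u in eqg
    ... | geodesic [] _ refl _ = farther (trans (δ-path (w ∷ []) (two e) (s≤s z≤n)) (sym (cong suc (δ-refl v))))
    ... | geodesic (a ∷ xs) nb end le = go
      where
      δvu : δ v u ≡ suc (length xs)
      δvu = cong (λ p → length (path p)) eqg
      go : Step v u w
      go with w Fin.≟ penultimate v a xs
      ... | yes refl = closer (trans (cong suc (pen-δ v a xs nb le)) (sym δvu))
        where
        pen-δ : ∀ v a xs → NB (v ∷ a ∷ xs) → suc (length xs) ≤ d → δ v (penultimate v a xs) ≡ length xs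
        pen-δ v a xs nb le with penultimate-split v a xs
        ... | ys , eq , l = trans (δ-unique (geodesic ys (NB-prefix v ys (subst NB eq nb)) l (≤-trans (≤-reflexive len) (≤-trans (n≤1+n _) le)))) len
          where
          len : length ys ≡ length xs
          len = sym (suc-injective (suc-injective (trans (cong length eq) (cong suc (length-∷ʳ _ ys)))))
      ... | no w≢ with m≤n⇒m<n∨m≡n le
      ...   | inj₁ lt = farther (trans (δ-unique (geodesic (a ∷ xs ∷ʳ w) (NB-snoc nb (subst (_~ w) (sym end) e) (λ q → w≢ (sym q))) (last-snoc xs)
                (≤-trans (≤-reflexive (cong suc (length-∷ʳ w xs))) lt))) (trans (cong suc (length-∷ʳ w xs)) (cong suc (sym δvu))))
      ...   | inj₂ eq with moore v (a ∷ xs ∷ʳ w) (cong suc (trans (length-∷ʳ w xs) eq)) (NB-snoc nb (subst (_~ w) (sym end) e) (λ q → w≢ (sym q)))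
      ...     | ys , len , nb′ , end′ = closer (trans (cong suc (trans (δ-unique (geodesic ys nb′ (trans end′ (last-snoc xs)) (≤-trans (≤-reflexive len) (n≤1+n _)))) len))
                  (trans (sym eq) (sym δvu)))

    closer-exists : ∀ v u → δ v u ≢ 0 → ∃ λ w → u ~ w × suc (δ v w) ≡ δ v u
    closer-exists v u ne with geo u v in eqg
    ... | geodesic [] _ refl _ = ⊥-elim (ne (δ-refl u))
    ... | geodesic (w ∷ xs) nb end le = w , NB-head nb ,
          trans (cong suc (trans (δ-sym v w) (δ-unique (geodesic xs (NB-tail nb) end (≤-trans (n≤1+n _) le)))))
            (trans (sym (cong (λ p → length (path p)) eqg)) (δ-sym u v))

    closer-NB : ∀ {v u w} → u ~ w → suc (δ v w) ≡ δ v u → NB (u ∷ w ∷ path (geo w v))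
    closer-NB {v} {u} {w} e eq with geo w v in eqg
    ... | geodesic [] _ _ _ = two e
    ... | geodesic (a ∷ xs) nb end le = cons e ne nb
      where
      δwv : δ w v ≡ suc (length xs)
      δwv = cong (λ p → length (path p)) eqg
      ne : u ≢ a
      ne refl = <⇒≢ {length xs} (n≤1+n _)
        (trans (sym (trans (δ-sym v a) (δ-unique (geodesic xs (NB-tail nb) end (≤-trans (n≤1+n _) le)))))
          (trans (sym eq) (trans (cong suc (δ-sym v w)) (cong suc δwv))))

    -- Two closer neighbours would give two walks to `v` with fewer than d edges each. At distance d
    -- itself every neighbour is closer, so the bound is sharp.
    closer-unique : ∀ {v u w w′} → δ v u < d → u ~ w → u ~ w′ → suc (δ v w) ≡ δ v u → suc (δ v w′) ≡ δ v u → w ≡ w′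
    closer-unique {v} {u} {w} {w′} lt e e′ eq eq′ = ∷-injectiveˡ
      (NB-unique u (w ∷ path (geo w v)) (w′ ∷ path (geo w′ v)) (closer-NB e eq) (closer-NB e′ eq′)
        (trans (end (geo w v)) (sym (end (geo w′ v))))
        (≤-trans (+-mono-<-≤ (≤-trans (s≤s (≤-reflexive (trans (cong suc (δ-sym w v)) eq))) lt)
                             (≤-trans (≤-reflexive (trans (cong suc (δ-sym w′ v)) eq′)) (<⇒≤ lt)))
          (≤-reflexive (sym g≡d+d))))
      where open import Data.List.Properties using (∷-injectiveˡ)

-- The generalised polygon.

module Polygons where

  open import Defs renaming (sym to adj-sym)
  open ListLemmas
  open Walks
  open CycleCounting
  open Distances
  open import Data.Nat using (ℕ; zero; suc; _+_; _*_; _^_; _≤_; s≤s)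
  open import Data.Nat.Properties using (≤-trans; ≤-reflexive; ≤-antisym; n≤1+n; suc-injective; <⇒≢; m≤n+m;
    +-identityʳ; m≤n⇒m⊓n≡m; +-mono-≤-<)
  open import Data.Bool.Properties using (not-¬; not-involutive)
  open import Data.Bool.ListAction using (any)
  open import Data.Fin using (Fin; zero; suc; join; splitAt)
  import Data.Fin.Properties as Fin
  open import Data.List using (lookup)
  open import Data.List.Relation.Unary.Any as Any using (here; index)
  open import Data.List.Relation.Unary.Any.Properties using (lookup-index)
  open import Data.List.Relation.Unary.All as All using ([]; _∷_)
  open import Data.List.Relation.Unary.Unique.Propositional using (Unique; []; _∷_)
  open import Function.Bundles using (Inverse; mk↔ₛ′)

  lookup-injective : ∀ {a} {A : Set a} (xs : List A) → Unique xs → ∀ i j → lookup xs i ≡ lookup xs j → i ≡ j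
  lookup-injective (x ∷ xs) u zero zero _ = refl
  lookup-injective (x ∷ xs) u zero (suc j) eq = ⊥-elim (Unique[x∷xs]⇒x∉xs u (subst (_∈ xs) (sym eq) (∈-lookup j)))
  lookup-injective (x ∷ xs) u (suc i) zero eq = ⊥-elim (Unique[x∷xs]⇒x∉xs u (subst (_∈ xs) eq (∈-lookup i)))
  lookup-injective (x ∷ xs) (_ ∷ u) (suc i) (suc j) eq = cong suc (lookup-injective xs u i j eq)

  module Homomorphism {n m : ℕ} (G : Graph n) (H : Graph m) (f : Fin n → Fin m)
    (f-injective : ∀ {u v} → f u ≡ f v → u ≡ v)
    (f-adj : ∀ u v → adj G u v ≡ adj H (f u) (f v)) where

    map-any : ∀ x xs → any (λ y → does (f x Fin.≟ y)) (map f xs) ≡ any (λ y → does (x Fin.≟ y)) xs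
    map-any x [] = refl
    map-any x (y ∷ xs) with x Fin.≟ y | f x Fin.≟ f y
    ... | yes _ | yes _ = refl
    ... | yes refl | no ne = ⊥-elim (ne refl)
    ... | no ne | yes eq = ⊥-elim (ne (f-injective eq))
    ... | no _ | no _ = map-any x xs

    map-distinct : ∀ xs → distinct H (map f xs) ≡ distinct G xs
    map-distinct [] = refl
    map-distinct (x ∷ xs) = cong₂ _∧_ (cong not (map-any x xs)) (map-distinct xs)

    map-chain : ∀ xs → chain H (map f xs) ≡ chain G xs
    map-chain [] = refl
    map-chain (x ∷ []) = refl
    map-chain (x ∷ y ∷ xs) = cong₂ _∧_ (sym (f-adj x y)) (map-chain (y ∷ xs))

    map-last : ∀ x xs → lastOr H (f x) (map f xs) ≡ f (lastOr G x xs)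
    map-last x [] = refl
    map-last x (y ∷ xs) = map-last y xs

    map-isCycle : ∀ xs → isCycle H (map f xs) ≡ isCycle G xs
    map-isCycle [] = refl
    map-isCycle (x ∷ []) = refl
    map-isCycle (x ∷ y ∷ []) = refl
    map-isCycle (x ∷ y ∷ z ∷ xs) = cong₂ _∧_ (map-distinct (x ∷ y ∷ z ∷ xs))
      (cong₂ _∧_ (map-chain (x ∷ y ∷ z ∷ xs))
        (trans (cong (λ t → adj H t (f x)) (map-last z xs)) (sym (f-adj (lastOr G z xs) x))))

    map-HasCycle : ∀ {ℓ} → HasCycle G ℓ → HasCycle H ℓ
    map-HasCycle (xs , len , c) = map f xs , trans (length-map f xs) len , trans (map-isCycle xs) c

    map-Walk : ∀ {u v ℓ} → Walk G u v ℓ → Walk H (f u) (f v) ℓ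
    map-Walk here = here
    map-Walk (step e w) = step (trans (sym (f-adj _ _)) e) (map-Walk w)

  module _ {n m : ℕ} {G : Graph n} {H : Graph m} (iso : G ≅ H) where

    private
      f = proj₁ iso
      f-adj = proj₂ iso
      to = Inverse.to f
      from = Inverse.from f
      to∘from : ∀ x → to (from x) ≡ x
      to∘from x = Inverse.inverseˡ f refl
      from∘to : ∀ x → from (to x) ≡ x
      from∘to x = Inverse.inverseʳ f refl
      module T = Homomorphism G H to (λ {u} {v} eq → trans (sym (from∘to u)) (trans (cong from eq) (from∘to v))) f-adj
      module F = Homomorphism H G from (λ {u} {v} eq → trans (sym (to∘from u)) (trans (cong to eq) (to∘from v)))
        (λ u v → trans (cong₂ (adj H) (sym (to∘from u)) (sym (to∘from v))) (sym (f-adj (from u) (from v))))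

    ≅-Girth : ∀ {g} → Girth G g → Girth H g
    ≅-Girth (c , s) = T.map-HasCycle c , λ ℓ lt c′ → s ℓ lt (F.map-HasCycle c′)

    ≅-Diameter : ∀ {d} → Diameter G d → Diameter H d
    ≅-Diameter {d} (D , u , v , far) = D′ , to u , to v ,
        λ ℓ w → far ℓ (subst₂ (λ a b → Walk G a b ℓ) (from∘to u) (from∘to v) (F.map-Walk w))
      where
      D′ : ∀ u v → ∃ λ ℓ → ℓ ≤ d × Walk H u v ℓ
      D′ u v with D (from u) (from v)
      ... | ℓ , le , w = ℓ , le , subst₂ (λ a b → Walk H a b ℓ) (to∘from u) (to∘from v) (T.map-Walk w)

  parity : ℕ → Bool
  parity zero = true
  parity (suc m) = not (parity m)

  module Polygon {n : ℕ} (Γ : Graph n) (e k : ℕ)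
    (Γ-girth : Girth Γ (2 * suc (suc e)))
    (conn : Connected Γ) (reg : Regular Γ (suc k))
    (moore : GirthCycles.Moore Γ e (proj₂ Γ-girth)) where

    open Distance Γ e (proj₂ Γ-girth) conn moore public
    open Geodesic

    NB-join : ∀ {a b xs c M} → NB (a ∷ b ∷ xs) → NB (last b xs ∷ c ∷ M) → penultimate a b xs ≢ c → NB (a ∷ b ∷ xs ++ c ∷ M)
    NB-join (two f) w ne = cons f ne w
    NB-join (cons f ne₁ w₁) w ne = cons f ne₁ (NB-join w₁ w ne)

    reverse-head : ∀ u ys → ∃ λ M → reverse ys ∷ʳ u ≡ last u ys ∷ M
    reverse-head u ys with initLast ys
    ... | [] = [] , refl
    ... | zs ∷ʳ′ z = reverse zs ∷ʳ u , trans (cong (_∷ʳ u) (reverse-++ zs (z ∷ []))) (cong (_∷ reverse zs ∷ʳ u) (sym (last-snoc zs)))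

    -- The short cut traversed backwards closes the walk. It does not backtrack at the junction:
    -- otherwise the vertex before the end would be reached from `u` by walks of d and of e edges,
    -- fewer than g in total, which would have to coincide. So one extremal edge at each vertex
    -- makes all edges extremal.
    closing : ∀ {u v} → u ~ v → Closing u v
    closing {u} {v} uv xs len w with moore u (v ∷ xs) (cong suc len) w
    ... | ys , len′ , w′ , end′ with initLast ys
    ... | ys₀ ∷ʳ′ x with trans (sym (last-snoc ys₀)) end′
    ... | refl = reverse ys₀ , trans (length-reverse ys₀) len₀ , joined (NB-rev u ys₀ _ w′)
      where
      len₀ : length ys₀ ≡ e
      len₀ = suc-injective (trans (sym (length-∷ʳ _ ys₀)) len′)
      sp = penultimate-split u v xs
      ne : penultimate u v xs ≢ last u ys₀
      ne eq = <⇒≢ {e} (n≤1+n _)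
        (trans (sym len₀) (trans (cong length (sym same)) lenA))
        where
        lenA : length (proj₁ sp) ≡ d
        lenA = trans (suc-injective (suc-injective (trans (cong suc (sym (length-∷ʳ _ (proj₁ sp)))) (sym (cong length (proj₁ (proj₂ sp))))))) len
        same : proj₁ sp ≡ ys₀
        same = NB-unique u _ _ (NB-prefix u (proj₁ sp) (subst NB (proj₁ (proj₂ sp)) w)) (NB-prefix u ys₀ w′)
          (trans (proj₂ (proj₂ sp)) eq)
          (≤-trans (+-mono-≤-< (≤-reflexive lenA) (≤-trans (≤-reflexive (cong suc len₀)) (n≤1+n _))) (≤-reflexive (sym g≡d+d)))
      joined : NB (last v xs ∷ reverse ys₀ ∷ʳ u) → NB (u ∷ v ∷ (xs ++ reverse ys₀) ∷ʳ u)
      joined b with reverse-head u ys₀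
      ... | M , eq = subst (λ l → NB (u ∷ v ∷ l))
              (trans (cong (xs ++_) (sym eq)) (sym (++-assoc xs (reverse ys₀) (u ∷ []))))
              (NB-join w (subst (λ l → NB (last v xs ∷ l)) eq b) ne)

    eps-constant : ∀ {u v} → u ~ v → eps Γ (2 * d) u v ≡ k ^ d
    eps-constant uv = Closing⇒eps-max reg uv (closing uv)

    NB⇒Walk : ∀ {u} xs → NB (u ∷ xs) → Walk Γ u (last u xs) (length xs)
    NB⇒Walk [] _ = here
    NB⇒Walk (x ∷ xs) w = step (NB-head w) (NB⇒Walk xs (NB-tail w))

    geodesic⇒Walk : ∀ u v → Walk Γ u v (δ u v)
    geodesic⇒Walk u v = subst (λ t → Walk Γ u t (δ u v)) (end (geo u v)) (NB⇒Walk (path (geo u v)) (nb (geo u v)))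

    δ≤walk : ∀ {u v ℓ} → Walk Γ u v ℓ → δ v u ≤ ℓ
    δ≤walk {u} here = ≤-reflexive (δ-refl u)
    δ≤walk {u} {v} (step {w = w} f q) with δ-step v f
    ... | closer eq = ≤-trans (≤-reflexive (sym eq)) (s≤s (δ≤walk q))
    ... | farther eq = ≤-trans (n≤1+n _) (≤-trans (≤-reflexive (sym eq)) (≤-trans (δ≤walk q) (n≤1+n _)))

    abstract
      -- The first d edges of a girth cycle form a geodesic. The pair serves as witness for the
      -- diameter, and later as root and first reference vertex.
      antipodes : ∃ λ u → ∃ λ v → δ u v ≡ d
      antipodes with proj₁ Γ-girth
      ... | x ∷ y ∷ z ∷ xs , len , c with ∧-true⁻ c
      ... | dis , c′ with ∧-true⁻ c′
      ... | ch , _ = x , _ , trans (δ-path ys (NB-prefix x ys (subst (λ l → NB (x ∷ l)) (sym (take++drop≡id d (y ∷ z ∷ xs)))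
                        (Unique∧chain⇒NB x (y ∷ z ∷ xs) (distinct⇒Unique dis) ch))) (≤-reflexive lys)) lys
        where
        ys : List V
        ys = take d (y ∷ z ∷ xs)
        lys : length ys ≡ d
        lys = trans (length-take d (y ∷ z ∷ xs)) (m≤n⇒m⊓n≡m (≤-trans
          (s≤s (≤-trans (≤-trans (≤-reflexive (cong suc (sym (+-identityʳ e)))) (n≤1+n _)) (m≤n+m (suc (suc (e + 0))) e)))
          (≤-reflexive (suc-injective (sym len)))))

    Γ-diameter : Diameter Γ d
    Γ-diameter = (λ u v → δ u v , δ≤d u v , geodesic⇒Walk u v) ,
      proj₁ antipodes , proj₁ (proj₂ antipodes) , λ ℓ w → ≤-trans (≤-reflexive (trans (sym (proj₂ (proj₂ antipodes))) (δ-sym _ _))) (δ≤walk w)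

    root : V
    root = proj₁ antipodes

    colour : V → Bool
    colour u = parity (δ root u)

    colour-flips : ∀ {u v} → u ~ v → colour v ≡ not (colour u)
    colour-flips {u} {v} f with δ-step root f
    ... | closer eq = sym (trans (cong (not ∘ parity) (sym eq)) (not-involutive _))
    ... | farther eq = cong parity eq

    class : Bool → List V
    class b = filter (λ u → colour u ≟ᴮ b) (allFin n)

    class-unique : ∀ b → Unique (class b)
    class-unique b = filter⁺ (λ u → colour u ≟ᴮ b) (allFin⁺ n)

    ∈-class : ∀ u {b} → colour u ≡ b → u ∈ class b
    ∈-class u {b} eq = ∈-filter⁺ (λ u → colour u ≟ᴮ b) (∈-allFin u) eq

    member : ∀ b → Fin (length (class b)) → V
    member b = lookup (class b)

    colour-member : ∀ b i → colour (member b i) ≡ b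
    colour-member b i = proj₂ (∈-filter⁻ (λ u → colour u ≟ᴮ b) {xs = allFin n} (∈-lookup i))

    position : ∀ u {b} → colour u ≡ b → Fin (length (class b))
    position u eq = index (∈-class u eq)

    member-position : ∀ u {b} (eq : colour u ≡ b) → member b (position u eq) ≡ u
    member-position u eq = sym (lookup-index (∈-class u eq))

    position-member : ∀ b i (eq : colour (member b i) ≡ b) → position (member b i) eq ≡ i
    position-member b i eq = lookup-injective (class b) (class-unique b) _ _ (member-position (member b i) eq)

    structureΓ : IncidenceStructure
    structureΓ = record { #points = length (class true) ; #lines = length (class false)
                        ; I = λ x y → adj Γ (member true x) (member false y) }

    H : Graph (length (class true) + length (class false))
    H = incidenceGraph structureΓ

    private
      p = length (class true)
      l = length (class false)

    unplace : Fin p ⊎ Fin l → V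
    unplace (inj₁ x) = member true x
    unplace (inj₂ y) = member false y

    place′ : ∀ u b → colour u ≡ b → Fin p ⊎ Fin l
    place′ u true eq = inj₁ (position u eq)
    place′ u false eq = inj₂ (position u eq)

    place : V → Fin p ⊎ Fin l
    place u = place′ u (colour u) refl

    unplace-place : ∀ u → unplace (place u) ≡ u
    unplace-place u = go (colour u) refl
      where
      go : ∀ b eq → unplace (place′ u b eq) ≡ u
      go true eq = member-position u eq
      go false eq = member-position u eq

    place-unplace : ∀ s → place (unplace s) ≡ s
    place-unplace (inj₁ x) = go (colour (member true x)) refl
      where
      go : ∀ b eq → place′ (member true x) b eq ≡ inj₁ x
      go true eq = cong inj₁ (position-member true x eq)
      go false eq = ⊥-elim (false≢true (trans (sym eq) (colour-member true x)))
    place-unplace (inj₂ y) = go (colour (member false y)) refl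
      where
      go : ∀ b eq → place′ (member false y) b eq ≡ inj₂ y
      go false eq = cong inj₂ (position-member false y eq)
      go true eq = ⊥-elim (false≢true (trans (sym (colour-member false y)) eq))

    same-colour : ∀ u v → colour u ≡ colour v → adj Γ u v ≡ false
    same-colour u v eq with adj Γ u v in e
    ... | false = refl
    ... | true = ⊥-elim (not-¬ refl (trans eq (colour-flips e)))

    H-adj : ∀ s t → adj Γ (unplace s) (unplace t) ≡ adj H (join p l s) (join p l t)
    H-adj s t with splitAt p (join p l s) | Fin.splitAt-join p l s | splitAt p (join p l t) | Fin.splitAt-join p l t
    H-adj (inj₁ x) (inj₁ y) | _ | refl | _ | refl = same-colour _ _ (trans (colour-member true x) (sym (colour-member true y)))
    H-adj (inj₁ x) (inj₂ y) | _ | refl | _ | refl = refl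
    H-adj (inj₂ x) (inj₁ y) | _ | refl | _ | refl = adj-sym Γ _ _
    H-adj (inj₂ x) (inj₂ y) | _ | refl | _ | refl = same-colour _ _ (trans (colour-member false x) (sym (colour-member false y)))

    Γ≅H : Γ ≅ H
    Γ≅H = mk↔ₛ′ (join p l ∘ place) (unplace ∘ splitAt p)
            (λ i → trans (cong (join p l) (place-unplace (splitAt p i))) (Fin.join-splitAt p l i))
            (λ u → trans (cong unplace (Fin.splitAt-join p l (place u))) (unplace-place u)) ,
          λ u v → trans (sym (cong₂ (adj Γ) (unplace-place u) (unplace-place v))) (H-adj (place u) (place v))

    incident-count : ∀ b (test : Fin (length (class b)) → Bool) u → colour u ≡ not b →
      (∀ i → test i ≡ adj Γ u (member b i)) →
      length (filter (λ i → test i ≟ᴮ true) (allFin (length (class b)))) ≡ suc k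
    incident-count b test u cu eq = trans (≤-antisym
        (subst (_≤ _) (length-map (member b) L) (unique-⊆⇒length≤ uq sub))
        (subst (_ ≤_) (length-map (member b) L) (unique-⊆⇒length≤ (neighbours-unique u) sup)))
        (reg u)
      where
      L = filter (λ i → test i ≟ᴮ true) (allFin (length (class b)))
      uq : Unique (map (member b) L)
      uq = map⁺ (lookup-injective (class b) (class-unique b) _ _) (filter⁺ (λ i → test i ≟ᴮ true) (allFin⁺ _))
      sub : map (member b) L ⊆ neighbours Γ u
      sub q with ∈-map⁻ (member b) q
      ... | i , i∈ , refl = ∈-neighbours⁺ (trans (sym (eq i)) (proj₂ (∈-filter⁻ (λ i → test i ≟ᴮ true) {xs = allFin _} i∈)))
      sup : neighbours Γ u ⊆ map (member b) L
      sup {v} q = subst (_∈ map (member b) L) (member-position v cv)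
        (∈-map⁺ (member b) (∈-filter⁺ (λ i → test i ≟ᴮ true) (∈-allFin _)
          (trans (eq _) (trans (cong (adj Γ u) (member-position v cv)) (∈-neighbours⁻ q)))))
        where
        cv : colour v ≡ b
        cv = trans (colour-flips (∈-neighbours⁻ q)) (trans (cong not cu) (not-involutive b))

    polygon : IsIncidenceGraphOfGenPolygon Γ d k k
    polygon = record
      { structure = structureΓ
      ; diameter = ≅-Diameter Γ≅H Γ-diameter
      ; girth = ≅-Girth Γ≅H Γ-girth
      ; linePts = λ L → incident-count true _ (member false L) (colour-member false L) (λ i → adj-sym Γ _ _)
      ; pointLns = λ P → incident-count false _ (member true P) (colour-member true P) (λ i → refl)
      } , Γ≅H

-- From the signature to the Moore property.

module Signatures where

  open import Defs renaming (sym to adj-sym)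
  open ListLemmas
  open Walks
  open CycleCounting
  open Distances
  open Polygons
  open import Data.Nat using (ℕ; zero; suc; _*_; _^_; _≤_; _<_; z≤n; s≤s)
  open import Data.Nat.Properties using (≤-decTotalOrder)
  open import Data.Fin using (Fin; toℕ; fromℕ)
  open import Data.Fin.Properties using (toℕ-fromℕ)
  open import Data.List.Relation.Binary.Permutation.Propositional.Properties using (∈-resp-↭)
  open import Data.List.Sort ≤-decTotalOrder using (sort-↭)
  open import Data.Vec using (Vec; _∷_; lookup; toList)

  lookup∈toList : ∀ {A : Set} {k} (a : Vec A k) i → lookup a i ∈ toList a
  lookup∈toList (x ∷ a) Fin.zero = here refl
  lookup∈toList (x ∷ a) (Fin.suc i) = there (lookup∈toList a i)

  module _ {n : ℕ} (Γ : Graph n) where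

    open NonBacktracking Γ using (_~_; V)
    open Neighbours Γ using (∈-neighbours⁺; ∈-neighbours⁻)

    signature-entry : ∀ g v {x} → x ∈ signature Γ g v → ∃ λ w → v ~ w × x ≡ eps Γ g v w
    signature-entry g v x∈ with ∈-map⁻ (eps Γ g v) (∈-resp-↭ (sort-↭ (map (eps Γ g v) (neighbours Γ v))) x∈)
    ... | w , w∈ , eq = w , ∈-neighbours⁻ w∈ , eq

    cycle-length≥3 : ∀ ℓ → HasCycle Γ ℓ → 3 ≤ ℓ
    cycle-length≥3 _ (x ∷ y ∷ z ∷ xs , refl , _) = s≤s (s≤s (s≤s z≤n))

    cycle-edge : ∀ {ℓ} → HasCycle Γ ℓ → ∃ λ u → ∃ λ v → u ~ v
    cycle-edge (x ∷ y ∷ z ∷ xs , _ , c) with ∧-true⁻ {distinct Γ (x ∷ y ∷ z ∷ xs)} c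
    ... | _ , c′ with ∧-true⁻ {chain Γ (x ∷ y ∷ z ∷ xs)} c′
    ... | c″ , _ = x , y , proj₁ (∧-true⁻ {adj Γ x y} c″)

    -- A cycle contains an edge, so the valence is positive and the truncated subtraction `k ∸ 1` is
    -- the true one.
    degree≢0 : ∀ {k ℓ} → HasCycle Γ ℓ → Regular Γ k → ∃ λ k′ → k ≡ suc k′
    degree≢0 {zero} c reg with cycle-edge c
    ... | u , v , e with subst (0 <_) (reg u) (∈-length (∈-neighbours⁺ e))
    ... | ()
    degree≢0 {suc k} c reg = k , refl

  half-girth≥2 : ∀ d → 3 ≤ 2 * d → ∃ λ e → d ≡ suc (suc e)
  half-girth≥2 (suc zero) (s≤s (s≤s ()))
  half-girth≥2 (suc (suc e)) _ = e , refl

  module _ {n : ℕ} (Γ : Graph n) (k e : ℕ) (a : Vec ℕ (suc k)) (reg : Regular Γ (suc k))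
    (girth-regular : GirthRegular Γ (2 * suc (suc e)) (toList a))
    (top : ∀ (i : Fin (suc k)) → suc (toℕ i) ≡ suc k → lookup a i ≡ k ^ suc (suc e)) where

    open GirthCycles Γ e (proj₂ (proj₁ girth-regular))

    maximal-edge : ∀ v → ∃ λ w → v ~ w × eps Γ g v w ≡ k ^ d
    maximal-edge v with signature-entry Γ g v (subst (lookup a (fromℕ k) ∈_) (sym (proj₂ girth-regular v)) (lookup∈toList a (fromℕ k)))
    ... | w , vw , eq = w , vw , trans (sym eq) (top (fromℕ k) (cong suc (toℕ-fromℕ k)))

    girth-regular⇒Moore : Moore
    girth-regular⇒Moore v with maximal-edge v
    ... | w , vw , eq = Closing⇒Moore vw (eps-max⇒Closing reg vw eq)
            (eps-max⇒Closing reg (~-sym vw) (trans (eps-reverse w v) eq))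

    -- Each entry is the ε of an actual edge at some vertex, and by the Moore property all edges
    -- attain k^d.
    signature-constant : (conn : Connected Γ) → ∀ i → lookup a i ≡ k ^ d
    signature-constant conn i with cycle-edge Γ (proj₁ (proj₁ girth-regular))
    ... | v , _ with signature-entry Γ g v (subst (lookup a i ∈_) (sym (proj₂ girth-regular v)) (lookup∈toList a i))
    ... | w , vw , eq = trans eq (Polygon.eps-constant Γ e k (proj₁ girth-regular) conn reg girth-regular⇒Moore vw)

-- Weighted sums over words and their rotations.

module ClosedWords where

  open import Data.Nat as ℕ using (ℕ; zero; suc; NonZero)
  import Data.Nat.Properties as ℕ
  open import Data.Nat.DivMod using (_%_; [m+kn]%n≡m%n; m<n⇒m%n≡m)
  open import Data.Nat.Divisibility using (_∣_; divides; *-monoʳ-∣; *-cancelˡ-∣; ∣1⇒≡1)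
  open import Data.Nat.GCD using (gcd[m,n]∣m; gcd[m,n]∣n; module Bézout)
  open import Data.Nat.Coprimality as Coprime using (Coprime; coprime-divisor)
  open import Data.Nat.Primality using (Prime; prime⇒irreducible; prime⇒nonZero)
  open import Data.Integer as ℤ using (ℤ; +_; _+_; _*_; 0ℤ; 1ℤ)
  open import Data.Integer.Properties as ℤ using (+-*-commutativeRing; *-assoc; *-comm; *-identityˡ;
    *-identityʳ; *-zeroˡ; +-identityˡ; +-identityʳ; *-distribʳ-+)
  open import Algebra.Bundles using (CommutativeRing)
  open import Algebra.Properties.Semiring.Sum (CommutativeRing.semiring +-*-commutativeRing) using (sum;
    sum-cong-≗; ∑-comm; ∑-distrib-+; *-distribˡ-sum; *-distribʳ-sum; sum-replicate-zero) public
  open import Data.Fin using (Fin; zero; suc; toℕ)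
  open import Data.Fin.Properties as Fin using (toℕ<n; toℕ-injective)
  open ListLemmas

  sum-single : ∀ {n} (f : Fin n → ℤ) i → (∀ j → j ≢ i → f j ≡ 0ℤ) → sum f ≡ f i
  sum-single {suc n} f zero h = trans (cong (λ s → f zero + s)
    (trans (sum-cong-≗ (λ j → h (suc j) (λ ()))) (sum-replicate-zero n))) (+-identityʳ (f zero))
  sum-single {suc n} f (suc i) h = trans (cong₂ _+_ (h zero (λ ())) (sum-single (f ∘ suc) i (λ j ne → h (suc j) (ne ∘ Fin.suc-injective))))
    (+-identityˡ (f (suc i)))

  sum-const : ∀ n (c : ℤ) → sum {n} (λ _ → c) ≡ + n * c
  sum-const zero c = sym (*-zeroˡ c)
  sum-const (suc n) c = trans (cong (λ s → c + s) (sum-const n c))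
    (trans (cong (_+ + n * c) (sym (*-identityˡ c))) (sym (*-distribʳ-+ c 1ℤ (+ n))))

  argmin : ∀ {n} (f : Fin (suc n) → ℕ) → ∃ λ i → ∀ j → f i ℕ.≤ f j
  argmin {zero} f = zero , λ { zero → ℕ.≤-refl }
  argmin {suc n} f with argmin (f ∘ suc)
  ... | i , h with ℕ.≤-total (f zero) (f (suc i))
  ... | inj₁ le = zero , λ { zero → ℕ.≤-refl ; (suc j) → ℕ.≤-trans le (h j) }
  ... | inj₂ le = suc i , λ { zero → le ; (suc j) → h j }

  prime-power-divisor : ∀ {p} → Prime p → ∀ j {g} → g ∣ p ℕ.^ suc j → g ≢ p ℕ.^ suc j → g ∣ p ℕ.^ j
  prime-power-divisor {p} pr j {g} g∣ ne with prime⇒irreducible pr (gcd[m,n]∣n g p)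
  ... | inj₁ gcd≡1 = coprime-divisor (Coprime.gcd≡1⇒coprime gcd≡1) g∣
  ... | inj₂ gcd≡p with subst (_∣ g) gcd≡p (gcd[m,n]∣m g p)
  ... | divides h refl = helper j (*-cancelˡ-∣ p {{prime⇒nonZero pr}} (subst (_∣ p ℕ.^ suc j) (ℕ.*-comm h p) g∣)) (λ eq → ne (trans (ℕ.*-comm h p) (cong (p ℕ.*_) eq)))
    where
    helper : ∀ j → h ∣ p ℕ.^ j → h ≢ p ℕ.^ j → h ℕ.* p ∣ p ℕ.^ j
    helper zero h∣1 ne = ⊥-elim (ne (∣1⇒≡1 h∣1))
    helper (suc j) h∣ ne = subst (_∣ p ℕ.^ suc j) (ℕ.*-comm p h) (*-monoʳ-∣ p (prime-power-divisor pr j h∣ ne))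

  module Words (m : ℕ) where

    X : Set
    X = Fin m

    sumL : ℕ → (List X → ℤ) → ℤ
    sumL zero f = f []
    sumL (suc N) f = sum (λ x → sumL N (λ w → f (x ∷ w)))

    sumL-cong : ∀ N {f g} → (∀ w → length w ≡ N → f w ≡ g w) → sumL N f ≡ sumL N g
    sumL-cong zero h = h [] refl
    sumL-cong (suc N) h = sum-cong-≗ (λ x → sumL-cong N (λ w len → h (x ∷ w) (cong suc len)))

    sumL-+ : ∀ N f g → sumL N (λ w → f w + g w) ≡ sumL N f + sumL N g
    sumL-+ zero f g = refl
    sumL-+ (suc N) f g = trans (sum-cong-≗ (λ x → sumL-+ N (f ∘ (x ∷_)) (g ∘ (x ∷_)))) (∑-distrib-+ (λ x → sumL N (f ∘ (x ∷_))) _)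

    sumL-*ˡ : ∀ N c f → sumL N (λ w → c * f w) ≡ c * sumL N f
    sumL-*ˡ zero c f = refl
    sumL-*ˡ (suc N) c f = trans (sum-cong-≗ (λ x → sumL-*ˡ N c (f ∘ (x ∷_)))) (sym (*-distribˡ-sum c (λ x → sumL N (f ∘ (x ∷_)))))

    sumL-sum : ∀ N {K} (h : Fin K → List X → ℤ) → sumL N (λ w → sum (λ i → h i w)) ≡ sum (λ i → sumL N (h i))
    sumL-sum zero h = refl
    sumL-sum (suc N) h = trans (sum-cong-≗ (λ x → sumL-sum N (λ i → h i ∘ (x ∷_)))) (∑-comm (λ x i → sumL N (h i ∘ (x ∷_))))

    sumL-++ : ∀ a b f → sumL (a ℕ.+ b) f ≡ sumL a (λ u → sumL b (λ v → f (u ++ v)))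
    sumL-++ zero b f = refl
    sumL-++ (suc a) b f = sum-cong-≗ (λ x → sumL-++ a b (f ∘ (x ∷_)))

    sumL-snoc : ∀ N f → sumL (suc N) f ≡ sum (λ x → sumL N (λ w → f (w ∷ʳ x)))
    sumL-snoc zero f = refl
    sumL-snoc (suc N) f = trans (sum-cong-≗ (λ y → sumL-snoc N (f ∘ (y ∷_)))) (∑-comm (λ y x → sumL N (λ w → f (y ∷ w ∷ʳ x))))

    sumL-single : ∀ N f v → length v ≡ N → (∀ w → length w ≡ N → w ≢ v → f w ≡ 0ℤ) → sumL N f ≡ f v
    sumL-single zero f [] _ _ = refl
    sumL-single (suc N) f (x ∷ v) len h = trans
      (sum-single (λ y → sumL N (f ∘ (y ∷_))) x (λ y ne → trans (sumL-cong N (λ w l → h (y ∷ w) (cong suc l) (ne ∘ proj₁ ∘ ∷-injective))) (zeros N)))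
      (sumL-single N (f ∘ (x ∷_)) v (ℕ.suc-injective len) (λ w l ne → h (x ∷ w) (cong suc l) (ne ∘ proj₂ ∘ ∷-injective)))
      where
      zeros : ∀ N → sumL N (λ _ → 0ℤ) ≡ 0ℤ
      zeros zero = refl
      zeros (suc N) = trans (sum-cong-≗ {m} (λ _ → zeros N)) (sum-replicate-zero m)

    sumL-const : ∀ N c → sumL N (λ _ → c) ≡ + (m ℕ.^ N) * c
    sumL-const zero c = sym (*-identityˡ c)
    sumL-const (suc N) c = trans (sum-cong-≗ {m} (λ _ → sumL-const N c)) (trans (sum-const m (+ (m ℕ.^ N) * c))
      (trans (sym (*-assoc (+ m) (+ (m ℕ.^ N)) c)) (cong (_* c) (sym (ℤ.pos-* m (m ℕ.^ N))))))

    rot : List X → List X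
    rot [] = []
    rot (x ∷ w) = w ∷ʳ x

    rotⁿ : ℕ → List X → List X
    rotⁿ zero w = w
    rotⁿ (suc k) w = rotⁿ k (rot w)

    length-rot : ∀ w → length (rot w) ≡ length w
    length-rot [] = refl
    length-rot (x ∷ w) = length-∷ʳ x w

    length-rotⁿ : ∀ k w → length (rotⁿ k w) ≡ length w
    length-rotⁿ zero w = refl
    length-rotⁿ (suc k) w = trans (length-rotⁿ k (rot w)) (length-rot w)

    rotⁿ-+ : ∀ a b w → rotⁿ (a ℕ.+ b) w ≡ rotⁿ b (rotⁿ a w)
    rotⁿ-+ zero b w = refl
    rotⁿ-+ (suc a) b w = rotⁿ-+ a b (rot w)

    rotⁿ-++ : ∀ u v → rotⁿ (length u) (u ++ v) ≡ v ++ u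
    rotⁿ-++ [] v = sym (++-identityʳ v)
    rotⁿ-++ (x ∷ u) v = trans (cong (rotⁿ (length u)) (++-assoc u v (x ∷ []))) (trans (rotⁿ-++ u (v ∷ʳ x)) (++-assoc v (x ∷ []) u))

    rotⁿ-length : ∀ w → rotⁿ (length w) w ≡ w
    rotⁿ-length w = trans (cong (rotⁿ (length w)) (sym (++-identityʳ w))) (rotⁿ-++ w [])

    rotⁿ-multiple : ∀ a q w → rotⁿ a w ≡ w → rotⁿ (q ℕ.* a) w ≡ w
    rotⁿ-multiple a zero w h = refl
    rotⁿ-multiple a (suc q) w h = trans (rotⁿ-+ a (q ℕ.* a) w) (trans (cong (rotⁿ (q ℕ.* a)) h) (rotⁿ-multiple a q w h))

    sumL-rot : ∀ N f → sumL N (f ∘ rot) ≡ sumL N f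
    sumL-rot zero f = refl
    sumL-rot (suc N) f = sym (sumL-snoc N f)

    sumL-rotⁿ : ∀ N k f → sumL N (f ∘ rotⁿ k) ≡ sumL N f
    sumL-rotⁿ N zero f = refl
    sumL-rotⁿ N (suc k) f = trans (sumL-rot N (f ∘ rotⁿ k)) (sumL-rotⁿ N k f)

    -- The word as a number in base m. Being injective on words of equal length, it singles out one
    -- rotation of a word, the least.
    code : List X → ℕ
    code [] = 0
    code (x ∷ w) = toℕ x ℕ.+ code w ℕ.* m

    code-injective : ∀ v w → length v ≡ length w → code v ≡ code w → v ≡ w
    code-injective [] [] _ _ = refl
    code-injective (x ∷ v) (y ∷ w) len eq = cong₂ _∷_ (toℕ-injective x≡y) (code-injective v w (ℕ.suc-injective len)
        (ℕ.*-cancelʳ-≡ (code v) (code w) m (ℕ.+-cancelˡ-≡ (toℕ x) _ _ (trans eq (cong (ℕ._+ code w ℕ.* m) (sym x≡y))))))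
      where
      instance
        m≢0 : NonZero m
        m≢0 = Fin.nonZeroIndex x
      x≡y : toℕ x ≡ toℕ y
      x≡y = trans (sym (red x v)) (trans (cong (_% m) eq) (red y w))
        where
        red : ∀ z u → (toℕ z ℕ.+ code u ℕ.* m) % m ≡ toℕ z
        red z u = trans ([m+kn]%n≡m%n (toℕ z) (code u) m) (m<n⇒m%n≡m (toℕ<n z))

    module _ (μ : X → X → ℤ) where

      weight : X → List X → X → ℤ
      weight x [] y = μ x y
      weight x (z ∷ w) y = μ x z * weight z w y

      -- The product of the entries of μ around the closed word; summed over all words of a positive
      -- length N it is the trace of the N-th power of μ.
      cyclic : List X → ℤ
      cyclic [] = 0ℤ
      cyclic (x ∷ w) = weight x w x

      weight-++ : ∀ x u z v y → weight x (u ++ z ∷ v) y ≡ weight x u z * weight z v y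
      weight-++ x [] z v y = refl
      weight-++ x (t ∷ u) z v y = trans (cong (μ x t *_) (weight-++ t u z v y)) (sym (*-assoc (μ x t) (weight t u z) (weight z v y)))

      cyclic-rot : ∀ w → cyclic (rot w) ≡ cyclic w
      cyclic-rot [] = refl
      cyclic-rot (x ∷ []) = refl
      cyclic-rot (x ∷ y ∷ w) = trans (weight-++ y w x [] y) (*-comm (weight y w x) (μ x y))

      cyclic-rotⁿ : ∀ k w → cyclic (rotⁿ k w) ≡ cyclic w
      cyclic-rotⁿ zero w = refl
      cyclic-rotⁿ (suc k) w = trans (cyclic-rotⁿ k (rot w)) (cyclic-rot w)

      power : ℕ → List X → List X
      power q u = concat (replicate q u)

      cyclic-power : ∀ q x u → weight x (u ++ power q (x ∷ u)) x ≡ (weight x u x) ℤ.^ suc q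
      cyclic-power zero x u = trans (cong (λ w → weight x w x) (++-identityʳ u)) (sym (*-identityʳ (weight x u x)))
      cyclic-power (suc q) x u = trans (weight-++ x u x (u ++ power q (x ∷ u)) x) (cong (weight x u x *_) (cyclic-power q x u))

      weight-cube : (∀ x y → μ x y * (μ x y * μ x y) ≡ μ x y) → ∀ x w y → weight x w y * (weight x w y * weight x w y) ≡ weight x w y
      weight-cube h x [] y = h x y
      weight-cube h x (z ∷ w) y = trans (rearr (μ x z) (weight z w y)) (cong₂ _*_ (h x z) (weight-cube h z w y))
        where
        open import Data.Integer.Tactic.RingSolver using (solve-∀)
        rearr : ∀ a b → (a * b) * ((a * b) * (a * b)) ≡ (a * (a * a)) * (b * (b * b))
        rearr = solve-∀

  -- Takes the place of Fermat's congruence: for entries 0, 1, -1 the p-th power of a weight is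
  -- equal to the weight and not merely congruent to it.
  odd-power : ∀ (a : ℤ) → a * (a * a) ≡ a → ∀ i → a ℤ.^ suc (2 ℕ.* i) ≡ a
  odd-power a h zero = *-identityʳ a
  odd-power a h (suc i) = trans (cong (λ k → a ℤ.^ suc k) (ℕ.*-suc 2 i)) (trans (cong (λ t → a * (a * t)) (odd-power a h i)) h)

-- Congruences between traces at consecutive powers of a prime.

module RotationOrbits where

  open ClosedWords
  open import Data.Nat as ℕ using (ℕ; zero; suc; NonZero)
  import Data.Nat.Properties as ℕ
  open import Data.Nat.DivMod using (_%_; _/_; m≡m%n+[m/n]*n; m%n<n)
  open import Data.Nat.Divisibility using (divides; ∣⇒≤)
  open import Data.Nat.GCD using (gcd; gcd[m,n]∣m; gcd[m,n]∣n; gcd-GCD; module Bézout)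
  open import Data.Nat.Primality using (Prime; prime⇒nonZero)
  open import Data.Integer as ℤ using (ℤ; +_; _+_; _*_; 0ℤ; 1ℤ)
  open import Data.Integer.Properties using (*-identityˡ; *-identityʳ; *-zeroˡ; +-comm)
  open import Data.Integer.Tactic.RingSolver using (solve-∀)
  open import Data.Fin using (Fin; zero; suc; toℕ; fromℕ<)
  open import Data.Fin.Properties as Fin using (toℕ<n; toℕ-injective; toℕ-fromℕ<; all?)
  open import Relation.Binary using (tri<; tri≈; tri>)

  indicator : ∀ {a} {A : Set a} → Dec A → ℤ
  indicator d = if does d then 1ℤ else 0ℤ

  indicator-true : ∀ {a} {A : Set a} (d : Dec A) → A → indicator d ≡ 1ℤ
  indicator-true (yes _) _ = refl
  indicator-true (no ¬x) x = ⊥-elim (¬x x)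

  indicator-false : ∀ {a} {A : Set a} (d : Dec A) → ¬ A → indicator d ≡ 0ℤ
  indicator-false (no _) _ = refl
  indicator-false (yes x) ¬x = ⊥-elim (¬x x)

  argmin′ : ∀ n .{{_ : NonZero n}} (f : Fin n → ℕ) → ∃ λ i → ∀ j → f i ℕ.≤ f j
  argmin′ (suc n) f = argmin f

  ++-same-length : ∀ {a} {A : Set a} (u u′ : List A) {v v′} → length u ≡ length u′ → u ++ v ≡ u′ ++ v′ → u ≡ u′ × v ≡ v′
  ++-same-length [] [] _ eq = refl , eq
  ++-same-length (x ∷ u) (y ∷ u′) len eq with ∷-injective eq
  ... | refl , eq′ with ++-same-length u u′ (ℕ.suc-injective len) eq′
  ... | refl , eq″ = refl , eq″

  -- Closed words of length p^(j+1) c under rotation by c letters: the orbits that are not fixed by the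
  -- p^j-th power of this rotation are free, hence contribute multiples of p^(j+1).
  module Orbits (m : ℕ) (μ : Fin m → Fin m → ℤ) (μ-cube : ∀ x y → μ x y * (μ x y * μ x y) ≡ μ x y)
    {p : ℕ} (p-prime : Prime p) {h : ℕ} (p-odd : p ≡ suc (2 ℕ.* h)) (c : ℕ) .{{_ : NonZero c}} (j : ℕ) where

    open Words m

    Q M N : ℕ
    Q = p ℕ.^ suc j
    M = p ℕ.^ j ℕ.* c
    N = Q ℕ.* c

    instance
      p≢0 : NonZero p
      p≢0 = prime⇒nonZero p-prime
      Q≢0 : NonZero Q
      Q≢0 = ℕ.m^n≢0 p (suc j)

    N≡pM : N ≡ p ℕ.* M
    N≡pM = ℕ.*-assoc p (p ℕ.^ j) c

    ρ : ℕ → List X → List X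
    ρ i = rotⁿ (i ℕ.* c)

    ρ-+ : ∀ a b w → ρ (a ℕ.+ b) w ≡ ρ b (ρ a w)
    ρ-+ a b w = trans (cong (λ t → rotⁿ t w) (ℕ.*-distribʳ-+ c a b)) (rotⁿ-+ (a ℕ.* c) (b ℕ.* c) w)

    ρ-multiple : ∀ a q w → ρ a w ≡ w → ρ (q ℕ.* a) w ≡ w
    ρ-multiple a q w h = trans (cong (λ t → rotⁿ t w) (ℕ.*-assoc q a c)) (rotⁿ-multiple (a ℕ.* c) q w h)

    length-ρ : ∀ i {w} → length w ≡ N → length (ρ i w) ≡ N
    length-ρ i {w} len = trans (length-rotⁿ (i ℕ.* c) w) len

    ρ-Q : ∀ {w} → length w ≡ N → ρ Q w ≡ w
    ρ-Q {w} len = trans (cong (λ t → rotⁿ t w) (sym len)) (rotⁿ-length w)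

    ρ-cancel : ∀ a b w → ρ b w ≡ w → ρ (b ℕ.+ a) w ≡ ρ a w
    ρ-cancel a b w h = trans (ρ-+ b a w) (cong (ρ a) h)

    ρ-% : ∀ a {w} → length w ≡ N → ρ (a % Q) w ≡ ρ a w
    ρ-% a {w} len = sym (trans (cong (λ t → ρ t w) (trans (m≡m%n+[m/n]*n a Q) (ℕ.+-comm (a % Q) _)))
      (ρ-cancel (a % Q) (a / Q ℕ.* Q) w (ρ-multiple Q (a / Q) w (ρ-Q len))))

    Fixed : List X → Set
    Fixed w = ρ (p ℕ.^ j) w ≡ w

    fixed? : ∀ w → Dec (Fixed w)
    fixed? w = ≡-dec Fin._≟_ (rotⁿ M w) w

    -- By Bézout a word fixed by rotation `i` is fixed by rotation gcd(i, Q). This is a divisor of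
    -- p^(j+1) other than `Q`, hence divides p^j, and the word would be `Fixed`.
    free : ∀ {w} → length w ≡ N → ¬ Fixed w → ∀ i → 0 ℕ.< i → i ℕ.< Q → ρ i w ≢ w
    free {w} len ¬fix i 0<i i<Q eq with prime-power-divisor p-prime j (gcd[m,n]∣n i Q) g≢Q
      where
      g≢Q : gcd i Q ≢ Q
      g≢Q g≡Q = ℕ.<⇒≱ i<Q (subst (ℕ._≤ i) g≡Q (∣⇒≤ {{ℕ.>-nonZero 0<i}} (gcd[m,n]∣m i Q)))
    ... | divides q eq′ = ¬fix (trans (cong (λ t → ρ t w) eq′) (ρ-multiple (gcd i Q) q w ρ-gcd))
      where
      ρ-gcd : ρ (gcd i Q) w ≡ w
      ρ-gcd with Bézout.identity (gcd-GCD i Q)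
      ... | Bézout.+- x y id = trans (sym (ρ-cancel (gcd i Q) (y ℕ.* Q) w (ρ-multiple Q y w (ρ-Q len))))
              (trans (cong (λ t → ρ t w) (trans (ℕ.+-comm (y ℕ.* Q) (gcd i Q)) id)) (ρ-multiple i x w eq))
      ... | Bézout.-+ x y id = trans (sym (ρ-cancel (gcd i Q) (x ℕ.* i) w (ρ-multiple i x w eq)))
              (trans (cong (λ t → ρ t w) (trans (ℕ.+-comm (x ℕ.* i) (gcd i Q)) id)) (ρ-multiple Q y w (ρ-Q len)))

    ρ-separates : ∀ {w} → length w ≡ N → ¬ Fixed w → ∀ {i k} → i ℕ.< k → k ℕ.< Q → ρ i w ≢ ρ k w
    ρ-separates {w} len ¬fix {i} {k} i<k k<Q eq = free len ¬fix (k ℕ.∸ i) (ℕ.m<n⇒0<n∸m i<k) (ℕ.≤-<-trans (ℕ.m∸n≤m k i) k<Q)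
      (begin
        ρ (k ℕ.∸ i) w                  ≡⟨ sym (ρ-cancel (k ℕ.∸ i) Q w (ρ-Q len)) ⟩
        ρ (Q ℕ.+ (k ℕ.∸ i)) w          ≡⟨ cong (λ t → ρ t w) arith ⟩
        ρ (k ℕ.+ (Q ℕ.∸ i)) w          ≡⟨ ρ-+ k (Q ℕ.∸ i) w ⟩
        ρ (Q ℕ.∸ i) (ρ k w)            ≡⟨ cong (ρ (Q ℕ.∸ i)) (sym eq) ⟩
        ρ (Q ℕ.∸ i) (ρ i w)            ≡⟨ sym (ρ-+ i (Q ℕ.∸ i) w) ⟩
        ρ (i ℕ.+ (Q ℕ.∸ i)) w          ≡⟨ cong (λ t → ρ t w) (ℕ.m+[n∸m]≡n i≤Q) ⟩
        ρ Q w                          ≡⟨ ρ-Q len ⟩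
        w                              ∎)
      where
      open ≡-Reasoning
      i≤Q = ℕ.<⇒≤ (ℕ.<-trans i<k k<Q)
      arith : Q ℕ.+ (k ℕ.∸ i) ≡ k ℕ.+ (Q ℕ.∸ i)
      arith = trans (sym (ℕ.+-∸-assoc Q (ℕ.<⇒≤ i<k))) (trans (cong (ℕ._∸ i) (ℕ.+-comm Q k)) (ℕ.+-∸-assoc k i≤Q))

    Minimal : List X → Set
    Minimal w = ∀ (i : Fin Q) → code w ℕ.≤ code (ρ (toℕ i) w)

    minimal? : ∀ w → Dec (Minimal w)
    minimal? w = all? (λ i → code w ℕ.≤? code (ρ (toℕ i) w))

    reduce : ∀ {w} → length w ≡ N → ∀ a → ∃ λ (i : Fin Q) → ρ (toℕ i) w ≡ ρ a w
    reduce {w} len a = fromℕ< (m%n<n a Q) , trans (cong (λ t → ρ t w) (toℕ-fromℕ< (m%n<n a Q))) (ρ-% a len)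

    -- The `Q` rotations of such a word are distinct, so exactly one has the least code. It
    -- represents the orbit.
    minimal-count : ∀ {w} → length w ≡ N → ¬ Fixed w → sum (λ (i : Fin Q) → indicator (minimal? (ρ (toℕ i) w))) ≡ 1ℤ
    minimal-count {w} len ¬fix with argmin′ Q (λ i → code (ρ (toℕ i) w))
    ... | i₀ , least = trans (sum-single (λ i → indicator (minimal? (ρ (toℕ i) w))) i₀ others) (indicator-true (minimal? (ρ (toℕ i₀) w)) min₀)
      where
      min₀ : Minimal (ρ (toℕ i₀) w)
      min₀ i with reduce len (toℕ i₀ ℕ.+ toℕ i)
      ... | t , eq = subst (λ l → code (ρ (toℕ i₀) w) ℕ.≤ code l) (trans eq (ρ-+ (toℕ i₀) (toℕ i) w)) (least t)
      others : ∀ i → i ≢ i₀ → indicator (minimal? (ρ (toℕ i) w)) ≡ 0ℤ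
      others i ne = indicator-false (minimal? (ρ (toℕ i) w)) ¬min
        where
        i≤Q = ℕ.<⇒≤ (toℕ<n i)
        ¬min : ¬ Minimal (ρ (toℕ i) w)
        ¬min mn with reduce (length-ρ (toℕ i) len) ((Q ℕ.∸ toℕ i) ℕ.+ toℕ i₀)
        ... | t , eq with code-injective (ρ (toℕ i) w) (ρ (toℕ i₀) w) (trans (length-ρ (toℕ i) len) (sym (length-ρ (toℕ i₀) len)))
                (ℕ.≤-antisym (subst (λ l → code (ρ (toℕ i) w) ℕ.≤ code l) back (mn t)) (least i))
          where
          back : ρ (toℕ t) (ρ (toℕ i) w) ≡ ρ (toℕ i₀) w
          back = trans eq (trans (sym (ρ-+ (toℕ i) _ w)) (trans (cong (λ s → ρ s w)
            (trans (sym (ℕ.+-assoc (toℕ i) (Q ℕ.∸ toℕ i) (toℕ i₀))) (cong (ℕ._+ toℕ i₀) (ℕ.m+[n∸m]≡n i≤Q))))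
            (ρ-cancel (toℕ i₀) Q w (ρ-Q len))))
        ... | same with ℕ.<-cmp (toℕ i) (toℕ i₀)
        ... | tri< lt _ _ = ρ-separates len ¬fix lt (toℕ<n i₀) same
        ... | tri≈ _ i≡ _ = ne (toℕ-injective i≡)
        ... | tri> _ _ gt = ρ-separates len ¬fix gt (toℕ<n i) (sym same)

    Fixed-ρ : ∀ i {w} → Fixed w → Fixed (ρ i w)
    Fixed-ρ i {w} fix = trans (sym (ρ-+ i (p ℕ.^ j) w)) (trans (cong (λ t → ρ t w) (ℕ.+-comm i (p ℕ.^ j))) (ρ-cancel i (p ℕ.^ j) w fix))

    -- Rotation by Q i - i undoes rotation by i.
    Fixed-ρ⁻ : ∀ i {w} → length w ≡ N → Fixed (ρ i w) → Fixed w
    Fixed-ρ⁻ i {w} len fix = subst Fixed (trans (sym (ρ-+ i (Q ℕ.* i ℕ.∸ i) w)) (trans (cong (λ t → ρ t w) (ℕ.m+[n∸m]≡n (ℕ.m≤n*m i Q)))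
      (trans (cong (λ t → ρ t w) (ℕ.*-comm Q i)) (ρ-multiple Q i w (ρ-Q len))))) (Fixed-ρ (Q ℕ.* i ℕ.∸ i) fix)

    aperiodic : List X → ℤ
    aperiodic w = 1ℤ + ℤ.- indicator (fixed? w)

    aperiodic-ρ : ∀ i {w} → length w ≡ N → aperiodic (ρ i w) ≡ aperiodic w
    aperiodic-ρ i {w} len with fixed? w
    ... | yes fix = cong (λ t → 1ℤ + ℤ.- t) (indicator-true (fixed? (ρ i w)) (Fixed-ρ i fix))
    ... | no ¬fix = cong (λ t → 1ℤ + ℤ.- t) (indicator-false (fixed? (ρ i w)) (¬fix ∘ Fixed-ρ⁻ i len))

    τ : List X → ℤ
    τ = cyclic μ

    F : List X → ℤ
    F w = (aperiodic w * τ w) * indicator (minimal? w)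

    -- The sum inserts a factor that counts the minimal rotations: it is 1 on a free orbit, and on a
    -- fixed word both sides vanish. Summed over all words, the `Q` terms become equal by rotation
    -- invariance, which produces the factor `Q`.
    spread : ∀ w → length w ≡ N → aperiodic w * τ w ≡ sum (λ (i : Fin Q) → F (ρ (toℕ i) w))
    spread w len = sym (begin
      sum (λ (i : Fin Q) → F (ρ (toℕ i) w))
        ≡⟨ sum-cong-≗ {Q} (λ i → cong (_* indicator (minimal? (ρ (toℕ i) w))) (cong₂ _*_ (aperiodic-ρ (toℕ i) {w} len) (cyclic-rotⁿ μ (toℕ i ℕ.* c) w))) ⟩
      sum (λ (i : Fin Q) → (aperiodic w * τ w) * indicator (minimal? (ρ (toℕ i) w)))
        ≡⟨ sym (*-distribˡ-sum (aperiodic w * τ w) (λ (i : Fin Q) → indicator (minimal? (ρ (toℕ i) w)))) ⟩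
      (aperiodic w * τ w) * sum (λ (i : Fin Q) → indicator (minimal? (ρ (toℕ i) w)))
        ≡⟨ finish ⟩
      aperiodic w * τ w ∎)
      where
      open ≡-Reasoning
      finish : (aperiodic w * τ w) * sum (λ (i : Fin Q) → indicator (minimal? (ρ (toℕ i) w))) ≡ aperiodic w * τ w
      finish with fixed? w
      ... | yes _ = trans (cong (_* S) (*-zeroˡ (τ w))) (trans (*-zeroˡ S) (sym (*-zeroˡ (τ w))))
        where S = sum (λ (i : Fin Q) → indicator (minimal? (ρ (toℕ i) w)))
      ... | no ¬fix = trans (cong ((1ℤ * τ w) *_) (minimal-count len ¬fix)) (*-identityʳ (1ℤ * τ w))

    aperiodic-sum : sumL N (λ w → aperiodic w * τ w) ≡ + Q * sumL N F
    aperiodic-sum = begin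
      sumL N (λ w → aperiodic w * τ w)                         ≡⟨ sumL-cong N spread ⟩
      sumL N (λ w → sum (λ (i : Fin Q) → F (ρ (toℕ i) w)))     ≡⟨ sumL-sum N (λ (i : Fin Q) w → F (ρ (toℕ i) w)) ⟩
      sum (λ (i : Fin Q) → sumL N (F ∘ ρ (toℕ i)))             ≡⟨ sum-cong-≗ {Q} (λ i → sumL-rotⁿ N (toℕ i ℕ.* c) F) ⟩
      sum (λ (i : Fin Q) → sumL N F)                           ≡⟨ sum-const Q (sumL N F) ⟩
      + Q * sumL N F                                           ∎
      where open ≡-Reasoning

    commuting-power : ∀ u q v → length v ≡ q ℕ.* length u → v ++ u ≡ u ++ v → v ≡ power μ q u
    commuting-power u zero [] _ _ = refl
    commuting-power u (suc q) v len eq = trans (sym (take++drop≡id (length u) v)) (cong₂ _++_ (sym u≡) rest)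
      where
      v₁ = take (length u) v
      v₂ = drop (length u) v
      len₁ : length v₁ ≡ length u
      len₁ = trans (length-take (length u) v) (ℕ.m≤n⇒m⊓n≡m (subst (length u ℕ.≤_) (sym len) (ℕ.m≤m+n (length u) (q ℕ.* length u))))
      split : u ++ v ≡ v₁ ++ (v₂ ++ u)
      split = trans (sym eq) (trans (cong (_++ u) (sym (take++drop≡id (length u) v))) (++-assoc v₁ v₂ u))
      u≡ : u ≡ v₁
      u≡ = proj₁ (++-same-length u v₁ (sym len₁) split)
      rest : v₂ ≡ power μ q u
      rest = commuting-power u q v₂
        (trans (length-drop (length u) v) (trans (cong (ℕ._∸ length u) len) (ℕ.m+n∸m≡n (length u) (q ℕ.* length u))))
        (trans (sym (proj₂ (++-same-length u v₁ (sym len₁) split))) (trans (sym (take++drop≡id (length u) v)) (cong (_++ v₂) (sym u≡))))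

    power-commutes : ∀ u q → power μ q u ++ u ≡ u ++ power μ q u
    power-commutes u zero = sym (++-identityʳ u)
    power-commutes u (suc q) = trans (++-assoc u (power μ q u) u) (cong (u ++_) (power-commutes u q))

    length-power : ∀ u q → length (power μ q u) ≡ q ℕ.* length u
    length-power u zero = refl
    length-power u (suc q) = trans (length-++ u) (cong (length u ℕ.+_) (length-power u q))

    -- This is p - 1, the number of copies of the period that follow the first one.
    r : ℕ
    r = 2 ℕ.* h

    -- A fixed word is the p-th power of its first `M` letters u, as u commutes with the rest. Its
    -- weight is τ(u)^p, which is τ(u) because p is odd and τ(u)³ = τ(u).
    periodic-sum : sumL N (λ w → indicator (fixed? w) * τ w) ≡ sumL M τ
    periodic-sum = begin
      sumL N P                                     ≡⟨ cong (λ t → sumL t P) (trans N≡pM (cong (ℕ._* M) p-odd)) ⟩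
      sumL (M ℕ.+ r ℕ.* M) P                       ≡⟨ sumL-++ M (r ℕ.* M) P ⟩
      sumL M (λ u → sumL (r ℕ.* M) (λ v → P (u ++ v)))  ≡⟨ sumL-cong M step ⟩
      sumL M τ                                     ∎
      where
      open ≡-Reasoning
      P = λ w → indicator (fixed? w) * τ w
      rotM : ∀ u v → length u ≡ M → rotⁿ M (u ++ v) ≡ v ++ u
      rotM u v len = trans (cong (λ t → rotⁿ t (u ++ v)) (sym len)) (rotⁿ-++ u v)
      τ-power : ∀ u → length u ≡ M → τ (u ++ power μ r u) ≡ τ u
      τ-power [] len = ⊥-elim (ℕ.≢-nonZero⁻¹ M {{ℕ.m*n≢0 (p ℕ.^ j) c {{ℕ.m^n≢0 p j}}}} (sym len))
      τ-power (x ∷ u) len = trans (cyclic-power μ r x u) (odd-power (weight μ x u x) (weight-cube μ μ-cube x u x) h)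
      step : ∀ u → length u ≡ M → sumL (r ℕ.* M) (λ v → P (u ++ v)) ≡ τ u
      step u len = trans (sumL-single (r ℕ.* M) (λ v → P (u ++ v)) (power μ r u) (trans (length-power u r) (cong (r ℕ.*_) len)) others)
        (trans (cong₂ _*_ (indicator-true (fixed? (u ++ power μ r u)) (trans (rotM u _ len) (power-commutes u r))) (τ-power u len)) (*-identityˡ (τ u)))
        where
        others : ∀ v → length v ≡ r ℕ.* M → v ≢ power μ r u → P (u ++ v) ≡ 0ℤ
        others v lv ne = trans (cong (_* τ (u ++ v)) (indicator-false (fixed? (u ++ v))
          (λ fix → ne (commuting-power u r v (trans lv (cong (r ℕ.*_) (sym len))) (trans (sym (rotM u v len)) fix))))) (*-zeroˡ (τ (u ++ v)))

    trace-congruence : ∃ λ z → sumL N τ ≡ sumL M τ + + Q * z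
    trace-congruence = sumL N F , (begin
      sumL N τ                                                                       ≡⟨ sumL-cong N (λ w _ → split (indicator (fixed? w)) (τ w)) ⟩
      sumL N (λ w → indicator (fixed? w) * τ w + aperiodic w * τ w)                  ≡⟨ sumL-+ N (λ w → indicator (fixed? w) * τ w) (λ w → aperiodic w * τ w) ⟩
      sumL N (λ w → indicator (fixed? w) * τ w) + sumL N (λ w → aperiodic w * τ w)   ≡⟨ cong₂ _+_ periodic-sum aperiodic-sum ⟩
      sumL M τ + + Q * sumL N F                                                      ∎)
      where
      open ≡-Reasoning
      split : ∀ a t → t ≡ a * t + (1ℤ + ℤ.- a) * t
      split = solve-∀

-- Chebyshev-like polynomials of the adjacency operator on radial functions.

module RadialPolynomials where

  open ClosedWords
  open RotationOrbits
  open import Data.Nat as ℕ using (ℕ; zero; suc; s≤s; z≤n)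
  import Data.Nat.Properties as ℕ
  open import Data.Integer as ℤ using (ℤ; +_; _+_; _*_; -_; _-_; 0ℤ; 1ℤ)
  open import Data.Integer.Properties using (+-identityʳ; +-comm; pos-*)
  open import Data.Integer.Tactic.RingSolver using (solve-∀)
  open import Data.Fin using (zero; suc)
  import Data.Fin.Properties as Fin

  2ℤ 3ℤ : ℤ
  2ℤ = + 2
  3ℤ = + 3

  infixr 8 2^_
  2^_ : ℕ → ℤ
  2^ i = + (2 ℕ.^ i)

  2^suc : ∀ i → 2^ suc i ≡ 2ℤ * 2^ i
  2^suc i = pos-* 2 (2 ℕ.^ i)

  -- The adjacency operator of a generalised d-gon of order (2,2), acting on functions of the distance to
  -- a fixed vertex, and the polynomials U in it with U (r+2) = L U (r+1) - 2 U r.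
  module Radial (e : ℕ) where

    d : ℕ
    d = suc (suc e)

    L : (ℕ → ℤ) → ℕ → ℤ
    L f zero = 3ℤ * f 1
    L f (suc m) with suc m ℕ.≟ d
    ... | yes _ = 3ℤ * f m
    ... | no _ = f m + 2ℤ * f (suc (suc m))

    U : ℕ → ℕ → ℤ
    U 0 m = 0ℤ
    U 1 zero = 1ℤ
    U 1 (suc m) = 0ℤ
    U (suc (suc r)) m = L (U (suc r)) m - 2ℤ * U r m

    -- The indicator of the distances r - 1, r - 3, and so on: in a tree of valence 3 the polynomial
    -- U r is the sum of the corresponding distance matrices.
    Ind : ℕ → ℕ → ℤ
    Ind 0 m = 0ℤ
    Ind 1 zero = 1ℤ
    Ind 1 (suc m) = 0ℤ
    Ind (suc (suc r)) zero = Ind r zero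
    Ind (suc (suc r)) (suc m) = Ind (suc r) m

    Ind-suc : ∀ r m → Ind (suc r) (suc m) ≡ Ind r m
    Ind-suc zero m = refl
    Ind-suc (suc r) m = refl

    Ind-vanishes : ∀ {r m} → r ℕ.≤ m → Ind r m ≡ 0ℤ
    Ind-vanishes {zero} _ = refl
    Ind-vanishes {suc r} {suc m} (s≤s le) = trans (Ind-suc r m) (Ind-vanishes le)

    even : ℕ → ℤ
    even 0 = 1ℤ
    even 1 = 0ℤ
    even (suc (suc m)) = even m

    -- The indicator of all distances with the parity of r - 1. The functions J r and J (r + 1) span
    -- the part on which `L` has the eigenvalues 3 and -3.
    J : ℕ → ℕ → ℤ
    J r m = even (suc (r ℕ.+ m))

    J-sucˡ : ∀ r m → J r (suc m) ≡ J (suc r) m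
    J-sucˡ r m = cong (λ x → even (suc x)) (ℕ.+-suc r m)

    L-cong : ∀ {f g} → (∀ {m} → m ℕ.≤ d → f m ≡ g m) → ∀ {m} → m ℕ.≤ d → L f m ≡ L g m
    L-cong h {zero} _ = cong (3ℤ *_) (h (s≤s z≤n))
    L-cong h {suc m} le with suc m ℕ.≟ d
    ... | yes _ = cong (3ℤ *_) (h (ℕ.<⇒≤ le))
    ... | no ne = cong₂ (λ a b → a + 2ℤ * b) (h (ℕ.<⇒≤ le)) (h (ℕ.≤∧≢⇒< le ne))

    L-linear : ∀ a b f g m → L (λ m → a * f m + b * g m) m ≡ a * L f m + b * L g m
    L-linear a b f g zero = lemma a b (f 1) (g 1)
      where
      lemma : ∀ a b x y → 3ℤ * (a * x + b * y) ≡ a * (3ℤ * x) + b * (3ℤ * y)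
      lemma = solve-∀
    L-linear a b f g (suc m) with suc m ℕ.≟ d
    ... | yes _ = lemma a b (f m) (g m)
      where
      lemma : ∀ a b x y → 3ℤ * (a * x + b * y) ≡ a * (3ℤ * x) + b * (3ℤ * y)
      lemma = solve-∀
    ... | no _ = lemma a b (f m) (g m) (f (suc (suc m))) (g (suc (suc m)))
      where
      lemma : ∀ a b x y z w → (a * x + b * y) + 2ℤ * (a * z + b * w) ≡ a * (x + 2ℤ * z) + b * (y + 2ℤ * w)
      lemma = solve-∀

    L-J : ∀ r m → L (J r) m ≡ 3ℤ * J (suc r) m
    L-J r zero = cong (3ℤ *_) (J-sucˡ r 0)
    L-J r (suc m) with suc m ℕ.≟ d
    ... | yes _ = cong (3ℤ *_) (sym (cong (λ x → even (suc (suc x))) (ℕ.+-suc r m)))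
    ... | no _ = trans (cong₂ (λ a b → a + 2ℤ * b) (sym eq₁) eq₂) (lemma (J (suc r) (suc m)))
      where
      lemma : ∀ x → x + 2ℤ * x ≡ 3ℤ * x
      lemma = solve-∀
      eq₁ : J (suc r) (suc m) ≡ J r m
      eq₁ = cong (λ x → even (suc (suc x))) (ℕ.+-suc r m)
      eq₂ : J r (suc (suc m)) ≡ J (suc r) (suc m)
      eq₂ = J-sucˡ r (suc m)

    -- Up to r = d the recurrence agrees with that of the infinite tree: at distance d, where `L`
    -- differs, all terms still vanish.
    U-inner : ∀ r → r ℕ.≤ d → ∀ {m} → m ℕ.≤ d → U r m ≡ Ind r m
    U-inner 0 _ _ = refl
    U-inner 1 _ {zero} _ = refl
    U-inner 1 _ {suc m} _ = refl
    U-inner (suc (suc r)) r≤ {m} m≤ = trans (cong₂ (λ a b → a - 2ℤ * b) (L-cong (U-inner (suc r) (ℕ.<⇒≤ r≤)) m≤) (U-inner r (ℕ.<⇒≤ (ℕ.<⇒≤ r≤)) m≤)) (step m m≤)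
      where
      lemma₃ : ∀ x → 3ℤ * x - 2ℤ * x ≡ x
      lemma₃ = solve-∀
      lemma₂ : ∀ x y → (x + 2ℤ * y) - 2ℤ * y ≡ x
      lemma₂ = solve-∀
      step : ∀ m → m ℕ.≤ d → L (Ind (suc r)) m - 2ℤ * Ind r m ≡ Ind (suc (suc r)) m
      step zero _ = trans (cong (λ x → 3ℤ * x - 2ℤ * Ind r 0) (Ind-suc r 0)) (lemma₃ (Ind r 0))
      step (suc m) _ with suc m ℕ.≟ d
      ... | yes refl = trans (cong₂ (λ a b → 3ℤ * a - 2ℤ * b) (Ind-vanishes (ℕ.≤-pred r≤)) (Ind-vanishes (ℕ.<⇒≤ (ℕ.<⇒≤ r≤))))
                         (sym (Ind-vanishes (ℕ.≤-pred r≤)))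
      ... | no _ = trans (cong (λ x → (Ind (suc r) m + 2ℤ * x) - 2ℤ * Ind r (suc m)) (Ind-suc r (suc m))) (lemma₂ (Ind (suc r) m) (Ind r (suc m)))

    Ind≡J : ∀ r m → m ℕ.≤ r → Ind r m ≡ J r m
    Ind≡J zero zero _ = refl
    Ind≡J 1 zero _ = refl
    Ind≡J (suc (suc r)) zero _ = Ind≡J r zero z≤n
    Ind≡J (suc r) (suc m) (s≤s le) = trans (Ind-suc r m) (trans (Ind≡J r m le) (cong (λ x → even (suc (suc x))) (sym (ℕ.+-suc r m))))

    -- Reflection at d, used for r = d + i and k = d - i. Modulo J the polynomial U d is zero, so
    -- both roots of z² - λ z + 2 have the same d-th power; as their product is 2, U (d + i) = - 2^i
    -- U (d - i). The J term corrects for the eigenvalues 3 and -3.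
    Middle : ℕ → ℕ → ℕ → Set
    Middle i k r = ∀ {m} → m ℕ.≤ d → U r m ≡ (2^ i + 1ℤ) * J r m + (- (2^ i)) * U k m

    middle-step : ∀ i k r′ → Middle (suc i) (suc k) (suc r′) → Middle i (suc (suc k)) r′ → Middle (suc (suc i)) k (suc (suc r′))
    middle-step i k r′ ih₁ ih₀ {m} m≤ = begin
        L (U (suc r′)) m - 2ℤ * U r′ m
          ≡⟨ cong₂ (λ a b → a - 2ℤ * b)
               (trans (L-cong ih₁ m≤)
                 (trans (L-linear (2^ suc i + 1ℤ) (- (2^ suc i)) (J (suc r′)) (U (suc k)) m)
                   (cong (λ a → (2^ suc i + 1ℤ) * a + (- (2^ suc i)) * L (U (suc k)) m) (L-J (suc r′) m))))
               (ih₀ m≤) ⟩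
        ((2^ suc i + 1ℤ) * (3ℤ * j) + (- (2^ suc i)) * l) - 2ℤ * ((2^ i + 1ℤ) * j + (- (2^ i)) * (l - 2ℤ * U k m))
          ≡⟨ cong (λ x → ((x + 1ℤ) * (3ℤ * j) + (- x) * l) - 2ℤ * ((2^ i + 1ℤ) * j + (- (2^ i)) * (l - 2ℤ * U k m))) (2^suc i) ⟩
        ((2ℤ * 2^ i + 1ℤ) * (3ℤ * j) + (- (2ℤ * 2^ i)) * l) - 2ℤ * ((2^ i + 1ℤ) * j + (- (2^ i)) * (l - 2ℤ * U k m))
          ≡⟨ lemma (2^ i) j l (U k m) ⟩
        (2ℤ * (2ℤ * 2^ i) + 1ℤ) * j + (- (2ℤ * (2ℤ * 2^ i))) * U k m
          ≡⟨ cong (λ x → (x + 1ℤ) * j + (- x) * U k m) (sym (trans (2^suc (suc i)) (cong (2ℤ *_) (2^suc i)))) ⟩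
        (2^ suc (suc i) + 1ℤ) * j + (- (2^ suc (suc i))) * U k m ∎
      where
      open ≡-Reasoning
      j = J (suc (suc r′)) m
      l = L (U (suc k)) m
      lemma : ∀ x j l u → ((2ℤ * x + 1ℤ) * (3ℤ * j) + (- (2ℤ * x)) * l) - 2ℤ * ((x + 1ℤ) * j + (- x) * (l - 2ℤ * u))
        ≡ (2ℤ * (2ℤ * x) + 1ℤ) * j + (- (2ℤ * (2ℤ * x))) * u
      lemma = solve-∀

    U-middle : ∀ i k r → i ℕ.+ k ≡ d → r ≡ d ℕ.+ i → Middle i k r
    U-middle zero k r refl r≡ {m} m≤ with trans r≡ (ℕ.+-identityʳ d)
    ... | refl = trans (lemma (U d m)) (cong (λ x → 2ℤ * x + (- 1ℤ) * U d m) (trans (U-inner d ℕ.≤-refl m≤) (Ind≡J d m m≤)))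
      where
      lemma : ∀ x → x ≡ 2ℤ * x + (- 1ℤ) * x
      lemma = solve-∀
    U-middle 1 k r refl r≡ {m} m≤ with trans r≡ (ℕ.+-comm d 1)
    ... | refl = trans (cong (λ a → a - 2ℤ * U (suc e) m)
                   (trans (L-cong (λ {m} m≤ → trans (U-inner d ℕ.≤-refl m≤) (Ind≡J d m m≤)) m≤) (L-J d m)))
                   (lemma (J (suc d) m) (U (suc e) m))
      where
      lemma : ∀ x y → 3ℤ * x - 2ℤ * y ≡ (2ℤ + 1ℤ) * x + (- 2ℤ) * y
      lemma = solve-∀
    U-middle (suc (suc i)) k r eq r≡ = subst (Middle (suc (suc i)) k)
      (sym (trans r≡ (trans (ℕ.+-suc d (suc i)) (cong suc (ℕ.+-suc d i)))))
      (middle-step i k (d ℕ.+ i)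
        (U-middle (suc i) (suc k) (suc (d ℕ.+ i)) (trans (ℕ.+-suc (suc i) k) eq) (sym (ℕ.+-suc d i)))
        (U-middle i (suc (suc k)) (d ℕ.+ i) (trans (ℕ.+-suc i (suc k)) (trans (cong suc (ℕ.+-suc i k)) eq)) refl))

    even-double : ∀ a t → even (a ℕ.+ a ℕ.+ t) ≡ even t
    even-double zero t = refl
    even-double (suc a) t = trans (cong (λ x → even (suc x ℕ.+ t)) (ℕ.+-suc a a)) (even-double a t)

    J-double : ∀ a r m → J (a ℕ.+ a ℕ.+ r) m ≡ J r m
    J-double a r m = trans (cong even (trans (cong suc (ℕ.+-assoc (a ℕ.+ a) r m)) (sym (ℕ.+-suc (a ℕ.+ a) (r ℕ.+ m))))) (even-double a (suc (r ℕ.+ m)))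

    -- Shift by 2d, used for s = 2d + r: modulo J it is multiplication by 2^d, since z^(2d) = 2^d
    -- there.
    Outer : ℕ → ℕ → Set
    Outer r s = ∀ {m} → m ℕ.≤ d → U s m ≡ (2^ (d ℕ.+ r) + 1ℤ) * J r m + 2^ d * U r m

    outer-zero : Outer 0 (d ℕ.+ d ℕ.+ 0)
    outer-zero {m} m≤ = begin
      U (d ℕ.+ d ℕ.+ 0) m                                      ≡⟨ U-middle d 0 _ (ℕ.+-identityʳ d) (ℕ.+-identityʳ (d ℕ.+ d)) m≤ ⟩
      (2^ d + 1ℤ) * J (d ℕ.+ d ℕ.+ 0) m + (- (2^ d)) * 0ℤ      ≡⟨ cong (λ x → (2^ d + 1ℤ) * x + (- (2^ d)) * 0ℤ) (J-double d 0 m) ⟩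
      (2^ d + 1ℤ) * J 0 m + (- (2^ d)) * 0ℤ                    ≡⟨ lemma (2^ d) (J 0 m) ⟩
      (2^ d + 1ℤ) * J 0 m + 2^ d * 0ℤ                          ≡⟨ cong (λ x → (2^ x + 1ℤ) * J 0 m + 2^ d * 0ℤ) (sym (ℕ.+-identityʳ d)) ⟩
      (2^ (d ℕ.+ 0) + 1ℤ) * J 0 m + 2^ d * 0ℤ                  ∎
      where
      open ≡-Reasoning
      lemma : ∀ x j → (x + 1ℤ) * j + (- x) * 0ℤ ≡ (x + 1ℤ) * j + x * 0ℤ
      lemma = solve-∀

    outer-one : Outer 1 (suc (suc (d ℕ.+ suc e)))
    outer-one {m} m≤ = begin
      L (U (suc t)) m - 2ℤ * U t m
        ≡⟨ cong₂ (λ a b → a - 2ℤ * b)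
             (trans (L-cong (subst (Outer 0) (trans (ℕ.+-identityʳ (d ℕ.+ d)) (ℕ.+-suc d (suc e))) outer-zero) m≤)
               (trans (L-linear (2^ (d ℕ.+ 0) + 1ℤ) (2^ d) (J 0) (U 0) m) (cong₂ (λ a b → (2^ (d ℕ.+ 0) + 1ℤ) * a + 2^ d * b) (L-J 0 m) (L-zero m))))
             (U-middle (suc e) 1 t (ℕ.+-comm (suc e) 1) refl m≤) ⟩
      ((2^ (d ℕ.+ 0) + 1ℤ) * (3ℤ * J 1 m) + 2^ d * 0ℤ) - 2ℤ * ((2^ suc e + 1ℤ) * J t m + (- (2^ suc e)) * U 1 m)
        ≡⟨ cong₂ (λ x y → ((2^ x + 1ℤ) * (3ℤ * J 1 m) + 2^ d * 0ℤ) - 2ℤ * ((2^ suc e + 1ℤ) * y + (- (2^ suc e)) * U 1 m)) (ℕ.+-identityʳ d) Jt ⟩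
      ((2^ d + 1ℤ) * (3ℤ * J 1 m) + 2^ d * 0ℤ) - 2ℤ * ((2^ suc e + 1ℤ) * J 1 m + (- (2^ suc e)) * U 1 m)
        ≡⟨ cong (λ x → ((x + 1ℤ) * (3ℤ * J 1 m) + x * 0ℤ) - 2ℤ * ((2^ suc e + 1ℤ) * J 1 m + (- (2^ suc e)) * U 1 m)) (2^suc (suc e)) ⟩
      ((2ℤ * 2^ suc e + 1ℤ) * (3ℤ * J 1 m) + (2ℤ * 2^ suc e) * 0ℤ) - 2ℤ * ((2^ suc e + 1ℤ) * J 1 m + (- (2^ suc e)) * U 1 m)
        ≡⟨ lemma (2^ suc e) (J 1 m) (U 1 m) ⟩
      (2ℤ * (2ℤ * 2^ suc e) + 1ℤ) * J 1 m + (2ℤ * 2^ suc e) * U 1 m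
        ≡⟨ cong₂ (λ x y → (x + 1ℤ) * J 1 m + y * U 1 m) (sym (trans (cong 2^_ (ℕ.+-comm d 1)) (trans (2^suc d) (cong (2ℤ *_) (2^suc (suc e)))))) (sym (2^suc (suc e))) ⟩
      (2^ (d ℕ.+ 1) + 1ℤ) * J 1 m + 2^ d * U 1 m ∎
      where
      open ≡-Reasoning
      t = d ℕ.+ suc e
      L-zero : ∀ m → L (U 0) m ≡ 0ℤ
      L-zero zero = refl
      L-zero (suc m) with suc m ℕ.≟ d
      ... | yes _ = refl
      ... | no _ = refl
      Jt : J t m ≡ J 1 m
      Jt = trans (cong (λ x → J x m) (trans (sym (ℕ.+-suc (suc e) (suc e))) (trans (ℕ.+-suc (suc e) (suc e)) (trans (sym (ℕ.+-comm (suc e ℕ.+ suc e) 1)) refl)))) (J-double (suc e) 1 m)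
      lemma : ∀ x j u → ((2ℤ * x + 1ℤ) * (3ℤ * j) + (2ℤ * x) * 0ℤ) - 2ℤ * ((x + 1ℤ) * j + (- x) * u) ≡ (2ℤ * (2ℤ * x) + 1ℤ) * j + (2ℤ * x) * u
      lemma = solve-∀

    outer-step : ∀ r s′ → Outer (suc r) (suc s′) → Outer r s′ → Outer (suc (suc r)) (suc (suc s′))
    outer-step r s′ ih₁ ih₀ {m} m≤ = begin
      L (U (suc s′)) m - 2ℤ * U s′ m
        ≡⟨ cong₂ (λ a b → a - 2ℤ * b)
             (trans (L-cong ih₁ m≤)
               (trans (L-linear (2^ (d ℕ.+ suc r) + 1ℤ) (2^ d) (J (suc r)) (U (suc r)) m)
                 (cong (λ a → (2^ (d ℕ.+ suc r) + 1ℤ) * a + 2^ d * L (U (suc r)) m) (L-J (suc r) m))))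
             (ih₀ m≤) ⟩
      ((2^ (d ℕ.+ suc r) + 1ℤ) * (3ℤ * j) + 2^ d * l) - 2ℤ * ((2^ (d ℕ.+ r) + 1ℤ) * j + 2^ d * U r m)
        ≡⟨ cong (λ x → ((x + 1ℤ) * (3ℤ * j) + 2^ d * l) - 2ℤ * ((2^ (d ℕ.+ r) + 1ℤ) * j + 2^ d * U r m)) (trans (cong 2^_ (ℕ.+-suc d r)) (2^suc (d ℕ.+ r))) ⟩
      ((2ℤ * y + 1ℤ) * (3ℤ * j) + 2^ d * l) - 2ℤ * ((y + 1ℤ) * j + 2^ d * U r m)
        ≡⟨ lemma y (2^ d) j l (U r m) ⟩
      (2ℤ * (2ℤ * y) + 1ℤ) * j + 2^ d * (l - 2ℤ * U r m)
        ≡⟨ cong (λ x → (x + 1ℤ) * j + 2^ d * (l - 2ℤ * U r m)) (sym (trans (cong 2^_ (trans (ℕ.+-suc d (suc r)) (cong suc (ℕ.+-suc d r)))) (trans (2^suc (suc (d ℕ.+ r))) (cong (2ℤ *_) (2^suc (d ℕ.+ r)))))) ⟩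
      (2^ (d ℕ.+ suc (suc r)) + 1ℤ) * j + 2^ d * (l - 2ℤ * U r m) ∎
      where
      open ≡-Reasoning
      j = J (suc (suc r)) m
      l = L (U (suc r)) m
      y = 2^ (d ℕ.+ r)
      lemma : ∀ y z j l u → ((2ℤ * y + 1ℤ) * (3ℤ * j) + z * l) - 2ℤ * ((y + 1ℤ) * j + z * u) ≡ (2ℤ * (2ℤ * y) + 1ℤ) * j + z * (l - 2ℤ * u)
      lemma = solve-∀

    U-outer : ∀ r s → s ≡ d ℕ.+ d ℕ.+ r → Outer r s
    U-outer zero s s≡ = subst (Outer 0) (sym s≡) outer-zero
    U-outer 1 s s≡ = subst (Outer 1) (sym (trans s≡ (trans (ℕ.+-comm (d ℕ.+ d) 1) (cong suc (ℕ.+-suc d (suc e)))))) outer-one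
    U-outer (suc (suc r)) s s≡ = subst (Outer (suc (suc r)))
      (sym (trans s≡ (trans (ℕ.+-suc (d ℕ.+ d) (suc r)) (cong suc (ℕ.+-suc (d ℕ.+ d) r)))))
      (outer-step r (d ℕ.+ d ℕ.+ r) (U-outer (suc r) (suc (d ℕ.+ d ℕ.+ r)) (sym (ℕ.+-suc (d ℕ.+ d) r))) (U-outer r (d ℕ.+ d ℕ.+ r) refl))

-- Traces of powers of the block matrix.

module CompanionTrace where

  open import Defs renaming (sym to adj-sym)
  open Walks
  open CycleCounting
  open Distances
  open Polygons
  open ClosedWords
  open RadialPolynomials
  open import Data.Nat as ℕ using (ℕ; zero; suc; s≤s)
  import Data.Nat.Properties as ℕ
  open import Data.Integer as ℤ using (ℤ; +_; _+_; _*_; -_; _-_; 0ℤ; 1ℤ)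
  open import Data.Integer.Properties using (*-identityˡ; *-identityʳ; *-zeroˡ; *-zeroʳ; +-identityʳ; +-identityˡ; +-assoc)
  open import Data.Integer.Tactic.RingSolver using (solve-∀)
  open import Data.Fin using (Fin; zero; suc; _↑ˡ_; _↑ʳ_; combine; remQuot)
  open import Data.Fin.Properties as Fin using (remQuot-combine)
  open import Data.List.Relation.Unary.Unique.Propositional using (Unique; []; _∷_)
  open import Data.List.Relation.Unary.All using ([]; _∷_)

  bit : Bool → ℤ
  bit b = if b then 1ℤ else 0ℤ

  sum-filter : ∀ {A : Set} {n} (b : A → Bool) (g : A → ℤ) (f : Fin n → A) →
    sum (λ i → bit (b (f i)) * g (f i)) ≡ foldr _+_ 0ℤ (map g (filter (λ x → b x ≟ᴮ true) (tabulate f)))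
  sum-filter {n = zero} b g f = refl
  sum-filter {n = suc n} b g f with b (f zero)
  ... | true = cong₂ _+_ (*-identityˡ (g (f zero))) (sum-filter b g (f ∘ suc))
  ... | false = trans (cong (_+ sum (λ i → bit (b (f (suc i))) * g (f (suc i)))) (*-zeroˡ (g (f zero)))) (trans (+-identityˡ _) (sum-filter b g (f ∘ suc)))

  sum-++ : ∀ a {b} (f : Fin (a ℕ.+ b) → ℤ) → sum f ≡ sum (f ∘ (_↑ˡ b)) + sum (f ∘ (a ↑ʳ_))
  sum-++ zero f = sym (+-identityˡ _)
  sum-++ (suc a) f = trans (cong (λ s → f zero + s) (sum-++ a (f ∘ suc))) (sym (+-assoc (f zero) _ _))

  sum-combine : ∀ m n (f : Fin (m ℕ.* n) → ℤ) → sum f ≡ sum (λ (i : Fin m) → sum (λ (j : Fin n) → f (combine i j)))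
  sum-combine zero n f = refl
  sum-combine (suc m) n f = trans (sum-++ n f) (cong (λ s → sum (f ∘ (_↑ˡ (m ℕ.* n))) + s) (sum-combine m n (f ∘ (n ↑ʳ_))))

  module Trace {n : ℕ} (Γ : Graph n) (e : ℕ)
    (Γ-girth : Girth Γ (2 ℕ.* suc (suc e)))
    (conn : Connected Γ) (reg : Regular Γ 3)
    (moore : GirthCycles.Moore Γ e (proj₂ Γ-girth)) where

    open Polygon Γ e 2 Γ-girth conn reg moore
    open Radial e using (L; L-linear; L-cong; U)

    three-neighbours : ∀ u → ∃ λ x → ∃ λ y → ∃ λ z → neighbours Γ u ≡ x ∷ y ∷ z ∷ []
    three-neighbours u with neighbours Γ u | reg u
    ... | x ∷ y ∷ z ∷ [] | refl = x , y , z , refl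

    a : V → V → ℤ
    a u v = bit (adj Γ u v)

    -- At distance 0 all three neighbours are farther, at distance d all three are closer, and in
    -- between exactly one is closer. The three cases of the last clause are the possible positions
    -- of that one.
    adjacency-radial : ∀ f v u → sum (λ w → a u w * f (δ v w)) ≡ L f (δ v u)
    adjacency-radial f v u with three-neighbours u
    ... | x , y , z , eq = trans (sum-filter (adj Γ u) (f ∘ δ v) (λ w → w)) (trans (cong (λ l → foldr _+_ 0ℤ (map (f ∘ δ v) l)) eq) (count (δ v u) refl))
      where
      mem : ∀ {w} → w ∈ x ∷ y ∷ z ∷ [] → u ~ w
      mem p = ∈-neighbours⁻ (subst (_ ∈_) (sym eq) p)
      ux = mem (here refl)
      uy = mem (there (here refl))
      uz = mem (there (there (here refl)))
      uq : Unique (x ∷ y ∷ z ∷ [])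
      uq = subst Unique eq (neighbours-unique u)
      x≢y : x ≢ y
      x≢y with uq
      ... | (p ∷ _) ∷ _ = p
      x≢z : x ≢ z
      x≢z with uq
      ... | (_ ∷ p ∷ _) ∷ _ = p
      y≢z : y ≢ z
      y≢z with uq
      ... | _ ∷ (p ∷ _) ∷ _ = p
      F : ℕ → ℕ → ℕ → ℤ
      F i j k = f i + (f j + (f k + 0ℤ))
      triple : ∀ t → t + (t + (t + 0ℤ)) ≡ 3ℤ * t
      triple = solve-∀
      far : ∀ {m w} → δ v u ≡ m → u ~ w → suc (δ v w) ≢ m → δ v w ≡ suc m
      far {m} {w} refl uw ne with δ-step v uw
      ... | closer c = ⊥-elim (ne c)
      ... | farther c = c
      near : ∀ {m w} → δ v u ≡ suc m → suc m ≡ d → u ~ w → δ v w ≡ m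
      near {m} {w} δ≡ m≡ uw with δ-step v uw
      ... | closer c = ℕ.suc-injective (trans c δ≡)
      ... | farther c = ⊥-elim (ℕ.<⇒≱ (s≤s (ℕ.≤-reflexive (sym (trans δ≡ m≡)))) (ℕ.≤-trans (ℕ.≤-reflexive (sym c)) (δ≤d v w)))
      away : ∀ {m w t} → δ v u ≡ suc m → suc m ≢ d → u ~ w → suc (δ v w) ≡ δ v u → u ~ t → w ≢ t → δ v t ≡ suc (suc m)
      away δ≡ ne uw c ut w≢t = far δ≡ ut (λ q → w≢t (closer-unique
        (subst (ℕ._< d) (sym δ≡) (ℕ.≤∧≢⇒< (subst (ℕ._≤ d) δ≡ (δ≤d v u)) ne)) uw ut c (trans q (sym δ≡))))
      lemma₁ : ∀ s t → s + (t + (t + 0ℤ)) ≡ s + 2ℤ * t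
      lemma₁ = solve-∀
      lemma₂ : ∀ s t → t + (s + (t + 0ℤ)) ≡ s + 2ℤ * t
      lemma₂ = solve-∀
      lemma₃ : ∀ s t → t + (t + (s + 0ℤ)) ≡ s + 2ℤ * t
      lemma₃ = solve-∀
      F-cong : ∀ {i j k i′ j′ k′} → i ≡ i′ → j ≡ j′ → k ≡ k′ → F i j k ≡ F i′ j′ k′
      F-cong refl refl refl = refl
      count : ∀ m → δ v u ≡ m → F (δ v x) (δ v y) (δ v z) ≡ L f m
      count zero δ≡ = trans (F-cong (far δ≡ ux (λ ())) (far δ≡ uy (λ ())) (far δ≡ uz (λ ()))) (triple (f 1))
      count (suc m) δ≡ with suc m ℕ.≟ d
      ... | yes m≡ = trans (F-cong (near δ≡ m≡ ux) (near δ≡ m≡ uy) (near δ≡ m≡ uz)) (triple (f m))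
      ... | no ne with closer-exists v u (λ q → ℕ.0≢1+n (trans (sym q) δ≡))
      ...   | w , uw , c with subst (w ∈_) eq (∈-neighbours⁺ uw)
      ...     | here refl = trans (F-cong (ℕ.suc-injective (trans c δ≡)) (away δ≡ ne uw c uy x≢y) (away δ≡ ne uw c uz x≢z)) (lemma₁ (f m) (f (suc (suc m))))
      ...     | there (here refl) = trans (F-cong (away δ≡ ne uw c ux (x≢y ∘ sym)) (ℕ.suc-injective (trans c δ≡)) (away δ≡ ne uw c uz y≢z)) (lemma₂ (f m) (f (suc (suc m))))
      ...     | there (there (here refl)) = trans (F-cong (away δ≡ ne uw c ux (x≢z ∘ sym)) (away δ≡ ne uw c uy (y≢z ∘ sym)) (ℕ.suc-injective (trans c δ≡))) (lemma₃ (f m) (f (suc (suc m))))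

    id : V → V → ℤ
    id u v = U 1 (δ v u)

    id-diag : ∀ u → id u u ≡ 1ℤ
    id-diag u = cong (U 1) (δ-refl u)

    id-off : ∀ {u v} → u ≢ v → id u v ≡ 0ℤ
    id-off {u} {v} ne with δ v u in eq
    ... | zero = ⊥-elim (ne (sym (δ≡0⇒≡ eq)))
    ... | suc _ = refl

    sum-id : ∀ u (g : V → ℤ) → sum (λ w → id u w * g w) ≡ g u
    sum-id u g = trans (sum-single (λ w → id u w * g w) u (λ w ne → trans (cong (_* g w) (id-off (ne ∘ sym))) (*-zeroˡ (g w))))
      (trans (cong (_* g u) (id-diag u)) (*-identityˡ (g u)))

    -- The block matrix with rows (A, -1, -1), (1, 0, 0), (1, 0, 0): its characteristic polynomial is that of
    -- z² - A z + 2, but its entries are only 0, 1 and -1.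
    ν : Fin 3 × V → Fin 3 × V → ℤ
    ν (zero , u) (zero , v) = a u v
    ν (zero , u) (suc _ , v) = - id u v
    ν (suc _ , u) (zero , v) = id u v
    ν (suc _ , u) (suc _ , v) = 0ℤ

    ν-cube : ∀ s t → ν s t * (ν s t * ν s t) ≡ ν s t
    ν-cube (zero , u) (zero , v) with adj Γ u v
    ... | true = refl
    ... | false = refl
    ν-cube (zero , u) (suc _ , v) with δ v u
    ... | zero = refl
    ... | suc _ = refl
    ν-cube (suc _ , u) (zero , v) with δ v u
    ... | zero = refl
    ... | suc _ = refl
    ν-cube (suc _ , u) (suc _ , v) = refl

    μ : Fin (3 ℕ.* n) → Fin (3 ℕ.* n) → ℤ
    μ x y = ν (remQuot n x) (remQuot n y)

    μ-cube : ∀ x y → μ x y * (μ x y * μ x y) ≡ μ x y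
    μ-cube x y = ν-cube (remQuot n x) (remQuot n y)

    open Words (3 ℕ.* n)

    μ-combine : ∀ s u t v → μ (combine s u) (combine t v) ≡ ν (s , u) (t , v)
    μ-combine s u t v = cong₂ ν (remQuot-combine s u) (remQuot-combine t v)

    P : ℕ → Fin (3 ℕ.* n) → Fin (3 ℕ.* n) → ℤ
    P N x y = sumL N (λ w → weight μ x w y)

    P-suc : ∀ N x y → P (suc N) x y ≡ sum (λ z → μ x z * P N z y)
    P-suc N x y = sum-cong-≗ (λ z → sumL-*ˡ N (μ x z) (λ w → weight μ z w y))

    -- The blocks of the power N + 1 of `ν`. Each is a polynomial in A, hence a function of the
    -- distance alone, and the recurrence of `U` is the induction step.
    block : ℕ → Fin 3 → Fin 3 → ℕ → ℤ
    block N zero zero m = U (suc (suc N)) m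
    block N zero (suc _) m = - U (suc N) m
    block N (suc _) zero m = U (suc N) m
    block N (suc _) (suc _) m = - U N m

    P-step : ∀ N → (∀ s u t v → P N (combine s u) (combine t v) ≡ block N s t (δ v u)) → ∀ s u t v →
      P (suc N) (combine s u) (combine t v) ≡ sum (λ r → sum (λ w → ν (s , u) (r , w) * block N r t (δ v w)))
    P-step N ih s u t v = trans (P-suc N (combine s u) (combine t v)) (trans (sum-combine 3 n (λ z → μ (combine s u) z * P N z (combine t v)))
      (sum-cong-≗ (λ r → sum-cong-≗ (λ w → cong₂ _*_ (μ-combine s u r w) (ih r w t v)))))

    sum-zero : ∀ (g : V → ℤ) → sum (λ w → 0ℤ * g w) ≡ 0ℤ
    sum-zero g = trans (sum-cong-≗ (λ w → *-zeroˡ (g w))) (sum-replicate-zero n)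

    P-row₊ : ∀ N → (∀ s u t v → P N (combine s u) (combine t v) ≡ block N s t (δ v u)) → ∀ i u t v →
      P (suc N) (combine (suc i) u) (combine t v) ≡ block N zero t (δ v u)
    P-row₊ N ih i u t v = trans (P-step N ih (suc i) u t v)
      (trans (cong₂ _+_ (sum-id u (λ w → block N zero t (δ v w))) (cong₂ _+_ (sum-zero (λ w → block N (suc zero) t (δ v w)))
        (cong (_+ 0ℤ) (sum-zero (λ w → block N (suc (suc zero)) t (δ v w)))))) (+-identityʳ (block N zero t (δ v u))))

    P-row₀ : ∀ N → (∀ s u t v → P N (combine s u) (combine t v) ≡ block N s t (δ v u)) → ∀ u t v →
      P (suc N) (combine {3} zero u) (combine t v) ≡ L (block N zero t) (δ v u) - 2ℤ * block N (suc zero) t (δ v u)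
    P-row₀ N ih u t v = trans (P-step N ih zero u t v)
      (trans (cong₂ _+_ (adjacency-radial (block N zero t) v u) (cong₂ (λ x y → x + (y + 0ℤ)) (neg (block N (suc zero) t)) (neg (block N (suc (suc zero)) t))))
        (same t))
      where
      neg : ∀ (f : ℕ → ℤ) → sum (λ w → (- id u w) * f (δ v w)) ≡ - f (δ v u)
      neg f = trans (sum-cong-≗ (λ w → lem (id u w) (f (δ v w)))) (sum-id u (λ w → - f (δ v w)))
        where
        lem : ∀ x y → (- x) * y ≡ x * (- y)
        lem = solve-∀
      lemma : ∀ x y → x + (- y + (- y + 0ℤ)) ≡ x - 2ℤ * y
      lemma = solve-∀
      same : ∀ t → L (block N zero t) (δ v u) + (- block N (suc zero) t (δ v u) + (- block N (suc (suc zero)) t (δ v u) + 0ℤ))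
               ≡ L (block N zero t) (δ v u) - 2ℤ * block N (suc zero) t (δ v u)
      same zero = lemma (L (block N zero zero) (δ v u)) (U (suc N) (δ v u))
      same (suc t) = lemma (L (block N zero (suc t)) (δ v u)) (- U N (δ v u))

    P-block : ∀ N s u t v → P N (combine s u) (combine t v) ≡ block N s t (δ v u)
    P-block zero zero u zero v = trans (μ-combine zero u zero v) (trans (sym adj-id) (trans (adjacency-radial (U 1) v u) (sym (+-identityʳ _))))
      where
      adj-id : sum (λ w → a u w * U 1 (δ v w)) ≡ a u v
      adj-id = trans (sum-single (λ w → a u w * id w v) v (λ w ne → trans (cong (a u w *_) (id-off ne)) (*-zeroʳ (a u w))))
        (trans (cong (a u v *_) (id-diag v)) (*-identityʳ (a u v)))
    P-block zero zero u (suc t) v = μ-combine zero u (suc t) v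
    P-block zero (suc s) u zero v = μ-combine (suc s) u zero v
    P-block zero (suc s) u (suc t) v = μ-combine (suc s) u (suc t) v
    P-block (suc N) zero u zero v = P-row₀ N (P-block N) u zero v
    P-block (suc N) zero u (suc t) v = trans (P-row₀ N (P-block N) u (suc t) v)
      (trans (cong (_- 2ℤ * (- U N (δ v u))) neg-L) (lemma (L (U (suc N)) (δ v u)) (U N (δ v u))))
      where
      expand : ∀ x → - x ≡ (- 1ℤ) * x + 0ℤ * x
      expand = solve-∀
      collapse : ∀ x → (- 1ℤ) * x + 0ℤ * x ≡ - x
      collapse = solve-∀
      neg-L : L (λ m → - U (suc N) m) (δ v u) ≡ - L (U (suc N)) (δ v u)
      neg-L = trans (L-cong (λ {m} _ → expand (U (suc N) m)) (δ≤d v u))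
        (trans (L-linear (- 1ℤ) 0ℤ (U (suc N)) (U (suc N)) (δ v u)) (collapse (L (U (suc N)) (δ v u))))
      lemma : ∀ x y → (- x) - 2ℤ * (- y) ≡ - (x - 2ℤ * y)
      lemma = solve-∀
    P-block (suc N) (suc s) u zero v = P-row₊ N (P-block N) s u zero v
    P-block (suc N) (suc s) u (suc t) v = P-row₊ N (P-block N) s u (suc t) v

    -- Spectrally this is the identity z^r + w^r = U (r + 1) - 2 U (r - 1) for the two roots z and w
    -- with z w = 2, at r = N + 1, summed over the eigenvalues.
    trace-formula : ∀ N → sumL (suc N) (cyclic μ) ≡ + n * (U (suc (suc N)) 0 - 2ℤ * U N 0)
    trace-formula N = begin
      sum (λ x → P N x x)                                             ≡⟨ sum-combine 3 n (λ x → P N x x) ⟩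
      sum {3} (λ s → sum {n} (λ u → P N (combine s u) (combine s u)))         ≡⟨ sum-cong-≗ {3} (λ s → sum-cong-≗ {n} (λ u → trans (P-block N s u s u) (cong (block N s s) (δ-refl u)))) ⟩
      sum {3} (λ s → sum {n} (λ u → block N s s 0))                       ≡⟨ sum-cong-≗ {3} (λ s → sum-const n (block N s s 0)) ⟩
      + n * U (suc (suc N)) 0 + (+ n * (- U N 0) + (+ n * (- U N 0) + 0ℤ))  ≡⟨ lemma (+ n) (U (suc (suc N)) 0) (U N 0) ⟩
      + n * (U (suc (suc N)) 0 - 2ℤ * U N 0)                          ∎
      where
      open ≡-Reasoning
      lemma : ∀ n x y → n * x + (n * (- y) + (n * (- y) + 0ℤ)) ≡ n * (x - 2ℤ * y)
      lemma = solve-∀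

-- The condition that an odd prime imposes on d.

module PrimePowers where

  open ClosedWords
  open RotationOrbits
  open RadialPolynomials
  open import Data.Nat as ℕ using (ℕ; zero; suc; s≤s; z≤n; NonZero)
  import Data.Nat.Properties as ℕ
  open import Data.Nat.Tactic.RingSolver using () renaming (solve-∀ to solveℕ-∀)
  open import Data.Nat.DivMod using (_%_; _/_; m≡m%n+[m/n]*n; m%n<n)
  open import Data.Nat.Divisibility as ℕ∣ using () renaming (_∣_ to _∣ℕ_)
  open import Data.Nat.Coprimality as Coprime using (Coprime; coprime-divisor)
  open import Data.Nat.Primality using (Prime; prime⇒irreducible; prime⇒nonZero; ¬prime[1]; euclidsLemma; prime⇒nonTrivial)
  open import Data.Nat.Primality.Factorisation using (factorise)
  open import Data.Nat.ListAction using (product)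
  open import Data.Integer as ℤ using (ℤ; +_; _+_; _*_; -_; _-_; 0ℤ; 1ℤ; ∣_∣)
  open import Data.Integer.Properties as ℤ using (*-identityˡ; *-identityʳ; *-zeroʳ; pos-*; abs-*)
  open import Data.Integer.Divisibility.Signed as ℤ∣ using (_∣_; divides)
  open import Data.Integer.Tactic.RingSolver using (solve-∀)
  open import Data.Fin using (zero; suc; toℕ; fromℕ<)
  open import Data.Fin.Properties as Fin using (pigeonhole; toℕ-fromℕ<)
  open import Data.List.Relation.Unary.All as All using ([]; _∷_)

  2^-+ : ∀ a b → 2^ (a ℕ.+ b) ≡ 2^ a * 2^ b
  2^-+ a b = trans (cong +_ (ℕ.^-distribˡ-+-* 2 a b)) (pos-* (2 ℕ.^ a) (2 ℕ.^ b))

  congruent : ∀ {a b A B q} → (∃ λ z → a ≡ b + q * z) → a ≡ A → b ≡ B → q ∣ A - B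
  congruent {b = b} {q = q} (z , eq) refl refl = divides z (trans (cong (_- b) eq) (lemma b q z))
    where
    lemma : ∀ b q z → (b + q * z) - b ≡ z * q
    lemma = solve-∀

  -- The trace congruence for the two by two matrix of ones, the L-th power of which has trace 2^L.
  2^-congruence : ∀ {p} → Prime p → ∀ {h} → p ≡ suc (2 ℕ.* h) → ∀ c .{{_ : NonZero c}} j →
    + (p ℕ.^ suc j) ∣ 2^ (p ℕ.^ suc j ℕ.* c) - 2^ (p ℕ.^ j ℕ.* c)
  2^-congruence {p} pr {h} p-odd c j = congruent (Orbits.trace-congruence 2 (λ _ _ → 1ℤ) (λ _ _ → refl) pr {h} p-odd c j)
      (ones (p ℕ.^ suc j ℕ.* c) {{ℕ.m*n≢0 (p ℕ.^ suc j) c {{ℕ.m^n≢0 p (suc j)}}}})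
      (ones (p ℕ.^ j ℕ.* c) {{ℕ.m*n≢0 (p ℕ.^ j) c {{ℕ.m^n≢0 p j}}}})
    where
    open Words 2
    instance
      p≢0 : NonZero p
      p≢0 = prime⇒nonZero pr
    weight-ones : ∀ x w y → weight (λ _ _ → 1ℤ) x w y ≡ 1ℤ
    weight-ones x [] y = refl
    weight-ones x (z ∷ w) y = trans (*-identityˡ _) (weight-ones z w y)
    ones : ∀ L .{{_ : NonZero L}} → sumL L (cyclic (λ _ _ → 1ℤ)) ≡ 2^ L
    ones (suc L) = trans (sum-cong-≗ {2} (λ x → trans (sumL-cong L (λ w _ → weight-ones x w x)) (sumL-const L 1ℤ)))
      (trans (sum-const 2 (2^ L * 1ℤ)) (trans (cong (2ℤ *_) (*-identityʳ (2^ L))) (sym (2^suc L))))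

  module RadialTrace (e : ℕ) where

    open Radial e

    E : ℕ → ℤ
    E q = U (suc (q ℕ.* 2)) 0

    -- For positive q the number n T q is the trace of the power 2q of the block matrix.
    T : ℕ → ℤ
    T zero = 0ℤ
    T (suc q) = E (suc q) - 2ℤ * E q

    even-2* : ∀ q → even (q ℕ.* 2) ≡ 1ℤ
    even-2* zero = refl
    even-2* (suc q) = even-2* q

    Ind-odd : ∀ q → Ind (suc (q ℕ.* 2)) 0 ≡ 1ℤ
    Ind-odd zero = refl
    Ind-odd (suc q) = Ind-odd q

    J-odd : ∀ q → J (suc (q ℕ.* 2)) 0 ≡ 1ℤ
    J-odd q = trans (cong (λ x → even (suc (suc x))) (ℕ.+-identityʳ (q ℕ.* 2))) (even-2* q)

    -- When 2q + 1 exceeds d the reflection formula applies, with the coefficients 2^i + 1 and -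
    -- 2^i, which add up to 1.
    E-inner : ∀ q q′ → q ℕ.+ suc q′ ≡ d → E q ≡ 1ℤ
    E-inner q q′ eq with suc (q ℕ.* 2) ℕ.≤? d
    ... | yes le = trans (U-inner (suc (q ℕ.* 2)) le z≤n) (Ind-odd q)
    ... | no gt = trans (U-middle i k r i+k≡d (sym (ℕ.m+[n∸m]≡n d≤r)) z≤n)
                    (trans (cong₂ (λ x y → (2^ i + 1ℤ) * x + (- (2^ i)) * y) (J-odd q) (trans (U-inner k k≤d z≤n) (Ind-odd q′))) (lemma (2^ i)))
      where
      r = suc (q ℕ.* 2)
      k = suc (q′ ℕ.* 2)
      d≤r = ℕ.<⇒≤ (ℕ.≰⇒> gt)
      i = r ℕ.∸ d
      r+k≡d+d : r ℕ.+ k ≡ d ℕ.+ d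
      r+k≡d+d = trans (lem q q′) (cong₂ ℕ._+_ eq eq)
        where
        lem : ∀ q q′ → suc (q ℕ.* 2) ℕ.+ suc (q′ ℕ.* 2) ≡ (q ℕ.+ suc q′) ℕ.+ (q ℕ.+ suc q′)
        lem = solveℕ-∀
      i+k≡d : i ℕ.+ k ≡ d
      i+k≡d = ℕ.+-cancelˡ-≡ d _ _ (trans (sym (ℕ.+-assoc d i k)) (trans (cong (ℕ._+ k) (ℕ.m+[n∸m]≡n d≤r)) r+k≡d+d))
      k≤d : k ℕ.≤ d
      k≤d = subst (k ℕ.≤_) i+k≡d (ℕ.m≤n+m k i)
      lemma : ∀ x → (x + 1ℤ) * 1ℤ + (- x) * 1ℤ ≡ 1ℤ
      lemma = solve-∀

    E-outer : ∀ q → E (d ℕ.+ q) ≡ (2^ d * (2ℤ * 2^ (q ℕ.* 2)) + 1ℤ) + 2^ d * E q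
    E-outer q = trans (U-outer (suc (q ℕ.* 2)) (suc ((d ℕ.+ q) ℕ.* 2)) (lem d q) z≤n)
      (cong₂ (λ x y → x + y) (trans (cong₂ (λ x y → (x + 1ℤ) * y) (trans (2^-+ d (suc (q ℕ.* 2))) (cong (2^ d *_) (2^suc (q ℕ.* 2)))) (J-odd q)) (*-identityʳ (2^ d * (2ℤ * 2^ (q ℕ.* 2)) + 1ℤ))) refl)
      where
      lem : ∀ d q → suc ((d ℕ.+ q) ℕ.* 2) ≡ d ℕ.+ d ℕ.+ suc (q ℕ.* 2)
      lem = solveℕ-∀

    T-inner : ∀ q q′ → suc q ℕ.+ suc q′ ≡ d → T (suc q) ≡ - 1ℤ
    T-inner q q′ eq = cong₂ (λ x y → x - 2ℤ * y) (E-inner (suc q) q′ eq) (E-inner q (suc q′) (trans (ℕ.+-suc q (suc q′)) eq))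

    T-outer : ∀ q → T (d ℕ.+ suc q) ≡ (2^ d * 2^ (suc q ℕ.* 2) - 1ℤ) + 2^ d * T (suc q)
    T-outer q = trans (cong T (ℕ.+-suc d q)) (begin
      E (suc (d ℕ.+ q)) - 2ℤ * E (d ℕ.+ q)
        ≡⟨ cong₂ (λ x y → x - 2ℤ * y) (trans (cong E (sym (ℕ.+-suc d q))) (E-outer (suc q))) (E-outer q) ⟩
      ((D * (2ℤ * 2^ (suc q ℕ.* 2)) + 1ℤ) + D * E (suc q)) - 2ℤ * ((D * (2ℤ * F) + 1ℤ) + D * E q)
        ≡⟨ cong (λ x → ((D * (2ℤ * x) + 1ℤ) + D * E (suc q)) - 2ℤ * ((D * (2ℤ * F) + 1ℤ) + D * E q)) four ⟩
      ((D * (2ℤ * (2ℤ * (2ℤ * F))) + 1ℤ) + D * E (suc q)) - 2ℤ * ((D * (2ℤ * F) + 1ℤ) + D * E q)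
        ≡⟨ lemma D F (E (suc q)) (E q) ⟩
      (D * (2ℤ * (2ℤ * F)) - 1ℤ) + D * (E (suc q) - 2ℤ * E q)
        ≡⟨ cong (λ x → (D * x - 1ℤ) + D * (E (suc q) - 2ℤ * E q)) (sym four) ⟩
      (D * 2^ (suc q ℕ.* 2) - 1ℤ) + D * (E (suc q) - 2ℤ * E q) ∎)
      where
      open ≡-Reasoning
      D = 2^ d
      F = 2^ (q ℕ.* 2)
      four : 2^ (suc q ℕ.* 2) ≡ 2ℤ * (2ℤ * F)
      four = trans (2^suc (suc (q ℕ.* 2))) (cong (2ℤ *_) (2^suc (q ℕ.* 2)))
      lemma : ∀ D F x y → ((D * (2ℤ * (2ℤ * (2ℤ * F))) + 1ℤ) + D * x) - 2ℤ * ((D * (2ℤ * F) + 1ℤ) + D * y) ≡ (D * (2ℤ * (2ℤ * F)) - 1ℤ) + D * (x - 2ℤ * y)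
      lemma = solve-∀

    -- (2^d - 1) T q - 4^q - 1 is 2^q times a d-periodic function of q.
    H : ℕ → ℤ
    H q = (2^ d - 1ℤ) * T q - 2^ (q ℕ.* 2) - 1ℤ

    H-outer : ∀ q → H (d ℕ.+ suc q) ≡ 2^ d * H (suc q)
    H-outer q = trans (cong₂ (λ x y → (2^ d - 1ℤ) * x - y - 1ℤ) (T-outer q) pow) (lemma (2^ d) (2^ (suc q ℕ.* 2)) (T (suc q)))
      where
      pow : 2^ ((d ℕ.+ suc q) ℕ.* 2) ≡ 2^ d * (2^ d * 2^ (suc q ℕ.* 2))
      pow = trans (cong 2^_ (lem d (suc q))) (trans (2^-+ d (d ℕ.+ suc q ℕ.* 2)) (cong (2^ d *_) (2^-+ d (suc q ℕ.* 2))))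
        where
        lem : ∀ d q → (d ℕ.+ q) ℕ.* 2 ≡ d ℕ.+ (d ℕ.+ q ℕ.* 2)
        lem = solveℕ-∀
      lemma : ∀ D F t → (D - 1ℤ) * ((D * F - 1ℤ) + D * t) - D * (D * F) - 1ℤ ≡ D * ((D - 1ℤ) * t - F - 1ℤ)
      lemma = solve-∀

    H-periodic : ∀ s q → H (suc q ℕ.+ s ℕ.* d) ≡ 2^ (s ℕ.* d) * H (suc q)
    H-periodic zero q = trans (cong H (ℕ.+-identityʳ (suc q))) (sym (*-identityˡ (H (suc q))))
    H-periodic (suc s) q = trans (cong H (lem q d (s ℕ.* d))) (trans (H-outer (q ℕ.+ s ℕ.* d))
      (trans (cong (2^ d *_) (H-periodic s q)) (trans (sym (ℤ.*-assoc (2^ d) (2^ (s ℕ.* d)) (H (suc q)))) (cong (_* H (suc q)) (sym (2^-+ d (s ℕ.* d)))))))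
      where
      lem : ∀ q d t → suc q ℕ.+ (d ℕ.+ t) ≡ d ℕ.+ suc (q ℕ.+ t)
      lem = solveℕ-∀

    -- In terms of the periodic function this is c(q) = - (2^d + 4^q) / 2^q for 0 < q < d.
    H-inner : ∀ q q′ → suc q ℕ.+ suc q′ ≡ d → H (suc q) ≡ - (2^ d + 2^ (suc q ℕ.* 2))
    H-inner q q′ eq = trans (cong (λ x → (2^ d - 1ℤ) * x - 2^ (suc q ℕ.* 2) - 1ℤ) (T-inner q q′ eq)) (lemma (2^ d) (2^ (suc q ℕ.* 2)))
      where
      lemma : ∀ D F → (D - 1ℤ) * (- 1ℤ) - F - 1ℤ ≡ - (D + F)
      lemma = solve-∀

  j<p^j : ∀ {p} → 2 ℕ.≤ p → ∀ j → j ℕ.< p ℕ.^ j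
  j<p^j le zero = s≤s z≤n
  j<p^j {p} le (suc j) = begin-strict
    suc j             ≤⟨ j<p^j le j ⟩
    p ℕ.^ j           <⟨ ℕ.m<m+n (p ℕ.^ j) (ℕ.<-≤-trans (s≤s z≤n) (j<p^j le j)) ⟩
    p ℕ.^ j ℕ.+ p ℕ.^ j    ≡⟨ cong (p ℕ.^ j ℕ.+_) (sym (ℕ.+-identityʳ (p ℕ.^ j))) ⟩
    2 ℕ.* p ℕ.^ j     ≤⟨ ℕ.*-monoˡ-≤ (p ℕ.^ j) le ⟩
    p ℕ.* p ℕ.^ j     ∎
    where open ℕ.≤-Reasoning

  coprime-power-divisor : ∀ {d p} → Coprime d p → ∀ i {x} → d ∣ℕ p ℕ.^ i ℕ.* x → d ∣ℕ x
  coprime-power-divisor c zero h = subst (_ ∣ℕ_) (ℕ.+-identityʳ _) h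
  coprime-power-divisor {d} {p} c (suc i) {x} h = coprime-power-divisor c i (coprime-divisor c (subst (d ∣ℕ_) (ℕ.*-assoc p (p ℕ.^ i) x) h))

  -- Among the d + 1 powers p^0, ..., p^d two have the same residue modulo d; the smaller one is
  -- coprime to d and cancels.
  power-one : ∀ {d p} .{{_ : NonZero d}} .{{_ : NonZero p}} → Coprime d p → ∃ λ t → ∃ λ s → p ℕ.^ suc t ≡ suc (s ℕ.* d)
  power-one {d} {p} cop with pigeonhole (ℕ.n<1+n d) (λ i → fromℕ< (m%n<n (p ℕ.^ toℕ i) d))
  ... | i , j , i<j , eq = j′ , proj₁ quotient , trans (sym (ℕ.m+[n∸m]≡n (ℕ.m^n>0 p (suc j′)))) (cong suc (proj₂ quotient))
    where
    a = toℕ i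
    b = toℕ j
    j′ = b ℕ.∸ suc a
    b≡ : b ≡ a ℕ.+ suc j′
    b≡ = trans (sym (ℕ.m+[n∸m]≡n i<j)) (sym (ℕ.+-suc a j′))
    rem : p ℕ.^ a % d ≡ p ℕ.^ b % d
    rem = trans (sym (toℕ-fromℕ< (m%n<n (p ℕ.^ a) d))) (trans (cong toℕ eq) (toℕ-fromℕ< (m%n<n (p ℕ.^ b) d)))
    diff : p ℕ.^ a ℕ.* (p ℕ.^ suc j′ ℕ.∸ 1) ≡ (p ℕ.^ b / d ℕ.∸ p ℕ.^ a / d) ℕ.* d
    diff = begin
      p ℕ.^ a ℕ.* (p ℕ.^ suc j′ ℕ.∸ 1)             ≡⟨ ℕ.*-distribˡ-∸ (p ℕ.^ a) (p ℕ.^ suc j′) 1 ⟩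
      p ℕ.^ a ℕ.* p ℕ.^ suc j′ ℕ.∸ p ℕ.^ a ℕ.* 1   ≡⟨ cong₂ ℕ._∸_ (trans (sym (ℕ.^-distribˡ-+-* p a (suc j′))) (cong (p ℕ.^_) (sym b≡))) (ℕ.*-identityʳ (p ℕ.^ a)) ⟩
      p ℕ.^ b ℕ.∸ p ℕ.^ a                          ≡⟨ cong₂ ℕ._∸_ (trans (m≡m%n+[m/n]*n (p ℕ.^ b) d) (cong (ℕ._+ p ℕ.^ b / d ℕ.* d) (sym rem))) (m≡m%n+[m/n]*n (p ℕ.^ a) d) ⟩
      (p ℕ.^ a % d ℕ.+ p ℕ.^ b / d ℕ.* d) ℕ.∸ (p ℕ.^ a % d ℕ.+ p ℕ.^ a / d ℕ.* d)   ≡⟨ ℕ.[m+n]∸[m+o]≡n∸o (p ℕ.^ a % d) (p ℕ.^ b / d ℕ.* d) (p ℕ.^ a / d ℕ.* d) ⟩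
      p ℕ.^ b / d ℕ.* d ℕ.∸ p ℕ.^ a / d ℕ.* d      ≡⟨ sym (ℕ.*-distribʳ-∸ d (p ℕ.^ b / d) (p ℕ.^ a / d)) ⟩
      (p ℕ.^ b / d ℕ.∸ p ℕ.^ a / d) ℕ.* d          ∎
      where open ≡-Reasoning
    quotient : ∃ λ s → p ℕ.^ suc j′ ℕ.∸ 1 ≡ s ℕ.* d
    quotient with coprime-power-divisor cop a (ℕ∣.divides (p ℕ.^ b / d ℕ.∸ p ℕ.^ a / d) diff)
    ... | ℕ∣.divides s q = s , q

  power-one-multiple : ∀ {d p t s} → p ℕ.^ t ≡ suc (s ℕ.* d) → ∀ K → ∃ λ s′ → p ℕ.^ (t ℕ.* K) ≡ suc (s′ ℕ.* d)
  power-one-multiple {d} {p} {t} {s} eq zero = 0 , cong (p ℕ.^_) (ℕ.*-zeroʳ t)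
  power-one-multiple {d} {p} {t} {s} eq (suc K) with power-one-multiple {d} {p} {t} {s} eq K
  ... | s′ , eq′ = s ℕ.+ s′ ℕ.+ s ℕ.* d ℕ.* s′ , trans (cong (p ℕ.^_) (ℕ.*-suc t K)) (trans (ℕ.^-distribˡ-+-* p t (t ℕ.* K)) (trans (cong₂ ℕ._*_ eq eq′) (lem d s s′)))
    where
    lem : ∀ d s s′ → suc (s ℕ.* d) ℕ.* suc (s′ ℕ.* d) ≡ suc ((s ℕ.+ s′ ℕ.+ s ℕ.* d ℕ.* s′) ℕ.* d)
    lem = solveℕ-∀

  -- Isolates c(1) and c(p). For q = p^j ≡ 1 modulo d and q' = p^(j+1) the three differences on the
  -- left are those of 4^q, n T q and 2^q, all divisible by p^(j+1). With H q = 2^q c(1) and H q' =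
  -- 2^q' c(p) the terms in 2^q' cancel, and 2^q n 2^p (c(1) - c(p)) is left. Here `P` is 2^p, `R`
  -- is 2^(p-1) and `S` is 2^(p+1).
  combination : ∀ P R n D F F′ t t′ x x′ A A′ S → P ≡ 2ℤ * R → S ≡ 2ℤ * P → x ≡ 2ℤ * A → x′ ≡ P * A′ →
    (D - 1ℤ) * t - F - 1ℤ ≡ A * (- (D + + 4)) → (D - 1ℤ) * t′ - F′ - 1ℤ ≡ A′ * (- (D + P * P)) →
    (P * n) * (F′ - F) - (P * (D - 1ℤ)) * (n * t′ - n * t) - (n * (D + P * P)) * (x′ - x) ≡ x * (n * ((D - S) * (1ℤ - R)))
  combination _ R n D F F′ t t′ _ _ A A′ _ refl refl refl refl h h′ = begin
    (2ℤ * R * n) * (F′ - F) - (2ℤ * R * (D - 1ℤ)) * (n * t′ - n * t) - (n * (D + 2ℤ * R * (2ℤ * R))) * (2ℤ * R * A′ - 2ℤ * A)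
      ≡⟨ gather (2ℤ * R) n D F F′ t t′ (2ℤ * A) (2ℤ * R * A′) ⟩
    - ((2ℤ * R * n) * (((D - 1ℤ) * t′ - F′ - 1ℤ) - ((D - 1ℤ) * t - F - 1ℤ))) - (n * (D + 2ℤ * R * (2ℤ * R))) * (2ℤ * R * A′ - 2ℤ * A)
      ≡⟨ cong (λ y → - ((2ℤ * R * n) * y) - (n * (D + 2ℤ * R * (2ℤ * R))) * (2ℤ * R * A′ - 2ℤ * A)) (cong₂ _-_ h′ h) ⟩
    - ((2ℤ * R * n) * (A′ * (- (D + 2ℤ * R * (2ℤ * R))) - A * (- (D + + 4)))) - (n * (D + 2ℤ * R * (2ℤ * R))) * (2ℤ * R * A′ - 2ℤ * A)
      ≡⟨ factor R n D A A′ ⟩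
    2ℤ * A * (n * ((D - 2ℤ * (2ℤ * R)) * (1ℤ - R))) ∎
    where
    open ≡-Reasoning
    gather : ∀ P n D F F′ t t′ x x′ → (P * n) * (F′ - F) - (P * (D - 1ℤ)) * (n * t′ - n * t) - (n * (D + P * P)) * (x′ - x)
      ≡ - ((P * n) * (((D - 1ℤ) * t′ - F′ - 1ℤ) - ((D - 1ℤ) * t - F - 1ℤ))) - (n * (D + P * P)) * (x′ - x)
    gather = solve-∀
    factor : ∀ R n D A A′ → - ((2ℤ * R * n) * (A′ * (- (D + 2ℤ * R * (2ℤ * R))) - A * (- (D + + 4)))) - (n * (D + 2ℤ * R * (2ℤ * R))) * (2ℤ * R * A′ - 2ℤ * A)
      ≡ 2ℤ * A * (n * ((D - 2ℤ * (2ℤ * R)) * (1ℤ - R)))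
    factor = solve-∀

  -- The exponents j with p^j ≡ 1 modulo d are unbounded, and p^(j+1) exceeds K as soon as j ≥ K.
  unbounded-divisors : ∀ {d p K} .{{_ : NonZero d}} .{{_ : NonZero p}} → Coprime d p → 2 ℕ.≤ p → K ≢ 0 →
    ¬ (∀ j s → p ℕ.^ j ≡ suc (s ℕ.* d) → p ℕ.^ suc j ∣ℕ K)
  unbounded-divisors {d} {p} {K} coprime p≥2 K≢0 div with power-one {d} {p} coprime
  ... | t , s , eq with power-one-multiple {d} {p} {suc t} {s} eq K
  ... | s′ , eq′ = ℕ.<⇒≱ (ℕ.≤-<-trans (ℕ.m≤n*m K (suc t)) (ℕ.<-trans (ℕ.n<1+n (suc t ℕ.* K)) (j<p^j p≥2 (suc (suc t ℕ.* K)))))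
                     (ℕ∣.∣⇒≤ {{ℕ.≢-nonZero K≢0}} (div (suc t ℕ.* K) s′ eq′))

  -- If p^j ≡ 1 mod d then p^(j+1) divides the fixed number n C, which is not zero because 1 < p < d - 1.
  module NoPolygon (e n : ℕ) .{{_ : NonZero n}} {p : ℕ} (p-prime : Prime p) {h : ℕ} (p-odd : p ≡ suc (2 ℕ.* h))
    (p+1<d : suc p ℕ.< suc (suc e)) (coprime : Coprime (suc (suc e)) p)
    (congruence : ∀ j → + (p ℕ.^ suc j) ∣ + n * RadialTrace.T e (p ℕ.^ suc j) - + n * RadialTrace.T e (p ℕ.^ j)) where

    open Radial e using (d)
    open RadialTrace e

    instance
      p≢0 : NonZero p
      p≢0 = prime⇒nonZero p-prime

    p≥2 : 2 ℕ.≤ p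
    p≥2 = ℕ.nonTrivial⇒n>1 p {{prime⇒nonTrivial p-prime}}

    -- The factored form of 2^p (c(1) - c(p)). Its first factor vanishes only for d = p + 1, its
    -- second only for p = 1.
    C : ℤ
    C = (2^ d - 2^ suc p) * (1ℤ - 2^ (2 ℕ.* h))

    divides-C : ∀ j s → p ℕ.^ j ≡ suc (s ℕ.* d) → + (p ℕ.^ suc j) ∣ 2^ (p ℕ.^ j) * (+ n * C)
    divides-C j s eq = subst (Q ∣_) final
        (ℤ∣.∣m∣n⇒∣m-n
          (ℤ∣.∣m∣n⇒∣m-n (ℤ∣.∣n⇒∣m*n (2^ p * + n) (2^-congruence p-prime {h} p-odd 2 j))
                       (ℤ∣.∣n⇒∣m*n (2^ p * (D - 1ℤ)) (congruence j)))
          (ℤ∣.∣n⇒∣m*n (+ n * (D + P * P)) (subst₂ (λ x y → Q ∣ 2^ x - 2^ y) (ℕ.*-identityʳ q′) (ℕ.*-identityʳ q) (2^-congruence p-prime {h} p-odd 1 j))))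
      where
      open ≡-Reasoning
      q = p ℕ.^ j
      q′ = p ℕ.^ suc j
      q*2 = q ℕ.* 2
      Q = + q′
      D = 2^ d
      P = 2^ p
      R = 2^ (2 ℕ.* h)
      s′ = p ℕ.* s
      A = 2^ (s ℕ.* d)
      A′ = 2^ (s′ ℕ.* d)
      q′≡ : q′ ≡ p ℕ.+ s′ ℕ.* d
      q′≡ = trans (cong (p ℕ.*_) eq) (lem p s d)
        where
        lem : ∀ p s d → p ℕ.* suc (s ℕ.* d) ≡ p ℕ.+ p ℕ.* s ℕ.* d
        lem = solveℕ-∀
      final : (P * + n) * (2^ (q′ ℕ.* 2) - 2^ q*2) - (P * (D - 1ℤ)) * (+ n * T q′ - + n * T q) - (+ n * (D + P * P)) * (2^ q′ - 2^ q)
            ≡ 2^ q * (+ n * C)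
      final = combination P R (+ n) D F F′ (T q) (T q′) (2^ q) (2^ q′) A A′ (2^ suc p) P≡ (2^suc p) 2^q 2^q′ Hq Hq′
        where
        F = 2^ (q ℕ.* 2)
        F′ = 2^ (q′ ℕ.* 2)
        P≡ : P ≡ 2ℤ * R
        P≡ = trans (cong 2^_ p-odd) (2^suc (2 ℕ.* h))
        2^q : 2^ q ≡ 2ℤ * A
        2^q = trans (cong 2^_ eq) (2^suc (s ℕ.* d))
        2^q′ : 2^ q′ ≡ P * A′
        2^q′ = trans (cong 2^_ q′≡) (2^-+ p (s′ ℕ.* d))
        Hq : H q ≡ A * (- (D + + 4))
        Hq = trans (cong H eq) (trans (H-periodic s 0) (cong (A *_) (H-inner 0 e refl)))
        Hq′ : H q′ ≡ A′ * (- (D + P * P))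
        Hq′ = trans (cong H (trans q′≡ (cong (ℕ._+ s′ ℕ.* d) p-odd))) (trans (H-periodic s′ (2 ℕ.* h))
          (cong (A′ *_) (trans (H-inner (2 ℕ.* h) (d ℕ.∸ suc p) inner) (cong (λ x → - (D + x)) pp))))
          where
          inner : suc (2 ℕ.* h) ℕ.+ suc (d ℕ.∸ suc p) ≡ d
          inner = trans (cong (ℕ._+ suc (d ℕ.∸ suc p)) (sym p-odd)) (trans (ℕ.+-suc p (d ℕ.∸ suc p)) (ℕ.m+[n∸m]≡n (ℕ.<⇒≤ p+1<d)))
          pp : 2^ (suc (2 ℕ.* h) ℕ.* 2) ≡ P * P
          pp = trans (cong (λ x → 2^ (x ℕ.* 2)) (sym p-odd)) (trans (cong 2^_ (lem p)) (2^-+ p p))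
            where
            lem : ∀ p → p ℕ.* 2 ≡ p ℕ.+ p
            lem = solveℕ-∀

    p-not-even : ¬ 2 ∣ℕ p
    p-not-even (ℕ∣.divides m eq) = odd≢even h m (trans (sym p-odd) (trans eq (ℕ.*-comm m 2)))
      where
      odd≢even : ∀ a b → suc (2 ℕ.* a) ≢ 2 ℕ.* b
      odd≢even zero zero ()
      odd≢even zero (suc b) eq with trans eq (ℕ.*-suc 2 b)
      ... | ()
      odd≢even (suc a) zero ()
      odd≢even (suc a) (suc b) eq = odd≢even a b (ℕ.suc-injective (ℕ.suc-injective (trans (sym (cong suc (ℕ.*-suc 2 a))) (trans eq (ℕ.*-suc 2 b)))))

    coprime-2 : ∀ j → Coprime (p ℕ.^ j) 2
    coprime-2 j {m} (m∣ , m∣2) with prime⇒irreducible prime2 m∣2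
      where open import Data.Nat.Primality using () renaming (prime[2] to prime2)
    ... | inj₁ m≡1 = m≡1
    ... | inj₂ refl = ⊥-elim (bad j m∣)
      where
      open import Data.Nat.Primality using (prime[2])
      bad : ∀ j → ¬ 2 ∣ℕ p ℕ.^ j
      bad zero h = ℕ.<⇒≢ (s≤s (s≤s z≤n)) (sym (ℕ∣.∣1⇒≡1 h))
      bad (suc j) h with euclidsLemma p (p ℕ.^ j) prime[2] h
      ... | inj₁ x = p-not-even x
      ... | inj₂ y = bad j y

    C≢0 : ∣ + n * C ∣ ≢ 0
    C≢0 eq with ℤ.i*j≡0⇒i≡0∨j≡0 (+ n) (ℤ.∣i∣≡0⇒i≡0 eq)
    ... | inj₁ n≡0 = ℕ.≢-nonZero⁻¹ n (ℤ.+-injective n≡0)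
    ... | inj₂ C≡0 with ℤ.i*j≡0⇒i≡0∨j≡0 (2^ d - 2^ suc p) C≡0
    ...   | inj₁ z = ℕ.<⇒≢ (ℕ.^-monoʳ-< 2 (s≤s (s≤s z≤n)) p+1<d) (sym (ℤ.+-injective (ℤ.i-j≡0⇒i≡j (2^ d) (2^ suc p) z)))
    ...   | inj₂ z = R≢1 h p-odd z
      where
      R≢1 : ∀ h → p ≡ suc (2 ℕ.* h) → 1ℤ - 2^ (2 ℕ.* h) ≢ 0ℤ
      R≢1 zero refl _ = ¬prime[1] p-prime
      R≢1 (suc h) _ z = ℕ.<⇒≢ (ℕ.^-monoʳ-< 2 (s≤s (s≤s z≤n)) {0} {2 ℕ.* suc h} (s≤s z≤n)) (ℤ.+-injective (ℤ.i-j≡0⇒i≡j 1ℤ (2^ (2 ℕ.* suc h)) z))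

    Q∣C : ∀ j s → p ℕ.^ j ≡ suc (s ℕ.* d) → p ℕ.^ suc j ∣ℕ ∣ + n * C ∣
    Q∣C j s eq = coprime-power-divisor (coprime-2 (suc j)) (p ℕ.^ j)
      (subst (p ℕ.^ suc j ∣ℕ_) (abs-* (2^ (p ℕ.^ j)) (+ n * C)) (ℤ∣.∣⇒∣ᵤ (divides-C j s eq)))

    impossible : ⊥
    impossible = unbounded-divisors coprime p≥2 C≢0 Q∣C

  prime-divisor : ∀ m → 2 ℕ.≤ m → ∃ λ p → Prime p × p ∣ℕ m
  prime-divisor m@(suc m′) le with factorise m
  ... | record { factors = [] ; isFactorisation = eq } = ⊥-elim (ℕ.<⇒≢ le (sym eq))
  ... | record { factors = p ∷ ps ; isFactorisation = eq ; factorsPrime = pr ∷ _ } = p , pr , subst (p ∣ℕ_) (sym eq) (ℕ∣.m∣m*n (product ps))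

  halves : ∀ m → ∃ λ x → m ≡ 2 ℕ.* x ⊎ m ≡ suc (2 ℕ.* x)
  halves zero = 0 , inj₁ refl
  halves (suc m) with halves m
  ... | x , inj₁ eq = x , inj₂ (cong suc eq)
  ... | x , inj₂ eq = suc x , inj₁ (trans (cong suc eq) (sym (ℕ.*-suc 2 x)))

  -- The odd number 2x - 1 is at least 3, less than d - 1 and coprime to d.
  Bad : ℕ → Set
  Bad d = ∃ λ x → ∃ λ c → ∃ λ b → 2 ℕ.≤ x × 2 ℕ.* x ℕ.< d × d ≡ c ℕ.* (2 ℕ.* x ℕ.∸ 1) ℕ.+ b × (b ≡ 2 ⊎ b ≡ 4)

  2x∸1 : ∀ x → 2 ℕ.* suc x ℕ.∸ 1 ≡ suc (2 ℕ.* x)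
  2x∸1 x = cong ℕ.pred (ℕ.*-suc 2 x)

  -- The number 2x - 1 is d - 2 for odd d, d/2 - 1 for d divisible by 4 and d/2 - 2 for the other
  -- even d. It is at least 3 except for d = 2, 3, 4, 6.
  classify : ∀ d → 2 ℕ.≤ d → (d ≡ 2 ⊎ d ≡ 3 ⊎ d ≡ 4 ⊎ d ≡ 6) ⊎ Bad d
  classify d le with halves d
  ... | zero , inj₁ refl = ⊥-elim (ℕ.<⇒≱ le z≤n)
  ... | zero , inj₂ refl = ⊥-elim (ℕ.<⇒≱ le (s≤s z≤n))
  ... | 1 , inj₂ refl = inj₁ (inj₂ (inj₁ refl))
  ... | suc (suc x) , inj₂ refl = inj₂ (suc (suc x) , 1 , 2 , s≤s (s≤s z≤n) , ℕ.≤-refl ,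
        trans (lem x) (cong (λ s → 1 ℕ.* s ℕ.+ 2) (sym (2x∸1 (suc x)))) , inj₁ refl)
    where
    lem : ∀ x → suc (2 ℕ.* suc (suc x)) ≡ 1 ℕ.* suc (2 ℕ.* suc x) ℕ.+ 2
    lem = solveℕ-∀
  ... | suc y , inj₁ refl with halves (suc y)
  ...   | zero , inj₂ refl = inj₁ (inj₁ refl)
  ...   | 1 , inj₁ refl = inj₁ (inj₂ (inj₂ (inj₁ refl)))
  ...   | 1 , inj₂ refl = inj₁ (inj₂ (inj₂ (inj₂ refl)))
  ...   | suc (suc x) , inj₁ eq = inj₂ (suc (suc x) , 2 , 2 , s≤s (s≤s z≤n) , lt ,
          trans (cong (2 ℕ.*_) eq) (trans (lem x) (cong (λ s → 2 ℕ.* s ℕ.+ 2) (sym (2x∸1 (suc x))))) , inj₁ refl)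
    where
    lem : ∀ x → 2 ℕ.* (2 ℕ.* suc (suc x)) ≡ 2 ℕ.* suc (2 ℕ.* suc x) ℕ.+ 2
    lem = solveℕ-∀
    lt : 2 ℕ.* suc (suc x) ℕ.< 2 ℕ.* suc y
    lt = ℕ.*-monoʳ-< 2 (subst (suc (suc x) ℕ.<_) (sym eq) (ℕ.m<m+n (suc (suc x)) (s≤s z≤n)))
  ...   | suc (suc x) , inj₂ eq = inj₂ (suc (suc x) , 2 , 4 , s≤s (s≤s z≤n) , lt ,
          trans (cong (2 ℕ.*_) eq) (trans (lem x) (cong (λ s → 2 ℕ.* s ℕ.+ 4) (sym (2x∸1 (suc x))))) , inj₂ refl)
    where
    lem : ∀ x → 2 ℕ.* suc (2 ℕ.* suc (suc x)) ≡ 2 ℕ.* suc (2 ℕ.* suc x) ℕ.+ 4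
    lem = solveℕ-∀
    lt : 2 ℕ.* suc (suc x) ℕ.< 2 ℕ.* suc y
    lt = ℕ.*-monoʳ-< 2 (subst (suc (suc x) ℕ.<_) (sym eq) (ℕ.m≤n⇒m≤1+n (ℕ.m<m+n (suc (suc x)) (s≤s z≤n))))

  -- Any prime factor p of 2x - 1 will do: it is odd, and if it divided d it would divide the
  -- remainder 2 or 4.
  Bad⇒prime : ∀ {d} → Bad d → ∃ λ p → ∃ λ h → Prime p × p ≡ suc (2 ℕ.* h) × suc p ℕ.< d × Coprime d p
  Bad⇒prime {d} (suc x , c , b , s≤s x≥1 , lt , d≡ , b≡) with prime-divisor (2 ℕ.* suc x ℕ.∸ 1) (ℕ.∸-monoˡ-≤ 1 (ℕ.≤-trans (s≤s (s≤s (s≤s z≤n))) (ℕ.*-monoʳ-≤ 2 (s≤s x≥1))))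
  ... | p , pr , p∣s with halves p
  ...   | h , inj₁ p≡ = ⊥-elim (odd≢ x (ℕ∣.∣-trans (ℕ∣.divides h (trans p≡ (ℕ.*-comm 2 h))) (subst (p ∣ℕ_) (2x∸1 x) p∣s)))
    where
    odd≢ : ∀ x → ¬ 2 ∣ℕ suc (2 ℕ.* x)
    odd≢ x 2∣ = ℕ.<⇒≢ (s≤s (s≤s z≤n)) (sym (ℕ∣.∣1⇒≡1 (ℕ∣.∣m+n∣m⇒∣n (subst (2 ∣ℕ_) (ℕ.+-comm 1 (2 ℕ.* x)) 2∣) (ℕ∣.m∣m*n x))))
  ...   | h , inj₂ p≡ = p , h , pr , p≡ , p<d , coprime
    where
    open import Data.Nat.Primality using (prime[2])
    s = 2 ℕ.* suc x ℕ.∸ 1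
    p≤s : p ℕ.≤ s
    p≤s = ℕ∣.∣⇒≤ {{subst NonZero (sym (2x∸1 x)) _}} p∣s
    p<d : suc p ℕ.< d
    p<d = ℕ.≤-<-trans (ℕ.≤-trans (s≤s p≤s) (ℕ.≤-reflexive (trans (cong suc (2x∸1 x)) (sym (ℕ.*-suc 2 x))))) lt
    2≢odd : ∀ h → 2 ≢ suc (2 ℕ.* h)
    2≢odd (suc h) q with trans q (cong suc (ℕ.*-suc 2 h))
    ... | ()
    p∤2 : ¬ p ∣ℕ 2
    p∤2 p∣2 with prime⇒irreducible prime[2] p∣2
    ... | inj₁ refl = ¬prime[1] pr
    ... | inj₂ refl = 2≢odd h p≡
    p∤b : b ≡ 2 ⊎ b ≡ 4 → ¬ p ∣ℕ b
    p∤b (inj₁ refl) = p∤2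
    p∤b (inj₂ refl) p∣4 with euclidsLemma 2 2 pr p∣4
    ... | inj₁ y = p∤2 y
    ... | inj₂ y = p∤2 y
    coprime : Coprime d p
    coprime {m} (m∣d , m∣p) with prime⇒irreducible pr m∣p
    ... | inj₁ m≡1 = m≡1
    ... | inj₂ refl = ⊥-elim (p∤b b≡ (ℕ∣.∣m+n∣m⇒∣n (subst (p ∣ℕ_) d≡ m∣d) (ℕ∣.∣n⇒∣m*n c p∣s)))

-- The possible values of d in valence 3.

module FeitHigmanTheorem where

  open import Defs renaming (sym to adj-sym)
  open CycleCounting
  open Polygons
  open ClosedWords
  open RotationOrbits
  open RadialPolynomials
  open CompanionTrace
  open PrimePowers
  open import Data.Nat as ℕ using (ℕ; suc; s≤s; z≤n; NonZero)
  import Data.Nat.Properties as ℕ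
  open import Data.Nat.Primality using (Prime; prime⇒nonZero)
  open import Data.Integer as ℤ using (+_; _+_; _*_; _-_)
  open import Data.Integer.Divisibility.Signed using (_∣_)
  import Data.Fin.Properties as Fin

  module FeitHigman {n : ℕ} (Γ : Graph n) (e : ℕ)
    (Γ-girth : Girth Γ (2 ℕ.* suc (suc e)))
    (conn : Connected Γ) (reg : Regular Γ 3)
    (moore : GirthCycles.Moore Γ e (proj₂ Γ-girth)) where

    open Trace Γ e Γ-girth conn reg moore
    open Polygon Γ e 2 Γ-girth conn reg moore using (d; root)
    open RadialTrace e
    open Words (3 ℕ.* n)

    trace≡T : ∀ q .{{_ : NonZero q}} → sumL (q ℕ.* 2) (cyclic μ) ≡ + n * T q
    trace≡T (suc q) = trace-formula (suc (q ℕ.* 2))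

    -- Rotation by blocks of two letters compares the word lengths 2 p^(j+1) and 2 p^j, that is the
    -- even powers that `T` describes.
    T-congruence : ∀ {p} → Prime p → ∀ {h} → p ≡ suc (2 ℕ.* h) → ∀ j →
      + (p ℕ.^ suc j) ∣ + n * T (p ℕ.^ suc j) - + n * T (p ℕ.^ j)
    T-congruence {p} pr {h} p-odd j = congruent (Orbits.trace-congruence (3 ℕ.* n) μ μ-cube pr {h} p-odd 2 j)
        (trace≡T (p ℕ.^ suc j) {{ℕ.m^n≢0 p (suc j)}}) (trace≡T (p ℕ.^ j) {{ℕ.m^n≢0 p j}})
      where
      instance
        p≢0 : NonZero p
        p≢0 = prime⇒nonZero pr

    feit-higman : d ≡ 2 ⊎ d ≡ 3 ⊎ d ≡ 4 ⊎ d ≡ 6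
    feit-higman with classify d (s≤s (s≤s z≤n))
    ... | inj₁ small = small
    ... | inj₂ bad with Bad⇒prime bad
    ...   | p , h , pr , p-odd , p<d , cop = ⊥-elim (NoPolygon.impossible e n {{Fin.nonZeroIndex root}} pr {h} p-odd p<d cop (T-congruence pr {h} p-odd))

-- Vertices opposite to a root and their addresses.

module OppositeVertices where

  open import Defs renaming (sym to adj-sym)
  open ListLemmas
  open Walks
  open CycleCounting
  open Distances
  open Polygons
  open import Data.Nat using (ℕ; zero; suc; _+_; _*_; _∸_; _≤_; _<_; z≤n; s≤s)
  open import Data.Nat.Properties hiding (_≟_)
  open import Data.Fin using (Fin; zero; suc)
  import Data.Fin.Properties as Fin
  open import Data.List.Relation.Unary.All using ([]; _∷_)
  open import Data.List.Relation.Unary.Unique.Propositional using (Unique; []; _∷_)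
  open import Relation.Nullary.Decidable using (recompute)

  take-≤ : ∀ {a} {A : Set a} {j k} (xs ys : List A) → j ≤ k → take k xs ≡ take k ys → take j xs ≡ take j ys
  take-≤ {j = zero} _ _ _ _ = refl
  take-≤ {j = suc j} {suc k} [] [] _ _ = refl
  take-≤ {j = suc j} {suc k} (x ∷ xs) (y ∷ ys) (s≤s le) eq with ∷-injective eq
  ... | refl , eq′ = cong (x ∷_) (take-≤ xs ys le eq′)

  take-++-length : ∀ {a} {A : Set a} (xs : List A) {ys} j → length xs ≡ j → take j (xs ++ ys) ≡ xs
  take-++-length [] zero _ = refl
  take-++-length (x ∷ xs) (suc j) eq = cong (x ∷_) (take-++-length xs j (suc-injective eq))

  split-at : ∀ {a} {A : Set a} j (xs : List A) → j < length xs → ∃ λ ps → ∃ λ x → ∃ λ qs → xs ≡ ps ++ x ∷ qs × length ps ≡ j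
  split-at zero (x ∷ xs) _ = [] , x , xs , refl , refl
  split-at (suc j) (x ∷ xs) (s≤s lt) with split-at j xs lt
  ... | ps , y , qs , eq , len = x ∷ ps , y , qs , cong (x ∷_) eq , cong suc len

  data Fork {a} {A : Set a} (xs ys : List A) : Set a where
    fork : ∀ ps {x y qs rs} → xs ≡ ps ++ x ∷ qs → ys ≡ ps ++ y ∷ rs → x ≢ y → Fork xs ys

  first-fork : ∀ {a} {A : Set a} → ((x y : A) → Dec (x ≡ y)) → (xs ys : List A) → length xs ≡ length ys → xs ≢ ys → Fork xs ys
  first-fork _≟_ [] [] _ ne = ⊥-elim (ne refl)
  first-fork _≟_ (x ∷ xs) (y ∷ ys) len ne with x ≟ y
  ... | no x≢y = fork [] refl refl x≢y
  ... | yes refl with first-fork _≟_ xs ys (suc-injective len) (λ eq → ne (cong (x ∷_) eq))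
  ...   | fork ps refl refl d = fork (x ∷ ps) refl refl d

  fork-length : ∀ {a} {A : Set a} {i} ps {x y : A} {qs rs} → x ≢ y → take i (ps ++ x ∷ qs) ≡ take i (ps ++ y ∷ rs) → i ≤ length ps
  fork-length {i = zero} ps ne eq = z≤n
  fork-length {i = suc i} [] ne eq = ⊥-elim (ne (proj₁ (∷-injective eq)))
  fork-length {i = suc i} (p ∷ ps) ne eq = s≤s (fork-length ps ne (proj₂ (∷-injective eq)))

  module Net {n : ℕ} (Γ : Graph n) (e : ℕ)
    (Γ-girth : Girth Γ (2 * suc (suc e)))
    (conn : Connected Γ) (reg : Regular Γ 3)
    (moore : GirthCycles.Moore Γ e (proj₂ Γ-girth)) where

    open Polygon Γ e 2 Γ-girth conn reg moore public
    open Geodesic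

    -- A non-backtracking walk with first arc a → b, last arc p → q and ℓ edges.
    data Arcs : V → V → V → V → ℕ → Set where
      arc : ∀ {a b} → a ~ b → Arcs a b a b 1
      _,_▸_ : ∀ {a b c p q ℓ} → a ~ b → a ≢ c → Arcs b c p q ℓ → Arcs a b p q (suc ℓ)

    Arcs-join : ∀ {a b p q c p′ q′ ℓ m} → Arcs a b p q ℓ → Arcs q c p′ q′ m → p ≢ c → Arcs a b p′ q′ (ℓ + m)
    Arcs-join (arc f) w ne = f , ne ▸ w
    Arcs-join (f , ne′ ▸ v) w ne = f , ne′ ▸ Arcs-join v w ne

    Arcs-reverse : ∀ {a b p q ℓ} → Arcs a b p q ℓ → Arcs q p b a ℓ
    Arcs-reverse (arc f) = arc (~-sym f)
    Arcs-reverse {a} {b} {p} {q} {suc ℓ} (f , ne ▸ w) =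
      subst (Arcs q p b a) (+-comm ℓ 1) (Arcs-join (Arcs-reverse w) (arc (~-sym f)) (λ eq → ne (sym eq)))

    NB⇒Arcs : ∀ {a b} xs → NB (a ∷ b ∷ xs) → Arcs a b (penultimate a b xs) (last b xs) (suc (length xs))
    NB⇒Arcs [] (two f) = arc f
    NB⇒Arcs (x ∷ xs) (cons f ne w) = f , ne ▸ NB⇒Arcs xs w

    Arcs⇒NB : ∀ {a b p q ℓ} → Arcs a b p q ℓ → ∃ λ xs → NB (a ∷ b ∷ xs) × last b xs ≡ q × suc (length xs) ≡ ℓ
    Arcs⇒NB (arc f) = [] , two f , refl , refl
    Arcs⇒NB (f , ne ▸ w) with Arcs⇒NB w
    ... | xs , nb , end , len = _ ∷ xs , cons f ne nb , end , cong suc len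

    Arcs-closed : ∀ {a b p ℓ} → Arcs a b p a ℓ → g ≤ ℓ
    Arcs-closed w with Arcs⇒NB w
    ... | xs , nb , end , refl = closed-long (_ ∷ xs) nb end (λ ())

    -- The proof of opposition is irrelevant, so that equality in `Z` is equality of vertices.
    record Z : Set where
      constructor mkZ
      field
        vertex : V
        .opposite : δ root vertex ≡ d
    open Z public

    opposite′ : (z : Z) → δ root (vertex z) ≡ d
    opposite′ (mkZ v p) = recompute (δ root v ≟ d) p
      where open import Data.Nat using (_≟_)

    Z-≡ : ∀ {z z′ : Z} → vertex z ≡ vertex z′ → z ≡ z′
    Z-≡ refl = refl

    z₀ : Z
    z₀ = mkZ (proj₁ (proj₂ antipodes)) (proj₂ (proj₂ antipodes))

    abstract
      root-neighbours : ∃ λ x → ∃ λ y → ∃ λ z → neighbours Γ root ≡ x ∷ y ∷ z ∷ []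
      root-neighbours with neighbours Γ root | reg root
      ... | x ∷ y ∷ z ∷ [] | _ = x , y , z , refl

    ray : Fin 3 → V
    ray zero = proj₁ root-neighbours
    ray (suc zero) = proj₁ (proj₂ root-neighbours)
    ray (suc (suc zero)) = proj₁ (proj₂ (proj₂ root-neighbours))

    root~ray : ∀ c → root ~ ray c
    root~ray c = ∈-neighbours⁻ (subst (ray c ∈_) (sym (proj₂ (proj₂ (proj₂ root-neighbours)))) (mem c))
      where
      mem : ∀ c → ray c ∈ ray zero ∷ ray (suc zero) ∷ ray (suc (suc zero)) ∷ []
      mem zero = here refl
      mem (suc zero) = there (here refl)
      mem (suc (suc zero)) = there (there (here refl))

    ray-injective : ∀ {c c′} → ray c ≡ ray c′ → c ≡ c′
    ray-injective {c} {c′} eq = go c c′ eq (subst Unique (proj₂ (proj₂ (proj₂ root-neighbours))) (neighbours-unique root))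
      where
      go : ∀ c c′ → ray c ≡ ray c′ → Unique (ray zero ∷ ray (suc zero) ∷ ray (suc (suc zero)) ∷ []) → c ≡ c′
      go zero zero _ _ = refl
      go (suc zero) (suc zero) _ _ = refl
      go (suc (suc zero)) (suc (suc zero)) _ _ = refl
      go zero (suc zero) eq ((p ∷ _) ∷ _) = ⊥-elim (p eq)
      go zero (suc (suc zero)) eq ((_ ∷ p ∷ _) ∷ _) = ⊥-elim (p eq)
      go (suc zero) (suc (suc zero)) eq (_ ∷ (p ∷ _) ∷ _) = ⊥-elim (p eq)
      go (suc zero) zero eq ((p ∷ _) ∷ _) = ⊥-elim (p (sym eq))
      go (suc (suc zero)) zero eq ((_ ∷ p ∷ _) ∷ _) = ⊥-elim (p (sym eq))
      go (suc (suc zero)) (suc zero) eq (_ ∷ (p ∷ _) ∷ _) = ⊥-elim (p (sym eq))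

    pathTo : Fin 3 → Z → List V
    pathTo c z = path (geo (ray c) (vertex z))

    ray-closer : ∀ c z → suc (δ (vertex z) (ray c)) ≡ δ (vertex z) root
    ray-closer c z with δ-step (vertex z) (root~ray c)
    ... | closer eq = eq
    ... | farther eq = ⊥-elim (<⇒≱ (≤-reflexive (sym eq)) (≤-trans (δ≤d _ _) (≤-reflexive (sym (trans (δ-sym _ _) (opposite′ z))))))

    pathTo-NB : ∀ c z → NB (root ∷ ray c ∷ pathTo c z)
    pathTo-NB c z = closer-NB (root~ray c) (ray-closer c z)

    pathTo-end : ∀ c z → last (ray c) (pathTo c z) ≡ vertex z
    pathTo-end c z = end (geo (ray c) (vertex z))

    length-pathTo : ∀ c z → length (pathTo c z) ≡ suc e
    length-pathTo c z = suc-injective (trans (cong suc (δ-sym (ray c) (vertex z))) (trans (ray-closer c z) (trans (δ-sym (vertex z) root) (opposite′ z))))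

    2[e+1]<g : suc e + suc e < g
    2[e+1]<g = ≤-trans (≤-reflexive refl) (≤-trans (s≤s (s≤s (+-monoʳ-≤ e (n≤1+n (suc e))))) (≤-reflexive (sym g≡d+d)))

    short-unique : ∀ {u xs ys} → NB (u ∷ xs) → NB (u ∷ ys) → last u xs ≡ last u ys → length xs ≤ suc e → length ys ≤ suc e → xs ≡ ys
    short-unique w w′ eq l l′ = NB-unique _ _ _ w w′ eq (≤-<-trans (+-mono-≤ l l′) 2[e+1]<g)

    pathTo-unique : ∀ c xs → NB (root ∷ ray c ∷ xs) → length xs ≡ suc e → ∃ λ z → vertex z ≡ last (ray c) xs × pathTo c z ≡ xs
    pathTo-unique c xs w len = z , refl , short-unique (NB-tail (pathTo-NB c z)) (NB-tail w) (pathTo-end c z)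
        (≤-reflexive (length-pathTo c z)) (≤-reflexive len)
      where
      z = mkZ (last (ray c) xs) (trans (δ-path (ray c ∷ xs) w (≤-reflexive (cong suc len))) (cong suc len))

    -- Agreement of the two geodesics for j steps beyond the ray `c`. For j = e the vertices have a
    -- common parent of that colour, for j = e + 1 they are equal.
    R : Fin 3 → ℕ → Z → Z → Set
    R c j z z′ = take j (pathTo c z) ≡ take j (pathTo c z′)

    abstract
      R? : ∀ c j z z′ → Dec (R c j z z′)
      R? c j z z′ = ≡-dec Fin._≟_ _ _

    R-≤ : ∀ {c j k z z′} → j ≤ k → R c k z z′ → R c j z z′
    R-≤ {c} {z = z} {z′} le eq = take-≤ (pathTo c z) (pathTo c z′) le eq

    parent : Fin 3 → Z → V
    parent c z = penultimate root (ray c) (pathTo c z)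

    unsnoc : ∀ r a xs {m} → length xs ≡ suc m →
      ∃ λ ps → xs ≡ ps ∷ʳ last a xs × length ps ≡ m × last a ps ≡ penultimate r a xs
    unsnoc r a xs len with initLast xs
    ... | ps ∷ʳ′ x = ps , cong (ps ∷ʳ_) (sym (last-snoc ps)) , suc-injective (trans (sym (length-∷ʳ x ps)) len) , sym (pen-snoc r a ps)

    parent-path : ∀ c z → ∃ λ ps → pathTo c z ≡ ps ∷ʳ vertex z × length ps ≡ e × last (ray c) ps ≡ parent c z
    parent-path c z with unsnoc root (ray c) (pathTo c z) (length-pathTo c z)
    ... | ps , eq , len , end = ps , trans eq (cong (ps ∷ʳ_) (pathTo-end c z)) , len , end

    -- A parent has distance d - 1 from the root, so its geodesic, and with it the ray, is unique.
    parent-colour : ∀ {c c′ z} → parent c z ≡ parent c′ z → c ≡ c′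
    parent-colour {c} {c′} {z} eq with parent-path c z | parent-path c′ z
    ... | ps , p , l , end | ps′ , p′ , l′ , end′ = ray-injective (proj₁ (∷-injective (short-unique
            (NB-prefix root (ray c ∷ ps) (subst (λ t → NB (root ∷ ray c ∷ t)) p (pathTo-NB c z)))
            (NB-prefix root (ray c′ ∷ ps′) (subst (λ t → NB (root ∷ ray c′ ∷ t)) p′ (pathTo-NB c′ z)))
            (trans end (trans eq (sym end′))) (≤-reflexive (cong suc l)) (≤-reflexive (cong suc l′)))))

    penultimate-++ : ∀ a b ps {x qs} → penultimate a b (ps ++ x ∷ qs) ≡ penultimate (last b ps) x qs
    penultimate-++ a b [] = refl
    penultimate-++ a b (p ∷ ps) = penultimate-++ b p ps

    -- Up from `z` to the vertex where the geodesics part, at least i steps beyond the ray, and down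
    -- to `z′`. The first and the last edge join the ends to their parents of colour `c`; since
    -- parents of different colours differ, segments of different colours can be joined without
    -- backtracking.
    segment : ∀ c {i z z′} → R c i z z′ → z ≢ z′ →
      ∃ λ ℓ → Arcs (vertex z) (parent c z) (parent c z′) (vertex z′) ℓ × ℓ ≤ (suc e ∸ i) + (suc e ∸ i)
    segment c {i} {z} {z′} r ne with first-fork Fin._≟_ (pathTo c z) (pathTo c z′) (trans (length-pathTo c z) (sym (length-pathTo c z′)))
        (λ eq → ne (Z-≡ (trans (sym (pathTo-end c z)) (trans (cong (last (ray c)) eq) (pathTo-end c z′)))))
    ... | fork ps {x} {y} {qs} {rs} eq eq′ x≢y = _ , Arcs-join (Arcs-reverse (down z qs eq)) (down z′ rs eq′) x≢y ,
          +-mono-≤ (bound z qs eq) (bound z′ rs eq′)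
      where
      i≤ : i ≤ length ps
      i≤ = fork-length ps x≢y (subst₂ (λ a b → take i a ≡ take i b) eq eq′ r)
      down : ∀ z {x} qs → pathTo c z ≡ ps ++ x ∷ qs → Arcs (last (ray c) ps) x (parent c z) (vertex z) (suc (length qs))
      down z {x} qs eq = subst₂ (λ p q → Arcs (last (ray c) ps) x p q (suc (length qs)))
        (trans (sym (penultimate-++ root (ray c) ps)) (cong (penultimate root (ray c)) (sym eq)))
        (trans (sym (last-++ (ray c) ps)) (trans (cong (last (ray c)) (sym eq)) (pathTo-end c z)))
        (NB⇒Arcs qs (NB-suffix root (ray c ∷ ps) (subst (λ t → NB (root ∷ ray c ∷ t)) eq (pathTo-NB c z))))
      bound : ∀ z {x} qs → pathTo c z ≡ ps ++ x ∷ qs → suc (length qs) ≤ suc e ∸ i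
      bound z {x} qs eq = ≤-trans (≤-reflexive (sym (trans (cong (_∸ length ps) (trans (sym (length-pathTo c z)) (trans (cong length eq) (length-++ ps)))) (m+n∸m≡n (length ps) (suc (length qs))))))
        (∸-monoʳ-≤ (suc e) i≤)

    -- A path z₁ → z₂ → ... in which consecutive steps have different colours; each step costs suc e ∸ i.
    data Chain : Fin 3 → Z → Fin 3 → Z → ℕ → Set where
      single : ∀ {c i z z′} → R c i z z′ → z ≢ z′ → Chain c z c z′ (suc e ∸ i)
      more   : ∀ {c c′ c″ i z z′ z″ s} → R c i z z′ → z ≢ z′ → c ≢ c′ → Chain c′ z′ c″ z″ s → Chain c z c″ z″ ((suc e ∸ i) + s)

    Chain⇒Arcs : ∀ {c z c′ z′ s} → Chain c z c′ z′ s →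
      ∃ λ ℓ → Arcs (vertex z) (parent c z) (parent c′ z′) (vertex z′) ℓ × ℓ ≤ s + s
    Chain⇒Arcs (single {c} {i} r ne) = segment c {i} r ne
    Chain⇒Arcs (more {c} {c′} {i = i} {z′ = z′} {s = s} r ne cc′ ch) with segment c {i} r ne | Chain⇒Arcs ch
    ... | ℓ , w , le | ℓ′ , w′ , le′ = ℓ + ℓ′ , Arcs-join w w′ (λ eq → cc′ (parent-colour {z = z′} eq)) ,
          ≤-trans (+-mono-≤ le le′) (≤-reflexive (rearr (suc e ∸ i) s))
      where
      open import Data.Nat.Tactic.RingSolver using (solve-∀)
      rearr : ∀ a b → (a + a) + (b + b) ≡ (a + b) + (a + b)
      rearr = solve-∀

    -- Such a chain would be a closed non-backtracking walk with at most 2 (e + 1) = g - 2 edges.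
    -- The first and last colours may agree, as `closed-long` allows backtracking at the base point.
    Chain-closed : ∀ {c z c′ s} → Chain c z c′ z s → ¬ s ≤ suc e
    Chain-closed ch le with Chain⇒Arcs ch
    ... | ℓ , w , b = <⇒≱ (≤-<-trans (≤-trans b (+-mono-≤ le le)) 2[e+1]<g) (Arcs-closed w)

    -- Going from `z` to `z′` in one colour and back in the other costs (e - i) + (i + 1) = e + 1,
    -- just the cost that `Chain-closed` still excludes.
    R-meet : ∀ {c c′ i z z′} → c ≢ c′ → i ≤ e → R c (suc i) z z′ → R c′ (e ∸ i) z z′ → z ≡ z′
    R-meet {c} {c′} {i} {z} {z′} cc′ i≤e r r′ with vertex z Fin.≟ vertex z′
    ... | yes eq = Z-≡ eq
    ... | no ne = ⊥-elim (Chain-closed (more {c = c} {i = suc i} r z≢ cc′ (single {c = c′} {i = e ∸ i} (sym r′) (λ eq → z≢ (sym eq)))) (≤-reflexive cost))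
      where
      z≢ : z ≢ z′
      z≢ eq = ne (cong vertex eq)
      cost : (e ∸ i) + (suc e ∸ (e ∸ i)) ≡ suc e
      cost = m+[n∸m]≡n (≤-trans (m∸n≤m e i) (n≤1+n e))

    other-successor : ∀ {u v} x → v ~ u → v ~ x → u ≢ x → ∃ λ y → v ~ y × u ≢ y × x ≢ y × (∀ t → v ~ t → u ≢ t → x ≢ t → t ≡ y)
    other-successor {u} {v} x vu vx ux with successors u v in eqs | length-successors reg vu | ∈-filter⁺ (λ w → ¬? (u Fin.≟ w)) (∈-neighbours⁺ vx) ux
      where
      open import Data.List.Membership.Propositional.Properties using (∈-filter⁺)
      open import Relation.Nullary using (¬?)
    ... | p ∷ q ∷ [] | refl | x∈ = pick x∈′
      where
      open import Data.List.Membership.Propositional.Properties using (∈-filter⁺)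
      open import Data.List.Relation.Unary.Unique.Propositional.Properties using (filter⁺)
      open import Relation.Nullary using (¬?)
      x∈′ : x ∈ p ∷ q ∷ []
      x∈′ = x∈
      uq : Unique (p ∷ q ∷ [])
      uq = subst Unique eqs (filter⁺ (λ w → ¬? (u Fin.≟ w)) (neighbours-unique v))
      p≢q : p ≢ q
      p≢q with uq
      ... | (r ∷ _) ∷ _ = r
      props : ∀ {y} → y ∈ p ∷ q ∷ [] → v ~ y × u ≢ y
      props y∈ = ∈-successors⁻ (subst (_ ∈_) (sym eqs) y∈)
      covers : ∀ t → v ~ t → u ≢ t → t ∈ p ∷ q ∷ []
      covers t vt ut = subst (t ∈_) eqs (∈-filter⁺ (λ w → ¬? (u Fin.≟ w)) (∈-neighbours⁺ vt) ut)
      pick : x ∈ p ∷ q ∷ [] → ∃ λ y → v ~ y × u ≢ y × x ≢ y × (∀ t → v ~ t → u ≢ t → x ≢ t → t ≡ y)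
      pick (here refl) = q , proj₁ (props (there (here refl))) , proj₂ (props (there (here refl))) , p≢q , rest
        where
        rest : ∀ t → v ~ t → u ≢ t → p ≢ t → t ≡ q
        rest t vt ut pt with covers t vt ut
        ... | here refl = ⊥-elim (pt refl)
        ... | there (here eq) = eq
      pick (there (here refl)) = p , proj₁ (props (here refl)) , proj₂ (props (here refl)) , (λ eq → p≢q (sym eq)) , rest
        where
        rest : ∀ t → v ~ t → u ≢ t → q ≢ t → t ≡ p
        rest t vt ut qt with covers t vt ut
        ... | here eq = eq
        ... | there (here refl) = ⊥-elim (qt refl)

    NB-pen≢ : ∀ {a b xs x ys} → NB (a ∷ b ∷ xs ++ x ∷ ys) → penultimate a b xs ≢ x
    NB-pen≢ {xs = []} (cons _ ne _) = ne
    NB-pen≢ {xs = _ ∷ _} (cons _ _ w) = NB-pen≢ w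

    record Branch (c : Fin 3) (z : Z) (j : ℕ) : Set where
      field
        stem     : List V
        taken    : V
        rest     : List V
        split-eq    : pathTo c z ≡ stem ++ taken ∷ rest
        len      : length stem ≡ j
        other    : V
        other-NB : NB (root ∷ ray c ∷ stem ∷ʳ other)
        differs  : taken ≢ other
        only     : ∀ {t ts} → NB (root ∷ ray c ∷ stem ++ t ∷ ts) → taken ≢ t → t ≡ other

    branch : ∀ c z j → j ≤ e → Branch c z j
    branch c z j j≤e with split-at j (pathTo c z) (subst (j <_) (sym (length-pathTo c z)) (s≤s j≤e))
    ... | ps , x , qs , eq , len with subst (λ t → NB (root ∷ ray c ∷ t)) eq (pathTo-NB c z)
    ... | w with other-successor x (~-sym (NB-pen~last (NB-prefix root (ray c ∷ ps) w))) (NB-head (NB-suffix root (ray c ∷ ps) w)) (NB-pen≢ w)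
    ... | y , vy , uy , xy , only = record
      { stem = ps ; taken = x ; rest = qs ; split-eq = eq ; len = len ; other = y
      ; other-NB = NB-snoc (NB-prefix root (ray c ∷ ps) w) vy uy ; differs = xy
      ; only = λ {t} w′ xt → only t (NB-head (NB-suffix root (ray c ∷ ps) w′)) (NB-pen≢ w′) xt }

    -- Each vertex has only two successors away from the root, so all geodesics that leave the one
    -- to `z` at this depth take the same edge.
    dichotomy : ∀ {c j z z′ z″} → j ≤ e → R c j z z′ → R c j z z″ → ¬ R c (suc j) z z′ → ¬ R c (suc j) z z″ → R c (suc j) z′ z″
    dichotomy {c} {j} {z} {z′} {z″} j≤e r r′ n n′ with branch c z j j≤e
    ... | b = trans (go z′ r n) (sym (go z″ r′ n′))
      where
      open Branch b
      stem≡ : take j (pathTo c z) ≡ stem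
      stem≡ = trans (cong (take j) split-eq) (take-++-length stem j len)
      take-suc : ∀ x qs → take (suc j) (stem ++ x ∷ qs) ≡ stem ∷ʳ x
      take-suc x qs = trans (cong (take (suc j)) (sym (++-assoc stem (x ∷ []) qs))) (take-++-length (stem ∷ʳ x) (suc j) (trans (length-∷ʳ x stem) (cong suc len)))
      go : ∀ t → R c j z t → ¬ R c (suc j) z t → take (suc j) (pathTo c t) ≡ stem ∷ʳ other
      go t rt nt with split-at j (pathTo c t) (subst (j <_) (sym (length-pathTo c t)) (s≤s j≤e))
      ... | ps , x , qs , eq , len′ with trans (sym (trans (cong (take j) eq) (take-++-length ps j len′))) (trans (sym rt) stem≡)
      ... | refl = trans (cong (take (suc j)) eq) (trans (take-suc x qs) (cong (stem ∷ʳ_) (only (subst (λ l → NB (root ∷ ray c ∷ l)) eq (pathTo-NB c t))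
              (λ x≡ → nt (trans (cong (take (suc j)) split-eq) (trans (take-suc taken rest) (trans (cong (stem ∷ʳ_) x≡) (sym (trans (cong (take (suc j)) eq) (take-suc x qs))))))))))

    mate′ : ∀ c z → ∃ λ u → R c e z u × z ≢ u
    mate′ c z with branch c z e ≤-refl
    ... | b with pathTo-unique c (stem ∷ʳ other) other-NB (trans (length-∷ʳ other stem) (cong suc len))
      where open Branch b
    ... | u , u≡ , pu = u , trans (trans (cong (take e) split-eq) (take-++-length stem e len)) (sym (trans (cong (take e) pu) (take-++-length stem e len))) , z≢u
      where
      open Branch b
      rest≡[] : rest ≡ []
      rest≡[] = length0 rest (suc-injective (+-cancelˡ-≡ e _ _ (trans (trans (cong (_+ suc (length rest)) (sym len)) (trans (sym (length-++ stem)) (trans (cong length (sym split-eq)) (length-pathTo c z)))) (+-comm 1 e))))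
        where
        length0 : ∀ (l : List V) → length l ≡ 0 → l ≡ []
        length0 [] _ = refl
      z≢u : z ≢ u
      z≢u refl = differs (trans (trans (sym (last-snoc stem)) (cong (last (ray c)) (trans (sym (trans split-eq (cong (λ l → stem ++ taken ∷ l) rest≡[]))) pu))) (last-snoc stem))

    abstract
      mate : ∀ c z → ∃ λ u → R c e z u × z ≢ u
      mate = mate′

    -- A common first vertex would leave walks of d and of e edges between the same ends; these have
    -- 2d - 2 edges together and would coincide.
    first-differs : ∀ y {a b xs ys} → NB (y ∷ a ∷ xs) → NB (y ∷ b ∷ ys) → last a xs ≡ last b ys →
      length (a ∷ xs) ≡ suc d → length (b ∷ ys) ≡ suc e → a ≢ b
    first-differs y {a} {b} {xs} {ys} w w′ eq l l′ refl = <⇒≢ {e} (n≤1+n (suc e))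
      (trans (sym (suc-injective l′)) (trans (cong length (sym same)) (suc-injective l)))
      where
      same : xs ≡ ys
      same = NB-unique a xs ys (NB-tail w) (NB-tail w′) eq
        (≤-trans (s≤s (≤-reflexive (cong₂ _+_ (suc-injective l) (suc-injective l′)))) (≤-trans (+-monoʳ-< d (n≤1+n (suc e))) (≤-reflexive (sym g≡d+d))))

    -- Two rays from the root extend to a girth cycle; its vertex opposite to the root is the meeting point.
    module Circuit {c c′ : Fin 3} (c≢c′ : c ≢ c′) (A B : List V) (wA : NB (root ∷ ray c ∷ A)) (wB : NB (root ∷ ray c′ ∷ B)) where

      far : ∀ {ℓ} → suc (length A) + suc (length B) ≡ suc ℓ →
        ∃ λ xs → NB (last (ray c) A ∷ penultimate root (ray c) A ∷ xs) × last (penultimate root (ray c) A) xs ≡ last (ray c′) B × length xs ≡ ℓ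
      far eq with Arcs⇒NB (Arcs-join (Arcs-reverse (NB⇒Arcs A wA)) (NB⇒Arcs B wB) (λ p → c≢c′ (ray-injective p)))
      ... | xs , w , end , len = xs , w , end , suc-injective (trans len eq)

      continue : suc (length A) + suc (length B) ≡ suc d → ∀ ys → NB (last (ray c) A ∷ ys) → last (last (ray c) A) ys ≡ last (ray c′) B →
        length ys ≡ suc e → NB (root ∷ ray c ∷ A ++ ys)
      continue eq (b ∷ ys) w end len with far eq
      ... | xs , w′ , end′ , len′ = NB-join wA w (first-differs _ w′ w (trans end′ (sym end)) (cong suc len′) len)

    -- The two stems form a walk of d + 1 edges through the root, and `moore` supplies the other d -
    -- 1 edges of a girth cycle. Its vertex opposite to the root is reached b + 1 steps after the
    -- end of `A`, because (a + 2) + (b + 1) = d; both halves of the cycle are geodesics to it.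
    meet : ∀ {c c′} → c ≢ c′ → ∀ A B {a b} → NB (root ∷ ray c ∷ A) → NB (root ∷ ray c′ ∷ B) → length A ≡ suc a → length B ≡ suc b → a + suc b ≡ e →
      ∃ λ u → take (suc a) (pathTo c u) ≡ A × take (suc b) (pathTo c′ u) ≡ B
    meet {c} {c′} c≢c′ A B {a} {b} wA wB lA lB a+b with Circuit.far c≢c′ A B wA wB len
      where
      len : suc (length A) + suc (length B) ≡ suc d
      len = trans (cong₂ (λ x y → suc x + suc y) lA lB) (cong (λ x → suc (suc x)) (trans (+-suc a (suc b)) (cong suc a+b)))
    ... | xs , w , end₁ , len₁ with moore _ (_ ∷ xs) (cong suc len₁) w
    ... | ys , lys , w′ , end₂ with unsnoc root (last (ray c) A) ys lys
    ... | L , ys≡ , lL , _ with split-at b L (subst (b <_) (sym lL) (subst (b <_) a+b (m≤n+m (suc b) a)))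
    ... | L₁ , u , L₂ , refl , lL₁ = zu , trans (cong (take (suc a)) (proj₂ (proj₂ P))) (take-++-length A (suc a) lA) ,
          trans (cong (take (suc b)) (trans (cong (pathTo c′) same) (proj₂ (proj₂ P′)))) (take-++-length B (suc b) lB)
      where
      y = last (ray c) A
      η = last (ray c′) B
      len : suc (length A) + suc (length B) ≡ suc d
      len = trans (cong₂ (λ x y → suc x + suc y) lA lB) (cong (λ x → suc (suc x)) (trans (+-suc a (suc b)) (cong suc a+b)))
      ys-end : last y ys ≡ η
      ys-end = trans end₂ end₁
      ys≡′ : ys ≡ (L₁ ++ u ∷ L₂) ∷ʳ η
      ys≡′ = trans ys≡ (cong ((L₁ ++ u ∷ L₂) ∷ʳ_) ys-end)
      lL₂ : length L₂ ≡ a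
      lL₂ = +-cancelˡ-≡ (suc b) _ _ (trans (trans (cong (λ t → suc t + length L₂) (sym lL₁)) (sym (trans (length-++ L₁) (+-suc (length L₁) (length L₂)))))
        (trans lL (trans (sym a+b) (+-comm a (suc b)))))
      w₁ : NB (root ∷ ray c ∷ A ++ (L₁ ∷ʳ u))
      w₁ = NB-prefix root (ray c ∷ A ++ (L₁ ∷ʳ u)) (subst (λ t → NB (root ∷ ray c ∷ t)) assoc (Circuit.continue c≢c′ A B wA wB len ys w′ ys-end lys))
        where
        assoc : A ++ ys ≡ (A ++ (L₁ ∷ʳ u)) ++ (L₂ ∷ʳ η)
        assoc = trans (cong (A ++_) (trans ys≡′ (trans (++-assoc L₁ (u ∷ L₂) (η ∷ [])) (sym (++-assoc L₁ (u ∷ []) (L₂ ∷ʳ η)))))) (sym (++-assoc A (L₁ ∷ʳ u) (L₂ ∷ʳ η)))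
      P = pathTo-unique c (A ++ (L₁ ∷ʳ u)) w₁ (trans (length-++ A) (trans (cong₂ _+_ lA (trans (length-∷ʳ u L₁) (cong suc lL₁))) (cong suc a+b)))
      zu = proj₁ P
      rev : NB (η ∷ reverse (L₁ ++ u ∷ L₂) ∷ʳ y)
      rev = NB-rev y (L₁ ++ u ∷ L₂) η (subst (λ t → NB (y ∷ t)) ys≡′ w′)
      rev≡ : reverse (L₁ ++ u ∷ L₂) ≡ (reverse L₂ ∷ʳ u) ++ reverse L₁
      rev≡ = trans (reverse-++ L₁ (u ∷ L₂)) (cong (_++ reverse L₁) (unfold-reverse u L₂))
      w₂ : NB (root ∷ ray c′ ∷ B ++ (reverse L₂ ∷ʳ u))
      w₂ = NB-prefix root (ray c′ ∷ B ++ (reverse L₂ ∷ʳ u)) (subst (λ t → NB (root ∷ ray c′ ∷ t)) assoc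
        (Circuit.continue (λ q → c≢c′ (sym q)) B A wB wA (trans (+-comm (suc (length B)) (suc (length A))) len) (reverse (L₁ ++ u ∷ L₂) ∷ʳ y) rev
          (last-snoc (reverse (L₁ ++ u ∷ L₂))) (trans (length-∷ʳ y (reverse (L₁ ++ u ∷ L₂))) (cong suc (trans (length-reverse (L₁ ++ u ∷ L₂)) lL)))))
        where
        assoc : B ++ (reverse (L₁ ++ u ∷ L₂) ∷ʳ y) ≡ (B ++ (reverse L₂ ∷ʳ u)) ++ (reverse L₁ ∷ʳ y)
        assoc = trans (cong (λ t → B ++ (t ∷ʳ y)) rev≡) (trans (cong (B ++_) (++-assoc (reverse L₂ ∷ʳ u) (reverse L₁) (y ∷ []))) (sym (++-assoc B (reverse L₂ ∷ʳ u) (reverse L₁ ∷ʳ y))))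
      P′ = pathTo-unique c′ (B ++ (reverse L₂ ∷ʳ u)) w₂ (trans (length-++ B) (trans (cong₂ _+_ lB (trans (length-∷ʳ u (reverse L₂)) (cong suc (trans (length-reverse L₂) lL₂))))
        (cong suc (trans (+-comm b (suc a)) (trans (sym (+-suc a b)) a+b)))))
      same : zu ≡ proj₁ P′
      same = Z-≡ (trans (trans (proj₁ (proj₂ P)) (lastu A L₁)) (sym (trans (proj₁ (proj₂ P′)) (lastu B (reverse L₂)))))
        where
        lastu : ∀ {x} A L → last x (A ++ (L ∷ʳ u)) ≡ u
        lastu {x} A L = trans (cong (last x) (sym (++-assoc A L (u ∷ [])))) (last-snoc (A ++ L))

    -- Builds a canonical vertex on the other branch: the sibling stem at depth j in colour `c` and
    -- the first e - j steps towards `z₁` in colour `c′` have the lengths required by `meet`. By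
    -- `R-meet` these data determine the vertex.
    next′ : ∀ {c c′} → c ≢ c′ → ∀ {j} → j < e → ∀ z z₁ → ∃ λ u → R c j z u × ¬ R c (suc j) z u × R c′ (e ∸ j) z₁ u
    next′ {c} {c′} c≢c′ {j} j<e z z₁ with branch c z j (<⇒≤ j<e)
    ... | br = result
      where
      open Branch br
      b = e ∸ suc j
      e∸j : e ∸ j ≡ suc b
      e∸j = +-∸-assoc 1 j<e
      B = take (suc b) (pathTo c′ z₁)
      wB : NB (root ∷ ray c′ ∷ B)
      wB = NB-prefix root (ray c′ ∷ B) (subst (λ t → NB (root ∷ ray c′ ∷ t)) (sym (take++drop≡id (suc b) (pathTo c′ z₁))) (pathTo-NB c′ z₁))
      lB : length B ≡ suc b
      lB = trans (length-take (suc b) (pathTo c′ z₁)) (m≤n⇒m⊓n≡m (subst (suc b ≤_) (sym (length-pathTo c′ z₁)) (s≤s (m∸n≤m e (suc j)))))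
      lA : length (stem ∷ʳ other) ≡ suc j
      lA = trans (length-∷ʳ other stem) (cong suc len)
      result : ∃ λ u → R c j z u × ¬ R c (suc j) z u × R c′ (e ∸ j) z₁ u
      result with meet c≢c′ (stem ∷ʳ other) B other-NB wB lA lB (trans (cong (j +_) (sym e∸j)) (m+[n∸m]≡n (<⇒≤ j<e)))
      ... | u , pA , pB = u , trans stem≡ (sym stemu) , apart , trans (cong (λ t → take t (pathTo c′ z₁)) e∸j) (sym (trans (cong (λ t → take t (pathTo c′ u)) e∸j) pB))
        where
        stem≡ : take j (pathTo c z) ≡ stem
        stem≡ = trans (cong (take j) split-eq) (take-++-length stem j len)
        stemu : take j (pathTo c u) ≡ stem
        stemu = trans (take-≤ (pathTo c u) (stem ∷ʳ other) (n≤1+n j) (trans pA (sym (trans (cong (take (suc j)) (sym (++-identityʳ (stem ∷ʳ other)))) (take-++-length (stem ∷ʳ other) (suc j) lA)))))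
          (take-++-length stem j len)
        taken≡ : take (suc j) (pathTo c z) ≡ stem ∷ʳ taken
        taken≡ = trans (cong (take (suc j)) (trans split-eq (sym (++-assoc stem (taken ∷ []) rest)))) (take-++-length (stem ∷ʳ taken) (suc j) (trans (length-∷ʳ taken stem) (cong suc len)))
        apart : ¬ R c (suc j) z u
        apart r = differs (trans (sym (last-snoc {ray c} stem)) (trans (cong (last (ray c)) (trans (sym taken≡) (trans r pA))) (last-snoc stem)))

    abstract
      next : ∀ {c c′} → c ≢ c′ → ∀ {j} → j < e → ∀ z z₁ → ∃ λ u → R c j z u × ¬ R c (suc j) z u × R c′ (e ∸ j) z₁ u
      next = next′

-- Normalised labels of the opposite vertices.

module Labels where

  open import Defs renaming (sym to adj-sym)
  open Walks
  open CycleCounting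
  open Distances
  open Polygons
  open OppositeVertices
  open import Data.Nat using (ℕ; zero; suc; _+_; _*_; _∸_; _≤_; _<_; z≤n; s≤s; _<?_)
  open import Data.Nat.Properties hiding (_≟_; _<?_)
  open import Data.Fin using (Fin; zero; suc)
  open ListLemmas

  nth : ℕ → List Bool → Bool
  nth _ [] = false
  nth zero (b ∷ _) = b
  nth (suc i) (_ ∷ bs) = nth i bs

  -- Vertices relative to the root: the three rays carry binary trees, of which the leaves are joined to the
  -- opposite vertices; the latter are named by an address in the tree of colour 0 and one further bit.
  data Code : Set where
    origin : Code
    node   : Fin 3 → List Bool → Code
    leaf   : List Bool → Bool → Code

  data Valid (e : ℕ) : Code → Set where
    origin : Valid e origin
    node   : ∀ {c π} → length π ≤ e → Valid e (node c π)
    leaf   : ∀ {π s} → length π ≡ e → Valid e (leaf π s)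

  module Labelling {n : ℕ} (Γ : Graph n) (e : ℕ)
    (Γ-girth : Girth Γ (2 * suc (suc e)))
    (conn : Connected Γ) (reg : Regular Γ 3)
    (moore : GirthCycles.Moore Γ e (proj₂ Γ-girth)) where

    open Net Γ e Γ-girth conn reg moore public

    -- The colour in which new reference vertices stay close to `z₀`: colour 1 for the tree of
    -- colour 0, and colour 0 for the other two trees.
    opposing : Fin 3 → Fin 3
    opposing zero = suc zero
    opposing (suc _) = zero

    ≢opposing : ∀ c → c ≢ opposing c
    ≢opposing zero ()
    ≢opposing (suc _) ()

    nxt : Fin 3 → ℕ → Z → Z
    nxt c j z with j <? e
    ... | yes lt = proj₁ (next (≢opposing c) lt z z₀)
    ... | no _ = z

    nxt-spec : ∀ c {j} → j < e → ∀ z → R c j z (nxt c j z) × ¬ R c (suc j) z (nxt c j z) × R (opposing c) (e ∸ j) z₀ (nxt c j z)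
    nxt-spec c {j} j<e z with j <? e
    ... | yes lt = proj₂ (next (≢opposing c) lt z z₀)
    ... | no ge = ⊥-elim (ge j<e)

    -- At every branching the bit 0 goes towards the current reference vertex; for the bit 1 the reference
    -- vertex is replaced by the one that agrees longest with z₀ along the opposing colour.
    rep : Fin 3 → ℕ → Z → List Bool → Z
    rep c j cur [] = cur
    rep c j cur (false ∷ π) = rep c (suc j) cur π
    rep c j cur (true ∷ π) = rep c (suc j) (nxt c j cur) π

    lab : Fin 3 → ℕ → ℕ → Z → Z → List Bool
    lab c j zero z cur = []
    lab c j (suc m) z cur with R? c (suc j) cur z
    ... | yes _ = false ∷ lab c (suc j) m z cur
    ... | no _ = true ∷ lab c (suc j) m z (nxt c j cur)

    length-lab : ∀ c j m z cur → length (lab c j m z cur) ≡ m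
    length-lab c j zero z cur = refl
    length-lab c j (suc m) z cur with R? c (suc j) cur z
    ... | yes _ = cong suc (length-lab c (suc j) m z cur)
    ... | no _ = cong suc (length-lab c (suc j) m z (nxt c j cur))

    private
      j<e : ∀ {j m} → j + suc m ≤ e → j < e
      j<e {j} {m} le = ≤-trans (s≤s (m≤m+n j m)) (≤-trans (≤-reflexive (sym (+-suc j m))) le)

      shift : ∀ {j m} → j + suc m ≤ e → suc j + m ≤ e
      shift {j} {m} le = ≤-trans (≤-reflexive (sym (+-suc j m))) le

    other-child : ∀ c {j m cur z} → j + suc m ≤ e → R c j cur z → ¬ R c (suc j) cur z → R c (suc j) (nxt c j cur) z
    other-child c {j} {m} {cur} {z} le r nr = dichotomy {c} {j} {cur} {nxt c j cur} {z} (<⇒≤ (j<e {j} {m} le)) (proj₁ s) r (proj₁ (proj₂ s)) nr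
      where s = nxt-spec c (j<e {j} {m} le) cur

    -- As long as the bits agree, both computations carry the same reference vertex, and an equal
    -- bit selects the same one of two branches.
    lab-R : ∀ c t {j m cur z z′} → j + m ≤ e → t ≤ m → R c j cur z → R c j cur z′ →
      (∀ i → i < t → nth i (lab c j m z cur) ≡ nth i (lab c j m z′ cur)) → R c (j + t) z z′
    lab-R c zero {j} {z = z} {z′} _ _ r r′ _ = subst (λ k → R c k z z′) (sym (+-identityʳ j)) (trans (sym r) r′)
    lab-R c (suc t) {j} {suc m} {cur} {z} {z′} le (s≤s t≤) r r′ h with R? c (suc j) cur z | R? c (suc j) cur z′
    ... | yes p | yes q = subst (λ k → R c k z z′) (sym (+-suc j t)) (lab-R c t (shift le) t≤ p q (λ i lt → h (suc i) (s≤s lt)))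
    ... | no p | no q = subst (λ k → R c k z z′) (sym (+-suc j t)) (lab-R c t (shift le) t≤ (other-child c {j} {m} {cur} {z} le r p) (other-child c {j} {m} {cur} {z′} le r′ q) (λ i lt → h (suc i) (s≤s lt)))
    ... | yes _ | no _ = ⊥-elim (false≢true (h zero (s≤s z≤n)))
    ... | no _ | yes _ = ⊥-elim (false≢true (sym (h zero (s≤s z≤n))))

    lab-rep : ∀ c m {j cur z} → j + m ≤ e → R c j cur z → R c (j + m) (rep c j cur (lab c j m z cur)) z
    lab-rep c zero {j} {cur} {z} le r = subst (λ k → R c k cur z) (sym (+-identityʳ j)) r
    lab-rep c (suc m) {j} {cur} {z} le r with R? c (suc j) cur z
    ... | yes p = subst (λ k → R c k (rep c (suc j) cur (lab c (suc j) m z cur)) z) (sym (+-suc j m)) (lab-rep c m (shift le) p)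
    ... | no p = subst (λ k → R c k (rep c (suc j) (nxt c j cur) (lab c (suc j) m z (nxt c j cur))) z) (sym (+-suc j m))
                   (lab-rep c m (shift le) (other-child c {j} {m} {cur} {z} le r p))

    rep-in : ∀ c {j cur} π → j + length π ≤ e → R c j cur (rep c j cur π)
    rep-in c [] le = refl
    rep-in c {j} {cur} (false ∷ π) le = R-≤ {c} {z = cur} {rep c (suc j) cur π} (n≤1+n j) (rep-in c π (shift le))
    rep-in c {j} {cur} (true ∷ π) le = trans (proj₁ (nxt-spec c (j<e le) cur)) (R-≤ {c} {z = nxt c j cur} {rep c (suc j) (nxt c j cur) π} (n≤1+n j) (rep-in c π (shift le)))

    rep-agree : ∀ c t {j cur} π π′ → j + length π ≤ e → j + length π′ ≤ e → t ≤ length π → t ≤ length π′ →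
      (∀ i → i < t → nth i π ≡ nth i π′) → R c (j + t) (rep c j cur π) (rep c j cur π′)
    rep-agree c zero {j} {cur} π π′ le le′ _ _ _ = subst (λ k → R c k (rep c j cur π) (rep c j cur π′)) (sym (+-identityʳ j))
      (trans (sym (rep-in c π le)) (rep-in c π′ le′))
    rep-agree c (suc t) {j} {cur} (b ∷ π) (b′ ∷ π′) le le′ (s≤s l) (s≤s l′) h with h zero (s≤s z≤n)
    rep-agree c (suc t) {j} {cur} (false ∷ π) (.false ∷ π′) le le′ (s≤s l) (s≤s l′) h | refl =
      subst (λ k → R c k (rep c (suc j) cur π) (rep c (suc j) cur π′)) (sym (+-suc j t))
        (rep-agree c t π π′ (shift le) (shift le′) l l′ (λ i lt → h (suc i) (s≤s lt)))
    rep-agree c (suc t) {j} {cur} (true ∷ π) (.true ∷ π′) le le′ (s≤s l) (s≤s l′) h | refl =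
      subst (λ k → R c k (rep c (suc j) (nxt c j cur) π) (rep c (suc j) (nxt c j cur) π′)) (sym (+-suc j t))
        (rep-agree c t π π′ (shift le) (shift le′) l l′ (λ i lt → h (suc i) (s≤s lt)))

    rep-zero : ∀ c t {j cur} π → j + length π ≤ e → t ≤ length π → (∀ i → i < t → nth i π ≡ false) → R c (j + t) cur (rep c j cur π)
    rep-zero c zero {j} {cur} π le _ _ = subst (λ k → R c k cur (rep c j cur π)) (sym (+-identityʳ j)) (rep-in c π le)
    rep-zero c (suc t) {j} {cur} (b ∷ π) le (s≤s l) h with h zero (s≤s z≤n)
    ... | refl = subst (λ k → R c k cur (rep c (suc j) cur π)) (sym (+-suc j t)) (rep-zero c t π (shift le) l (λ i lt → h (suc i) (s≤s lt)))

    rep-separates : ∀ c {j cur} π π′ → length π ≡ length π′ → j + length π ≤ e → R c (j + length π) (rep c j cur π) (rep c j cur π′) → π ≡ π′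
    rep-separates c [] [] _ _ _ = refl
    rep-separates c {j} {cur} (b ∷ π) (b′ ∷ π′) len le r = go b b′ r
      where
      len′ = suc-injective len
      le₁ = shift {j} le
      le₂ : suc j + length π′ ≤ e
      le₂ = subst (λ k → suc j + k ≤ e) len′ le₁
      suc≤ : suc j ≤ j + suc (length π)
      suc≤ = ≤-trans (s≤s (m≤m+n j (length π))) (≤-reflexive (sym (+-suc j (length π))))
      go : ∀ b b′ → R c (j + suc (length π)) (rep c j cur (b ∷ π)) (rep c j cur (b′ ∷ π′)) → b ∷ π ≡ b′ ∷ π′
      go false false r = cong (false ∷_) (rep-separates c π π′ len′ le₁ (subst (λ k → R c k (rep c (suc j) cur π) (rep c (suc j) cur π′)) (+-suc j (length π)) r))
      go true true r = cong (true ∷_) (rep-separates c π π′ len′ le₁ (subst (λ k → R c k (rep c (suc j) (nxt c j cur) π) (rep c (suc j) (nxt c j cur) π′)) (+-suc j (length π)) r))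
      go false true r = ⊥-elim (proj₁ (proj₂ (nxt-spec c (j<e le) cur))
        (trans (rep-in c π le₁) (trans (R-≤ {c} {z = rep c (suc j) cur π} {rep c (suc j) (nxt c j cur) π′} suc≤ r) (sym (rep-in c π′ le₂)))))
      go true false r = ⊥-elim (proj₁ (proj₂ (nxt-spec c (j<e le) cur))
        (trans (rep-in c π′ le₂) (trans (sym (R-≤ {c} {z = rep c (suc j) (nxt c j cur) π} {rep c (suc j) cur π′} suc≤ r)) (sym (rep-in c π le₁)))))

    lab-prefix-false : ∀ c t {j m cur z} → t ≤ m → R c (j + t) cur z → ∀ i → i < t → nth i (lab c j m z cur) ≡ false
    lab-prefix-false c (suc t) {j} {suc m} {cur} {z} (s≤s t≤) r i i<t with R? c (suc j) cur z
    lab-prefix-false c (suc t) {j} {suc m} {cur} {z} (s≤s t≤) r zero i<t | yes _ = refl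
    lab-prefix-false c (suc t) {j} {suc m} {cur} {z} (s≤s t≤) r (suc i) (s≤s i<t) | yes _ =
      lab-prefix-false c t t≤ (subst (λ k → R c k cur z) (+-suc j t) r) i i<t
    ... | no nr = ⊥-elim (nr (R-≤ {c} {z = cur} {z} (≤-trans (s≤s (m≤m+n j t)) (≤-reflexive (sym (+-suc j t)))) r))

    lab-self : ∀ c {j} m z i → nth i (lab c j m z z) ≡ false
    lab-self c zero z i = refl
    lab-self c {j} (suc m) z i with R? c (suc j) z z
    lab-self c {j} (suc m) z zero | yes _ = refl
    lab-self c {j} (suc m) z (suc i) | yes _ = lab-self c m z i
    ... | no nr = ⊥-elim (nr refl)

    -- At the bit 1 the reference becomes the vertex on the branch of `z` that agrees with `z₀` in
    -- colour 0 as long as `z` does. `R-meet` identifies it with `z`, so from there on `z` is its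
    -- own reference and all further bits are 0.
    lab-gauge : ∀ c′ i {j m cur z} → let c = suc c′ in j + m ≤ e → R c j cur z → i < m → nth i (lab c j m z cur) ≡ true → R zero (e ∸ (j + i)) z₀ z →
      ∀ k → i < k → nth k (lab c j m z cur) ≡ false
    lab-gauge c′ zero {j} {suc m} {cur} {z} le r _ b r₀ (suc k) _ with R? (suc c′) (suc j) cur z
    lab-gauge c′ zero {j} {suc m} {cur} {z} le r _ () r₀ (suc k) _ | yes _
    ... | no nr = subst (λ x → nth k (lab (suc c′) (suc j) m z x) ≡ false) (sym same) (lab-self (suc c′) m z k)
      where
      same : nxt (suc c′) j cur ≡ z
      same = R-meet {suc c′} {zero} {j} (λ ()) (<⇒≤ (j<e le)) (other-child (suc c′) {j} {m} {cur} {z} le r nr)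
        (trans (sym (proj₂ (proj₂ (nxt-spec (suc c′) (j<e le) cur)))) (subst (λ x → R zero (e ∸ x) z₀ z) (+-identityʳ j) r₀))
    lab-gauge c′ (suc i) {j} {suc m} {cur} {z} le r (s≤s i<m) b r₀ (suc k) (s≤s i<k) with R? (suc c′) (suc j) cur z
    ... | yes p = lab-gauge c′ i (shift le) p i<m b (subst (λ x → R zero (e ∸ x) z₀ z) (+-suc j i) r₀) k i<k
    ... | no p = lab-gauge c′ i (shift le) (other-child (suc c′) {j} {m} {cur} {z} le r p) i<m b (subst (λ x → R zero (e ∸ x) z₀ z) (+-suc j i) r₀) k i<k

    base : List Bool → Z
    base = rep zero 0 z₀

    zname : List Bool → Bool → Z
    zname π false = base π
    zname π true = proj₁ (mate zero (base π))

    zname-base : ∀ π s → R zero e (base π) (zname π s)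
    zname-base π false = refl
    zname-base π true = proj₁ (proj₂ (mate zero (base π)))

    zname-injective : ∀ {π s π′ s′} → length π ≡ e → length π′ ≡ e → zname π s ≡ zname π′ s′ → π ≡ π′ × s ≡ s′
    zname-injective {π} {s} {π′} {s′} l l′ eq with rep-separates zero {0} {z₀} π π′ (trans l (sym l′)) (≤-reflexive l)
        (subst (λ k → R zero k (base π) (base π′)) (sym l) (trans (zname-base π s) (trans (cong (λ z → take e (pathTo zero z)) eq) (sym (zname-base π′ s′)))))
    ... | refl = refl , go s s′ eq
      where
      go : ∀ s s′ → zname π s ≡ zname π s′ → s ≡ s′
      go false false _ = refl
      go true true _ = refl
      go false true eq = ⊥-elim (proj₂ (proj₂ (mate zero (base π))) eq)
      go true false eq = ⊥-elim (proj₂ (proj₂ (mate zero (base π))) (sym eq))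

    zname-R : ∀ t π s π′ s′ → length π ≡ e → length π′ ≡ e → t ≤ e → (∀ i → i < t → nth i π ≡ nth i π′) → R zero t (zname π s) (zname π′ s′)
    zname-R t π s π′ s′ l l′ t≤ h = trans (sym (R-≤ {zero} {z = base π} {zname π s} t≤ (zname-base π s)))
      (trans (rep-agree zero t {0} {z₀} π π′ (≤-reflexive l) (≤-reflexive l′) (subst (t ≤_) (sym l) t≤) (subst (t ≤_) (sym l′) t≤) h)
        (R-≤ {zero} {z = base π′} {zname π′ s′} t≤ (zname-base π′ s′)))

    zname-zero : ∀ t π s → length π ≡ e → t ≤ e → (∀ i → i < t → nth i π ≡ false) → R zero t z₀ (zname π s)
    zname-zero t π s l t≤ h = trans (rep-zero zero t {0} {z₀} π (≤-reflexive l) (subst (t ≤_) (sym l) t≤) h)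
      (R-≤ {zero} {z = base π} {zname π s} t≤ (zname-base π s))

    -- A length of guaranteed agreement with `z₀` in colour 1: a bit 1 at depth j installs a
    -- reference that agrees for e - j steps, and the last such bit decides.
    shared : ℕ → ℕ → List Bool → ℕ
    shared j a [] = a
    shared j a (false ∷ π) = shared (suc j) a π
    shared j a (true ∷ π) = shared (suc j) (e ∸ j) π

    shared-R : ∀ {j a cur} π → j + length π ≤ e → R (suc zero) a z₀ cur → R (suc zero) (shared j a π) z₀ (rep zero j cur π)
    shared-R [] _ r = r
    shared-R (false ∷ π) le r = shared-R π (shift le) r
    shared-R {j} {a} {cur} (true ∷ π) le r = shared-R π (shift le) (proj₂ (proj₂ (nxt-spec zero (j<e le) cur)))

    label : Fin 3 → Z → List Bool
    label c z = lab c 0 e z z₀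

    -- A node is cut out of the geodesic to one representative below it; every opposite vertex whose
    -- label begins with π would give the same node.
    vert : Code → V
    vert origin = root
    vert (node c π) = last (ray c) (take (length π) (pathTo c (rep c 0 z₀ π)))
    vert (leaf π s) = vertex (zname π s)

    length-take-path : ∀ c z {j} → j ≤ suc e → length (take j (pathTo c z)) ≡ j
    length-take-path c z {j} le = trans (length-take j (pathTo c z)) (m≤n⇒m⊓n≡m (subst (j ≤_) (sym (length-pathTo c z)) le))

    NB-take : ∀ c z j → NB (root ∷ ray c ∷ take j (pathTo c z))
    NB-take c z j = NB-prefix root (ray c ∷ take j (pathTo c z)) (subst (λ t → NB (root ∷ ray c ∷ t)) (sym (take++drop≡id j (pathTo c z))) (pathTo-NB c z))

    depth : Code → ℕ
    depth origin = 0
    depth (node c π) = suc (length π)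
    depth (leaf π s) = d

    δ-vert : ∀ {x} → Valid e x → δ root (vert x) ≡ depth x
    δ-vert origin = δ-refl root
    δ-vert (node {c} {π} le) = trans (δ-path (ray c ∷ take (length π) (pathTo c z)) (NB-take c z (length π))
        (s≤s (≤-trans (≤-reflexive (length-take-path c z (m≤n⇒m≤1+n le))) (m≤n⇒m≤1+n le)))) (cong suc (length-take-path c z (m≤n⇒m≤1+n le)))
      where z = rep c 0 z₀ π
    δ-vert (leaf {π} {s} _) = opposite′ (zname π s)

    -- The distance from the root separates the levels. Within a level below d geodesics are unique,
    -- hence so are the ray and the address.
    vert-injective : ∀ {x y} → Valid e x → Valid e y → vert x ≡ vert y → x ≡ y
    vert-injective {x} {y} vx vy eq = go vx vy eq (trans (sym (δ-vert vx)) (trans (cong (δ root) eq) (δ-vert vy)))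
      where
      go : ∀ {x y} → Valid e x → Valid e y → vert x ≡ vert y → depth x ≡ depth y → x ≡ y
      go origin origin _ _ = refl
      go (node le) (leaf _) _ dp = ⊥-elim (<⇒≢ (s≤s (s≤s le)) dp)
      go (leaf _) (node le) _ dp = ⊥-elim (<⇒≢ (s≤s (s≤s le)) (sym dp))
      go (leaf {π} {s} l) (leaf {π′} {s′} l′) eq _ with zname-injective {π} {s} {π′} {s′} l l′ (Z-≡ eq)
      ... | refl , refl = refl
      go (node {c} {π} le) (node {c′} {π′} le′) eq dp with ∷-injective (short-unique (NB-take c z (length π)) (NB-take c′ z′ (length π′)) eq
          (s≤s (≤-trans (≤-reflexive (length-take-path c z (m≤n⇒m≤1+n le))) le))
          (s≤s (≤-trans (≤-reflexive (length-take-path c′ z′ (m≤n⇒m≤1+n le′))) le′)))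
        where
        z = rep c 0 z₀ π
        z′ = rep c′ 0 z₀ π′
      ... | rays , tails with ray-injective {c} {c′} rays
      ...   | refl = cong (node c) (rep-separates c {0} {z₀} π π′ (suc-injective dp) le
                (trans tails (cong (λ k → take k (pathTo c (rep c 0 z₀ π′))) (sym (suc-injective dp)))))

    path-step : ∀ c z j → j ≤ e → last (ray c) (take j (pathTo c z)) ~ last (ray c) (take (suc j) (pathTo c z))
    path-step c z j le with split-at j (pathTo c z) (subst (j <_) (sym (length-pathTo c z)) (s≤s le))
    ... | ps , x , qs , eq , len = subst₂ _~_ (cong (last (ray c)) (sym (trans (cong (take j) eq) (take-++-length ps j len))))
          (trans (sym (last-snoc ps)) (cong (last (ray c)) (sym (trans (cong (take (suc j)) (trans eq (sym (++-assoc ps (x ∷ []) qs)))) (take-++-length (ps ∷ʳ x) (suc j) (trans (length-∷ʳ x ps) (cong suc len)))))))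
          (NB-head (NB-suffix root (ray c ∷ ps) (subst (λ t → NB (root ∷ ray c ∷ t)) eq (pathTo-NB c z))))

    origin~node : ∀ c → vert origin ~ vert (node c [])
    origin~node c = root~ray c

    node~node : ∀ c π b → length π < e → vert (node c π) ~ vert (node c (π ∷ʳ b))
    node~node c π b lt = subst₂ _~_ (cong (last (ray c)) (sym (agree)))
        (cong (λ k → last (ray c) (take k (pathTo c z′))) (sym (length-∷ʳ b π))) (path-step c z′ (length π) (<⇒≤ lt))
      where
      z′ = rep c 0 z₀ (π ∷ʳ b)
      nth-++ : ∀ i (π : List Bool) {ys} → i < length π → nth i π ≡ nth i (π ++ ys)
      nth-++ zero (_ ∷ _) _ = refl
      nth-++ (suc i) (_ ∷ π) (s≤s lt) = nth-++ i π lt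
      agree : R c (length π) (rep c 0 z₀ π) z′
      agree = rep-agree c (length π) {0} {z₀} π (π ∷ʳ b) (<⇒≤ lt) (≤-trans (≤-reflexive (length-∷ʳ b π)) lt) ≤-refl
        (≤-trans (n≤1+n (length π)) (≤-reflexive (sym (length-∷ʳ b π)))) (λ i lt → nth-++ i π lt)

    take-all : ∀ c z → last (ray c) (take (suc e) (pathTo c z)) ≡ vertex z
    take-all c z = trans (cong (last (ray c)) (trans (cong (take (suc e)) (sym (++-identityʳ (pathTo c z)))) (take-++-length (pathTo c z) (suc e) (length-pathTo c z)))) (pathTo-end c z)
      where open import Data.List.Properties using (++-identityʳ)

    node~leaf : ∀ c π z → length π ≡ e → R c e (rep c 0 z₀ π) z → vert (node c π) ~ vertex z
    node~leaf c π z l r = subst₂ _~_ (cong (last (ray c)) (sym (trans (cong (λ k → take k (pathTo c (rep c 0 z₀ π))) l) r))) (take-all c z) (path-step c z e ≤-refl)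

    node~label : ∀ c z → vert (node c (label c z)) ~ vertex z
    node~label c z = node~leaf c (label c z) z (length-lab c 0 e z z₀) (lab-rep c e {0} {z₀} {z} ≤-refl refl)

-- A checker for case trees and its soundness.

module Recognition where

  open import Defs renaming (sym to adj-sym)
  open ListLemmas
  open Walks
  open CycleCounting
  open Polygons
  open OppositeVertices
  open Labels
  open import Data.Nat using (ℕ; zero; suc; _+_; _*_; _∸_; _^_; _≤_; _<_; z≤n; s≤s; _≡ᵇ_; _<ᵇ_; _≤ᵇ_; _/_; _%_)
  open import Data.Nat.Properties using (≤-refl; ≤-reflexive; ≡ᵇ⇒≡; <ᵇ⇒<; ≤ᵇ⇒≤; suc-injective; m∸n≤m)
  open import Data.Bool using (T)
  open import Data.Bool.ListAction using (all; any)
  open import Data.Maybe using (Maybe; just; nothing)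
  open import Data.Fin using (Fin; zero; suc; toℕ)
  import Data.Fin.Properties as Fin
  open import Data.List.Relation.Unary.Unique.Propositional using (Unique; []; _∷_)
  open import Data.Vec as Vec using (Vec; []; _∷_)
  open import Data.Unit using (tt)
  open import Function.Bundles using (mk↔ₛ′)

  ≡true⇒T : ∀ {b} → b ≡ true → T b
  ≡true⇒T refl = tt

  ∨-true⁻ : ∀ {a b} → a ∨ b ≡ true → a ≡ true ⊎ b ≡ true
  ∨-true⁻ {true} _ = inj₁ refl
  ∨-true⁻ {false} eq = inj₂ eq

  not-true⁻ : ∀ {a} → not a ≡ true → a ≡ false
  not-true⁻ {false} _ = refl

  all-∈ : ∀ {A : Set} (p : A → Bool) {xs x} → all p xs ≡ true → x ∈ xs → p x ≡ true
  all-∈ p {y ∷ xs} h (here refl) = proj₁ (∧-true⁻ h)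
  all-∈ p {y ∷ xs} h (there x∈) = all-∈ p (proj₂ (∧-true⁻ {p y} h)) x∈

  -- Three distinct neighbours are mapped injectively into three, hence onto all neighbours of the
  -- image. Walks therefore lift, connectedness makes `φ` onto, and an edge between images comes
  -- from an edge. So only edges need to be verified, never non-edges.
  module Cover {n m : ℕ} (Γ : Graph n) (H : Graph m) (conn : Connected Γ) (reg : Regular Γ 3)
    (φ : Fin m → Fin n) (φ-injective : ∀ {u v} → φ u ≡ φ v → u ≡ v)
    (φ-adj : ∀ u v → adj H u v ≡ true → adj Γ (φ u) (φ v) ≡ true)
    (three : ∀ u → ∃ λ L → Unique L × length L ≡ 3 × (∀ {v} → v ∈ L → adj H u v ≡ true)) (u₀ : Fin m) where

    open Neighbours Γ

    lift : ∀ u y → adj Γ (φ u) y ≡ true → ∃ λ v → y ≡ φ v × adj H u v ≡ true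
    lift u y e with three u
    ... | L , uq , len , adjL with ∈-map⁻ φ (unique-⊆⇒⊇ Fin._≟_ {map φ L} {neighbours Γ (φ u)} (map⁺ φ-injective uq) sub
            (≤-reflexive (trans (reg (φ u)) (sym (trans (length-map φ L) len)))) (∈-neighbours⁺ e))
      where
      sub : map φ L ⊆ neighbours Γ (φ u)
      sub p with ∈-map⁻ φ p
      ... | v , v∈ , refl = ∈-neighbours⁺ (φ-adj u v (adjL v∈))
    ... | v , v∈ , eq = v , eq , adjL v∈

    onto : ∀ {ℓ} u y → Walk Γ (φ u) y ℓ → ∃ λ v → y ≡ φ v
    onto u y here = u , refl
    onto u y (step e w) with lift u _ e
    ... | v , refl , _ = onto v y w

    φ⁻¹ : Fin n → Fin m
    φ⁻¹ y = proj₁ (onto u₀ y (proj₂ (conn (φ u₀) y)))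

    φ-φ⁻¹ : ∀ y → φ (φ⁻¹ y) ≡ y
    φ-φ⁻¹ y = sym (proj₂ (onto u₀ y (proj₂ (conn (φ u₀) y))))

    adj-≡ : ∀ u v → adj Γ (φ u) (φ v) ≡ adj H u v
    adj-≡ u v with adj H u v in eq | adj Γ (φ u) (φ v) in eq′
    ... | true | true = refl
    ... | false | false = refl
    ... | true | false = trans (sym eq′) (φ-adj u v eq)
    ... | false | true with lift u (φ v) eq′
    ...   | v′ , same , e with φ-injective same
    ...     | refl = trans (sym e) eq

    cover : Γ ≅ H
    cover = mk↔ₛ′ φ⁻¹ φ (λ u → φ-injective (φ-φ⁻¹ (φ u))) φ-φ⁻¹ ,
      λ x y → trans (sym (cong₂ (adj Γ) (φ-φ⁻¹ x) (φ-φ⁻¹ y))) (adj-≡ (φ⁻¹ x) (φ⁻¹ y))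

  incident : ℕ → List (ℕ × ℕ) → List ℕ
  incident a [] = []
  incident a ((x , y) ∷ es) = if x ≡ᵇ a then y ∷ incident a es else if y ≡ᵇ a then x ∷ incident a es else incident a es

  memberᵇ : ℕ → List ℕ → Bool
  memberᵇ b = any (_≡ᵇ b)

  incident-edgeIn : ∀ a b es → memberᵇ b (incident a es) ≡ true → edgeIn es a b ≡ true
  incident-edgeIn a b ((x , y) ∷ es) h with x ≡ᵇ a
  ... | true with y ≡ᵇ b
  ...   | true = refl
  ...   | false = ∨-right (((x ≡ᵇ b) ∧ (y ≡ᵇ a))) (incident-edgeIn a b es h)
    where
    ∨-right : ∀ c {d} → d ≡ true → c ∨ d ≡ true
    ∨-right true _ = refl
    ∨-right false eq = eq
  incident-edgeIn a b ((x , y) ∷ es) h | false with y ≡ᵇ a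
  ... | true with x ≡ᵇ b
  ...   | true = refl
  ...   | false = incident-edgeIn a b es h
  incident-edgeIn a b ((x , y) ∷ es) h | false | false with x ≡ᵇ b
  ... | true = incident-edgeIn a b es h
  ... | false = incident-edgeIn a b es h

  edgeIn-∈ : ∀ es {a b} → edgeIn es a b ≡ true → (a , b) ∈ es ⊎ (b , a) ∈ es
  edgeIn-∈ ((x , y) ∷ es) {a} {b} h with ∨-true⁻ {((x ≡ᵇ a) ∧ (y ≡ᵇ b)) ∨ ((x ≡ᵇ b) ∧ (y ≡ᵇ a))} h
  ... | inj₂ h′ with edgeIn-∈ es h′
  ...   | inj₁ p = inj₁ (there p)
  ...   | inj₂ p = inj₂ (there p)
  edgeIn-∈ ((x , y) ∷ es) {a} {b} h | inj₁ h′ with ∨-true⁻ {(x ≡ᵇ a) ∧ (y ≡ᵇ b)} h′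
  ... | inj₁ q with ∧-true⁻ {x ≡ᵇ a} q
  ...   | p , q′ rewrite ≡ᵇ⇒≡ x a (≡true⇒T p) | ≡ᵇ⇒≡ y b (≡true⇒T q′) = inj₁ (here refl)
  edgeIn-∈ ((x , y) ∷ es) {a} {b} h | inj₁ h′ | inj₂ q with ∧-true⁻ {x ≡ᵇ b} q
  ...   | p , q′ rewrite ≡ᵇ⇒≡ x b (≡true⇒T p) | ≡ᵇ⇒≡ y a (≡true⇒T q′) = inj₂ (here refl)

  -- The equation that defines adjacency in `fromEdges`, with a literal list in place of the
  -- computed one.
  EdgeList : ∀ {m} → Graph m → List (ℕ × ℕ) → Set
  EdgeList {m} H es = ∀ u v → adj H u v ≡ not (does (u Fin.≟ v)) ∧ edgeIn es (toℕ u) (toℕ v)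

  adjacentTo : ∀ {m} → Fin m → List ℕ → List (Fin m)
  adjacentTo {m} u ns = filter (λ v → (not (does (u Fin.≟ v)) ∧ memberᵇ (toℕ v) ns) ≟ᴮ true) (allFin m)

  cubicᵇ : ℕ → List (ℕ × ℕ) → Bool
  cubicᵇ m es = all (λ u → length (adjacentTo {m} u (incident (toℕ u) es)) ≡ᵇ 3) (allFin m)

  cubic-three : ∀ {m} {H : Graph m} {es} → EdgeList H es → cubicᵇ m es ≡ true →
    ∀ u → ∃ λ L → Unique L × length L ≡ 3 × (∀ {v} → v ∈ L → adj H u v ≡ true)
  cubic-three {m} {H} {es} eqs h u = adjacentTo u ns , filter⁺ test (allFin⁺ m) ,
      ≡ᵇ⇒≡ _ 3 (≡true⇒T (all-∈ (λ u → length (adjacentTo {m} u (incident (toℕ u) es)) ≡ᵇ 3) {x = u} h (∈-allFin u))) , adjL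
    where
    ns = incident (toℕ u) es
    test = λ v → (not (does (u Fin.≟ v)) ∧ memberᵇ (toℕ v) ns) ≟ᴮ true
    adjL : ∀ {v} → v ∈ adjacentTo u ns → adj H u v ≡ true
    adjL {v} v∈ with ∧-true⁻ {not (does (u Fin.≟ v))} (proj₂ (∈-filter⁻ test {xs = allFin m} v∈))
    ... | p , q = trans (eqs u v) (∧-true⁺ p (incident-edgeIn (toℕ u) (toℕ v) es q))

  data Trie (A : Set) : ℕ → Set where
    tip  : A → Trie A 0
    fork : ∀ {k} → Trie A k → Trie A k → Trie A (suc k)

  find : ∀ {A k} → Trie A k → Vec Bool k → A
  find (tip a) [] = a
  find (fork l r) (false ∷ v) = find l v
  find (fork l r) (true ∷ v) = find r v

  update : ∀ {A k} → (A → A) → Vec Bool k → Trie A k → Trie A k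
  update f [] (tip a) = tip (f a)
  update f (false ∷ v) (fork l r) = fork (update f v l) r
  update f (true ∷ v) (fork l r) = fork l (update f v r)

  constant : ∀ {A} k → A → Trie A k
  constant zero a = tip a
  constant (suc k) a = fork (constant k a) (constant k a)

  find-constant : ∀ {A} k {a : A} v → find (constant k a) v ≡ a
  find-constant zero [] = refl
  find-constant (suc k) (false ∷ v) = find-constant k v
  find-constant (suc k) (true ∷ v) = find-constant k v

  find-update : ∀ {A k} (P : Vec Bool k → A → Set) f v (t : Trie A k) → (∀ w → P w (find t w)) → P v (f (find t v)) → ∀ w → P w (find (update f v t) w)
  find-update P f [] (tip a) h p [] = p
  find-update P f (false ∷ v) (fork l r) h p (false ∷ w) = find-update (λ w → P (false ∷ w)) f v l (λ w → h (false ∷ w)) p w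
  find-update P f (false ∷ v) (fork l r) h p (true ∷ w) = h (true ∷ w)
  find-update P f (true ∷ v) (fork l r) h p (false ∷ w) = h (false ∷ w)
  find-update P f (true ∷ v) (fork l r) h p (true ∷ w) = find-update (λ w → P (true ∷ w)) f v r (λ w → h (true ∷ w)) p w

  -- A partially known label; `nothing` stands for a bit on which no branching has taken place.
  Bits : Set
  Bits = List (Maybe Bool)

  get : ℕ → Bits → Maybe Bool
  get _ [] = nothing
  get zero (b ∷ _) = b
  get (suc j) (_ ∷ bs) = get j bs

  set : ℕ → Bool → Bits → Bits
  set _ _ [] = []
  set zero b (_ ∷ bs) = just b ∷ bs
  set (suc j) b (x ∷ bs) = x ∷ set j b bs

  get-set : ∀ (Q : ℕ → Bool → Set) j b bs → (∀ i x → get i bs ≡ just x → Q i x) → Q j b → ∀ i x → get i (set j b bs) ≡ just x → Q i x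
  get-set Q j b [] h q i x ()
  get-set Q zero b (y ∷ bs) h q zero x refl = q
  get-set Q zero b (y ∷ bs) h q (suc i) x eq = h (suc i) x eq
  get-set Q (suc j) b (y ∷ bs) h q zero x eq = h zero x eq
  get-set Q (suc j) b (y ∷ bs) h q (suc i) x eq = get-set (λ i → Q (suc i)) j b bs (λ i → h (suc i)) q i x eq

  data Route : Set where
    end : Route
    hop : Fin 3 → ℕ → ℕ → Route → Route

  -- `split c j v` branches on bit j of the label of colour c of the vertex named v.  A leaf `clash` names a short
  -- closed sequence of opposite vertices, `common`, `zero` and `gauge` say that a bit contradicts the
  -- normalisation of the labels, and `done` lists the vertices of the target graph in the numbering `decode`.
  data Cert : Set where
    split  : Fin 3 → ℕ → ℕ → Cert → Cert → Cert
    clash  : Route → Cert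
    common : ℕ → ℕ → Cert
    zero   : ℕ → Cert
    gauge  : Fin 3 → ℕ → ℕ → ℕ → Cert
    done   : List ℕ → Cert

  bits : ∀ k → ℕ → Vec Bool k
  bits zero _ = []
  bits (suc k) x = (x % 2 ≡ᵇ 1) ∷ bits k (x / 2)

  value : List Bool → ℕ
  value [] = 0
  value (false ∷ v) = 2 * value v
  value (true ∷ v) = suc (2 * value v)

  heapPath : ℕ → ℕ → List Bool
  heapPath zero _ = []
  heapPath (suc k) h = if h ≤ᵇ 1 then [] else (h % 2 ≡ᵇ 1) ∷ heapPath k (h / 2)

  nthℕ : ℕ → List ℕ → ℕ
  nthℕ _ [] = 0
  nthℕ zero (x ∷ _) = x
  nthℕ (suc i) (_ ∷ xs) = nthℕ i xs

  position-of : ℕ → List ℕ → ℕ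
  position-of x [] = 0
  position-of x (y ∷ ys) = if y ≡ᵇ x then 0 else suc (position-of x ys)

  _==_ : List Bool → List Bool → Bool
  [] == [] = true
  (false ∷ xs) == (false ∷ ys) = xs == ys
  (true ∷ xs) == (true ∷ ys) = xs == ys
  _ == _ = false

  snocᵇ : List Bool → List Bool → Bool
  snocᵇ [] (_ ∷ []) = true
  snocᵇ (false ∷ xs) (false ∷ ys) = snocᵇ xs ys
  snocᵇ (true ∷ xs) (true ∷ ys) = snocᵇ xs ys
  snocᵇ _ _ = false

  snocᵇ-sound : ∀ xs ys → snocᵇ xs ys ≡ true → ∃ λ b → ys ≡ xs Data.List.∷ʳ b
  snocᵇ-sound [] (b ∷ []) _ = b , refl
  snocᵇ-sound (false ∷ xs) (false ∷ ys) h with snocᵇ-sound xs ys h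
  ... | b , eq = b , cong (false ∷_) eq
  snocᵇ-sound (true ∷ xs) (true ∷ ys) h with snocᵇ-sound xs ys h
  ... | b , eq = b , cong (true ∷_) eq

  finᵇ : Fin 3 → Fin 3 → Bool
  finᵇ c c′ = does (c Fin.≟ c′)

  finᵇ⇒≡ : ∀ {c c′} → finᵇ c c′ ≡ true → c ≡ c′
  finᵇ⇒≡ {c} {c′} h with c Fin.≟ c′
  ... | yes p = p

  finᵇ⇒≢ : ∀ {c c′} → not (finᵇ c c′) ≡ true → c ≢ c′
  finᵇ⇒≢ {c} {c′} h with c Fin.≟ c′
  ... | no p = p

  nth-ext : ∀ xs ys → length xs ≡ length ys → (∀ i → i < length xs → nth i xs ≡ nth i ys) → xs ≡ ys
  nth-ext [] [] _ _ = refl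
  nth-ext (x ∷ xs) (y ∷ ys) len h = cong₂ _∷_ (h 0 (s≤s z≤n)) (nth-ext xs ys (suc-injective len) (λ i lt → h (suc i) (s≤s lt)))

  address : ∀ {k} → Vec Bool (suc k) → List Bool
  address {zero} _ = []
  address {suc k} (b ∷ v) = b ∷ address v

  sign : ∀ {k} → Vec Bool (suc k) → Bool
  sign {zero} (s ∷ []) = s
  sign {suc k} (b ∷ v) = sign v

  toName : ∀ k → List Bool → Bool → Vec Bool (suc k)
  toName zero _ s = s ∷ []
  toName (suc k) [] s = false ∷ toName k [] s
  toName (suc k) (b ∷ π) s = b ∷ toName k π s

  length-address : ∀ {k} (v : Vec Bool (suc k)) → length (address v) ≡ k
  length-address {zero} _ = refl
  length-address {suc k} (b ∷ v) = cong suc (length-address v)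

  address-toName : ∀ k π {s} → length π ≡ k → address (toName k π s) ≡ π
  address-toName zero [] _ = refl
  address-toName (suc k) (b ∷ π) len = cong (b ∷_) (address-toName k π (suc-injective len))

  sign-toName : ∀ k π {s} → sign (toName k π s) ≡ s
  sign-toName zero π = refl
  sign-toName (suc k) [] = sign-toName k []
  sign-toName (suc k) (b ∷ π) = sign-toName k π

  module Check (e : ℕ) where

    Assignment : Set
    Assignment = Trie (Bits × Bits) (suc e)

    Name : Set
    Name = Vec Bool (suc e)

    -- Least significant bit first: the e low bits are the address of colour 0, the top bit tells a
    -- base vertex from its mate.
    name : ℕ → Name
    name = bits (suc e)

    -- Bits of colour 0 are part of the name; the unknowns are the labels of colours 1 and 2.
    row : Assignment → Fin 3 → Name → ℕ → Maybe Bool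
    row ρ zero v j = just (nth j (address v))
    row ρ (suc zero) v j = get j (proj₁ (find ρ v))
    row ρ (suc (suc zero)) v j = get j (proj₂ (find ρ v))

    assign : Fin 3 → ℕ → Name → Bool → Assignment → Assignment
    assign zero j v b ρ = ρ
    assign (suc zero) j v b ρ = update (λ (y , w) → set j b y , w) v ρ
    assign (suc (suc zero)) j v b ρ = update (λ (y , w) → y , set j b w) v ρ

    sameᵇ : Maybe Bool → Maybe Bool → Bool
    sameᵇ (just false) (just false) = true
    sameᵇ (just true) (just true) = true
    sameᵇ _ _ = false

    prefixᵇ : Assignment → Fin 3 → ℕ → Name → Name → Bool
    prefixᵇ ρ c zero v w = true
    prefixᵇ ρ c (suc i) v w = sameᵇ (row ρ c v i) (row ρ c w i) ∧ prefixᵇ ρ c i v w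

    differentᵇ : Name → Name → Bool
    differentᵇ v w = not ((address v == address w) ∧ does (sign v ≟ᴮ sign w))

    segmentᵇ : Assignment → Fin 3 → ℕ → Name → Name → Bool
    segmentᵇ ρ c i v w = (i ≤ᵇ e) ∧ (differentᵇ v w ∧ prefixᵇ ρ c i v w)

    routeᵇ : Assignment → Name → Fin 3 → ℕ → Name → Route → Bool
    routeᵇ ρ v₀ c i v end = segmentᵇ ρ c i v v₀
    routeᵇ ρ v₀ c i v (hop c′ i′ v′ r) = segmentᵇ ρ c i v (name v′) ∧ (not (finᵇ c c′) ∧ routeᵇ ρ v₀ c′ i′ (name v′) r)

    cost : ℕ → Route → ℕ
    cost i end = suc e ∸ i
    cost i (hop _ i′ _ r) = (suc e ∸ i) + cost i′ r

    -- The function `shared` once more, free of any graph, so that checking a certificate involves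
    -- only numbers and bits.
    sharedᵇ : ℕ → ℕ → List Bool → ℕ
    sharedᵇ j a [] = a
    sharedᵇ j a (false ∷ π) = sharedᵇ (suc j) a π
    sharedᵇ j a (true ∷ π) = sharedᵇ (suc j) (e ∸ j) π

    zerosᵇ : ℕ → List Bool → Bool
    zerosᵇ zero _ = true
    zerosᵇ (suc t) (false ∷ π) = zerosᵇ t π
    zerosᵇ (suc t) _ = false

    M : ℕ
    M = 2 ^ suc e ∸ 1

    -- The root is 0; then follow the three trees, each with its `M` nodes in heap order and
    -- addresses read from the low bit, and finally the opposite vertices in the order of their
    -- names.
    decode : ℕ → Code
    decode zero = origin
    decode (suc k) =
      if k <ᵇ M then node zero (heapPath (suc e) (suc k))
      else if k <ᵇ 2 * M then node (suc zero) (heapPath (suc e) (suc (k ∸ M)))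
      else if k <ᵇ 3 * M then node (suc (suc zero)) (heapPath (suc e) (suc (k ∸ 2 * M)))
      else (λ v → leaf (address v) (sign v)) (name (k ∸ 3 * M))

    encode : Code → ℕ
    encode origin = 0
    encode (node c π) = toℕ c * M + (value π + 2 ^ length π)
    encode (leaf π s) = suc (3 * M + (value π + (if s then 2 ^ e else 0)))

    validᵇ : Code → Bool
    validᵇ origin = true
    validᵇ (node c π) = length π ≤ᵇ e
    validᵇ (leaf π s) = length π ≡ᵇ e

    labelᵇ : Assignment → Fin 3 → List Bool → Name → ℕ → Bool
    labelᵇ ρ c π v zero = true
    labelᵇ ρ c π v (suc i) = sameᵇ (just (nth i π)) (row ρ c v i) ∧ labelᵇ ρ c π v i

    knownᵇ : Assignment → Code → Code → Bool
    knownᵇ ρ origin (node c []) = true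
    knownᵇ ρ (node c π) (node c′ π′) = (finᵇ c c′ ∧ (length π <ᵇ e)) ∧ snocᵇ π π′
    knownᵇ ρ (node c π) (leaf π′ s) = ((length π ≡ᵇ e) ∧ (length π′ ≡ᵇ e)) ∧ labelᵇ ρ c π (toName e π′ s) e
    knownᵇ ρ _ _ = false

    -- Recovering the index i from the code of the i-th entry shows that different entries have
    -- different codes. This tests injectivity in one pass and needs no proof that `encode` inverts
    -- `decode`.
    tableᵇ : ℕ → List (ℕ × ℕ) → List ℕ → Assignment → Bool
    tableᵇ m es table ρ =
      all (λ i → validᵇ (decode (nthℕ i table)) ∧ (position-of (encode (decode (nthℕ i table))) table ≡ᵇ i)) (upTo m)
      ∧ all (λ (a , b) → knownᵇ ρ (decode (nthℕ a table)) (decode (nthℕ b table)) ∨ knownᵇ ρ (decode (nthℕ b table)) (decode (nthℕ a table))) es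

    trueᵇ : Maybe Bool → Bool
    trueᵇ (just true) = true
    trueᵇ _ = false

    z₀-name : Name
    z₀-name = toName e (replicate e false) false

    checkᵇ : ℕ → List (ℕ × ℕ) → Assignment → Cert → Bool
    checkᵇ m es ρ (split c j v f t) = not (finᵇ c zero) ∧ (checkᵇ m es (assign c j (name v) false ρ) f ∧ checkᵇ m es (assign c j (name v) true ρ) t)
    checkᵇ m es ρ (clash end) = false
    checkᵇ m es ρ (clash (hop c i v r)) = (cost i r ≤ᵇ suc e) ∧ routeᵇ ρ (name v) c i (name v) r
    -- The agreement computed by `shared` is that of the base vertex, so the sign has to be `false`.
    checkᵇ m es ρ (common j v) = trueᵇ (row ρ (suc zero) (name v) j) ∧ (not (sign (name v)) ∧ ((j <ᵇ sharedᵇ 0 e (address (name v))) ∧ (sharedᵇ 0 e (address (name v)) ≤ᵇ e)))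
    checkᵇ m es ρ (zero j) = trueᵇ (row ρ (suc (suc zero)) z₀-name j)
    -- If the first e - j address bits are 0, the vertex agrees with `z₀` for e - j steps in colour
    -- 0, which is what `lab-gauge` requires at bit j.
    checkᵇ m es ρ (gauge c j k v) = not (finᵇ c zero) ∧ (((trueᵇ (row ρ c (name v) j) ∧ trueᵇ (row ρ c (name v) k)) ∧ ((j <ᵇ k) ∧ (j <ᵇ e))) ∧ zerosᵇ (e ∸ j) (address (name v)))
    checkᵇ m es ρ (done table) = tableᵇ m es table ρ

    unknown : Assignment
    unknown = constant (suc e) (replicate e nothing , replicate e nothing)

  module Sound {n : ℕ} (Γ : Graph n) (e : ℕ)
    (Γ-girth : Girth Γ (2 * suc (suc e)))
    (conn : Connected Γ) (reg : Regular Γ 3)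
    (moore : GirthCycles.Moore Γ e (proj₂ Γ-girth)) where

    open Check e
    open Labelling Γ e Γ-girth conn reg moore

    named : Name → Z
    named v = zname (address v) (sign v)

    bitOf : Fin 3 → Name → ℕ → Bool
    bitOf zero v j = nth j (address v)
    bitOf (suc c) v j = nth j (label (suc c) (named v))

    Sound-row : Name → Bits × Bits → Set
    Sound-row v (ys , ws) = (∀ i x → get i ys ≡ just x → bitOf (suc zero) v i ≡ x) × (∀ i x → get i ws ≡ just x → bitOf (suc (suc zero)) v i ≡ x)

    Consistent : Assignment → Set
    Consistent ρ = ∀ v → Sound-row v (find ρ v)

    row-sound : ∀ {ρ} → Consistent ρ → ∀ c v j {x} → row ρ c v j ≡ just x → bitOf c v j ≡ x
    row-sound con zero v j refl = refl
    row-sound con (suc zero) v j eq = proj₁ (con v) j _ eq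
    row-sound con (suc (suc zero)) v j eq = proj₂ (con v) j _ eq

    assign-sound : ∀ {ρ} → Consistent ρ → ∀ c j v b → c ≢ zero → bitOf c v j ≡ b → Consistent (assign c j v b ρ)
    assign-sound con zero j v b c≢0 eq = ⊥-elim (c≢0 refl)
    assign-sound {ρ} con (suc zero) j v b _ eq = find-update Sound-row (λ (y , w) → set j b y , w) v ρ con
      (get-set (λ i x → bitOf (suc zero) v i ≡ x) j b (proj₁ (find ρ v)) (proj₁ (con v)) eq , proj₂ (con v))
    assign-sound {ρ} con (suc (suc zero)) j v b _ eq = find-update Sound-row (λ (y , w) → y , set j b w) v ρ con
      (proj₁ (con v) , get-set (λ i x → bitOf (suc (suc zero)) v i ≡ x) j b (proj₂ (find ρ v)) (proj₂ (con v)) eq)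

    sameᵇ-sound : ∀ {x y} → sameᵇ x y ≡ true → ∃ λ b → x ≡ just b × y ≡ just b
    sameᵇ-sound {just false} {just false} _ = false , refl , refl
    sameᵇ-sound {just true} {just true} _ = true , refl , refl

    prefix-sound : ∀ {ρ} → Consistent ρ → ∀ c t v w → prefixᵇ ρ c t v w ≡ true → ∀ i → i < t → bitOf c v i ≡ bitOf c w i
    prefix-sound {ρ} con c (suc t) v w h i (s≤s i≤t) with ∧-true⁻ {sameᵇ (row ρ c v t) (row ρ c w t)} h
    ... | p , q with m≤n⇒m<n∨m≡n i≤t
      where open import Data.Nat.Properties using (m≤n⇒m<n∨m≡n)
    ...   | inj₁ lt = prefix-sound con c t v w q i lt
    ...   | inj₂ refl with sameᵇ-sound {row ρ c v i} {row ρ c w i} p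
    ...     | b , eq , eq′ = trans (row-sound {ρ} con c v i eq) (sym (row-sound {ρ} con c w i eq′))

    bits⇒R : ∀ c t v w → t ≤ e → (∀ i → i < t → bitOf c v i ≡ bitOf c w i) → R c t (named v) (named w)
    bits⇒R zero t v w le h = zname-R t (address v) (sign v) (address w) (sign w) (length-address v) (length-address w) le h
    bits⇒R (suc c) t v w le h = lab-R (suc c) t {0} {e} {z₀} {named v} {named w} ≤-refl le refl refl h

    different-sound : ∀ v w → differentᵇ v w ≡ true → named v ≢ named w
    different-sound v w h eq with zname-injective {address v} {sign v} {address w} {sign w} (length-address v) (length-address w) eq
    ... | p , q = false≢true (trans (sym (cong not both)) h)
      where
      refl-== : ∀ xs → (xs == xs) ≡ true
      refl-== [] = refl
      refl-== (false ∷ xs) = refl-== xs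
      refl-== (true ∷ xs) = refl-== xs
      refl-≟ : ∀ b → does (b ≟ᴮ b) ≡ true
      refl-≟ false = refl
      refl-≟ true = refl
      both : (address v == address w) ∧ does (sign v ≟ᴮ sign w) ≡ true
      both = ∧-true⁺ (subst (λ l → (address v == l) ≡ true) p (refl-== (address v))) (subst (λ b → does (sign v ≟ᴮ b) ≡ true) q (refl-≟ (sign v)))

    segment-sound : ∀ {ρ} → Consistent ρ → ∀ c i v w → segmentᵇ ρ c i v w ≡ true → R c i (named v) (named w) × named v ≢ named w
    segment-sound {ρ} con c i v w h with ∧-true⁻ {i ≤ᵇ e} h
    ... | p , h′ with ∧-true⁻ {differentᵇ v w} h′
    ... | q , r = bits⇒R c i v w (≤ᵇ⇒≤ i e (≡true⇒T p)) (prefix-sound {ρ} con c i v w r) , different-sound v w q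

    route-sound : ∀ {ρ} → Consistent ρ → ∀ v₀ c i v r → routeᵇ ρ v₀ c i v r ≡ true → ∃ λ c′ → Chain c (named v) c′ (named v₀) (cost i r)
    route-sound {ρ} con v₀ c i v end h with segment-sound {ρ} con c i v v₀ h
    ... | p , q = c , single {c} {i} p q
    route-sound {ρ} con v₀ c i v (hop c′ i′ v′ r) h with ∧-true⁻ {segmentᵇ ρ c i v (name v′)} h
    ... | s , h′ with ∧-true⁻ {not (finᵇ c c′)} h′
    ... | d , h″ with segment-sound {ρ} con c i v (name v′) s | route-sound {ρ} con v₀ c′ i′ (name v′) r h″
    ... | p , q | c″ , ch = c″ , more {c} {c′} {c″} {i} p q (finᵇ⇒≢ d) ch

    trueᵇ-sound : ∀ {ρ} → Consistent ρ → ∀ c v j → trueᵇ (row ρ c v j) ≡ true → bitOf c v j ≡ true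
    trueᵇ-sound {ρ} con c v j h with row ρ c v j in eq
    ... | just true = row-sound {ρ} con c v j eq

    sharedᵇ≡ : ∀ j a π → sharedᵇ j a π ≡ shared j a π
    sharedᵇ≡ j a [] = refl
    sharedᵇ≡ j a (false ∷ π) = sharedᵇ≡ (suc j) a π
    sharedᵇ≡ j a (true ∷ π) = sharedᵇ≡ (suc j) (e ∸ j) π

    zeros-sound : ∀ t π → zerosᵇ t π ≡ true → ∀ i → i < t → nth i π ≡ false
    zeros-sound (suc t) (false ∷ π) h zero _ = refl
    zeros-sound (suc t) (false ∷ π) h (suc i) (s≤s lt) = zeros-sound t π h i lt

    rep-replicate : ∀ c j cur k → rep c j cur (replicate k false) ≡ cur
    rep-replicate c j cur zero = refl
    rep-replicate c j cur (suc k) = rep-replicate c (suc j) cur k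

    named-z₀ : named z₀-name ≡ z₀
    named-z₀ = trans (cong₂ zname (address-toName e (replicate e false) (length-replicate e)) (sign-toName e (replicate e false))) (rep-replicate zero 0 z₀ e)

    label-sound : ∀ {ρ} → Consistent ρ → ∀ c π v t → labelᵇ ρ c π v t ≡ true → ∀ i → i < t → nth i π ≡ bitOf c v i
    label-sound {ρ} con c π v (suc t) h i (s≤s i≤t) with ∧-true⁻ {sameᵇ (just (nth t π)) (row ρ c v t)} h
    ... | p , q with m≤n⇒m<n∨m≡n i≤t
      where open import Data.Nat.Properties using (m≤n⇒m<n∨m≡n)
    ...   | inj₁ lt = label-sound con c π v t q i lt
    ...   | inj₂ refl with sameᵇ-sound {just (nth i π)} {row ρ c v i} p
    ...     | b , refl , eq′ = sym (row-sound {ρ} con c v i eq′)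

    known-sound : ∀ {ρ} → Consistent ρ → ∀ x y → knownᵇ ρ x y ≡ true → vert x ~ vert y
    known-sound con origin (node c []) h = origin~node c
    known-sound con (node c π) (node c′ π′) h with ∧-true⁻ {finᵇ c c′ ∧ (length π <ᵇ e)} h
    ... | p , q with ∧-true⁻ {finᵇ c c′} p
    ... | p₁ , p₂ with finᵇ⇒≡ {c} {c′} p₁ | snocᵇ-sound π π′ q
    ... | refl | b , refl = node~node c π b (<ᵇ⇒< (length π) e (≡true⇒T p₂))
    known-sound {ρ} con (node c π) (leaf π′ s) h with ∧-true⁻ {(length π ≡ᵇ e) ∧ (length π′ ≡ᵇ e)} h
    ... | p , q with ∧-true⁻ {length π ≡ᵇ e} p
    ... | p₁ , p₂ = subst (λ z → vert (node c π) ~ vertex z) named≡ (joined c (≡ᵇ⇒≡ (length π) e (≡true⇒T p₁)) (label-sound {ρ} con c π v e q))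
      where
      v = toName e π′ s
      named≡ : named v ≡ zname π′ s
      named≡ = cong₂ zname (address-toName e π′ (≡ᵇ⇒≡ (length π′) e (≡true⇒T p₂))) (sign-toName e π′)
      joined : ∀ c → length π ≡ e → (∀ i → i < e → nth i π ≡ bitOf c v i) → vert (node c π) ~ vertex (named v)
      joined zero len h = subst (λ π → vert (node zero π) ~ vertex (named v)) (sym (nth-ext π (address v) (trans len (sym (length-address v))) (λ i lt → h i (subst (i <_) len lt))))
        (node~leaf zero (address v) (named v) (length-address v) (zname-base (address v) (sign v)))
      joined (suc c) len h = subst (λ π → vert (node (suc c) π) ~ vertex (named v))
        (sym (nth-ext π (label (suc c) (named v)) (trans len (sym (length-lab (suc c) 0 e (named v) z₀))) (λ i lt → h i (subst (i <_) len lt))))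
        (node~label (suc c) (named v))

    valid-sound : ∀ x → validᵇ x ≡ true → Valid e x
    valid-sound origin _ = origin
    valid-sound (node c π) h = node (≤ᵇ⇒≤ (length π) e (≡true⇒T h))
    valid-sound (leaf π s) h = leaf (≡ᵇ⇒≡ (length π) e (≡true⇒T h))

    module Target {m : ℕ} (H : Graph m) (es : List (ℕ × ℕ)) (edges : EdgeList H es) (cubic : cubicᵇ m es ≡ true) (u₀ : Fin m) where

      table-sound : ∀ {ρ} → Consistent ρ → ∀ table → tableᵇ m es table ρ ≡ true → Γ ≅ H
      table-sound {ρ} con table h with ∧-true⁻ {all (λ i → validᵇ (decode (nthℕ i table)) ∧ (position-of (encode (decode (nthℕ i table))) table ≡ᵇ i)) (upTo m)} h
      ... | h₁ , h₂ = Cover.cover Γ H conn reg φ φ-injective φ-adj (cubic-three {m} {H} {es} edges cubic) u₀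
        where
        code : Fin m → Code
        code u = decode (nthℕ (toℕ u) table)
        entry : ∀ u → validᵇ (code u) ≡ true × position-of (encode (code u)) table ≡ toℕ u
        entry u with ∧-true⁻ {validᵇ (code u)} (all-∈ (λ i → validᵇ (decode (nthℕ i table)) ∧ (position-of (encode (decode (nthℕ i table))) table ≡ᵇ i)) {x = toℕ u} h₁ (∈-upTo⁺ (Fin.toℕ<n u)))
        ... | p , q = p , ≡ᵇ⇒≡ _ (toℕ u) (≡true⇒T q)
        φ : Fin m → V
        φ u = vert (code u)
        φ-injective : ∀ {u v} → φ u ≡ φ v → u ≡ v
        φ-injective {u} {v} eq = Fin.toℕ-injective (trans (sym (proj₂ (entry u)))
          (trans (cong (λ x → position-of (encode x) table) (vert-injective (valid-sound (code u) (proj₁ (entry u))) (valid-sound (code v) (proj₁ (entry v))) eq)) (proj₂ (entry v))))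
        edge : ∀ {a b} → (a , b) ∈ es → vert (decode (nthℕ a table)) ~ vert (decode (nthℕ b table))
        edge {a} {b} p with ∨-true⁻ {knownᵇ ρ (decode (nthℕ a table)) (decode (nthℕ b table))}
            (all-∈ (λ (a , b) → knownᵇ ρ (decode (nthℕ a table)) (decode (nthℕ b table)) ∨ knownᵇ ρ (decode (nthℕ b table)) (decode (nthℕ a table))) {x = a , b} h₂ p)
        ... | inj₁ k = known-sound {ρ} con (decode (nthℕ a table)) (decode (nthℕ b table)) k
        ... | inj₂ k = ~-sym (known-sound {ρ} con (decode (nthℕ b table)) (decode (nthℕ a table)) k)
        φ-adj : ∀ u v → adj H u v ≡ true → φ u ~ φ v
        φ-adj u v a with ∧-true⁻ {not (does (u Fin.≟ v))} (trans (sym (edges u v)) a)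
        ... | _ , b with edgeIn-∈ es b
        ...   | inj₁ p = edge p
        ...   | inj₂ p = ~-sym (edge p)

      -- `Γ` itself selects a path through the tree, at every `split` the branch of the actual bit,
      -- so the assignment stays true of `Γ`. A refuting leaf on this path is absurd; the path must
      -- end in a table, which is an isomorphism.
      check-sound : ∀ {ρ} → Consistent ρ → ∀ t → checkᵇ m es ρ t ≡ true → Γ ≅ H
      check-sound {ρ} con (split c j v f t) h with ∧-true⁻ {not (finᵇ c zero)} h
      ... | c≢0 , h′ with ∧-true⁻ {checkᵇ m es (assign c j (name v) false ρ) f} h′
      ... | hf , ht with bitOf c (name v) j in eq
      ...   | false = check-sound (assign-sound {ρ} con c j (name v) false (finᵇ⇒≢ c≢0) eq) f hf
      ...   | true = check-sound (assign-sound {ρ} con c j (name v) true (finᵇ⇒≢ c≢0) eq) t ht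
      check-sound {ρ} con (clash (hop c i v r)) h with ∧-true⁻ {cost i r ≤ᵇ suc e} h
      ... | p , q with route-sound {ρ} con (name v) c i (name v) r q
      ... | c′ , ch = ⊥-elim (Chain-closed ch (≤ᵇ⇒≤ (cost i r) (suc e) (≡true⇒T p)))
      check-sound {ρ} con (common j v) h with ∧-true⁻ {trueᵇ (row ρ (suc zero) (name v) j)} h
      ... | p , h′ with ∧-true⁻ {not (sign (name v))} h′
      ... | s , h″ with ∧-true⁻ {j <ᵇ sharedᵇ 0 e (address (name v))} h″
      ... | lt , le = ⊥-elim (false≢true (trans (sym bit-false) (trueᵇ-sound {ρ} con (suc zero) (name v) j p)))
        where
        k = sharedᵇ 0 e (address (name v))
        base≡ : base (address (name v)) ≡ named (name v)
        base≡ = cong (zname (address (name v))) (sym (not-true⁻ s))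
        r : R (suc zero) k z₀ (named (name v))
        r = subst (λ z → R (suc zero) k z₀ z) base≡ (subst (λ k → R (suc zero) k z₀ (base (address (name v)))) (sym (sharedᵇ≡ 0 e (address (name v))))
          (shared-R {0} {e} {z₀} (address (name v)) (≤-reflexive (length-address (name v))) refl))
        bit-false : bitOf (suc zero) (name v) j ≡ false
        bit-false = lab-prefix-false (suc zero) k {0} {e} {z₀} {named (name v)} (≤ᵇ⇒≤ k e (≡true⇒T le)) r j (<ᵇ⇒< j k (≡true⇒T lt))
      check-sound {ρ} con (zero j) h = ⊥-elim (false≢true (trans (sym (trans (cong (λ z → nth j (label (suc (suc zero)) z)) named-z₀) (lab-self (suc (suc zero)) {0} e z₀ j)))
        (trueᵇ-sound {ρ} con (suc (suc zero)) z₀-name j h)))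
      check-sound {ρ} con (gauge (suc c) j k v) h with ∧-true⁻ {(trueᵇ (row ρ (suc c) (name v) j) ∧ trueᵇ (row ρ (suc c) (name v) k)) ∧ ((j <ᵇ k) ∧ (j <ᵇ e))} h
      ... | h₁ , z with ∧-true⁻ {trueᵇ (row ρ (suc c) (name v) j) ∧ trueᵇ (row ρ (suc c) (name v) k)} h₁
      ... | h₂ , h₃ with ∧-true⁻ {trueᵇ (row ρ (suc c) (name v) j)} h₂ | ∧-true⁻ {j <ᵇ k} h₃
      ... | bj , bk | j<k , j<e = ⊥-elim (false≢true (trans (sym
            (lab-gauge c j {0} {e} {z₀} {named (name v)} ≤-refl refl (<ᵇ⇒< j e (≡true⇒T j<e)) (trueᵇ-sound {ρ} con (suc c) (name v) j bj)
              (zname-zero (e ∸ j) (address (name v)) (sign (name v)) (length-address (name v)) (m∸n≤m e j) (zeros-sound (e ∸ j) (address (name v)) z))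
              k (<ᵇ⇒< j k (≡true⇒T j<k))))
          (trueᵇ-sound {ρ} con (suc c) (name v) k bk)))
      check-sound {ρ} con (done table) h = table-sound {ρ} con table h

      unknown-consistent : Consistent unknown
      unknown-consistent v = subst (Sound-row v) (sym (find-constant (suc e) v)) (none (suc zero) , none (suc (suc zero)))
        where
        get-nothing : ∀ k i → get i (replicate k nothing) ≡ nothing
        get-nothing zero i = refl
        get-nothing (suc k) zero = refl
        get-nothing (suc k) (suc i) = get-nothing k i
        none : ∀ c i x → get i (replicate e nothing) ≡ just x → bitOf c v i ≡ x
        none c i x eq with trans (sym (get-nothing e i)) eq
        ... | ()

      recognise : ∀ t → checkᵇ m es unknown t ≡ true → Γ ≅ H
      recognise = check-sound unknown-consistent

-- Edge lists and case trees for the four graphs.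

module Certificates where

  open import Defs using (K33; heawood; tutteCoxeter; tutte12cage)
  open Recognition
  open import Data.Nat using (ℕ)
  open import Data.Fin using (Fin; zero; suc)

  -- The colours.  The branching order of the certificates comes from a lookahead search.
  x y w : Fin 3
  x = zero
  y = suc zero
  w = suc (suc zero)

  K33-list : List (ℕ × ℕ)
  K33-list =
    (0 , 3) ∷ (0 , 4) ∷ (0 , 5) ∷ (1 , 3) ∷ (1 , 4) ∷ (1 , 5) ∷ (2 , 3) ∷ (2 , 4) ∷ (2 , 5) ∷ []

  K33-edges : EdgeList {6} (K33) K33-list
  K33-edges u v = refl

  K33-cubic : cubicᵇ 6 K33-list ≡ true
  K33-cubic = refl

  solution0-1 : List ℕ
  solution0-1 =
    0 ∷ 4 ∷ 5 ∷ 1 ∷ 2 ∷ 3 ∷ []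

  -- For e = 0 labels are empty, so there is nothing to branch on.
  certificate0 : Cert
  certificate0 =
    done solution0-1

  certificate0-valid : Check.checkᵇ 0 6 K33-list (Check.unknown 0) certificate0 ≡ true
  certificate0-valid = refl

  heawood-list : List (ℕ × ℕ)
  heawood-list =
    (0 , 1) ∷ (0 , 5) ∷ (1 , 2) ∷ (1 , 10) ∷ (2 , 3) ∷ (2 , 7) ∷ (3 , 4) ∷ (3 , 12) ∷ (4 , 5) ∷ (4 , 9) ∷
    (5 , 6) ∷ (5 , 0) ∷ (6 , 7) ∷ (6 , 11) ∷ (7 , 8) ∷ (7 , 2) ∷ (8 , 9) ∷ (8 , 13) ∷ (9 , 10) ∷ (9 , 4) ∷
    (10 , 11) ∷ (10 , 1) ∷ (11 , 12) ∷ (11 , 6) ∷ (12 , 13) ∷ (12 , 3) ∷ (13 , 0) ∷ (13 , 8) ∷ []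

  heawood-edges : EdgeList {14} (proj₂ heawood) heawood-list
  heawood-edges u v = refl

  heawood-cubic : cubicᵇ 14 heawood-list ≡ true
  heawood-cubic = refl

  solution1-1 : List ℕ
  solution1-1 =
    0 ∷ 1 ∷ 2 ∷ 10 ∷ 5 ∷ 4 ∷ 6 ∷ 12 ∷ 9 ∷ 11 ∷ 3 ∷ 13 ∷ 8 ∷ 7 ∷ []

  -- The bits fixed by the normalisation are split first; their second branches, refuted by `common`
  -- and `zero`, therefore stand at the end.
  certificate1 : Cert
  certificate1 =
    split w 0 0 (split y 0 1 (split y 0 0 (split y 0 2 (clash (hop x 1 2 (hop y 1 0 end)))
    (split y 0 3 (clash (hop x 1 3 (hop y 1 1 end)))
    (split w 0 2 (clash (hop x 1 2 (hop w 1 0 end)))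
    (split w 0 1 (clash (hop y 1 1 (hop w 1 0 end)))
    (split w 0 3 (done solution1-1)
    (clash (hop y 1 3 (hop w 1 2 end))))))))
    (common 0 0))
    (common 0 1))
    (zero 0)

  certificate1-valid : Check.checkᵇ 1 14 heawood-list (Check.unknown 1) certificate1 ≡ true
  certificate1-valid = refl

  tutteCoxeter-list : List (ℕ × ℕ)
  tutteCoxeter-list =
    (0 , 1) ∷ (0 , 17) ∷ (1 , 2) ∷ (1 , 22) ∷ (2 , 3) ∷ (2 , 9) ∷ (3 , 4) ∷ (3 , 26) ∷ (4 , 5) ∷ (4 , 13) ∷
    (5 , 6) ∷ (5 , 18) ∷ (6 , 7) ∷ (6 , 23) ∷ (7 , 8) ∷ (7 , 28) ∷ (8 , 9) ∷ (8 , 15) ∷ (9 , 10) ∷ (9 , 2) ∷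
    (10 , 11) ∷ (10 , 19) ∷ (11 , 12) ∷ (11 , 24) ∷ (12 , 13) ∷ (12 , 29) ∷ (13 , 14) ∷ (13 , 4) ∷ (14 , 15) ∷
    (14 , 21) ∷ (15 , 16) ∷ (15 , 8) ∷ (16 , 17) ∷ (16 , 25) ∷ (17 , 18) ∷ (17 , 0) ∷ (18 , 19) ∷ (18 , 5) ∷
    (19 , 20) ∷ (19 , 10) ∷ (20 , 21) ∷ (20 , 27) ∷ (21 , 22) ∷ (21 , 14) ∷ (22 , 23) ∷ (22 , 1) ∷ (23 , 24) ∷
    (23 , 6) ∷ (24 , 25) ∷ (24 , 11) ∷ (25 , 26) ∷ (25 , 16) ∷ (26 , 27) ∷ (26 , 3) ∷ (27 , 28) ∷ (27 , 20) ∷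
    (28 , 29) ∷ (28 , 7) ∷ (29 , 0) ∷ (29 , 12) ∷ []

  tutteCoxeter-edges : EdgeList {30} (proj₂ tutteCoxeter) tutteCoxeter-list
  tutteCoxeter-edges u v = refl

  tutteCoxeter-cubic : cubicᵇ 30 tutteCoxeter-list ≡ true
  tutteCoxeter-cubic = refl

  solution2-1 : List ℕ
  solution2-1 =
    0 ∷ 1 ∷ 2 ∷ 4 ∷ 22 ∷ 11 ∷ 23 ∷ 21 ∷ 28 ∷ 6 ∷ 24 ∷ 20 ∷ 16 ∷ 18 ∷ 29 ∷ 14 ∷ 10 ∷ 8 ∷ 9 ∷ 13 ∷ 25 ∷ 7 ∷ 3 ∷
    5 ∷ 27 ∷ 12 ∷ 26 ∷ 19 ∷ 17 ∷ 15 ∷ []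

  certificate2 : Cert
  certificate2 =
    split w 1 0 (split w 0 0 (split y 1 1 (split y 1 0 (split y 0 3 (split y 0 1 (split y 0 2 (split y 0 0 (split y 0 4 (clash (hop x 2 4 (hop y 1 0 end)))
    (split y 0 6 (clash (hop x 2 6 (hop y 1 2 end)))
    (split y 1 2 (clash (hop x 1 2 (hop y 2 0 end)))
    (split y 0 5 (clash (hop x 2 5 (hop y 1 1 end)))
    (split y 0 7 (clash (hop x 2 7 (hop y 1 3 end)))
    (split y 1 3 (clash (hop x 1 3 (hop y 2 1 end)))
    (split w 0 4 (clash (hop x 2 4 (hop w 1 0 end)))
    (split w 0 1 (clash (hop y 2 1 (hop w 1 0 end)))
    (split w 0 5 (split w 1 5 (clash (hop x 2 5 (hop y 2 1 (hop w 2 0 end))))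
    (split y 1 4 (split y 1 6 (clash (hop x 1 6 (hop y 2 4 end)))
    (split w 1 4 (split w 1 1 (clash (hop x 2 4 (hop y 2 0 (hop w 2 1 end))))
    (split w 0 2 (split w 0 6 (clash (hop x 2 6 (hop w 1 2 end)))
    (split w 0 3 (clash (hop y 2 3 (hop w 1 2 end)))
    (split w 0 7 (split w 1 2 (clash (hop x 1 2 (hop w 2 0 end)))
    (split w 1 6 (clash (hop x 1 6 (hop w 2 4 end)))
    (split w 1 3 (split w 1 7 (split y 1 5 (split y 1 7 (clash (hop x 1 7 (hop y 2 5 end)))
    (done solution2-1))
    (clash (hop x 2 2 (hop y 2 6 (hop w 2 5 end)))))
    (clash (hop x 1 7 (hop w 2 5 end))))
    (clash (hop x 1 3 (hop w 2 1 end))))))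
    (clash (hop x 2 7 (hop w 1 3 end))))))
    (split w 1 2 (clash (hop x 1 2 (hop w 2 4 end)))
    (clash (hop y 1 1 (hop w 2 2 end))))))
    (gauge w 0 1 4)))
    (gauge y 0 1 4)))
    (clash (hop x 2 5 (hop w 1 1 end))))))))))))
    (common 0 0))
    (common 0 2))
    (common 0 1))
    (common 0 3))
    (common 1 0))
    (common 1 1))
    (zero 0))
    (zero 1)

  certificate2-valid : Check.checkᵇ 2 30 tutteCoxeter-list (Check.unknown 2) certificate2 ≡ true
  certificate2-valid = refl

  tutte12cage-list : List (ℕ × ℕ)
  tutte12cage-list =
    (0 , 1) ∷ (0 , 17) ∷ (1 , 2) ∷ (1 , 28) ∷ (2 , 3) ∷ (2 , 115) ∷ (3 , 4) ∷ (3 , 70) ∷ (4 , 5) ∷ (4 , 95) ∷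
    (5 , 6) ∷ (5 , 40) ∷ (6 , 7) ∷ (6 , 121) ∷ (7 , 8) ∷ (7 , 20) ∷ (8 , 9) ∷ (8 , 81) ∷ (9 , 10) ∷ (9 , 62) ∷
    (10 , 11) ∷ (10 , 109) ∷ (11 , 12) ∷ (11 , 32) ∷ (12 , 13) ∷ (12 , 69) ∷ (13 , 14) ∷ (13 , 24) ∷
    (14 , 15) ∷ (14 , 119) ∷ (15 , 16) ∷ (15 , 84) ∷ (16 , 17) ∷ (16 , 75) ∷ (17 , 18) ∷ (17 , 0) ∷ (18 , 19) ∷
    (18 , 35) ∷ (19 , 20) ∷ (19 , 46) ∷ (20 , 21) ∷ (20 , 7) ∷ (21 , 22) ∷ (21 , 88) ∷ (22 , 23) ∷ (22 , 113) ∷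
    (23 , 24) ∷ (23 , 58) ∷ (24 , 25) ∷ (24 , 13) ∷ (25 , 26) ∷ (25 , 38) ∷ (26 , 27) ∷ (26 , 99) ∷ (27 , 28) ∷
    (27 , 80) ∷ (28 , 29) ∷ (28 , 1) ∷ (29 , 30) ∷ (29 , 50) ∷ (30 , 31) ∷ (30 , 87) ∷ (31 , 32) ∷ (31 , 42) ∷
    (32 , 33) ∷ (32 , 11) ∷ (33 , 34) ∷ (33 , 102) ∷ (34 , 35) ∷ (34 , 93) ∷ (35 , 36) ∷ (35 , 18) ∷
    (36 , 37) ∷ (36 , 53) ∷ (37 , 38) ∷ (37 , 64) ∷ (38 , 39) ∷ (38 , 25) ∷ (39 , 40) ∷ (39 , 106) ∷
    (40 , 41) ∷ (40 , 5) ∷ (41 , 42) ∷ (41 , 76) ∷ (42 , 43) ∷ (42 , 31) ∷ (43 , 44) ∷ (43 , 56) ∷ (44 , 45) ∷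
    (44 , 117) ∷ (45 , 46) ∷ (45 , 98) ∷ (46 , 47) ∷ (46 , 19) ∷ (47 , 48) ∷ (47 , 68) ∷ (48 , 49) ∷
    (48 , 105) ∷ (49 , 50) ∷ (49 , 60) ∷ (50 , 51) ∷ (50 , 29) ∷ (51 , 52) ∷ (51 , 120) ∷ (52 , 53) ∷
    (52 , 111) ∷ (53 , 54) ∷ (53 , 36) ∷ (54 , 55) ∷ (54 , 71) ∷ (55 , 56) ∷ (55 , 82) ∷ (56 , 57) ∷
    (56 , 43) ∷ (57 , 58) ∷ (57 , 124) ∷ (58 , 59) ∷ (58 , 23) ∷ (59 , 60) ∷ (59 , 94) ∷ (60 , 61) ∷
    (60 , 49) ∷ (61 , 62) ∷ (61 , 74) ∷ (62 , 63) ∷ (62 , 9) ∷ (63 , 64) ∷ (63 , 116) ∷ (64 , 65) ∷ (64 , 37) ∷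
    (65 , 66) ∷ (65 , 86) ∷ (66 , 67) ∷ (66 , 123) ∷ (67 , 68) ∷ (67 , 78) ∷ (68 , 69) ∷ (68 , 47) ∷
    (69 , 70) ∷ (69 , 12) ∷ (70 , 71) ∷ (70 , 3) ∷ (71 , 72) ∷ (71 , 54) ∷ (72 , 73) ∷ (72 , 89) ∷ (73 , 74) ∷
    (73 , 100) ∷ (74 , 75) ∷ (74 , 61) ∷ (75 , 76) ∷ (75 , 16) ∷ (76 , 77) ∷ (76 , 41) ∷ (77 , 78) ∷
    (77 , 112) ∷ (78 , 79) ∷ (78 , 67) ∷ (79 , 80) ∷ (79 , 92) ∷ (80 , 81) ∷ (80 , 27) ∷ (81 , 82) ∷ (81 , 8) ∷
    (82 , 83) ∷ (82 , 55) ∷ (83 , 84) ∷ (83 , 104) ∷ (84 , 85) ∷ (84 , 15) ∷ (85 , 86) ∷ (85 , 96) ∷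
    (86 , 87) ∷ (86 , 65) ∷ (87 , 88) ∷ (87 , 30) ∷ (88 , 89) ∷ (88 , 21) ∷ (89 , 90) ∷ (89 , 72) ∷ (90 , 91) ∷
    (90 , 107) ∷ (91 , 92) ∷ (91 , 118) ∷ (92 , 93) ∷ (92 , 79) ∷ (93 , 94) ∷ (93 , 34) ∷ (94 , 95) ∷
    (94 , 59) ∷ (95 , 96) ∷ (95 , 4) ∷ (96 , 97) ∷ (96 , 85) ∷ (97 , 98) ∷ (97 , 110) ∷ (98 , 99) ∷ (98 , 45) ∷
    (99 , 100) ∷ (99 , 26) ∷ (100 , 101) ∷ (100 , 73) ∷ (101 , 102) ∷ (101 , 122) ∷ (102 , 103) ∷ (102 , 33) ∷
    (103 , 104) ∷ (103 , 114) ∷ (104 , 105) ∷ (104 , 83) ∷ (105 , 106) ∷ (105 , 48) ∷ (106 , 107) ∷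
    (106 , 39) ∷ (107 , 108) ∷ (107 , 90) ∷ (108 , 109) ∷ (108 , 125) ∷ (109 , 110) ∷ (109 , 10) ∷
    (110 , 111) ∷ (110 , 97) ∷ (111 , 112) ∷ (111 , 52) ∷ (112 , 113) ∷ (112 , 77) ∷ (113 , 114) ∷ (113 , 22) ∷
    (114 , 115) ∷ (114 , 103) ∷ (115 , 116) ∷ (115 , 2) ∷ (116 , 117) ∷ (116 , 63) ∷ (117 , 118) ∷ (117 , 44) ∷
    (118 , 119) ∷ (118 , 91) ∷ (119 , 120) ∷ (119 , 14) ∷ (120 , 121) ∷ (120 , 51) ∷ (121 , 122) ∷ (121 , 6) ∷
    (122 , 123) ∷ (122 , 101) ∷ (123 , 124) ∷ (123 , 66) ∷ (124 , 125) ∷ (124 , 57) ∷ (125 , 0) ∷ (125 , 108) ∷ []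

  tutte12cage-edges : EdgeList {126} (proj₂ tutte12cage) tutte12cage-list
  tutte12cage-edges u v = refl

  tutte12cage-cubic : cubicᵇ 126 tutte12cage-list ≡ true
  tutte12cage-cubic = refl

  solution4-1 : List ℕ
  solution4-1 =
    0 ∷ 1 ∷ 2 ∷ 4 ∷ 8 ∷ 16 ∷ 94 ∷ 47 ∷ 95 ∷ 93 ∷ 77 ∷ 85 ∷ 114 ∷ 54 ∷ 46 ∷ 38 ∷ 34 ∷ 32 ∷ 33 ∷ 35 ∷ 39 ∷ 55 ∷
    96 ∷ 88 ∷ 123 ∷ 29 ∷ 13 ∷ 5 ∷ 3 ∷ 7 ∷ 11 ∷ 27 ∷ 105 ∷ 57 ∷ 41 ∷ 37 ∷ 45 ∷ 61 ∷ 107 ∷ 79 ∷ 110 ∷ 48 ∷ 121 ∷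
    92 ∷ 100 ∷ 59 ∷ 43 ∷ 51 ∷ 101 ∷ 23 ∷ 15 ∷ 31 ∷ 109 ∷ 53 ∷ 106 ∷ 84 ∷ 76 ∷ 68 ∷ 72 ∷ 80 ∷ 117 ∷ 60 ∷ 124 ∷
    30 ∷ 108 ∷ 90 ∷ 74 ∷ 82 ∷ 98 ∷ 20 ∷ 12 ∷ 28 ∷ 122 ∷ 52 ∷ 44 ∷ 36 ∷ 40 ∷ 56 ∷ 119 ∷ 25 ∷ 9 ∷ 17 ∷ 111 ∷ 58 ∷
    42 ∷ 50 ∷ 113 ∷ 19 ∷ 97 ∷ 83 ∷ 75 ∷ 91 ∷ 103 ∷ 49 ∷ 102 ∷ 24 ∷ 118 ∷ 81 ∷ 99 ∷ 21 ∷ 115 ∷ 86 ∷ 104 ∷ 26 ∷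
    120 ∷ 87 ∷ 71 ∷ 67 ∷ 65 ∷ 69 ∷ 73 ∷ 89 ∷ 112 ∷ 18 ∷ 10 ∷ 6 ∷ 14 ∷ 22 ∷ 116 ∷ 62 ∷ 125 ∷ 78 ∷ 70 ∷ 66 ∷ 64 ∷
    63 ∷ []

  -- Here vertex 1 of the target is the root and vertex 0 lies on a ray, the reverse of the first
  -- solution. The hexagon is not self-dual, so a root that is a point and a root that is a line
  -- lead to different assignments.
  solution4-2 : List ℕ
  solution4-2 =
    1 ∷ 0 ∷ 32 ∷ 33 ∷ 35 ∷ 39 ∷ 47 ∷ 94 ∷ 78 ∷ 125 ∷ 31 ∷ 109 ∷ 57 ∷ 108 ∷ 30 ∷ 14 ∷ 6 ∷ 2 ∷ 4 ∷ 8 ∷ 16 ∷ 110 ∷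
    48 ∷ 115 ∷ 92 ∷ 76 ∷ 68 ∷ 64 ∷ 63 ∷ 65 ∷ 67 ∷ 75 ∷ 83 ∷ 114 ∷ 20 ∷ 12 ∷ 28 ∷ 122 ∷ 84 ∷ 97 ∷ 55 ∷ 96 ∷ 91 ∷
    123 ∷ 50 ∷ 118 ∷ 24 ∷ 102 ∷ 81 ∷ 73 ∷ 69 ∷ 77 ∷ 85 ∷ 106 ∷ 53 ∷ 107 ∷ 29 ∷ 13 ∷ 21 ∷ 99 ∷ 89 ∷ 120 ∷ 62 ∷
    46 ∷ 54 ∷ 119 ∷ 25 ∷ 103 ∷ 49 ∷ 41 ∷ 37 ∷ 45 ∷ 61 ∷ 104 ∷ 26 ∷ 10 ∷ 18 ∷ 112 ∷ 90 ∷ 74 ∷ 66 ∷ 70 ∷ 86 ∷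
    116 ∷ 22 ∷ 100 ∷ 87 ∷ 71 ∷ 79 ∷ 105 ∷ 27 ∷ 121 ∷ 82 ∷ 98 ∷ 51 ∷ 43 ∷ 59 ∷ 101 ∷ 80 ∷ 72 ∷ 88 ∷ 111 ∷ 52 ∷
    44 ∷ 60 ∷ 113 ∷ 19 ∷ 11 ∷ 7 ∷ 15 ∷ 23 ∷ 117 ∷ 56 ∷ 40 ∷ 36 ∷ 34 ∷ 38 ∷ 42 ∷ 58 ∷ 124 ∷ 93 ∷ 95 ∷ 17 ∷ 9 ∷
    5 ∷ 3 ∷ []

  certificate4 : Cert
  certificate4 =
    split w 3 0 (split w 2 0 (split w 1 0 (split w 0 0 (split y 3 1 (split y 3 0 (split y 2 3 (split y 2 1 (split y 2 2 (split y 2 0 (split y 1 7 (split y 1 3 (split y 1 5 (split y 1 1 (split y 1 6 (split y 1 2 (split y 1 4 (split y 1 0 (split y 0 15 (split y 0 7 (split y 0 11 (split y 0 3 (split y 0 13 (split y 0 5 (split y 0 9 (split y 0 1 (split y 0 14 (split y 0 6 (split y 0 10 (split y 0 2 (split y 0 12 (split y 0 4 (split y 0 8 (split y 0 0 (split y 0 16 (clash (hop x 4 16 (hop y 1 0 end)))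
    (split y 0 24 (clash (hop x 4 24 (hop y 1 8 end)))
    (split y 1 8 (clash (hop x 3 8 (hop y 2 0 end)))
    (split y 0 20 (clash (hop x 4 20 (hop y 1 4 end)))
    (split y 2 4 (clash (hop x 2 4 (hop y 3 0 end)))
    (split y 0 28 (clash (hop x 4 28 (hop y 1 12 end)))
    (split y 1 12 (clash (hop x 3 12 (hop y 2 4 end)))
    (split y 0 18 (clash (hop x 4 18 (hop y 1 2 end)))
    (split y 3 2 (clash (hop x 1 2 (hop y 4 0 end)))
    (split y 0 26 (clash (hop x 4 26 (hop y 1 10 end)))
    (split y 1 10 (clash (hop x 3 10 (hop y 2 2 end)))
    (split y 0 22 (clash (hop x 4 22 (hop y 1 6 end)))
    (split y 2 6 (clash (hop x 2 6 (hop y 3 2 end)))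
    (split y 0 30 (clash (hop x 4 30 (hop y 1 14 end)))
    (split y 1 14 (clash (hop x 3 14 (hop y 2 6 end)))
    (split y 0 17 (clash (hop x 4 17 (hop y 1 1 end)))
    (split y 0 25 (clash (hop x 4 25 (hop y 1 9 end)))
    (split y 1 9 (clash (hop x 3 9 (hop y 2 1 end)))
    (split y 0 21 (clash (hop x 4 21 (hop y 1 5 end)))
    (split y 2 5 (clash (hop x 2 5 (hop y 3 1 end)))
    (split y 0 29 (clash (hop x 4 29 (hop y 1 13 end)))
    (split y 1 13 (clash (hop x 3 13 (hop y 2 5 end)))
    (split y 0 19 (clash (hop x 4 19 (hop y 1 3 end)))
    (split y 3 3 (clash (hop x 1 3 (hop y 4 1 end)))
    (split y 0 27 (clash (hop x 4 27 (hop y 1 11 end)))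
    (split y 1 11 (clash (hop x 3 11 (hop y 2 3 end)))
    (split y 0 23 (clash (hop x 4 23 (hop y 1 7 end)))
    (split y 2 7 (clash (hop x 2 7 (hop y 3 3 end)))
    (split y 0 31 (clash (hop x 4 31 (hop y 1 15 end)))
    (split y 1 15 (clash (hop x 3 15 (hop y 2 7 end)))
    (split w 0 16 (clash (hop x 4 16 (hop w 1 0 end)))
    (split w 0 1 (clash (hop y 4 1 (hop w 1 0 end)))
    (split w 0 17 (split w 1 17 (clash (hop x 4 17 (hop y 4 1 (hop w 2 0 end))))
    (split y 1 16 (split y 1 24 (clash (hop x 3 24 (hop y 2 16 end)))
    (split w 1 16 (split w 1 1 (clash (hop x 4 16 (hop y 4 0 (hop w 2 1 end))))
    (split y 2 16 (split w 2 16 (split y 3 16 (split w 3 16 (split y 2 8 (split y 2 12 (clash (hop x 2 12 (hop y 3 8 end)))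
    (split y 3 8 (split y 2 24 (split y 3 24 (split y 3 4 (split y 3 6 (clash (hop x 1 6 (hop y 4 4 end)))
    (split y 3 12 (split w 1 8 (split w 0 8 (clash (hop x 3 8 (hop w 2 0 end)))
    (clash (hop x 3 8 (hop w 2 16 end))))
    (split w 2 8 (split w 3 8 (split w 1 24 (split w 0 24 (clash (hop x 3 24 (hop w 2 0 end)))
    (clash (hop x 3 24 (hop w 2 16 end))))
    (split w 2 24 (split w 3 24 (split y 2 20 (split y 1 20 (clash (hop x 2 20 (hop y 3 16 end)))
    (clash (hop x 2 20 (hop y 3 24 end))))
    (split y 3 20 (split y 2 28 (split y 1 28 (clash (hop x 2 28 (hop y 3 16 end)))
    (clash (hop x 2 28 (hop y 3 24 end))))
    (split y 3 28 (split w 2 1 (split w 0 8 (split w 0 24 (clash (hop x 1 24 (hop w 4 8 end)))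
    (clash (hop x 3 24 (hop y 4 0 (hop w 3 1 end)))))
    (clash (hop x 3 8 (hop y 4 0 (hop w 3 1 end)))))
    (split w 1 9 (split w 1 25 (split y 3 14 (split y 2 14 (clash (hop x 1 14 (hop y 4 8 end)))
    (clash (hop x 1 14 (hop y 4 12 end))))
    (split y 3 10 (split y 2 10 (clash (hop x 1 10 (hop y 4 8 end)))
    (clash (hop x 1 10 (hop y 4 12 end))))
    (split w 0 19 (split w 0 3 (clash (hop x 4 19 (hop w 1 3 end)))
    (split w 0 2 (split w 0 18 (clash (hop x 4 18 (hop w 1 2 end)))
    (split w 1 3 (split w 1 2 (clash (hop y 3 2 (hop w 2 0 end)))
    (split w 1 18 (clash (hop x 4 18 (hop y 4 2 (hop w 2 3 end))))
    (split w 1 19 (split w 2 3 (clash (hop x 4 16 (hop y 3 0 (hop w 3 3 end))))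
    (split w 2 18 (split w 2 19 (clash (hop x 4 19 (hop y 3 3 (hop w 3 0 end))))
    (split w 3 18 (split w 0 8 (split w 0 24 (clash (hop x 1 24 (hop w 4 8 end)))
    (clash (hop x 1 18 (hop w 4 24 end))))
    (clash (hop x 1 18 (hop w 4 8 end))))
    (split w 1 27 (split w 0 27 (clash (hop x 3 27 (hop w 2 19 end)))
    (clash (hop x 3 27 (hop w 2 3 end))))
    (split w 1 26 (split w 1 10 (split w 1 11 (split w 0 11 (clash (hop x 3 11 (hop w 2 19 end)))
    (clash (hop x 3 11 (hop w 2 3 end))))
    (split w 0 10 (split w 0 26 (clash (hop x 3 26 (hop w 2 10 end)))
    (split w 2 26 (split w 3 26 (clash (hop x 1 26 (hop w 4 16 end)))
    (split y 1 26 (clash (hop y 2 26 (hop w 3 16 end)))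
    (split y 1 18 (split y 3 18 (split y 2 18 (clash (hop x 1 18 (hop y 4 16 end)))
    (split y 1 20 (clash (hop x 1 18 (hop y 4 20 end)))
    (split y 1 28 (clash (hop x 1 18 (hop y 4 28 end)))
    (clash (hop x 1 28 (hop y 4 20 end))))))
    (split y 3 26 (split y 2 26 (clash (hop x 1 26 (hop y 4 24 end)))
    (split y 1 20 (split y 1 28 (clash (hop x 1 28 (hop y 4 20 end)))
    (clash (hop x 1 26 (hop y 4 28 end))))
    (clash (hop x 1 26 (hop y 4 20 end)))))
    (split w 2 25 (split w 0 25 (clash (hop x 3 25 (hop y 4 1 (hop w 3 0 end))))
    (split w 3 25 (clash (hop y 1 25 (hop w 4 16 end)))
    (clash (hop y 1 25 (hop w 4 26 end)))))
    (split y 3 5 (split y 3 7 (clash (hop x 1 7 (hop y 4 5 end)))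
    (split w 0 6 (split w 0 22 (clash (hop x 4 22 (hop w 1 6 end)))
    (split w 0 7 (clash (hop y 4 7 (hop w 1 6 end)))
    (split w 0 23 (split w 1 22 (split w 1 7 (clash (hop x 4 22 (hop y 4 6 (hop w 2 7 end))))
    (split w 2 7 (split w 3 7 (split w 0 8 (split w 0 24 (clash (hop x 1 24 (hop w 4 8 end)))
    (split y 1 23 (split y 1 31 (clash (hop x 3 31 (hop y 2 23 end)))
    (split w 0 31 (split w 0 15 (clash (hop x 4 31 (hop w 1 15 end)))
    (split w 1 15 (split w 2 15 (split w 3 15 (split y 2 15 (clash (hop x 3 16 (hop y 3 8 (hop w 4 15 end))))
    (split y 2 11 (split y 2 10 (split w 0 11 (clash (hop y 3 11 (hop w 2 8 end)))
    (split w 0 27 (split w 2 27 (clash (hop x 4 27 (hop y 3 11 (hop w 3 8 end))))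
    (split y 3 11 (clash (hop x 4 24 (hop y 4 8 (hop w 2 11 end))))
    (split w 2 10 (split w 3 10 (clash (hop x 1 10 (hop w 4 0 end)))
    (split w 2 23 (split w 1 23 (split w 3 23 (clash (hop x 4 0 (hop y 2 16 (hop w 4 23 end))))
    (clash (hop x 2 23 (hop y 4 11 (hop w 4 10 end)))))
    (clash (hop x 4 24 (hop w 3 8 (hop x 4 23 (hop w 4 7 end))))))
    (split w 1 23 (clash (hop x 2 23 (hop w 3 19 end)))
    (clash (hop x 2 23 (hop w 3 27 end))))))
    (clash (hop x 3 19 (hop y 4 11 (hop w 3 10 end)))))))
    (clash (hop x 3 27 (hop w 2 11 end)))))
    (clash (hop x 4 26 (hop y 3 10 (hop w 3 15 end)))))
    (clash (hop x 2 15 (hop y 3 11 end)))))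
    (clash (hop x 4 26 (hop y 2 10 (hop w 4 15 end)))))
    (clash (hop x 2 15 (hop w 3 3 end))))
    (clash (hop x 3 15 (hop w 2 7 end)))))
    (split w 1 31 (split w 2 31 (clash (hop y 2 31 (hop w 3 26 end)))
    (clash (hop x 2 31 (hop w 3 3 end))))
    (clash (hop x 3 31 (hop w 2 7 end))))))
    (clash (hop x 4 7 (hop y 2 23 (hop w 4 24 end))))))
    (clash (hop y 1 7 (hop w 4 8 end))))
    (clash (hop x 4 18 (hop y 2 2 (hop w 4 7 end)))))
    (clash (hop y 2 7 (hop w 3 1 end)))))
    (split w 1 7 (split w 2 7 (split w 3 7 (clash (hop x 4 16 (hop y 2 0 (hop w 4 7 end))))
    (clash (hop x 2 26 (hop y 4 6 (hop w 4 7 end)))))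
    (clash (hop x 2 7 (hop w 3 3 end))))
    (clash (hop x 4 22 (hop y 4 6 (hop w 2 7 end))))))
    (clash (hop x 4 23 (hop w 1 7 end))))))
    (split w 2 6 (split w 1 6 (clash (hop x 2 6 (hop w 3 26 end)))
    (clash (hop x 2 6 (hop w 3 18 end))))
    (split w 1 6 (clash (hop y 2 3 (hop w 3 6 end)))
    (clash (hop y 2 1 (hop w 3 6 end)))))))
    (split y 3 7 (split w 0 21 (split w 0 5 (clash (hop x 4 21 (hop w 1 5 end)))
    (split w 0 6 (split w 0 22 (clash (hop x 4 22 (hop w 1 6 end)))
    (split w 1 22 (split w 1 5 (clash (hop x 4 22 (hop y 4 6 (hop w 2 5 end))))
    (split w 2 22 (clash (hop x 2 22 (hop w 3 26 end)))
    (split w 2 5 (split w 3 5 (split w 0 8 (split w 0 24 (clash (hop x 1 24 (hop w 4 8 end)))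
    (split y 1 21 (split y 1 29 (clash (hop x 3 29 (hop y 2 21 end)))
    (split y 2 29 (clash (hop x 3 5 (hop y 3 29 (hop w 4 24 end))))
    (split w 0 7 (split w 0 4 (clash (hop y 4 7 (hop w 1 4 end)))
    (split w 1 4 (split w 2 4 (clash (hop x 2 4 (hop w 3 16 end)))
    (clash (hop y 2 3 (hop w 3 4 end))))
    (clash (hop y 3 5 (hop w 2 4 end)))))
    (split w 0 23 (split w 0 4 (split w 0 20 (clash (hop x 4 20 (hop w 1 4 end)))
    (split w 1 7 (split w 1 20 (clash (hop x 4 20 (hop y 4 4 (hop w 2 7 end))))
    (split w 2 7 (split w 2 20 (clash (hop x 2 20 (hop w 3 24 end)))
    (split w 3 20 (split w 3 7 (clash (hop x 4 16 (hop y 2 0 (hop w 4 7 end))))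
    (split w 3 1 (clash (hop x 2 20 (hop y 4 0 (hop w 4 1 end))))
    (split y 1 23 (split y 1 31 (clash (hop x 3 31 (hop y 2 23 end)))
    (split y 2 23 (clash (hop x 4 7 (hop y 3 23 (hop w 3 16 end))))
    (split w 0 28 (split w 0 12 (clash (hop x 4 28 (hop w 1 12 end)))
    (split w 1 12 (split w 2 12 (clash (hop x 2 12 (hop w 3 16 end)))
    (split w 3 12 (split w 3 3 (clash (hop y 1 3 (hop w 4 12 end)))
    (split w 3 22 (clash (hop x 1 22 (hop w 4 12 end)))
    (clash (hop x 2 22 (hop y 4 2 (hop w 4 3 end))))))
    (gauge w 2 3 12)))
    (clash (hop x 3 12 (hop w 2 20 end)))))
    (split w 0 12 (split w 1 28 (split w 2 28 (clash (hop x 2 28 (hop w 3 16 end)))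
    (split w 3 28 (split w 3 22 (clash (hop x 1 22 (hop w 4 28 end)))
    (split w 3 3 (split w 1 23 (split w 1 4 (clash (hop x 4 23 (hop y 4 7 (hop w 2 4 end))))
    (split w 1 12 (split w 2 12 (clash (hop x 2 12 (hop w 3 0 end)))
    (clash (hop x 4 28 (hop w 3 12 (hop x 4 19 (hop w 4 3 end))))))
    (clash (hop x 3 12 (hop w 2 4 end)))))
    (split w 1 4 (split w 1 6 (clash (hop y 3 6 (hop w 2 4 end)))
    (split w 1 12 (clash (hop x 3 12 (hop w 2 4 end)))
    (split w 1 21 (split w 2 4 (clash (hop x 2 4 (hop w 3 0 end)))
    (split w 3 4 (split w 2 12 (clash (hop x 2 12 (hop w 3 8 end)))
    (split w 2 21 (split w 3 12 (split w 3 19 (clash (hop x 4 19 (hop y 2 3 (hop w 4 4 end))))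
    (split w 3 21 (clash (hop x 4 0 (hop y 2 16 (hop w 4 21 end))))
    (split y 2 21 (clash (hop x 4 0 (hop y 3 16 (hop w 3 21 end))))
    (split y 2 18 (split y 1 20 (split y 1 28 (clash (hop x 1 28 (hop y 4 20 end)))
    (split y 1 19 (split y 2 19 (clash (hop x 4 2 (hop y 3 18 (hop x 4 19 (hop y 4 3 end)))))
    (clash (hop y 3 19 (hop w 2 21 end))))
    (clash (hop x 4 3 (hop y 2 19 (hop w 4 28 end))))))
    (split y 1 28 (split y 1 22 (clash (hop y 2 22 (hop w 3 28 end)))
    (split y 1 19 (clash (hop x 4 3 (hop y 2 19 (hop w 4 28 end))))
    (split y 1 30 (split y 1 27 (split y 3 23 (clash (hop x 4 12 (hop y 4 28 (hop w 2 23 end))))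
    (split y 2 19 (split w 2 23 (split y 3 21 (split y 2 30 (clash (hop x 2 30 (hop y 3 18 end)))
    (split y 2 27 (split y 2 22 (clash (hop x 4 3 (hop y 3 19 (hop w 3 22 end))))
    (split y 2 31 (clash (hop x 2 31 (hop y 3 19 end)))
    (split w 2 6 (clash (hop x 4 23 (hop y 3 7 (hop w 3 6 end))))
    (split y 2 26 (split w 2 2 (split w 2 17 (clash (hop x 4 17 (hop y 3 1 (hop w 3 2 end))))
    (split y 3 30 (clash (hop x 1 30 (hop y 4 28 end)))
    (split y 3 22 (clash (hop x 1 22 (hop y 4 20 end)))
    (split w 3 6 (clash (hop x 1 6 (hop w 4 12 end)))
    (split w 0 27 (split y 3 19 (split w 3 2 (clash (hop x 1 2 (hop w 4 8 end)))
    (split w 3 23 (split w 0 11 (clash (hop x 3 27 (hop w 2 11 end)))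
    (split w 2 10 (split w 3 17 (split w 0 30 (clash (hop y 4 23 (hop w 1 30 end)))
    (split w 0 14 (split w 2 27 (clash (hop x 2 23 (hop w 3 27 end)))
    (split w 2 11 (clash (hop x 3 11 (hop y 4 19 (hop w 3 24 end))))
    (split y 3 27 (split w 3 10 (clash (hop x 1 10 (hop w 4 0 end)))
    (split y 2 15 (clash (hop x 3 23 (hop y 3 15 (hop w 4 8 end))))
    (split w 1 30 (clash (hop y 3 30 (hop w 2 28 end)))
    (split y 1 17 (clash (hop y 2 27 (hop w 3 17 end)))
    (split y 2 9 (split y 2 11 (split w 1 14 (split y 1 25 (split y 2 13 (clash (hop x 2 13 (hop y 3 9 end)))
    (split w 3 27 (clash (hop x 1 27 (hop w 4 17 end)))
    (split w 3 11 (split w 2 30 (clash (hop x 2 30 (hop w 3 18 end)))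
    (split y 2 10 (split y 2 17 (split y 3 11 (clash (hop x 4 24 (hop y 4 8 (hop w 2 11 end))))
    (split w 2 14 (clash (hop x 2 14 (hop w 3 10 end)))
    (split y 2 14 (clash (hop x 1 14 (hop y 4 10 end)))
    (split y 2 25 (split y 3 13 (clash (hop x 2 17 (hop y 4 13 (hop w 4 12 end))))
    (split y 3 9 (split y 3 15 (split w 0 25 (split w 3 30 (clash (hop x 1 30 (hop w 4 20 end)))
    (split y 3 31 (clash (hop x 2 11 (hop y 4 31 (hop w 4 20 end))))
    (split w 0 9 (clash (hop y 4 9 (hop w 1 8 end)))
    (split y 3 17 (clash (hop x 1 19 (hop y 4 17 end)))
    (split w 3 14 (clash (hop x 1 14 (hop w 4 4 end)))
    (split y 3 29 (split y 3 25 (clash (hop x 1 27 (hop y 4 25 end)))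
    (split w 0 13 (clash (hop y 4 13 (hop w 1 14 end)))
    (split w 0 15 (clash (hop y 4 15 (hop w 1 12 end)))
    (split w 0 29 (split w 0 31 (split w 2 9 (clash (hop x 3 16 (hop y 4 8 (hop w 3 9 end))))
    (split w 3 25 (split w 1 13 (split w 1 15 (clash (hop y 3 15 (hop w 2 13 end)))
    (split w 1 29 (clash (hop x 3 29 (hop w 2 21 end)))
    (split w 1 31 (split w 3 9 (clash (hop x 1 3 (hop w 4 9 end)))
    (split w 2 13 (split w 2 15 (split w 2 29 (split w 2 31 (split w 3 13 (split w 3 15 (clash (hop x 1 15 (hop w 4 5 end)))
    (split w 3 29 (clash (hop x 1 23 (hop w 4 29 end)))
    (split w 3 31 (done solution4-1)
    (clash (hop x 1 31 (hop w 4 21 end))))))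
    (clash (hop x 1 7 (hop w 4 13 end))))
    (clash (hop x 2 31 (hop w 3 19 end))))
    (clash (hop x 2 29 (hop w 3 17 end))))
    (clash (hop x 2 15 (hop w 3 11 end))))
    (clash (hop x 2 13 (hop w 3 9 end)))))
    (clash (hop y 3 31 (hop w 2 29 end))))))
    (clash (hop x 3 13 (hop w 2 5 end))))
    (clash (hop x 1 19 (hop w 4 25 end)))))
    (clash (hop y 4 31 (hop w 1 22 end))))
    (clash (hop y 4 29 (hop w 1 20 end)))))))
    (clash (hop x 1 31 (hop y 4 29 end)))))))))
    (clash (hop y 3 25 (hop w 2 16 end))))
    (clash (hop x 1 15 (hop y 4 13 end))))
    (clash (hop x 1 11 (hop y 4 9 end)))))
    (clash (hop x 2 21 (hop y 3 25 end)))))))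
    (clash (hop x 2 29 (hop y 3 17 end))))
    (clash (hop x 3 21 (hop y 3 13 (hop w 4 10 end))))))
    (clash (hop x 1 11 (hop w 4 1 end))))))
    (clash (hop x 3 25 (hop y 2 17 end))))
    (clash (hop x 3 14 (hop w 2 6 end))))
    (clash (hop x 2 15 (hop y 3 11 end))))
    (clash (hop x 3 17 (hop y 3 9 (hop w 4 12 end)))))))))
    (clash (hop x 4 2 (hop y 4 18 (hop w 2 27 end)))))))
    (clash (hop x 4 30 (hop w 1 14 end)))))
    (clash (hop x 4 17 (hop y 2 1 (hop w 4 6 end)))))
    (clash (hop x 4 10 (hop y 3 26 (hop w 3 19 end))))))
    (clash (hop x 4 2 (hop y 2 18 (hop w 4 23 end))))))
    (clash (hop x 4 10 (hop y 4 26 (hop w 2 19 end)))))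
    (clash (hop y 3 27 (hop w 2 18 end))))))))
    (clash (hop x 2 6 (hop w 3 2 end))))
    (clash (hop x 2 22 (hop y 3 26 end)))))))
    (clash (hop x 2 23 (hop y 3 27 end)))))
    (clash (hop x 1 23 (hop y 4 21 end))))
    (clash (hop x 4 12 (hop y 3 28 (hop w 3 23 end)))))
    (clash (hop x 4 4 (hop y 3 20 (hop w 3 19 end))))))
    (clash (hop x 3 27 (hop y 2 19 end))))
    (clash (hop x 3 30 (hop y 2 22 end))))))
    (clash (hop x 1 28 (hop y 4 20 end)))))
    (clash (hop x 4 5 (hop y 3 21 (hop w 3 18 end))))))))
    (gauge w 2 3 12))
    (clash (hop x 4 21 (hop y 3 5 (hop w 3 4 end))))))
    (gauge w 2 3 4)))
    (clash (hop x 4 21 (hop y 4 5 (hop w 2 6 end)))))))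
    (clash (hop x 4 23 (hop y 4 7 (hop w 2 4 end))))))
    (clash (hop x 2 22 (hop y 4 2 (hop w 4 3 end))))))
    (gauge w 2 3 28)))
    (clash (hop x 3 28 (hop w 2 20 end))))
    (clash (hop x 4 28 (hop w 1 12 end)))))))
    (clash (hop x 4 7 (hop y 2 23 (hop w 4 26 end)))))))
    (gauge w 2 3 20)))
    (clash (hop x 2 7 (hop w 3 3 end)))))
    (clash (hop y 3 7 (hop w 2 5 end)))))
    (clash (hop y 4 7 (hop w 1 4 end))))
    (clash (hop x 4 23 (hop w 1 7 end)))))))
    (clash (hop x 4 5 (hop y 2 21 (hop w 4 24 end))))))
    (clash (hop y 1 5 (hop w 4 8 end))))
    (clash (hop x 4 18 (hop y 2 2 (hop w 4 5 end)))))
    (clash (hop x 2 5 (hop w 3 1 end))))))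
    (split w 1 5 (split w 2 5 (split w 3 5 (clash (hop x 4 16 (hop y 2 0 (hop w 4 5 end))))
    (clash (hop x 2 26 (hop y 4 6 (hop w 4 5 end)))))
    (clash (hop y 2 3 (hop w 3 5 end))))
    (clash (hop x 4 22 (hop y 4 6 (hop w 2 5 end)))))))
    (clash (hop y 4 5 (hop w 1 6 end)))))
    (split w 0 5 (split w 0 6 (clash (hop y 4 5 (hop w 1 6 end)))
    (split w 2 6 (split w 1 6 (clash (hop x 2 6 (hop w 3 26 end)))
    (clash (hop x 2 6 (hop w 3 18 end))))
    (split w 1 6 (clash (hop y 2 3 (hop w 3 6 end)))
    (clash (hop y 2 1 (hop w 3 6 end))))))
    (clash (hop x 4 21 (hop w 1 5 end)))))
    (clash (hop x 1 7 (hop y 4 5 end))))))))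
    (clash (hop x 3 26 (hop y 2 18 end))))))
    (clash (hop x 3 26 (hop y 4 2 (hop w 3 3 end))))))
    (split w 2 10 (split w 3 10 (clash (hop x 1 10 (hop w 4 16 end)))
    (split y 3 7 (split y 3 5 (clash (hop x 1 7 (hop y 4 5 end)))
    (split w 0 21 (split w 0 5 (clash (hop x 4 21 (hop w 1 5 end)))
    (split w 1 5 (split w 2 5 (split w 3 5 (clash (hop x 4 16 (hop y 2 0 (hop w 4 5 end))))
    (clash (hop y 1 5 (hop w 4 10 end))))
    (clash (hop y 2 3 (hop w 3 5 end))))
    (split w 0 4 (split w 0 7 (clash (hop y 4 7 (hop w 1 4 end)))
    (split w 1 7 (split w 2 7 (split w 3 7 (clash (hop x 4 16 (hop y 2 0 (hop w 4 7 end))))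
    (clash (hop y 1 7 (hop w 4 10 end))))
    (clash (hop x 2 7 (hop w 3 3 end))))
    (clash (hop y 3 7 (hop w 2 5 end)))))
    (split w 1 4 (split w 2 4 (clash (hop x 2 4 (hop w 3 16 end)))
    (clash (hop y 2 3 (hop w 3 4 end))))
    (clash (hop y 3 5 (hop w 2 4 end)))))))
    (split w 0 5 (split w 0 6 (clash (hop y 4 5 (hop w 1 6 end)))
    (split w 2 6 (split w 1 6 (clash (hop x 2 6 (hop w 3 10 end)))
    (clash (hop x 2 6 (hop w 3 18 end))))
    (split w 1 6 (clash (hop y 2 3 (hop w 3 6 end)))
    (clash (hop y 2 1 (hop w 3 6 end))))))
    (clash (hop x 4 21 (hop w 1 5 end))))))
    (split y 3 5 (split w 0 21 (split w 0 5 (clash (hop x 4 21 (hop w 1 5 end)))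
    (split w 1 5 (split w 2 5 (split w 3 5 (clash (hop x 4 16 (hop y 2 0 (hop w 4 5 end))))
    (clash (hop y 1 5 (hop w 4 10 end))))
    (clash (hop y 2 3 (hop w 3 5 end))))
    (split w 2 5 (split w 3 5 (split w 0 8 (split w 0 24 (clash (hop x 1 24 (hop w 4 8 end)))
    (clash (hop x 2 24 (hop y 4 4 (hop w 4 5 end)))))
    (clash (hop y 1 5 (hop w 4 8 end))))
    (clash (hop x 4 18 (hop y 2 2 (hop w 4 5 end)))))
    (clash (hop x 2 5 (hop w 3 1 end))))))
    (split w 0 5 (split w 0 4 (clash (hop y 4 5 (hop w 1 4 end)))
    (split w 2 4 (split w 1 4 (clash (hop x 2 4 (hop w 3 16 end)))
    (split w 0 8 (split w 0 24 (clash (hop x 1 24 (hop w 4 8 end)))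
    (clash (hop x 2 4 (hop w 3 24 end))))
    (clash (hop x 2 4 (hop w 3 8 end)))))
    (split w 1 4 (clash (hop y 2 3 (hop w 3 4 end)))
    (clash (hop y 2 1 (hop w 3 4 end))))))
    (clash (hop x 4 21 (hop w 1 5 end)))))
    (clash (hop x 1 7 (hop y 4 5 end))))))
    (clash (hop x 3 10 (hop y 4 2 (hop w 3 3 end)))))))
    (split w 0 10 (clash (hop x 3 10 (hop w 2 2 end)))
    (clash (hop x 3 10 (hop w 2 18 end)))))
    (split w 0 26 (clash (hop x 3 26 (hop w 2 2 end)))
    (clash (hop x 3 26 (hop w 2 18 end))))))))
    (clash (hop x 4 18 (hop y 3 2 (hop w 3 1 end))))))
    (clash (hop x 4 19 (hop y 4 3 (hop w 2 2 end)))))))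
    (clash (hop y 3 3 (hop w 2 1 end)))))
    (clash (hop y 4 3 (hop w 1 2 end)))))
    (split w 0 3 (split w 0 2 (clash (hop y 4 3 (hop w 1 2 end)))
    (split w 0 18 (split w 1 3 (clash (hop y 3 3 (hop w 2 0 end)))
    (split w 1 2 (split w 1 18 (split w 1 19 (clash (hop x 4 19 (hop y 4 3 (hop w 2 2 end))))
    (split w 2 2 (clash (hop x 4 16 (hop y 3 0 (hop w 3 2 end))))
    (split w 2 18 (clash (hop x 4 18 (hop y 3 2 (hop w 3 0 end))))
    (split w 2 19 (split w 1 27 (split w 1 10 (split w 0 10 (clash (hop x 3 10 (hop w 2 18 end)))
    (clash (hop x 3 10 (hop w 2 2 end))))
    (split w 1 11 (split w 1 26 (split w 0 26 (clash (hop x 3 26 (hop w 2 18 end)))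
    (clash (hop x 3 26 (hop w 2 2 end))))
    (split w 0 27 (split w 0 11 (clash (hop x 3 27 (hop w 2 11 end)))
    (split w 2 11 (split w 2 9 (split w 0 9 (clash (hop x 3 9 (hop y 4 1 (hop w 3 0 end))))
    (clash (hop y 2 11 (hop w 3 9 end))))
    (split w 0 6 (split w 1 6 (split w 2 6 (clash (hop y 2 6 (hop w 3 0 end)))
    (clash (hop x 2 6 (hop w 3 18 end))))
    (split w 0 7 (split w 1 7 (split y 3 7 (split y 3 5 (clash (hop x 1 7 (hop y 4 5 end)))
    (split w 2 7 (clash (hop y 2 7 (hop w 3 0 end)))
    (split w 2 27 (split w 0 5 (clash (hop y 4 5 (hop w 1 6 end)))
    (split w 0 21 (split w 3 27 (clash (hop x 3 27 (hop y 3 3 (hop w 4 0 end))))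
    (split w 1 21 (split w 2 21 (split w 3 21 (clash (hop x 2 21 (hop y 4 1 (hop w 4 0 end))))
    (clash (hop x 1 27 (hop w 4 21 end))))
    (clash (hop x 4 21 (hop y 3 5 (hop w 3 7 end)))))
    (clash (hop x 4 21 (hop y 4 5 (hop w 2 6 end))))))
    (clash (hop x 4 21 (hop w 1 5 end)))))
    (clash (hop x 2 7 (hop w 3 27 end))))))
    (clash (hop y 4 7 (hop w 1 6 end))))
    (clash (hop y 3 7 (hop w 2 6 end))))
    (split w 1 7 (split w 2 7 (clash (hop x 2 7 (hop w 3 11 end)))
    (clash (hop y 2 7 (hop w 3 2 end))))
    (split w 2 7 (clash (hop x 2 7 (hop w 3 19 end)))
    (clash (hop y 2 7 (hop w 3 1 end)))))))
    (split w 0 22 (split w 2 6 (split w 3 6 (split w 1 6 (clash (hop x 1 6 (hop w 4 16 end)))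
    (split w 0 8 (split w 0 24 (clash (hop x 1 24 (hop w 4 8 end)))
    (clash (hop x 1 6 (hop w 4 24 end))))
    (clash (hop x 1 6 (hop w 4 8 end)))))
    (split y 1 19 (split y 1 27 (clash (hop x 3 27 (hop y 2 19 end)))
    (split y 2 11 (split w 3 11 (clash (hop x 3 16 (hop y 3 8 (hop w 4 11 end))))
    (split w 1 6 (clash (hop y 1 11 (hop w 4 6 end)))
    (split w 3 19 (split w 0 8 (split w 0 24 (clash (hop x 1 24 (hop w 4 8 end)))
    (clash (hop y 1 19 (hop w 4 24 end))))
    (clash (hop x 3 19 (hop y 3 11 (hop w 4 8 end)))))
    (clash (hop x 4 19 (hop y 2 3 (hop w 4 6 end)))))))
    (split y 2 15 (split y 2 19 (split w 3 11 (clash (hop x 3 11 (hop y 3 19 (hop w 4 16 end))))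
    (split w 1 6 (clash (hop y 1 11 (hop w 4 6 end)))
    (split w 3 19 (split w 0 8 (split w 0 24 (clash (hop x 1 24 (hop w 4 8 end)))
    (clash (hop y 1 19 (hop w 4 24 end))))
    (clash (hop x 3 8 (hop y 3 16 (hop w 4 19 end)))))
    (clash (hop x 4 19 (hop y 2 3 (hop w 4 6 end)))))))
    (split w 1 12 (split w 0 12 (split w 2 12 (clash (hop x 2 12 (hop w 3 0 end)))
    (split w 3 12 (split w 3 18 (clash (hop x 1 18 (hop w 4 12 end)))
    (split w 0 9 (clash (hop y 2 9 (hop w 3 12 end)))
    (split w 0 25 (split w 2 25 (clash (hop x 3 25 (hop y 4 1 (hop w 3 0 end))))
    (split w 3 25 (clash (hop x 4 25 (hop y 2 9 (hop w 4 12 end))))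
    (clash (hop y 1 25 (hop w 4 18 end)))))
    (clash (hop x 3 25 (hop w 2 9 end))))))
    (gauge w 2 3 12)))
    (clash (hop y 3 11 (hop w 2 12 end))))
    (split w 0 8 (split w 0 24 (clash (hop x 1 24 (hop w 4 8 end)))
    (split w 3 19 (clash (hop y 1 19 (hop w 4 24 end)))
    (split w 1 6 (split w 3 11 (split y 3 11 (clash (hop x 2 16 (hop y 4 12 (hop w 4 11 end))))
    (split y 2 14 (split y 2 10 (clash (hop x 1 14 (hop y 4 10 end)))
    (split w 0 10 (split w 0 26 (clash (hop x 3 26 (hop w 2 10 end)))
    (split w 0 12 (clash (hop y 3 10 (hop w 2 12 end)))
    (split w 2 12 (clash (hop x 2 12 (hop w 3 24 end)))
    (split w 2 26 (split w 3 26 (clash (hop x 1 26 (hop w 4 24 end)))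
    (clash (hop y 1 19 (hop w 4 26 end))))
    (clash (hop x 4 26 (hop y 3 10 (hop w 3 12 end))))))))
    (clash (hop y 4 11 (hop w 1 10 end)))))
    (clash (hop x 3 6 (hop y 4 14 (hop w 3 11 end))))))
    (clash (hop y 1 11 (hop w 4 6 end))))
    (clash (hop x 4 19 (hop y 2 3 (hop w 4 6 end)))))))
    (split w 0 24 (split w 0 10 (split w 0 26 (clash (hop x 3 26 (hop w 2 10 end)))
    (split w 0 12 (split w 2 12 (clash (hop x 2 12 (hop w 3 24 end)))
    (split w 2 10 (split y 2 10 (clash (hop x 4 24 (hop y 3 8 (hop w 3 10 end))))
    (clash (hop y 3 10 (hop w 2 12 end))))
    (clash (hop y 2 10 (hop w 3 12 end)))))
    (split w 0 28 (split y 3 11 (clash (hop y 4 11 (hop w 1 12 end)))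
    (split w 2 12 (clash (hop x 2 12 (hop w 3 8 end)))
    (split w 3 12 (split w 3 1 (clash (hop y 1 1 (hop w 4 12 end)))
    (split y 3 9 (split y 2 9 (split y 2 13 (clash (hop x 2 13 (hop y 3 9 end)))
    (split y 3 15 (clash (hop x 1 15 (hop y 4 9 end)))
    (split w 0 9 (split y 3 13 (split w 0 25 (clash (hop x 3 25 (hop w 2 9 end)))
    (split w 0 13 (split w 0 29 (clash (hop x 4 29 (hop w 1 13 end)))
    (split w 1 29 (split w 2 29 (clash (hop x 4 29 (hop y 3 13 (hop w 3 11 end))))
    (split w 2 25 (split w 3 25 (clash (hop y 1 25 (hop w 4 16 end)))
    (split w 3 11 (split y 1 25 (clash (hop y 2 25 (hop w 3 16 end)))
    (split y 1 17 (split y 2 25 (clash (hop x 4 8 (hop y 3 24 (hop x 4 25 (hop y 4 9 end)))))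
    (split y 2 27 (split y 2 17 (clash (hop x 4 0 (hop y 3 16 (hop x 4 17 (hop y 4 1 end)))))
    (split y 3 27 (clash (hop y 4 27 (hop w 1 24 end)))
    (split w 0 20 (split w 0 4 (clash (hop x 4 20 (hop w 1 4 end)))
    (split w 1 4 (split w 2 4 (clash (hop x 2 4 (hop w 3 16 end)))
    (clash (hop y 2 2 (hop w 3 4 end))))
    (clash (hop x 3 12 (hop w 2 4 end)))))
    (split w 0 4 (split w 1 20 (split w 2 20 (clash (hop x 2 20 (hop w 3 16 end)))
    (split w 3 20 (split y 1 20 (split y 1 28 (clash (hop x 1 28 (hop y 4 20 end)))
    (split w 3 2 (clash (hop x 1 2 (hop w 4 20 end)))
    (split w 3 29 (clash (hop y 1 29 (hop w 4 20 end)))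
    (split y 1 29 (clash (hop y 2 29 (hop w 3 20 end)))
    (split y 1 21 (split y 3 19 (clash (hop y 4 19 (hop w 1 20 end)))
    (split y 3 17 (split y 1 18 (split y 2 29 (split y 1 26 (clash (hop x 3 26 (hop y 2 18 end)))
    (split y 2 21 (split y 2 18 (split y 3 29 (split w 1 4 (split y 2 26 (clash (hop x 3 2 (hop y 3 26 (hop w 4 29 end))))
    (split w 1 28 (clash (hop x 3 28 (hop w 2 4 end)))
    (split w 1 13 (split y 3 18 (clash (hop x 1 18 (hop y 4 16 end)))
    (split w 2 4 (clash (hop x 2 4 (hop w 3 0 end)))
    (split y 3 26 (clash (hop x 1 26 (hop y 4 28 end)))
    (split w 3 4 (split w 2 28 (clash (hop x 2 28 (hop w 3 24 end)))
    (split y 3 25 (split w 2 26 (split w 3 28 (split w 2 10 (split w 2 17 (split w 2 13 (split w 2 27 (clash (hop x 4 13 (hop y 3 29 (hop w 3 27 end))))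
    (split w 2 3 (clash (hop x 3 10 (hop y 4 2 (hop w 3 3 end))))
    (split w 3 18 (clash (hop x 1 18 (hop w 4 4 end)))
    (split w 3 9 (clash (hop y 1 9 (hop w 4 4 end)))
    (split w 3 26 (clash (hop x 1 26 (hop w 4 8 end)))
    (split w 3 19 (split w 1 6 (split w 3 10 (clash (hop x 1 10 (hop w 4 24 end)))
    (split w 3 17 (clash (hop y 1 17 (hop w 4 24 end)))
    (split w 3 13 (clash (hop y 1 13 (hop w 4 0 end)))
    (split w 3 27 (split y 2 10 (clash (hop x 4 24 (hop y 3 8 (hop w 3 10 end))))
    (split y 2 14 (split y 3 21 (split y 3 7 (clash (hop x 2 27 (hop y 4 7 (hop w 4 4 end))))
    (split y 3 5 (split y 1 22 (split w 0 21 (split y 1 30 (clash (hop x 3 30 (hop y 2 22 end)))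
    (split w 0 5 (clash (hop y 4 5 (hop w 1 4 end)))
    (split w 0 7 (split w 1 21 (clash (hop y 3 21 (hop w 2 18 end)))
    (split w 0 23 (clash (hop x 4 23 (hop w 1 7 end)))
    (split y 2 22 (clash (hop x 2 22 (hop y 3 18 end)))
    (split w 1 5 (clash (hop y 3 5 (hop w 2 6 end)))
    (split y 2 30 (split w 1 7 (clash (hop y 3 7 (hop w 2 4 end)))
    (split w 1 23 (clash (hop x 4 23 (hop y 4 7 (hop w 2 6 end))))
    (split w 1 22 (split w 2 21 (clash (hop x 2 21 (hop w 3 17 end)))
    (split y 3 22 (clash (hop x 1 22 (hop y 4 20 end)))
    (split w 2 5 (split y 3 30 (clash (hop x 1 30 (hop y 4 24 end)))
    (split w 2 7 (split w 2 23 (clash (hop x 2 23 (hop w 3 19 end)))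
    (split w 2 22 (split w 3 21 (clash (hop y 1 21 (hop w 4 28 end)))
    (split w 3 3 (split w 3 5 (clash (hop y 1 5 (hop w 4 8 end)))
    (split w 0 30 (clash (hop y 4 27 (hop w 1 30 end)))
    (split w 3 7 (split w 0 14 (split w 3 23 (split w 3 22 (clash (hop x 1 22 (hop w 4 0 end)))
    (split w 0 15 (clash (hop y 4 15 (hop w 1 14 end)))
    (split w 0 31 (split w 1 30 (clash (hop x 3 30 (hop w 2 6 end)))
    (split w 1 14 (clash (hop x 3 14 (hop w 2 22 end)))
    (split w 1 15 (split y 1 23 (split w 1 31 (split y 1 31 (clash (hop x 3 31 (hop y 2 23 end)))
    (split w 2 30 (clash (hop x 2 30 (hop w 3 26 end)))
    (split w 2 14 (clash (hop x 2 14 (hop w 3 10 end)))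
    (split w 2 15 (clash (hop x 2 15 (hop w 3 11 end)))
    (split y 2 23 (split w 2 31 (split y 2 31 (clash (hop x 2 31 (hop y 3 27 end)))
    (split w 3 30 (clash (hop x 1 30 (hop w 4 12 end)))
    (split w 3 14 (clash (hop x 1 14 (hop w 4 28 end)))
    (split w 3 15 (split y 3 23 (clash (hop y 4 23 (hop w 1 16 end)))
    (split w 3 31 (split y 3 31 (clash (hop y 4 31 (hop w 1 28 end)))
    (done solution4-2))
    (clash (hop y 1 31 (hop w 4 22 end)))))
    (clash (hop y 1 15 (hop w 4 2 end)))))))
    (clash (hop x 2 31 (hop w 3 27 end))))
    (clash (hop x 2 23 (hop y 3 19 end))))))))
    (clash (hop x 3 31 (hop w 2 7 end))))
    (clash (hop x 4 12 (hop y 2 28 (hop w 4 23 end)))))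
    (clash (hop y 3 15 (hop w 2 8 end))))))
    (clash (hop x 4 31 (hop w 1 15 end))))))
    (clash (hop x 1 23 (hop w 4 1 end))))
    (clash (hop x 4 30 (hop w 1 14 end))))
    (clash (hop y 1 7 (hop w 4 10 end))))))
    (clash (hop x 1 3 (hop w 4 21 end)))))
    (clash (hop x 2 22 (hop w 3 18 end)))))
    (clash (hop x 2 7 (hop w 3 3 end)))))
    (clash (hop x 2 5 (hop w 3 1 end))))))
    (clash (hop y 3 17 (hop w 2 22 end))))))
    (clash (hop x 2 30 (hop y 3 26 end))))))))
    (clash (hop y 4 7 (hop w 1 6 end))))))
    (clash (hop y 4 21 (hop w 1 16 end))))
    (clash (hop x 4 6 (hop y 2 22 (hop w 4 25 end)))))
    (clash (hop x 1 7 (hop y 4 5 end)))))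
    (clash (hop x 2 9 (hop y 4 21 (hop w 4 18 end)))))
    (clash (hop x 1 14 (hop y 4 10 end)))))
    (clash (hop y 1 27 (hop w 4 18 end)))))))
    (clash (hop x 1 6 (hop w 4 26 end))))
    (clash (hop y 1 19 (hop w 4 26 end)))))))))
    (clash (hop x 2 13 (hop w 3 9 end))))
    (clash (hop x 3 28 (hop y 4 20 (hop w 3 17 end)))))
    (clash (hop x 4 10 (hop y 3 26 (hop w 3 28 end)))))
    (gauge w 2 3 28))
    (clash (hop x 4 12 (hop y 3 28 (hop w 3 26 end)))))
    (clash (hop y 4 25 (hop w 1 26 end)))))
    (gauge w 2 3 4)))))
    (clash (hop x 4 28 (hop y 4 12 (hop w 2 13 end)))))))
    (clash (hop x 4 4 (hop y 4 20 (hop w 2 17 end)))))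
    (clash (hop x 1 27 (hop y 4 29 end))))
    (clash (hop x 4 2 (hop y 3 18 (hop w 3 20 end)))))
    (clash (hop x 2 21 (hop y 3 17 end)))))
    (clash (hop x 2 29 (hop y 3 25 end))))
    (clash (hop x 4 2 (hop y 2 18 (hop w 4 29 end)))))
    (clash (hop x 1 19 (hop y 4 17 end)))))
    (clash (hop x 3 29 (hop y 2 21 end))))))))
    (clash (hop y 3 25 (hop w 2 20 end))))
    (gauge w 2 3 20)))
    (clash (hop x 3 12 (hop w 2 20 end))))
    (clash (hop x 4 20 (hop w 1 4 end)))))))
    (clash (hop x 4 11 (hop y 3 27 (hop w 3 25 end))))))
    (clash (hop x 3 25 (hop y 2 17 end)))))
    (clash (hop x 1 11 (hop w 4 25 end)))))
    (clash (hop x 2 29 (hop w 3 25 end)))))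
    (clash (hop x 4 29 (hop y 4 13 (hop w 2 12 end))))))
    (clash (hop y 4 13 (hop w 1 12 end)))))
    (clash (hop x 1 11 (hop y 4 13 end))))
    (clash (hop y 4 9 (hop w 1 8 end))))))
    (clash (hop x 3 1 (hop y 4 9 (hop w 3 12 end)))))
    (split y 2 9 (split y 2 13 (clash (hop x 2 13 (hop y 3 9 end)))
    (split y 3 15 (split y 3 13 (split w 0 15 (split w 0 13 (split w 0 29 (clash (hop x 4 29 (hop w 1 13 end)))
    (split w 1 15 (split w 1 29 (split w 0 9 (clash (hop y 3 15 (hop w 2 9 end)))
    (split w 2 29 (clash (hop x 4 29 (hop y 3 13 (hop w 3 11 end))))
    (clash (hop x 2 29 (hop w 3 9 end)))))
    (clash (hop x 4 29 (hop y 4 13 (hop w 2 12 end)))))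
    (clash (hop x 4 24 (hop y 4 8 (hop w 2 15 end))))))
    (clash (hop y 4 13 (hop w 1 12 end))))
    (clash (hop y 4 15 (hop w 1 8 end))))
    (clash (hop x 1 11 (hop y 4 13 end))))
    (clash (hop x 1 15 (hop y 4 9 end)))))
    (clash (hop x 1 11 (hop y 4 9 end))))))
    (gauge w 2 3 12))))
    (clash (hop x 4 28 (hop w 1 12 end))))))
    (split w 0 26 (split y 2 10 (clash (hop y 3 10 (hop w 2 8 end)))
    (split y 3 11 (split w 0 12 (split w 2 12 (clash (hop x 2 12 (hop w 3 24 end)))
    (split w 2 26 (split w 2 3 (clash (hop x 3 26 (hop y 4 2 (hop w 3 3 end))))
    (clash (hop x 3 3 (hop y 4 11 (hop w 3 12 end)))))
    (clash (hop x 4 26 (hop y 3 10 (hop w 3 12 end))))))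
    (clash (hop y 3 10 (hop w 2 12 end))))
    (clash (hop y 4 11 (hop w 1 10 end)))))
    (clash (hop x 3 26 (hop w 2 10 end)))))
    (clash (hop x 1 24 (hop w 4 8 end)))))))
    (clash (hop x 2 15 (hop y 3 11 end))))))
    (split y 1 27 (split w 0 24 (split w 3 11 (clash (hop x 4 11 (hop y 2 27 (hop w 4 16 end))))
    (split w 0 8 (clash (hop x 1 24 (hop w 4 8 end)))
    (split w 1 6 (clash (hop y 1 11 (hop w 4 6 end)))
    (split w 3 19 (clash (hop x 4 8 (hop y 2 24 (hop w 4 19 end))))
    (clash (hop x 4 19 (hop y 2 3 (hop w 4 6 end))))))))
    (clash (hop y 2 19 (hop w 3 24 end))))
    (clash (hop x 3 27 (hop y 2 19 end))))))
    (split w 1 6 (clash (hop x 2 6 (hop w 3 2 end)))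
    (clash (hop y 2 1 (hop w 3 6 end)))))
    (clash (hop x 4 22 (hop w 1 6 end))))))
    (clash (hop x 3 11 (hop y 4 3 (hop w 3 2 end))))))
    (split w 2 27 (split w 3 27 (clash (hop y 1 27 (hop w 4 16 end)))
    (split y 3 5 (split y 3 7 (clash (hop x 1 7 (hop y 4 5 end)))
    (split w 0 23 (split w 0 7 (clash (hop x 4 23 (hop w 1 7 end)))
    (split w 2 7 (split w 1 7 (clash (hop x 2 7 (hop w 3 27 end)))
    (clash (hop x 2 7 (hop w 3 19 end))))
    (split w 1 7 (clash (hop y 2 7 (hop w 3 2 end)))
    (clash (hop y 2 7 (hop w 3 1 end))))))
    (split w 0 7 (split w 0 6 (clash (hop y 4 7 (hop w 1 6 end)))
    (split w 1 23 (split w 1 6 (clash (hop x 4 23 (hop y 4 7 (hop w 2 6 end))))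
    (split w 0 14 (split w 0 30 (clash (hop x 4 30 (hop w 1 14 end)))
    (split w 1 30 (split w 2 30 (split w 3 30 (clash (hop x 1 30 (hop w 4 16 end)))
    (clash (hop y 1 27 (hop w 4 30 end))))
    (clash (hop x 2 30 (hop w 3 2 end))))
    (clash (hop x 3 30 (hop w 2 6 end)))))
    (split w 1 14 (split w 2 14 (split w 3 14 (clash (hop x 1 14 (hop w 4 16 end)))
    (clash (hop x 4 27 (hop y 2 11 (hop w 4 14 end)))))
    (clash (hop x 2 14 (hop w 3 2 end))))
    (clash (hop x 3 14 (hop w 2 6 end))))))
    (split w 1 6 (split w 2 6 (split w 3 6 (clash (hop x 1 6 (hop w 4 16 end)))
    (clash (hop x 2 27 (hop y 4 7 (hop w 4 6 end)))))
    (clash (hop x 2 6 (hop w 3 2 end))))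
    (clash (hop x 4 23 (hop y 4 7 (hop w 2 6 end)))))))
    (clash (hop x 4 23 (hop w 1 7 end))))))
    (split y 3 7 (split w 0 7 (split w 0 4 (clash (hop y 4 7 (hop w 1 4 end)))
    (split w 2 4 (split w 1 4 (clash (hop x 2 4 (hop w 3 16 end)))
    (split w 0 8 (split w 0 24 (clash (hop x 1 24 (hop w 4 8 end)))
    (clash (hop x 2 4 (hop w 3 24 end))))
    (clash (hop x 2 4 (hop w 3 8 end)))))
    (split w 1 4 (clash (hop y 2 2 (hop w 3 4 end)))
    (clash (hop y 2 1 (hop w 3 4 end))))))
    (split w 2 7 (split w 1 7 (clash (hop x 2 7 (hop w 3 27 end)))
    (clash (hop x 2 7 (hop w 3 19 end))))
    (split w 1 7 (clash (hop y 2 7 (hop w 3 2 end)))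
    (clash (hop y 2 7 (hop w 3 1 end))))))
    (clash (hop x 1 7 (hop y 4 5 end))))))
    (clash (hop x 3 27 (hop y 4 3 (hop w 3 2 end)))))))
    (split w 0 11 (clash (hop x 3 11 (hop w 2 3 end)))
    (clash (hop x 3 11 (hop w 2 19 end))))))
    (split w 0 27 (clash (hop x 3 27 (hop w 2 3 end)))
    (clash (hop x 3 27 (hop w 2 19 end)))))
    (clash (hop x 4 19 (hop y 3 3 (hop w 3 1 end))))))))
    (clash (hop x 4 18 (hop y 4 2 (hop w 2 3 end)))))
    (clash (hop y 3 1 (hop w 2 2 end)))))
    (clash (hop x 4 18 (hop w 1 2 end)))))
    (clash (hop x 4 19 (hop w 1 3 end)))))))
    (split w 0 25 (clash (hop x 3 25 (hop w 2 17 end)))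
    (clash (hop x 3 25 (hop w 2 1 end)))))
    (split w 0 9 (clash (hop x 3 9 (hop w 2 17 end)))
    (clash (hop x 3 9 (hop w 2 1 end))))))
    (gauge y 2 3 28)))
    (gauge y 2 3 20)))
    (gauge w 1 3 24))
    (gauge w 1 2 24)))
    (gauge w 1 3 8))
    (gauge w 1 2 8)))
    (gauge y 2 3 12)))
    (gauge y 2 3 4))
    (gauge y 1 3 24))
    (gauge y 1 2 24))
    (gauge y 1 3 8)))
    (gauge y 1 2 8))
    (gauge w 0 3 16))
    (gauge y 0 3 16))
    (gauge w 0 2 16))
    (gauge y 0 2 16)))
    (gauge w 0 1 16)))
    (gauge y 0 1 16)))
    (clash (hop x 4 17 (hop w 1 1 end))))))))))))))))))))))))))))))))))))
    (common 0 0))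
    (common 0 8))
    (common 0 4))
    (common 0 12))
    (common 0 2))
    (common 0 10))
    (common 0 6))
    (common 0 14))
    (common 0 1))
    (common 0 9))
    (common 0 5))
    (common 0 13))
    (common 0 3))
    (common 0 11))
    (common 0 7))
    (common 0 15))
    (common 1 0))
    (common 1 4))
    (common 1 2))
    (common 1 6))
    (common 1 1))
    (common 1 5))
    (common 1 3))
    (common 1 7))
    (common 2 0))
    (common 2 2))
    (common 2 1))
    (common 2 3))
    (common 3 0))
    (common 3 1))
    (zero 0))
    (zero 1))
    (zero 2))
    (zero 3)

  certificate4-valid : Check.checkᵇ 4 126 tutte12cage-list (Check.unknown 4) certificate4 ≡ true
  certificate4-valid = refl

-- From the hypotheses to the polygon and the four cubic graphs.

open import Defs renaming (sym to adj-sym)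
open import Data.Nat using (ℕ; suc; _*_; _∸_; _^_)
open import Data.Fin using (Fin; toℕ; zero)
open import Data.Vec using (Vec; lookup; toList)
open CycleCounting using (module GirthCycles)
open Polygons using (module Polygon)
open Signatures
open FeitHigmanTheorem using (module FeitHigman)
open Recognition using (module Sound)
open Certificates

theorem1p3 : ∀ {n} (Γ : Graph n) (k d : ℕ) (a : Vec ℕ k) →
    Connected Γ → Regular Γ k → GirthRegular Γ (2 * d) (toList a) →
    (∀ (i : Fin k) → suc (toℕ i) ≡ k → lookup a i ≡ (k ∸ 1) ^ d) →
    (∀ (i j : Fin k) → lookup a i ≡ lookup a j)
    × IsIncidenceGraphOfGenPolygon Γ d (k ∸ 1) (k ∸ 1)
    × (k ≡ 3 →
    (2 * d ≡ 4 × Γ ≅ K33)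
    ⊎ (2 * d ≡ 6 × Γ ≅' heawood)
    ⊎ (2 * d ≡ 8 × Γ ≅' tutteCoxeter)
    ⊎ (2 * d ≡ 12 × Γ ≅' tutte12cage))
theorem1p3 Γ k d a conn reg gr top
  -- A girth cycle has three vertices and an edge, which gives d = e + 2 and k = k′ + 1 before
  -- anything else is unfolded.
  with half-girth≥2 d (cycle-length≥3 Γ (2 * d) (proj₁ (proj₁ gr))) | degree≢0 Γ (proj₁ (proj₁ gr)) reg
... | e , refl | k′ , refl =
      (λ i j → trans (signature-constant Γ k′ e a reg gr top conn i) (sym (signature-constant Γ k′ e a reg gr top conn j)))
    , Polygon.polygon Γ e k′ (proj₁ gr) conn reg moore
    , λ { refl → cubic e (proj₁ gr) reg moore }
  where
  moore : GirthCycles.Moore Γ e (proj₂ (proj₁ gr))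
  moore = girth-regular⇒Moore Γ k′ e a reg gr top
  -- Generalised over `e` and over all that depends on it, so that each equation for d can be
  -- matched by `refl` and the certificate for that value applies.
  cubic : ∀ e (Γ-girth : Girth Γ (2 * suc (suc e))) (reg : Regular Γ 3) (moore : GirthCycles.Moore Γ e (proj₂ Γ-girth)) →
    (2 * suc (suc e) ≡ 4 × Γ ≅ K33)
    ⊎ (2 * suc (suc e) ≡ 6 × Γ ≅' heawood)
    ⊎ (2 * suc (suc e) ≡ 8 × Γ ≅' tutteCoxeter)
    ⊎ (2 * suc (suc e) ≡ 12 × Γ ≅' tutte12cage)
  cubic e Γ-girth reg moore with FeitHigman.feit-higman Γ e Γ-girth conn reg moore
  ... | inj₁ refl = inj₁ (refl ,
        Sound.Target.recognise Γ 0 Γ-girth conn reg moore K33 K33-list K33-edges K33-cubic zero certificate0 certificate0-valid)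
  ... | inj₂ (inj₁ refl) = inj₂ (inj₁ (refl ,
        Sound.Target.recognise Γ 1 Γ-girth conn reg moore (proj₂ heawood) heawood-list heawood-edges heawood-cubic zero certificate1 certificate1-valid))
  ... | inj₂ (inj₂ (inj₁ refl)) = inj₂ (inj₂ (inj₁ (refl ,
        Sound.Target.recognise Γ 2 Γ-girth conn reg moore (proj₂ tutteCoxeter) tutteCoxeter-list tutteCoxeter-edges tutteCoxeter-cubic zero certificate2 certificate2-valid)))
  ... | inj₂ (inj₂ (inj₂ refl)) = inj₂ (inj₂ (inj₂ (refl ,
        Sound.Target.recognise Γ 4 Γ-girth conn reg moore (proj₂ tutte12cage) tutte12cage-list tutte12cage-edges tutte12cage-cubic zero certificate4 certificate4-valid)))
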